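{- Let $a$ and $b$ be positive integers. Then there exist nonnegative integers $\alpha_{(a,b)}(i,j)$ ($1\le i\le a$, $1\le j\le b$), independent of $m$ and $n$, such that for all $m,n\in\mathbb{Z}_{\ge 0}$ \[ u_{(a,b)}(m,n)=\frac{1}{\gcd(a,b)}\sum_{\substack{1\le i\le a,\\ 1\le j\le b}}\alpha_{(a,b)}(i,j)\binom{m}{i}\binom{n}{j}. \]
   Context: Let $N^+=\mathbb{Z}_{\ge0}^2\setminus\{(0,0)\}$ and for $(a,b),(c,d)\in\mathbb{Z}^2$ put $\{(a,b),(c,d)\}=bc-ad$. Let $\mathfrak{g}=\bigoplus_{n\in N^+}\mathbb{Q}X_n$ be the $N^+$-graded Lie algebra over $\mathbb{Q}$ with $[X_n,X_{n'}]=\{n,n'\}X_{n+n'}$. Put $\deg(a,b)=a+b$, $\mathfrak{g}^{>l}=\bigoplus_{\deg n>l}\mathbb{Q}X_n$, $\mathfrak{g}^{\le l}=\mathfrak{g}/\mathfrak{g}^{>l}$ (nilpotent), $G^{\le l}=\exp(\mathfrak{g}^{\le l})$ with the Baker–Campbell–Hausdorff product, and $G=\varprojlim G^{\le l}$ (the structure group). For $g=\exp(X)\in G$ and $c\in\mathbb{Q}$, $g^c=\exp(cX)$. The dilogarithm element is $[a,b]:=\exp\big(\sum_{j\ge1}\frac{(-1)^{j+1}}{j^2}X_{j(a,b)}\big)$ for $(a,b)\in N^+$. Total order on $N^+$: $(a,b)\le(c,d)$ iff $\{(a,b),(c,d)\}<0$ or $(c,d)=k(a,b)$ for some rational $k\ge1$.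 A product $\prod_{j\in J}[a_j,b_j]^{u_j}$ over a countable totally ordered index set $J$ ($u_j\in\mathbb{Q}$) is called ordered if $(a_i,b_i)<(a_j,b_j)$ whenever $i<j$; infinite such products are interpreted in $G$ via the projections to the $G^{\le l}$. It is known that for $m,n\in\mathbb{Z}_{\ge0}$ the element $[0,1]^n[1,0]^m$ equals a unique ordered product $\prod_{(a,b)\in N^+}[a,b]^{u_{(a,b)}(m,n)}$ with $u_{(a,b)}(m,n)\in\mathbb{Q}$; this defines $u_{(a,b)}(m,n)$. -}

module Defs where

-- Concrete model of the structure group G of the paper.
-- An element of G = exp(ĝ) is represented by its logarithm, an element of the
-- completion ĝ = ∏_{n ∈ N⁺} ℚ X_n, i.e. a coefficient function
-- X (a , b) ↦ coefficient of X_(a,b)  (the value at (0,0) is never used).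
-- The group law is the Baker–Campbell–Hausdorff product, given by Dynkin's
-- formula; the coefficient at X_n only involves words of length ≤ deg n,
-- so it is a finite sum.  Equality in G^{≤l} is equality of all
-- coefficients of degree 1..l.

open import Data.Nat as ℕ using (ℕ; zero; suc; _≡ᵇ_; _<ᵇ_; _≤ᵇ_; _∸_; _!)
open import Data.Integer as ℤ using (ℤ; +_)
open import Data.Rational as ℚ using (ℚ; 0ℚ; 1ℚ)
open import Data.Bool using (Bool; true; false; if_then_else_; _∧_; _∨_)
open import Data.List using (List; []; _∷_; _++_; map; concatMap; replicate; upTo; foldr; filterᵇ)
open import Data.Bool.ListAction using (and)
open import Data.Product using (_×_; _,_; proj₁; proj₂)

-- n ↦ n as a rational; z / d (with z / 0 := 0, only used with d ≠ 0)
frac : ℤ → ℕ → ℚ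
frac z zero    = 0ℚ
frac z (suc d) = z ℚ./ suc d

ℕtoℚ : ℕ → ℚ
ℕtoℚ n = frac (+ n) 1

sgn : ℕ → ℤ
sgn zero    = + 1
sgn (suc k) = ℤ.- sgn k

sum1 : ℕ → (ℕ → ℚ) → ℚ
sum1 zero    f = 0ℚ
sum1 (suc n) f = sum1 n f ℚ.+ f (suc n)

sum0 : ℕ → (ℕ → ℚ) → ℚ
sum0 n f = f 0 ℚ.+ sum1 n f

sumList : {A : Set} → List A → (A → ℚ) → ℚ
sumList xs f = foldr (λ x acc → f x ℚ.+ acc) 0ℚ xs

pairing : ℕ × ℕ → ℕ × ℕ → ℤ
pairing (a , b) (c , d) = (+ (b ℕ.* c)) ℤ.- (+ (a ℕ.* d))

deg : ℕ × ℕ → ℕ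
deg (a , b) = a ℕ.+ b

-- elements of the completed Lie algebra ĝ (coefficients of X_(a,b))
Elt : Set
Elt = ℕ → ℕ → ℚ

zeroElt : Elt
zeroElt _ _ = 0ℚ

-- Lie bracket  [X_n , X_n'] = {n,n'} X_(n+n')
-- (terms with n or n' = (0,0) have pairing 0, so summing over all splittings is harmless)
bracket : Elt → Elt → Elt
bracket X Y a b =
  sum0 a λ i → sum0 b λ j →
    frac (pairing (i , j) (a ∸ i , b ∸ j)) 1 ℚ.* (X i j ℚ.* Y (a ∸ i) (b ∸ j))

nest : List Elt → Elt
nest []            = zeroElt
nest (Z ∷ [])      = Z
nest (Z ∷ W ∷ Zs)  = bracket Z (nest (W ∷ Zs))

grid : ℕ → List (ℕ × ℕ)
grid d = concatMap (λ r → map (r ,_) (upTo (suc d))) (upTo (suc d))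

seqs : ℕ → ℕ → List (List (ℕ × ℕ))
seqs d zero    = [] ∷ []
seqs d (suc k) = concatMap (λ p → map (p ∷_) (seqs d k)) (grid d)

total : List (ℕ × ℕ) → ℕ
total σ = foldr (λ p acc → deg p ℕ.+ acc) 0 σ

factProd : List (ℕ × ℕ) → ℕ
factProd σ = foldr (λ p acc → (proj₁ p !) ℕ.* ((proj₂ p !) ℕ.* acc)) 1 σ

word : Elt → Elt → List (ℕ × ℕ) → List Elt
word X Y σ = concatMap (λ p → replicate (proj₁ p) X ++ replicate (proj₂ p) Y) σ

-- sequence admissible in Dynkin's formula (r_i + s_i ≥ 1), truncated to total ≤ d
valid : ℕ → List (ℕ × ℕ) → Bool
valid d σ = and (map (λ p → 1 ≤ᵇ deg p) σ) ∧ (total σ ≤ᵇ d)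

dynkinCoeff : ℕ → List (ℕ × ℕ) → ℚ
dynkinCoeff k σ = frac (sgn (k ∸ 1)) (k ℕ.* (total σ ℕ.* factProd σ))

bch : Elt → Elt → Elt
bch X Y a b =
  sum1 (a ℕ.+ b) λ k →
    sumList (seqs (a ℕ.+ b) k) λ σ →
      if valid (a ℕ.+ b) σ then dynkinCoeff k σ ℚ.* nest (word X Y σ) a b else 0ℚ

-- [p , q]^u = exp( u · Σ_{j≥1} (-1)^{j+1}/j² X_{j(p,q)} )   (for (p,q) ∈ N⁺)
dilog : ℕ × ℕ → ℚ → Elt
dilog (p , q) u c e =
  sum0 (c ℕ.+ e) λ j →
    if (suc j ℕ.* p ≡ᵇ c) ∧ (suc j ℕ.* q ≡ᵇ e)
    then u ℚ.* frac (sgn j) (suc j ℕ.* suc j)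
    else 0ℚ

-- strict version of the total order on N⁺:
-- x < y  iff  {x,y} < 0, or y = k x with k > 1 rational
-- (for x , y ∈ N⁺ with {x,y} = 0, y = k x with k > 1 iff deg x < deg y)
_<ₒ_ : ℕ × ℕ → ℕ × ℕ → Bool
(a , b) <ₒ (c , d) = (b ℕ.* c <ᵇ a ℕ.* d) ∨ ((b ℕ.* c ≡ᵇ a ℕ.* d) ∧ (a ℕ.+ b <ᵇ c ℕ.+ d))

insert : ℕ × ℕ → List (ℕ × ℕ) → List (ℕ × ℕ)
insert x []       = x ∷ []
insert x (y ∷ ys) = if x <ₒ y then x ∷ y ∷ ys else y ∷ insert x ys

sortₒ : List (ℕ × ℕ) → List (ℕ × ℕ)
sortₒ = foldr insert []

posPairs : ℕ → List (ℕ × ℕ)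
posPairs l = sortₒ (filterᵇ (λ p → (1 ≤ᵇ deg p) ∧ (deg p ≤ᵇ l)) (grid l))

-- image in G^{≤l} of the ordered product ∏_{(a,b) ∈ N⁺} [a,b]^{u(a,b)}
-- (factors with deg > l are trivial in G^{≤l})
orderedProd : ℕ → (ℕ → ℕ → ℚ) → Elt
orderedProd l u = foldr (λ p acc → bch (dilog p (u (proj₁ p) (proj₂ p))) acc) zeroElt (posPairs l)

lhsElt : ℕ → ℕ → Elt
lhsElt m n = bch (dilog (0 , 1) (ℕtoℚ n)) (dilog (1 , 0) (ℕtoℚ m))

-- [0,1]^n [1,0]^m = ∏_{(a,b) ∈ N⁺} [a,b]^{u(a,b)}  as an ordered product in G,
-- i.e. equality in every G^{≤l}
IsOrderedFactorization : ℕ → ℕ → (ℕ → ℕ → ℚ) → Set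
IsOrderedFactorization m n u =
  ∀ (l c d : ℕ) → 1 ℕ.≤ c ℕ.+ d → c ℕ.+ d ℕ.≤ l → orderedProd l u c d ≡ lhsElt m n c d
  where open import Relation.Binary.PropositionalEquality using (_≡_)

{-# OPTIONS --safe #-}
module Submission where

-- The Lie algebra acts on the series y^w ℚ[[y₁,y₂]] by X_n y^v = {n,v} y^(n+v), so by the Baker–Campbell–Hausdorff formula
-- G^{≤l} acts on the truncated series, [a,b]^u by y^v ↦ y^v (1 + y^(a,b))^(u {(a,b),v}). The top coefficients of
-- a word in the letters [p]^x are affine in the exponents of the letters of top degree. Hence the exponents of an ordered word
-- are determined by its action, and gcd(p) x is integral whenever the word equals one whose letters have that property.
--
-- Vandermonde's identity gives the pentagon relation [p]^(1/D) [q]^(1/D) = [q]^(1/D) [p+q]^(1/D) [p]^(1/D) for D = {p,q} > 0.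
-- The linear map (i,j) ↦ i q + j p multiplies the form by D and raises degrees unless deg p = deg q = 1, so the
-- factorization of [0,1]^n [1,0]^m up to degree l reorders [p]^(x/D) [q]^(y/D) up to degree l + 1. Writing [1,0]^(m+1) =
-- [1,0] [1,0]^m (and likewise for n), the top exponents at m + 1 exceed those at m by the contributions of such crossings, which
-- are non-negative combinations of products of binomials of lower degree; summing over m and n gives the claim.
-- The terms with i = 0 or j = 0 vanish because [0,1]^n and [1,0]^m are ordered already.

-- The group law is given by Dynkin's formula, so it must first be shown that exponentials turn it
-- into composition of operators. Its denominators are eigenvalues of an Euler derivation. No
-- derivation fixing two arbitrary, non-homogeneous elements is at hand; hence a detour through
-- series in an auxiliary variable t.
--
-- The weight w enters because every letter fixes y^0. The form {(a,b), w} is b for w = (1,0) and -a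
-- for w = (0,1), so these two weights together detect the exponent x at every point, and
-- integrality of x a and x b gives that of gcd(a,b) x.
--
-- Non-negativity and integrality have different sources. Reordering yields natural numbers over
-- denominators gcd(r) D, and only the action shows that these quotients have the right denominator.
--
-- The degree bound (a, b) shapes the induction. A step of m or n must change an exponent by a
-- polynomial of one degree less in that variable, because summation raises the degree again. Below
-- the top degree the exponents are known by uniqueness, so only the top degree is summed, and there
-- the letters are central.

open import Defs
open import Level using (0ℓ)
open import Algebra.Bundles using (CommutativeMonoid; AbelianGroup; Ring)
import Algebra.Properties.AbelianGroup as AbelianGroupProperties
import Algebra.Properties.Ring as RingProperties
open import Data.Nat as ℕ using (ℕ; zero; suc; z≤n; s≤s; _≤_; _<_; _!; _∸_)
import Data.Nat.Properties as ℕₚ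
open import Data.Nat.DivMod using (_/_; m/n*n≡m)
open import Data.Nat.Divisibility as Div using (_∣_; ∣m⇒∣m*n; ∣n⇒∣m*n; ∣m+n∣m⇒∣n; divides)
open import Data.Nat.GCD as GCD using (gcd; gcd-GCD; module Bézout; gcd[m,n]∣m; gcd[m,n]∣n)
open import Data.Nat.Induction using (<-rec)
import Data.Nat.Tactic.RingSolver as ℕSolver
open import Data.Integer as ℤ using (ℤ; +_; -[1+_])
import Data.Integer.Properties as ℤₚ
open import Data.Rational as ℚ using (ℚ; 0ℚ; 1ℚ; toℚᵘ)
import Data.Rational.Properties as ℚₚ
open import Data.Rational.Unnormalised as ℚᵘ using (mkℚᵘ; *≡*)
import Data.Rational.Unnormalised.Properties as ℚᵘₚ
open import Data.Bool using (Bool; true; false; if_then_else_; _∧_) renaming (T to True)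
open import Data.Bool.ListAction using (and)
open import Data.Empty using (⊥; ⊥-elim)
open import Data.Unit using (⊤; tt)
open import Data.Product using (_×_; _,_; proj₁; proj₂; Σ)
open import Data.Product.Properties using (≡-dec)
open import Data.Sum using (_⊎_; inj₁; inj₂; [_,_]′)
open import Data.List using (List; []; _∷_; _++_; map; concatMap; replicate; upTo; applyUpTo; foldr; length; filterᵇ; cartesianProduct)
import Data.List.Properties as Listₚ
open import Data.List.Membership.Propositional using (_∈_; _∉_)
import Data.List.Membership.Propositional.Properties as Memₚ
open import Data.List.Relation.Binary.Pointwise as PW using (Pointwise; []; _∷_)
open import Data.List.Relation.Unary.All as All using (All; []; _∷_)
import Data.List.Relation.Unary.All.Properties as Allₚ
open import Data.List.Relation.Unary.AllPairs as AllPairs using (AllPairs; []; _∷_)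
open import Data.List.Relation.Unary.Any using (here; there)
open import Data.List.Relation.Unary.Unique.Propositional using (Unique)
import Data.List.Relation.Unary.Unique.Propositional.Properties as Uniqueₚ
open import Relation.Binary using (tri<; tri≈; tri>)
open import Relation.Binary.PropositionalEquality as ≡ using (_≡_; refl; cong; cong₂; sym; trans)
open import Relation.Nullary using (yes; no; ¬_)
open import Relation.Nullary.Decidable using (Dec; dec⇒maybe)
open import Tactic.RingSolver using (solve-∀)
open import Tactic.RingSolver.Core.AlmostCommutativeRing using (AlmostCommutativeRing; fromCommutativeRing)

-- Rational arithmetic and finite sums

ℚring : AlmostCommutativeRing 0ℓ 0ℓ
ℚring = fromCommutativeRing ℚₚ.+-*-commutativeRing λ x → dec⇒maybe (0ℚ ℚₚ.≟ x)

private
  toℚᵘ-/ : ∀ z d → toℚᵘ (z ℚ./ suc d) ℚᵘ.≃ mkℚᵘ z d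
  toℚᵘ-/ z d = ℚₚ.toℚᵘ-fromℚᵘ (mkℚᵘ z d)

opaque
  ιℤ : ℤ → ℚ
  ιℤ z = frac z 1

  inv : ℕ → ℚ
  inv n = frac (+ 1) n

  ι : ℕ → ℚ
  ι n = ℕtoℚ n

  ι-def : ∀ n → ι n ≡ ℕtoℚ n
  ι-def n = refl

  ιℤ-def : ∀ z → ιℤ z ≡ frac z 1
  ιℤ-def z = refl

  inv-def : ∀ n → inv n ≡ frac (+ 1) n
  inv-def n = refl

  ιℤ-pos : ∀ n → ιℤ (+ n) ≡ ι n
  ιℤ-pos n = refl

  ι-0 : ι 0 ≡ 0ℚ
  ι-0 = refl

  ι-1 : ι 1 ≡ 1ℚ
  ι-1 = refl

  ιℤ-1 : ιℤ (+ 1) ≡ 1ℚ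
  ιℤ-1 = refl

  inv-1 : inv 1 ≡ 1ℚ
  inv-1 = refl


  ιℤ-+ : ∀ x y → ιℤ (x ℤ.+ y) ≡ ιℤ x ℚ.+ ιℤ y
  ιℤ-+ x y = ℚₚ.toℚᵘ-injective (ℚᵘₚ.≃-trans (toℚᵘ-/ (x ℤ.+ y) 0) (ℚᵘₚ.≃-sym
    (ℚᵘₚ.≃-trans (ℚₚ.toℚᵘ-homo-+ (ιℤ x) (ιℤ y)) (ℚᵘₚ.≃-trans (ℚᵘₚ.+-cong (toℚᵘ-/ x 0) (toℚᵘ-/ y 0))
    (*≡* (cong (ℤ._* + 1) (cong₂ ℤ._+_ (ℤₚ.*-identityʳ x) (ℤₚ.*-identityʳ y))))))))

  ιℤ-* : ∀ x y → ιℤ (x ℤ.* y) ≡ ιℤ x ℚ.* ιℤ y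
  ιℤ-* x y = ℚₚ.toℚᵘ-injective (ℚᵘₚ.≃-trans (toℚᵘ-/ (x ℤ.* y) 0) (ℚᵘₚ.≃-sym
    (ℚᵘₚ.≃-trans (ℚₚ.toℚᵘ-homo-* (ιℤ x) (ιℤ y)) (ℚᵘₚ.*-cong (toℚᵘ-/ x 0) (toℚᵘ-/ y 0)))))

  frac-inv : ∀ z d → frac z d ≡ ιℤ z ℚ.* inv d
  frac-inv z zero    = sym (ℚₚ.*-zeroʳ (ιℤ z))
  frac-inv z (suc d) = ℚₚ.toℚᵘ-injective (ℚᵘₚ.≃-trans (toℚᵘ-/ z d) (ℚᵘₚ.≃-sym
    (ℚᵘₚ.≃-trans (ℚₚ.toℚᵘ-homo-* (ιℤ z) (inv (suc d))) (ℚᵘₚ.≃-trans (ℚᵘₚ.*-cong (toℚᵘ-/ z 0) (toℚᵘ-/ (+ 1) d))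
    (*≡* (cong₂ ℤ._*_ (ℤₚ.*-identityʳ z) (cong (λ k → + suc k) (sym (ℕₚ.+-identityʳ d)))))))))

  inv-* : ∀ m n → inv (m ℕ.* n) ≡ inv m ℚ.* inv n
  inv-* zero    n       = sym (ℚₚ.*-zeroˡ (inv n))
  inv-* (suc m) zero    = trans (cong inv (ℕₚ.*-zeroʳ m)) (sym (ℚₚ.*-zeroʳ (inv (suc m))))
  inv-* (suc m) (suc n) = ℚₚ.toℚᵘ-injective (ℚᵘₚ.≃-trans (toℚᵘ-/ (+ 1) (n ℕ.+ m ℕ.* suc n)) (ℚᵘₚ.≃-sym
    (ℚᵘₚ.≃-trans (ℚₚ.toℚᵘ-homo-* (inv (suc m)) (inv (suc n))) (ℚᵘₚ.*-cong (toℚᵘ-/ (+ 1) m) (toℚᵘ-/ (+ 1) n)))))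

  ι-inv : ∀ n → ι (suc n) ℚ.* inv (suc n) ≡ 1ℚ
  ι-inv n = ℚₚ.toℚᵘ-injective (ℚᵘₚ.≃-trans (ℚₚ.toℚᵘ-homo-* (ι (suc n)) (inv (suc n)))
    (ℚᵘₚ.≃-trans (ℚᵘₚ.*-cong (toℚᵘ-/ (+ suc n) 0) (toℚᵘ-/ (+ 1) n))
    (*≡* (cong +_ (trans (ℕₚ.*-identityʳ (suc (n ℕ.* 1))) (cong suc (trans (ℕₚ.*-identityʳ n)
       (trans (sym (ℕₚ.+-identityʳ n)) (sym (ℕₚ.+-identityʳ (n ℕ.+ 0)))))))))))

  ιℤ-injective : ∀ {x y} → ιℤ x ≡ ιℤ y → x ≡ y
  ιℤ-injective {x} {y} e with ℚᵘₚ.≃-trans (ℚᵘₚ.≃-sym (toℚᵘ-/ x 0)) (ℚᵘₚ.≃-trans (ℚᵘₚ.≃-reflexive (cong toℚᵘ e)) (toℚᵘ-/ y 0))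
  ... | *≡* q = trans (sym (ℤₚ.*-identityʳ x)) (trans q (ℤₚ.*-identityʳ y))

  ι-+ : ∀ m n → ι (m ℕ.+ n) ≡ ι m ℚ.+ ι n
  ι-+ m n = ιℤ-+ (+ m) (+ n)

  ι-* : ∀ m n → ι (m ℕ.* n) ≡ ι m ℚ.* ι n
  ι-* m n = trans (cong ιℤ (ℤₚ.pos-* m n)) (ιℤ-* (+ m) (+ n))

  ι-injective : ∀ {m n} → ι m ≡ ι n → m ≡ n
  ι-injective e = ℤₚ.+-injective (ιℤ-injective e)

  ιℤ-neg : ∀ x → ιℤ (ℤ.- x) ≡ ℚ.- ιℤ x
  ιℤ-neg x = trans (cong ιℤ (sym (ℤₚ.-1*i≡-i x))) (trans (ιℤ-* (-[1+ 0 ]) x) (lem (ιℤ x)))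
    where lem : ∀ y → ιℤ (-[1+ 0 ]) ℚ.* y ≡ ℚ.- y
          lem = λ y → trans (sym (ℚₚ.neg-distribˡ-* 1ℚ y)) (cong ℚ.-_ (ℚₚ.*-identityˡ y))

  ι-cancel : ∀ n {x y} → ι (suc n) ℚ.* x ≡ ι (suc n) ℚ.* y → x ≡ y
  ι-cancel n {x} {y} e = trans (lem x) (trans (cong (inv (suc n) ℚ.*_) e) (sym (lem y)))
    where
    lem : ∀ x → x ≡ inv (suc n) ℚ.* (ι (suc n) ℚ.* x)
    lem x = trans (sym (ℚₚ.*-identityˡ x)) (trans (cong (ℚ._* x) (trans (sym (ι-inv n)) (ℚₚ.*-comm (ι (suc n)) (inv (suc n)))))
              (ℚₚ.*-assoc (inv (suc n)) (ι (suc n)) x))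

  inv-ι : ∀ n x → inv (suc n) ℚ.* (ι (suc n) ℚ.* x) ≡ x
  inv-ι n x = trans (sym (ℚₚ.*-assoc (inv (suc n)) (ι (suc n)) x))
    (trans (cong (ℚ._* x) (trans (ℚₚ.*-comm (inv (suc n)) (ι (suc n))) (ι-inv n))) (ℚₚ.*-identityˡ x))

module Sums (M : CommutativeMonoid 0ℓ 0ℓ) where
  open CommutativeMonoid M using (Carrier; _≈_; setoid)
    renaming (_∙_ to _+_; ε to 0#; ∙-cong to +-cong; assoc to +-assoc; comm to +-comm;
              identityˡ to +-identityˡ; identityʳ to +-identityʳ;
              refl to ≈-refl; sym to ≈-sym; trans to ≈-trans)
  open import Relation.Binary.Reasoning.Setoid setoid

  +-interchange : ∀ a b c d → (a + b) + (c + d) ≈ (a + c) + (b + d)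
  +-interchange a b c d = begin
    (a + b) + (c + d)  ≈⟨ +-assoc a b (c + d) ⟩
    a + (b + (c + d))  ≈⟨ +-cong ≈-refl (≈-sym (+-assoc b c d)) ⟩
    a + ((b + c) + d)  ≈⟨ +-cong ≈-refl (+-cong (+-comm b c) ≈-refl) ⟩
    a + ((c + b) + d)  ≈⟨ +-cong ≈-refl (+-assoc c b d) ⟩
    a + (c + (b + d))  ≈⟨ ≈-sym (+-assoc a c (b + d)) ⟩
    (a + c) + (b + d)  ∎

  sum : ℕ → (ℕ → Carrier) → Carrier
  sum zero    f = 0#
  sum (suc n) f = f 0 + sum n (λ i → f (suc i))

  sum-cong : ∀ n {f g : ℕ → Carrier} → (∀ i → i < n → f i ≈ g i) → sum n f ≈ sum n g
  sum-cong zero    e = ≈-refl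
  sum-cong (suc n) e = +-cong (e 0 (s≤s z≤n)) (sum-cong n (λ i i<n → e (suc i) (s≤s i<n)))

  sum-zero : ∀ n {f : ℕ → Carrier} → (∀ i → i < n → f i ≈ 0#) → sum n f ≈ 0#
  sum-zero zero    e = ≈-refl
  sum-zero (suc n) e = ≈-trans (+-cong (e 0 (s≤s z≤n)) (sum-zero n (λ i i<n → e (suc i) (s≤s i<n))))
                               (+-identityˡ 0#)

  sum-+ : ∀ n (f g : ℕ → Carrier) → sum n (λ i → f i + g i) ≈ sum n f + sum n g
  sum-+ zero    f g = ≈-sym (+-identityˡ 0#)
  sum-+ (suc n) f g = ≈-trans (+-cong ≈-refl (sum-+ n _ _)) (+-interchange _ _ _ _)

  sum-last : ∀ n (f : ℕ → Carrier) → sum (suc n) f ≈ sum n f + f n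
  sum-last zero    f = ≈-trans (+-identityʳ _) (≈-sym (+-identityˡ _))
  sum-last (suc n) f = ≈-trans (+-cong ≈-refl (sum-last n _)) (≈-sym (+-assoc _ _ _))

  sum-peel : ∀ {m n} → m ≡ suc n → ∀ f → sum m f ≈ f 0 + sum n (λ i → f (suc i))
  sum-peel refl f = ≈-refl

  sum-peel-last : ∀ {m n} → m ≡ suc n → ∀ f → sum m f ≈ sum n f + f n
  sum-peel-last {n = n} refl f = sum-last n f

  sum-swap : ∀ m n (F : ℕ → ℕ → Carrier) →
             sum m (λ i → sum n (F i)) ≈ sum n (λ j → sum m (λ i → F i j))
  sum-swap zero    n F = ≈-sym (sum-zero n (λ _ _ → ≈-refl))
  sum-swap (suc m) n F = ≈-trans (+-cong ≈-refl (sum-swap m n (λ i → F (suc i)))) (≈-sym (sum-+ n _ _))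

  sum-extend : ∀ {m n} (f : ℕ → Carrier) → m ≤ n → (∀ i → m ≤ i → f i ≈ 0#) → sum n f ≈ sum m f
  sum-extend {n = n} f z≤n     e = sum-zero n (λ i _ → e i z≤n)
  sum-extend         f (s≤s p) e = +-cong ≈-refl (sum-extend _ p (λ i m≤i → e (suc i) (s≤s m≤i)))

  sum-single : ∀ {n} k (f : ℕ → Carrier) → k < n → (∀ i → ¬ i ≡ k → f i ≈ 0#) → sum n f ≈ f k
  sum-single {suc n} zero f _ e =
    ≈-trans (+-cong ≈-refl (sum-zero n (λ i _ → e (suc i) (λ ())))) (+-identityʳ _)
  sum-single {suc n} (suc k) f (s≤s k<n) e =
    ≈-trans (+-cong (e 0 (λ ())) (sum-single k _ k<n (λ i i≢k → e (suc i) (λ q → i≢k (ℕₚ.suc-injective q)))))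
            (+-identityˡ _)

  -- The antidiagonal sum over i + j = n, that is, the coefficient of a Cauchy product. Recursion on
  -- the first index keeps both indices explicit and avoids truncated subtraction.
  diag : (ℕ → ℕ → Carrier) → ℕ → Carrier
  diag F zero    = F 0 0
  diag F (suc n) = F 0 (suc n) + diag (λ i → F (suc i)) n

  diag-cong : ∀ n {F G : ℕ → ℕ → Carrier} → (∀ i j → i ℕ.+ j ≡ n → F i j ≈ G i j) → diag F n ≈ diag G n
  diag-cong zero    e = e 0 0 refl
  diag-cong (suc n) e = +-cong (e 0 (suc n) refl) (diag-cong n (λ i j q → e (suc i) j (≡.cong suc q)))

  diag-zero : ∀ n {F : ℕ → ℕ → Carrier} → (∀ i j → i ℕ.+ j ≡ n → F i j ≈ 0#) → diag F n ≈ 0#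
  diag-zero zero    e = e 0 0 refl
  diag-zero (suc n) e = ≈-trans (+-cong (e 0 (suc n) refl) (diag-zero n (λ i j q → e (suc i) j (≡.cong suc q))))
                                (+-identityˡ 0#)

  diag-+ : ∀ n (F G : ℕ → ℕ → Carrier) → diag (λ i j → F i j + G i j) n ≈ diag F n + diag G n
  diag-+ zero    F G = ≈-refl
  diag-+ (suc n) F G = ≈-trans (+-cong ≈-refl (diag-+ n _ _)) (+-interchange _ _ _ _)

  diag-last : ∀ n (F : ℕ → ℕ → Carrier) → diag F (suc n) ≈ diag (λ i j → F i (suc j)) n + F (suc n) 0
  diag-last zero    F = ≈-refl
  diag-last (suc n) F = ≈-trans (+-cong ≈-refl (diag-last n (λ i → F (suc i)))) (≈-sym (+-assoc _ _ _))

  diag-flip : ∀ n (F : ℕ → ℕ → Carrier) → diag F n ≈ diag (λ i j → F j i) n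
  diag-flip zero    F = ≈-refl
  diag-flip (suc n) F = ≈-trans (+-comm _ _)
    (≈-trans (+-cong (diag-flip n (λ i → F (suc i))) ≈-refl) (≈-sym (diag-last n (λ i j → F j i))))

  -- Both sides run over i + j + k = n. This is associativity of the Cauchy product, in one variable
  -- here and in two through `D2-assoc`.
  diag-assoc : ∀ n (F : ℕ → ℕ → ℕ → Carrier) →
    diag (λ s k → diag (λ i j → F i j k) s) n ≈ diag (λ i s → diag (λ j k → F i j k) s) n
  diag-assoc zero    F = ≈-refl
  diag-assoc (suc n) F = begin
    F 0 0 (suc n) + diag (λ s k → F 0 (suc s) k + diag (λ i j → F (suc i) j k) s) n
      ≈⟨ +-cong ≈-refl (diag-+ n _ _) ⟩
    F 0 0 (suc n) + (diag (λ s k → F 0 (suc s) k) n + diag (λ s k → diag (λ i j → F (suc i) j k) s) n)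
      ≈⟨ +-cong ≈-refl (+-cong ≈-refl (diag-assoc n (λ i → F (suc i)))) ⟩
    F 0 0 (suc n) + (diag (λ s k → F 0 (suc s) k) n + diag (λ i s → diag (λ j k → F (suc i) j k) s) n)
      ≈⟨ ≈-sym (+-assoc _ _ _) ⟩
    (F 0 0 (suc n) + diag (λ s k → F 0 (suc s) k) n) + diag (λ i s → diag (λ j k → F (suc i) j k) s) n ∎

  diag-exchange : ∀ m n (F : ℕ → ℕ → ℕ → ℕ → Carrier) →
    diag (λ i i′ → diag (λ j j′ → F i i′ j j′) n) m ≈ diag (λ j j′ → diag (λ i i′ → F i i′ j j′) m) n
  diag-exchange zero    n F = ≈-refl
  diag-exchange (suc m) n F =
    ≈-trans (+-cong ≈-refl (diag-exchange m n (λ i → F (suc i)))) (≈-sym (diag-+ n _ _))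

  diag-sum-exchange : ∀ m n (F : ℕ → ℕ → ℕ → Carrier) →
    diag (λ i i′ → sum n (λ k → F i i′ k)) m ≈ sum n (λ k → diag (λ i i′ → F i i′ k) m)
  diag-sum-exchange zero    n F = ≈-refl
  diag-sum-exchange (suc m) n F =
    ≈-trans (+-cong ≈-refl (diag-sum-exchange m n (λ i → F (suc i)))) (≈-sym (sum-+ n _ _))

  -- The square of index pairs below n reduces to the triangle i + j < n. In the applications the
  -- terms outside the triangle vanish by nilpotency, so products of truncated sums become truncated
  -- Cauchy products.
  sum-diag : ∀ n (G : ℕ → ℕ → Carrier) → (∀ i j → n ≤ i ℕ.+ j → G i j ≈ 0#) →
             sum n (λ i → sum n (G i)) ≈ sum n (diag G)
  sum-diag zero    G e = ≈-refl
  sum-diag (suc n) G e = begin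
    (G 0 0 + sum n (λ j → G 0 (suc j))) + sum n (λ i → sum (suc n) (G (suc i)))
      ≈⟨ +-cong ≈-refl (sum-cong n (λ i _ → sum-extend (G (suc i)) (ℕₚ.n≤1+n n)
            (λ j n≤j → e (suc i) j (s≤s (ℕₚ.≤-trans n≤j (ℕₚ.m≤n+m j i)))))) ⟩
    (G 0 0 + sum n (λ j → G 0 (suc j))) + sum n (λ i → sum n (G (suc i)))
      ≈⟨ +-cong ≈-refl (sum-diag n (λ i → G (suc i)) (λ i j p → e (suc i) j (s≤s p))) ⟩
    (G 0 0 + sum n (λ j → G 0 (suc j))) + sum n (diag (λ i → G (suc i)))
      ≈⟨ +-assoc _ _ _ ⟩
    G 0 0 + (sum n (λ j → G 0 (suc j)) + sum n (diag (λ i → G (suc i))))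
      ≈⟨ +-cong ≈-refl (≈-sym (sum-+ n _ _)) ⟩
    G 0 0 + sum n (λ k → G 0 (suc k) + diag (λ i → G (suc i)) k) ∎

  -- Coefficients of s^i f(s).
  shift : ℕ → (ℕ → Carrier) → ℕ → Carrier
  shift zero    f n       = f n
  shift (suc i) f zero    = 0#
  shift (suc i) f (suc n) = shift i f n

  shift-cong : ∀ i n {f g : ℕ → Carrier} → (∀ k → i ℕ.+ k ≡ n → f k ≈ g k) → shift i f n ≈ shift i g n
  shift-cong zero    n       e = e n refl
  shift-cong (suc i) zero    e = ≈-refl
  shift-cong (suc i) (suc n) e = shift-cong i n (λ k q → e k (≡.cong suc q))

  shift-shift : ∀ i j n (f : ℕ → Carrier) → shift i (shift j f) n ≈ shift (i ℕ.+ j) f n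
  shift-shift zero    j n       f = ≈-refl
  shift-shift (suc i) j zero    f = ≈-refl
  shift-shift (suc i) j (suc n) f = shift-shift i j n f

  shift-big : ∀ i n (f : ℕ → Carrier) → n < i → shift i f n ≈ 0#
  shift-big (suc i) zero    f _       = ≈-refl
  shift-big (suc i) (suc n) f (s≤s p) = shift-big i n f p

  shift-at : ∀ i k (f : ℕ → Carrier) → shift i f (i ℕ.+ k) ≈ f k
  shift-at zero    k f = ≈-refl
  shift-at (suc i) k f = shift-at i k f

  diag-single : ∀ k n (F : ℕ → ℕ → Carrier) → (∀ i j → ¬ i ≡ k → F i j ≈ 0#) → diag F n ≈ shift k (F k) n
  diag-single zero    zero    F e = ≈-refl
  diag-single zero    (suc n) F e =
    ≈-trans (+-cong ≈-refl (diag-zero n (λ i j _ → e (suc i) j (λ ())))) (+-identityʳ _)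
  diag-single (suc k) zero    F e = e 0 0 (λ ())
  diag-single (suc k) (suc n) F e =
    ≈-trans (+-cong (e 0 (suc n) (λ ()))
                    (diag-single k n (λ i → F (suc i)) (λ i j i≢k → e (suc i) j (λ q → i≢k (ℕₚ.suc-injective q)))))
            (+-identityˡ _)

module SumHom (M N : CommutativeMonoid 0ℓ 0ℓ) where
  private
    module M = CommutativeMonoid M
    module N = CommutativeMonoid N
    module SM = Sums M
    module SN = Sums N
  module _ (h : M.Carrier → N.Carrier) (h-ε : h M.ε N.≈ N.ε)
           (h-∙ : ∀ a b → h (a M.∙ b) N.≈ (h a N.∙ h b)) where

    hom-sum : ∀ n (f : ℕ → M.Carrier) → h (SM.sum n f) N.≈ SN.sum n (λ i → h (f i))
    hom-sum zero    f = h-ε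
    hom-sum (suc n) f = N.trans (h-∙ _ _) (N.∙-cong N.refl (hom-sum n _))

    hom-diag : ∀ n (F : ℕ → ℕ → M.Carrier) → h (SM.diag F n) N.≈ SN.diag (λ i j → h (F i j)) n
    hom-diag zero    F = N.refl
    hom-diag (suc n) F = N.trans (h-∙ _ _) (N.∙-cong N.refl (hom-diag n _))

    hom-shift : ∀ i n (f : ℕ → M.Carrier) → h (SM.shift i f n) N.≈ SN.shift i (λ k → h (f k)) n
    hom-shift zero    n       f = N.refl
    hom-shift (suc i) zero    f = h-ε
    hom-shift (suc i) (suc n) f = hom-shift i n f

-- Filtered algebras and exponentials

ℚ⁺ : CommutativeMonoid 0ℓ 0ℓ
ℚ⁺ = AbelianGroup.commutativeMonoid (Ring.+-abelianGroup ℚₚ.+-*-ring)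

record QModule : Set₁ where
  infixr 8 _·_
  field
    group : AbelianGroup 0ℓ 0ℓ
  open AbelianGroup group public
    using (Carrier; _≈_; setoid)
    renaming (_∙_ to _+_; ε to 0#; _⁻¹ to -_; ∙-cong to +-cong; ⁻¹-cong to -‿cong;
              refl to ≈-refl; sym to ≈-sym; trans to ≈-trans;
              assoc to +-assoc; comm to +-comm; identityˡ to +-identityˡ; identityʳ to +-identityʳ;
              inverseˡ to -‿inverseˡ; inverseʳ to -‿inverseʳ; commutativeMonoid to +-commutativeMonoid)
  field
    _·_       : ℚ → Carrier → Carrier
    ·-cong    : ∀ c {a b} → a ≈ b → c · a ≈ c · b
    ·-distˡ   : ∀ c a b → c · (a + b) ≈ c · a + c · b
    ·-distʳ   : ∀ c d a → (c ℚ.+ d) · a ≈ c · a + d · a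
    ·-assoc   : ∀ c d a → (c ℚ.* d) · a ≈ c · (d · a)
    ·-1       : ∀ a → 1ℚ · a ≈ a

  open Sums +-commutativeMonoid public
  module GP = AbelianGroupProperties group

  ·-congˡ : ∀ {c d} a → c ≡ d → c · a ≈ d · a
  ·-congˡ a refl = ≈-refl

  private
    cancel : ∀ {a} → a ≈ a + a → a ≈ 0#
    cancel {a} e = GP.identityʳ-unique a a (≈-sym e)

  0· : ∀ a → 0ℚ · a ≈ 0#
  0· a = cancel (≈-trans (·-congˡ a (≡.sym (ℚₚ.+-identityʳ 0ℚ))) (·-distʳ 0ℚ 0ℚ a))

  ·0 : ∀ c → c · 0# ≈ 0#
  ·0 c = cancel (≈-trans (·-cong c (≈-sym (+-identityʳ 0#))) (·-distˡ c 0# 0#))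

  ·-0 : ∀ c {a} → a ≈ 0# → c · a ≈ 0#
  ·-0 c e = ≈-trans (·-cong c e) (·0 c)

  ·-neg : ∀ c a → c · (- a) ≈ - (c · a)
  ·-neg c a = GP.inverseʳ-unique (c · a) (c · (- a))
    (≈-trans (≈-sym (·-distˡ c a (- a))) (·-0 c (-‿inverseʳ a)))

  inv·ι : ∀ k a → inv (suc k) · (ι (suc k) · a) ≈ a
  inv·ι k a = ≈-trans (≈-sym (·-assoc _ _ a)) (≈-trans
    (·-congˡ a (≡.trans (ℚₚ.*-comm (inv (suc k)) (ι (suc k))) (ι-inv k))) (·-1 a))

  ι·inv : ∀ k a → ι (suc k) · (inv (suc k) · a) ≈ a
  ι·inv k a = ≈-trans (≈-sym (·-assoc _ _ a)) (≈-trans (·-congˡ a (ι-inv k)) (·-1 a))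

  ·-sum : ∀ c n f → c · sum n f ≈ sum n (λ i → c · f i)
  ·-sum c = SumHom.hom-sum +-commutativeMonoid +-commutativeMonoid (c ·_) (·0 c) (·-distˡ c)

  ·-diag : ∀ c n F → c · diag F n ≈ diag (λ i j → c · F i j) n
  ·-diag c = SumHom.hom-diag +-commutativeMonoid +-commutativeMonoid (c ·_) (·0 c) (·-distˡ c)

  ι·diag : ∀ n F → ι n · diag F n ≈ diag (λ i j → ι i · F i j) n + diag (λ i j → ι j · F i j) n
  ι·diag n F = ≈-trans (·-diag _ n F) (≈-trans
    (diag-cong n (λ i j q → ≈-trans (·-congˡ _ (≡.trans (≡.cong ι (≡.sym q)) (ι-+ i j))) (·-distʳ _ _ _)))
    (diag-+ n _ _))

  sum·-diag : ∀ a n (c : ℕ → ℕ → ℚ) →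
    diag (λ i j → c i j · a) n ≈ Sums.diag ℚ⁺ c n · a
  sum·-diag a n c = ≈-sym (SumHom.hom-diag ℚ⁺ +-commutativeMonoid
    (_· a) (0· a) (λ x y → ·-distʳ x y a) n c)

  sum·-sum : ∀ a n (c : ℕ → ℚ) →
    sum n (λ i → c i · a) ≈ Sums.sum ℚ⁺ n c · a
  sum·-sum a n c = ≈-sym (SumHom.hom-sum ℚ⁺ +-commutativeMonoid
    (_· a) (0· a) (λ x y → ·-distʳ x y a) n c)

record QAlgebra : Set₁ where
  infixr 8 _·_
  field
    ring : Ring 0ℓ 0ℓ
  open Ring ring public using (Carrier; _≈_; _+_; _*_; 0#; 1#; -_; setoid; +-cong; *-cong;
    *-assoc; *-identityˡ; *-identityʳ; distribˡ; distribʳ; zeroˡ; zeroʳ; -‿cong)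
    renaming (refl to ≈-refl; sym to ≈-sym; trans to ≈-trans)
  field
    _·_       : ℚ → Carrier → Carrier
    ·-cong    : ∀ c {a b} → a ≈ b → c · a ≈ c · b
    ·-distˡ   : ∀ c a b → c · (a + b) ≈ c · a + c · b
    ·-distʳ   : ∀ c d a → (c ℚ.+ d) · a ≈ c · a + d · a
    ·-assoc   : ∀ c d a → (c ℚ.* d) · a ≈ c · (d · a)
    ·-1       : ∀ a → 1ℚ · a ≈ a
    ·-*ˡ      : ∀ c a b → c · (a * b) ≈ (c · a) * b
    ·-*ʳ      : ∀ c a b → c · (a * b) ≈ a * (c · b)

  qmodule : QModule
  qmodule = record { group = Ring.+-abelianGroup ring ; _·_ = _·_ ; ·-cong = ·-cong ; ·-distˡ = ·-distˡ
                   ; ·-distʳ = ·-distʳ ; ·-assoc = ·-assoc ; ·-1 = ·-1 }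
  open QModule qmodule public using (+-assoc; +-comm; +-identityˡ; +-identityʳ; -‿inverseˡ; -‿inverseʳ;
    +-commutativeMonoid; ·-congˡ; 0·; ·0; ·-0; ·-neg; inv·ι; ι·inv; ·-sum; ·-diag; ι·diag; sum·-diag; sum·-sum;
    +-interchange; sum; sum-cong; sum-zero; sum-+; sum-last; sum-peel; sum-peel-last; sum-swap; sum-extend; sum-single; sum-diag;
    diag; diag-cong; diag-zero; diag-+; diag-last; diag-flip; diag-assoc; diag-exchange; diag-single;
    shift; shift-cong; shift-shift; shift-big; shift-at; module GP)
  module RP = RingProperties ring

  *-sumˡ : ∀ a n f → a * sum n f ≈ sum n (λ i → a * f i)
  *-sumˡ a = SumHom.hom-sum +-commutativeMonoid +-commutativeMonoid (a *_) (zeroʳ a) (distribˡ a)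

  *-sumʳ : ∀ a n f → sum n f * a ≈ sum n (λ i → f i * a)
  *-sumʳ a = SumHom.hom-sum +-commutativeMonoid +-commutativeMonoid (_* a) (zeroˡ a) (λ b c → distribʳ a b c)

  *-diagˡ : ∀ a n F → a * diag F n ≈ diag (λ i j → a * F i j) n
  *-diagˡ a = SumHom.hom-diag +-commutativeMonoid +-commutativeMonoid (a *_) (zeroʳ a) (distribˡ a)

  *-diagʳ : ∀ a n F → diag F n * a ≈ diag (λ i j → F i j * a) n
  *-diagʳ a = SumHom.hom-diag +-commutativeMonoid +-commutativeMonoid (_* a) (zeroˡ a) (λ b c → distribʳ a b c)

  ad : Carrier → Carrier → Carrier
  ad z h = z * h + - (h * z)

  ad-cong : ∀ {z z′ h h′} → z ≈ z′ → h ≈ h′ → ad z h ≈ ad z′ h′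
  ad-cong p q = +-cong (*-cong p q) (-‿cong (*-cong q p))

  ad-+ʳ : ∀ z h → ad z h + h * z ≈ z * h
  ad-+ʳ z h = ≈-trans (+-assoc _ _ _) (≈-trans (+-cong ≈-refl (-‿inverseˡ (h * z))) (+-identityʳ _))

  neg-+ : ∀ a b → - (a + b) ≈ - a + - b
  neg-+ a b = ≈-sym (RP.-‿+-comm a b)

  ad-distˡ : ∀ z g h → ad z (g + h) ≈ ad z g + ad z h
  ad-distˡ z g h = ≈-trans (+-cong (distribˡ z g h) (≈-trans (-‿cong (distribʳ z g h)) (neg-+ _ _)))
                           (+-interchange _ _ _ _)

  ad-· : ∀ z c h → ad z (c · h) ≈ c · ad z h
  ad-· z c h = ≈-trans (+-cong (≈-sym (·-*ʳ c z h)) (≈-trans (-‿cong (≈-sym (·-*ˡ c h z))) (≈-sym (·-neg c _))))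
                       (≈-sym (·-distˡ c _ _))

  ad-self : ∀ z → ad z z ≈ 0#
  ad-self z = -‿inverseʳ (z * z)

  ad-0 : ∀ z → ad z 0# ≈ 0#
  ad-0 z = ≈-trans (+-cong (zeroʳ z) (-‿cong (zeroˡ z))) (-‿inverseʳ 0#)

record Filtration (M : QModule) (K : ℕ) : Set₁ where
  open QModule M
  field
    F       : ℕ → Carrier → Set
    F-cong  : ∀ {k a b} → a ≈ b → F k a → F k b
    F-0     : ∀ a → F 0 a
    F-+     : ∀ {k a b} → F k a → F k b → F k (a + b)
    F-neg   : ∀ {k a} → F k a → F k (- a)
    F-·     : ∀ {k a} c → F k a → F k (c · a)
    F-zero  : ∀ k → F k 0#
    F-top   : ∀ {k a} → K ≤ k → F k a → a ≈ 0#

  F-sum : ∀ {k} n {f : ℕ → Carrier} → (∀ i → i < n → F k (f i)) → F k (sum n f)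
  F-sum zero    e = F-zero _
  F-sum (suc n) e = F-+ (e 0 (s≤s z≤n)) (F-sum n (λ i p → e (suc i) (s≤s p)))

record RaisingOperator (M : QModule) {K : ℕ} (Φ : Filtration M K) : Set where
  open QModule M
  open Filtration Φ
  field
    T      : Carrier → Carrier
    T-cong : ∀ {a b} → a ≈ b → T a ≈ T b
    T-+    : ∀ a b → T (a + b) ≈ T a + T b
    T-·    : ∀ c a → T (c · a) ≈ c · T a
    T-F    : ∀ {k a} → F k a → F (suc k) (T a)

_⊛_ : (ℕ → ℚ) → (ℕ → ℚ) → ℕ → ℚ
(c ⊛ d) n = Sums.diag ℚ⁺ (λ i j → c i ℚ.* d j) n

module Eval (M : QModule) {K : ℕ} (Φ : Filtration M K) (Op : RaisingOperator M Φ) where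
  open QModule M
  open Filtration Φ
  open RaisingOperator Op
  open import Relation.Binary.Reasoning.Setoid setoid

  T-0 : T 0# ≈ 0#
  T-0 = ≈-trans (T-cong (≈-sym (0· 0#))) (≈-trans (T-· 0ℚ 0#) (0· _))

  pow : ℕ → Carrier → Carrier
  pow zero    h = h
  pow (suc k) h = T (pow k h)

  pow-cong : ∀ k {a b} → a ≈ b → pow k a ≈ pow k b
  pow-cong zero    e = e
  pow-cong (suc k) e = T-cong (pow-cong k e)

  pow-0 : ∀ k → pow k 0# ≈ 0#
  pow-0 zero    = ≈-refl
  pow-0 (suc k) = ≈-trans (T-cong (pow-0 k)) T-0

  pow-+ : ∀ k a b → pow k (a + b) ≈ pow k a + pow k b
  pow-+ zero    a b = ≈-refl
  pow-+ (suc k) a b = ≈-trans (T-cong (pow-+ k a b)) (T-+ _ _)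

  pow-· : ∀ k c a → pow k (c · a) ≈ c · pow k a
  pow-· zero    c a = ≈-refl
  pow-· (suc k) c a = ≈-trans (T-cong (pow-· k c a)) (T-· c _)

  pow-pow : ∀ i j h → pow i (pow j h) ≡ pow (i ℕ.+ j) h
  pow-pow zero    j h = refl
  pow-pow (suc i) j h = ≡.cong T (pow-pow i j h)

  pow-F : ∀ i {k h} → F k h → F (i ℕ.+ k) (pow i h)
  pow-F zero    p = p
  pow-F (suc i) p = T-F (pow-F i p)

  pow-top : ∀ i h → K ≤ i → pow i h ≈ 0#
  pow-top i h K≤i = F-top (≡.subst (K ≤_) (≡.sym (ℕₚ.+-identityʳ i)) K≤i) (pow-F i (F-0 h))

  pow-sum : ∀ k n f → pow k (sum n f) ≈ sum n (λ i → pow k (f i))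
  pow-sum k = SumHom.hom-sum +-commutativeMonoid +-commutativeMonoid (pow k) (pow-0 k) (pow-+ k)

  ev : (ℕ → ℚ) → Carrier → Carrier
  ev c h = sum K (λ k → c k · pow k h)

  ev-cong : ∀ {c d h g} → (∀ k → k < K → c k ≡ d k) → h ≈ g → ev c h ≈ ev d g
  ev-cong p e = sum-cong K (λ k k<K → ≈-trans (·-congˡ _ (p k k<K)) (·-cong _ (pow-cong k e)))

  ev-+ : ∀ c a b → ev c (a + b) ≈ ev c a + ev c b
  ev-+ c a b = ≈-trans (sum-cong K (λ k _ → ≈-trans (·-cong _ (pow-+ k a b)) (·-distˡ _ _ _))) (sum-+ K _ _)

  -- Terms with i + j ≥ K vanish because the operator raises the filtration. So substituting it into
  -- power series is multiplicative, and identities between scalar series carry over to operators.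
  ev-⊛ : ∀ c d h → ev c (ev d h) ≈ ev (c ⊛ d) h
  ev-⊛ c d h = begin
    sum K (λ i → c i · pow i (sum K (λ j → d j · pow j h)))
      ≈⟨ sum-cong K (λ i _ → ≈-trans (·-cong _ (pow-sum i K _)) (·-sum _ K _)) ⟩
    sum K (λ i → sum K (λ j → c i · pow i (d j · pow j h)))
      ≈⟨ sum-cong K (λ i _ → sum-cong K (λ j _ → ≈-trans (·-cong _ (pow-· i _ _))
           (≈-trans (≈-sym (·-assoc _ _ _)) (reflexive′ (≡.cong ((c i ℚ.* d j) ·_) (pow-pow i j h)))))) ⟩
    sum K (λ i → sum K (λ j → (c i ℚ.* d j) · pow (i ℕ.+ j) h))
      ≈⟨ sum-diag K _ (λ i j K≤ → ·-0 _ (pow-top (i ℕ.+ j) h K≤)) ⟩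
    sum K (diag (λ i j → (c i ℚ.* d j) · pow (i ℕ.+ j) h))
      ≈⟨ sum-cong K (λ k _ → diag-cong k (λ i j q → reflexive′ (≡.cong (λ r → (c i ℚ.* d j) · pow r h) q))) ⟩
    sum K (λ k → diag (λ i j → (c i ℚ.* d j) · pow k h) k)
      ≈⟨ sum-cong K (λ k _ → sum·-diag _ k _) ⟩
    sum K (λ k → (c ⊛ d) k · pow k h) ∎
    where
    reflexive′ : ∀ {a b} → a ≡ b → a ≈ b
    reflexive′ refl = ≈-refl

record FilteredAlgebra (K : ℕ) : Set₁ where
  field
    algebra    : QAlgebra
  open QAlgebra algebra public
  field
    filtration : Filtration qmodule K
  open Filtration filtration public
  field
    F-* : ∀ {i j a b} → F i a → F j b → F (i ℕ.+ j) (a * b)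

record Derivation (A : QAlgebra) : Set where
  open QAlgebra A
  field
    δ      : Carrier → Carrier
    δ-cong : ∀ {a b} → a ≈ b → δ a ≈ δ b
    δ-+    : ∀ a b → δ (a + b) ≈ δ a + δ b
    δ-·    : ∀ c a → δ (c · a) ≈ c · δ a
    δ-*    : ∀ a b → δ (a * b) ≈ δ a * b + a * δ b

  δ-0 : δ 0# ≈ 0#
  δ-0 = ≈-trans (δ-cong (≈-sym (0· 0#))) (≈-trans (δ-· 0ℚ 0#) (0· _))

  δ-1 : δ 1# ≈ 0#
  δ-1 = GP.identityʳ-unique (δ 1#) (δ 1#) (≈-sym (≈-trans (δ-cong (≈-sym (*-identityˡ 1#)))
    (≈-trans (δ-* 1# 1#) (+-cong (*-identityʳ _) (*-identityˡ _)))))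

  δ-sum : ∀ n f → δ (sum n f) ≈ sum n (λ i → δ (f i))
  δ-sum = SumHom.hom-sum +-commutativeMonoid +-commutativeMonoid δ δ-0 δ-+

module _ (A : QAlgebra) where
  open QAlgebra A
  open import Relation.Binary.Reasoning.Setoid setoid

  innerDerivation : Carrier → Derivation A
  innerDerivation h = record
    { δ = ad h ; δ-cong = ad-cong ≈-refl ; δ-+ = ad-distˡ h ; δ-· = ad-· h
    ; δ-* = λ a b → begin
        h * (a * b) + - (a * b * h)
          ≈⟨ +-cong (≈-sym (*-assoc h a b)) (-‿cong (*-assoc a b h)) ⟩
        h * a * b + - (a * (b * h))
          ≈⟨ +-cong (*-cong (≈-sym (ad-+ʳ h a)) ≈-refl) ≈-refl ⟩
        (ad h a + a * h) * b + - (a * (b * h))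
          ≈⟨ +-cong (distribʳ b _ _) ≈-refl ⟩
        (ad h a * b + a * h * b) + - (a * (b * h))
          ≈⟨ +-assoc _ _ _ ⟩
        ad h a * b + (a * h * b + - (a * (b * h)))
          ≈⟨ +-cong ≈-refl (+-cong (*-assoc a h b) (RP.-‿distribʳ-* a (b * h))) ⟩
        ad h a * b + (a * (h * b) + a * - (b * h))
          ≈⟨ +-cong ≈-refl (≈-sym (distribˡ a _ _)) ⟩
        ad h a * b + a * ad h b ∎ }

  -- divided powers z^k / k!
  dp : Carrier → ℕ → Carrier
  dp z zero    = 1#
  dp z (suc k) = inv (suc k) · (z * dp z k)

  dp-cong : ∀ {z z′} k → z ≈ z′ → dp z k ≈ dp z′ k
  dp-cong zero    e = ≈-refl
  dp-cong (suc k) e = ·-cong _ (*-cong e (dp-cong k e))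

  ι·dp : ∀ z k → ι (suc k) · dp z (suc k) ≈ z * dp z k
  ι·dp z k = ι·inv k _

  -- (ad z)^k u / (k+1)!
  adp : Carrier → Carrier → ℕ → Carrier
  adp z u zero    = u
  adp z u (suc k) = inv (suc (suc k)) · ad z (adp z u k)

  module _ (D : Derivation A) (z : Carrier) where
    open Derivation D

    -- In the induction step multiply by k + 2 and split this factor as (i + 1) + j on the
    -- antidiagonal i + j = k + 1. For i ≥ 1 the first part turns `q i` into `ad z` of its
    -- predecessor; the second turns `dp z j` into `z` times its predecessor. The identity
    -- `ad z q + q * z = z * q` recombines them.
    derivation-dp : ∀ k → δ (dp z (suc k)) ≈ diag (λ i j → adp z (δ z) i * dp z j) k
    derivation-dp zero = begin
      δ (inv 1 · (z * 1#))  ≈⟨ δ-cong (≈-trans (·-congˡ _ inv-1) (≈-trans (·-1 _) (*-identityʳ z))) ⟩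
      δ z                   ≈⟨ ≈-sym (*-identityʳ _) ⟩
      δ z * 1#              ∎
    derivation-dp (suc k) = begin
      δ (inv (suc (suc k)) · (z * dp z (suc k)))
        ≈⟨ ≈-trans (δ-· _ _) (·-cong _ (δ-* _ _)) ⟩
      inv (suc (suc k)) · (u * dp z (suc k) + z * δ (dp z (suc k)))
        ≈⟨ ·-cong _ (+-cong ≈-refl (*-cong ≈-refl (derivation-dp k))) ⟩
      inv (suc (suc k)) · (u * dp z (suc k) + z * diag G k)
        ≈⟨ ·-cong _ (≈-sym key) ⟩
      inv (suc (suc k)) · (ι (suc (suc k)) · diag G (suc k))
        ≈⟨ inv·ι (suc k) _ ⟩
      diag G (suc k) ∎
      where
      u = δ z
      q = adp z u
      G : ℕ → ℕ → Carrier
      G i j = q i * dp z j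
      ι-suc : ∀ i a → ι (suc i) · a ≈ ι i · a + a
      ι-suc i a = ≈-trans (·-congˡ a (≡.trans (ι-+ 1 i) (≡.trans (≡.cong (ℚ._+ ι i) ι-1) (ℚₚ.+-comm 1ℚ (ι i))))) (≈-trans (·-distʳ _ _ a) (+-cong ≈-refl (·-1 a)))
      left : ι (suc k) · diag G (suc k) + diag G (suc k) ≈
             diag (λ i j → ι (suc i) · G i j) (suc k) + diag (λ i j → ι j · G i j) (suc k)
      left = begin
        ι (suc k) · diag G (suc k) + diag G (suc k)
          ≈⟨ +-cong (ι·diag (suc k) G) ≈-refl ⟩
        (diag (λ i j → ι i · G i j) (suc k) + diag (λ i j → ι j · G i j) (suc k)) + diag G (suc k)
          ≈⟨ ≈-trans (+-assoc _ _ _) (≈-trans (+-cong ≈-refl (+-comm _ _)) (≈-sym (+-assoc _ _ _))) ⟩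
        (diag (λ i j → ι i · G i j) (suc k) + diag G (suc k)) + diag (λ i j → ι j · G i j) (suc k)
          ≈⟨ +-cong (≈-trans (≈-sym (diag-+ (suc k) (λ i j → ι i · G i j) G)) (diag-cong (suc k) {λ i j → ι i · G i j + G i j} {λ i j → ι (suc i) · G i j} (λ i j _ → ≈-sym (ι-suc i (G i j))))) ≈-refl ⟩
        diag (λ i j → ι (suc i) · G i j) (suc k) + diag (λ i j → ι j · G i j) (suc k) ∎
      first : diag (λ i j → ι (suc i) · G i j) (suc k) ≈ u * dp z (suc k) + diag (λ i j → ad z (q i) * dp z j) k
      first = +-cong (≈-trans (·-congˡ _ ι-1) (·-1 _)) (diag-cong k (λ i j _ → ≈-trans (·-*ˡ _ _ _) (*-cong (ι·inv (suc i) _) ≈-refl)))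
      second : diag (λ i j → ι j · G i j) (suc k) ≈ diag (λ i j → q i * (z * dp z j)) k
      second = ≈-trans (diag-last k (λ i j → ι j · G i j)) (≈-trans (+-cong (diag-cong k (λ i j _ →
        ≈-trans (·-*ʳ _ _ _) (*-cong ≈-refl (ι·dp z j)))) (≈-trans (·-congˡ _ ι-0) (0· _))) (+-identityʳ _))
      key : ι (suc (suc k)) · diag G (suc k) ≈ u * dp z (suc k) + z * diag G k
      key = begin
        ι (suc (suc k)) · diag G (suc k)  ≈⟨ ι-suc (suc k) _ ⟩
        ι (suc k) · diag G (suc k) + diag G (suc k)  ≈⟨ left ⟩
        diag (λ i j → ι (suc i) · G i j) (suc k) + diag (λ i j → ι j · G i j) (suc k)
          ≈⟨ +-cong first second ⟩
        (u * dp z (suc k) + diag (λ i j → ad z (q i) * dp z j) k) + diag (λ i j → q i * (z * dp z j)) k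
          ≈⟨ ≈-trans (+-assoc _ _ _) (+-cong ≈-refl (≈-sym (diag-+ k _ _))) ⟩
        u * dp z (suc k) + diag (λ i j → ad z (q i) * dp z j + q i * (z * dp z j)) k
          ≈⟨ +-cong ≈-refl (diag-cong k (λ i j _ → begin
               ad z (q i) * dp z j + q i * (z * dp z j)    ≈⟨ +-cong ≈-refl (≈-sym (*-assoc _ _ _)) ⟩
               ad z (q i) * dp z j + q i * z * dp z j      ≈⟨ ≈-sym (distribʳ _ _ _) ⟩
               (ad z (q i) + q i * z) * dp z j             ≈⟨ *-cong (ad-+ʳ z (q i)) ≈-refl ⟩
               z * q i * dp z j                            ≈⟨ *-assoc _ _ _ ⟩
               z * (q i * dp z j)                          ∎)) ⟩
        u * dp z (suc k) + diag (λ i j → z * (q i * dp z j)) k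
          ≈⟨ +-cong ≈-refl (≈-sym (*-diagˡ z k _)) ⟩
        u * dp z (suc k) + z * diag G k ∎

expCoeff : ℕ → ℚ
expCoeff k = inv (k !)

-- coefficients of (e^s - 1) / s
φ : ℕ → ℚ
φ k = inv (suc k !)

module Exp {K l : ℕ} (K≡ : K ≡ suc l) (𝔸 : FilteredAlgebra K) where
  open FilteredAlgebra 𝔸
  open import Relation.Binary.Reasoning.Setoid setoid

  exp : Carrier → Carrier
  exp z = sum K (dp algebra z)

  exp-cong : ∀ {z z′} → z ≈ z′ → exp z ≈ exp z′
  exp-cong e = sum-cong K (λ k _ → dp-cong algebra k e)

  dp-F : ∀ {z} → F 1 z → ∀ k → F k (dp algebra z k)
  dp-F p zero    = F-0 _
  dp-F p (suc k) = F-· _ (F-* p (dp-F p k))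

  ad-F : ∀ {z} → F 1 z → ∀ {k a} → F k a → F (suc k) (ad z a)
  ad-F {z} p {k} {a} q = F-+ (F-* p q) (F-neg (≡.subst (λ i → F i (a * z)) (ℕₚ.+-comm k 1) (F-* q p)))

  ad-F0 : ∀ {z} → F 1 z → ∀ a → F 1 (ad a z)
  ad-F0 {z} p a = F-+ (F-* (F-0 a) p) (F-neg (F-* p (F-0 a)))

  adOp : ∀ {z} → F 1 z → RaisingOperator qmodule filtration
  adOp {z} p = record { T = ad z ; T-cong = ad-cong ≈-refl ; T-+ = ad-distˡ z ; T-· = ad-· z ; T-F = ad-F p }

  mulOp : ∀ {n} → F 1 n → RaisingOperator qmodule filtration
  mulOp {n} p = record { T = n *_ ; T-cong = *-cong ≈-refl ; T-+ = distribˡ n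
                       ; T-· = λ c a → ≈-sym (·-*ʳ c n a) ; T-F = F-* p }

  module Ad {z} (p : F 1 z) = Eval qmodule filtration (adOp p)
  module Mul {n} (p : F 1 n) = Eval qmodule filtration (mulOp p)

  adp-φ : ∀ {z} (p : F 1 z) u i → adp algebra z u i ≈ φ i · Ad.pow p i u
  adp-φ p u zero    = ≈-sym (≈-trans (·-congˡ u inv-1) (·-1 u))
  adp-φ {z} p u (suc i) = begin
    inv (suc (suc i)) · ad z (adp algebra z u i)   ≈⟨ ·-cong _ (≈-trans (ad-cong ≈-refl (adp-φ p u i)) (ad-· z _ _)) ⟩
    inv (suc (suc i)) · (φ i · Ad.pow p (suc i) u) ≈⟨ ≈-sym (·-assoc _ _ _) ⟩
    (inv (suc (suc i)) ℚ.* φ i) · Ad.pow p (suc i) u ≈⟨ ·-congˡ _ (≡.sym (inv-* (suc (suc i)) (suc i !))) ⟩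
    φ (suc i) · Ad.pow p (suc i) u ∎

  module _ (D : Derivation algebra) {z} (p : F 1 z) where
    open Derivation D

    -- Since `δ z` has order 1, the term (i, j) lies in `F (suc (i + j))`. So the antidiagonals from
    -- l on contribute nothing, and the sum over k completes to a full square of indices, which
    -- factors.
    derivation-exp : F 1 (δ z) → δ (exp z) ≈ Ad.ev p φ (δ z) * exp z
    derivation-exp q = begin
      δ (exp z)                                ≈⟨ ≈-trans (δ-sum K _) (sum-peel K≡ _) ⟩
      δ 1# + sum l (λ k → δ (dp algebra z (suc k)))
        ≈⟨ +-cong δ-1 (sum-cong l (λ k _ → derivation-dp algebra D z k)) ⟩
      0# + sum l (diag G)                      ≈⟨ +-comm _ _ ⟩
      sum l (diag G) + 0#                      ≈⟨ +-cong ≈-refl (≈-sym (diag-zero l (λ i j e → G-zero i j (ℕₚ.≤-reflexive (≡.trans K≡ (≡.cong suc (≡.sym e))))))) ⟩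
      sum l (diag G) + diag G l                ≈⟨ ≈-sym (sum-peel-last K≡ (diag G)) ⟩
      sum K (diag G)                           ≈⟨ ≈-sym (sum-diag K G (λ i j e → G-zero i j (ℕₚ.m≤n⇒m≤1+n e))) ⟩
      sum K (λ i → sum K (λ j → G i j))        ≈⟨ sum-cong K (λ i _ → ≈-sym (*-sumˡ _ K _)) ⟩
      sum K (λ i → adp algebra z (δ z) i * exp z) ≈⟨ ≈-sym (*-sumʳ _ K _) ⟩
      sum K (adp algebra z (δ z)) * exp z      ≈⟨ *-cong (sum-cong K (λ i _ → adp-φ p (δ z) i)) ≈-refl ⟩
      Ad.ev p φ (δ z) * exp z                  ∎
      where
      G : ℕ → ℕ → Carrier
      G i j = adp algebra z (δ z) i * dp algebra z j
      adp-F : ∀ i → F (suc i) (adp algebra z (δ z) i)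
      adp-F zero    = q
      adp-F (suc i) = F-· _ (ad-F p (adp-F i))
      G-zero : ∀ i j → K ≤ suc (i ℕ.+ j) → G i j ≈ 0#
      G-zero i j e = F-top e (F-* (adp-F i) (dp-F p j))

  expAd : ∀ {z} → F 1 z → Carrier → Carrier
  expAd p = Ad.ev p expCoeff

  expAd-φ : ∀ {z} (p : F 1 z) h → expAd p h ≈ h + Ad.ev p φ (ad z h)
  expAd-φ {z} p h = ≈-trans (sum-peel K≡ _) (+-cong (≈-trans (·-congˡ h inv-1) (·-1 h)) (begin
    sum l (λ k → expCoeff (suc k) · pow (suc k) h)     ≈⟨ sum-cong l (λ k _ → ·-cong _ (≈-sym (pow-T k))) ⟩
    sum l (λ k → φ k · pow k (ad z h))                 ≈⟨ ≈-sym (+-identityʳ _) ⟩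
    sum l (λ k → φ k · pow k (ad z h)) + 0#
      ≈⟨ +-cong ≈-refl (≈-sym (·-0 _ (≈-trans (pow-T l) (Ad.pow-top p (suc l) h (ℕₚ.≤-reflexive K≡))))) ⟩
    sum l (λ k → φ k · pow k (ad z h)) + φ l · pow l (ad z h) ≈⟨ ≈-sym (sum-peel-last K≡ (λ k → φ k · pow k (ad z h))) ⟩
    Ad.ev p φ (ad z h) ∎))
    where
    pow = Ad.pow p
    pow-T : ∀ k → pow k (ad z h) ≈ pow (suc k) h
    pow-T zero    = ≈-refl
    pow-T (suc k) = ad-cong ≈-refl (pow-T k)

  -- Hadamard's lemma is derivation-exp for the inner derivation ad h.
  hadamard : ∀ {z} (p : F 1 z) h → exp z * h ≈ expAd p h * exp z
  hadamard {z} p h = begin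
    e * h                                   ≈⟨ ≈-sym (+-identityʳ _) ⟩
    e * h + 0#                              ≈⟨ +-cong ≈-refl (≈-sym vanish) ⟩
    e * h + (ad h e + W * e)                ≈⟨ ≈-sym (+-assoc _ _ _) ⟩
    (e * h + ad h e) + W * e                ≈⟨ +-cong (≈-trans (+-comm _ _) (ad-+ʳ h e)) ≈-refl ⟩
    h * e + W * e                           ≈⟨ ≈-sym (distribʳ e h W) ⟩
    (h + W) * e                             ≈⟨ *-cong (≈-sym (expAd-φ p h)) ≈-refl ⟩
    expAd p h * e                           ∎
    where
    e = exp z
    W = Ad.ev p φ (ad z h)
    opp : ad h z + ad z h ≈ 0#
    opp = ≈-trans (+-interchange _ _ _ _) (≈-trans (+-cong ≈-refl (+-comm _ _))
          (≈-trans (+-interchange _ _ _ _) (≈-trans (+-cong (-‿inverseʳ _) (-‿inverseʳ _)) (+-identityˡ _))))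
    vanish : ad h e + W * e ≈ 0#
    vanish = begin
      ad h e + W * e                             ≈⟨ +-cong (derivation-exp (innerDerivation algebra h) p (ad-F0 p h)) ≈-refl ⟩
      Ad.ev p φ (ad h z) * e + W * e             ≈⟨ ≈-sym (distribʳ e _ _) ⟩
      (Ad.ev p φ (ad h z) + W) * e               ≈⟨ *-cong (≈-sym (Ad.ev-+ p φ _ _)) ≈-refl ⟩
      Ad.ev p φ (ad h z + ad z h) * e            ≈⟨ *-cong (Ad.ev-cong p (λ _ _ → refl) opp) ≈-refl ⟩
      Ad.ev p φ 0# * e                           ≈⟨ *-cong (sum-zero K (λ k _ → ·-0 _ (Ad.pow-0 p k))) ≈-refl ⟩
      0# * e                                     ≈⟨ zeroˡ e ⟩
      0# ∎

  -- From w = - w n, membership of w in `F k` improves to `F (suc k)`, until w lies in `F K`.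
  cancel-zero : ∀ {w n} → F 1 n → w * (1# + n) ≈ 0# → w ≈ 0#
  cancel-zero {w} {n} p e = F-top {K} ℕₚ.≤-refl (go K)
    where
    w≈ : w ≈ - (w * n)
    w≈ = GP.inverseˡ-unique w (w * n) (≈-trans (≈-sym (≈-trans (distribˡ w 1# n) (+-cong (*-identityʳ w) ≈-refl))) e)
    go : ∀ k → F k w
    go zero    = F-0 w
    go (suc k) = F-cong (≈-sym w≈) (F-neg (≡.subst (λ i → F i (w * n)) (ℕₚ.+-comm k 1) (F-* (go k) p)))

  cancel : ∀ {w v n} → F 1 n → w * (1# + n) ≈ v * (1# + n) → w ≈ v
  cancel {w} {v} {n} p e = difference-zero (cancel-zero p (begin
    (w + - v) * (1# + n)                ≈⟨ distribʳ _ _ _ ⟩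
    w * (1# + n) + - v * (1# + n)       ≈⟨ +-cong e (≈-sym (RP.-‿distribˡ-* v _)) ⟩
    v * (1# + n) + - (v * (1# + n))     ≈⟨ -‿inverseʳ _ ⟩
    0# ∎))
    where
    difference-zero : w + - v ≈ 0# → w ≈ v
    difference-zero q = ≈-trans (≈-sym (+-identityʳ w)) (≈-trans (+-cong ≈-refl (≈-sym (-‿inverseˡ v)))
      (≈-trans (≈-sym (+-assoc _ _ _)) (≈-trans (+-cong q ≈-refl) (+-identityˡ v))))

  exp-1+F : ∀ {z} → F 1 z → F 1 (sum l (λ k → dp algebra z (suc k)))
  exp-1+F p = F-sum l (λ k _ → F-· _ (F-* p (F-0 _)))

-- Series modulo t^K in a central variable t over a possibly noncommutative algebra. The scalar case
-- serves for identities between coefficients, the general case for the Euler derivation t d/dt.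
module Series (A : QAlgebra) (K : ℕ) where
  private module A = QAlgebra A

  C : Set
  C = ℕ → A.Carrier

  _≈ₛ_ : C → C → Set
  a ≈ₛ b = ∀ n → n < K → a n A.≈ b n

  _*ₛ_ : C → C → C
  (a *ₛ b) n = A.diag (λ i j → a i A.* b j) n

  one : C
  one zero    = A.1#
  one (suc n) = A.0#

  private
    below : ∀ {i j n} → i ℕ.+ j ≡ n → n < K → (i < K) × (j < K)
    below {i} {j} refl p = ℕₚ.≤-<-trans (ℕₚ.m≤m+n i j) p , ℕₚ.≤-<-trans (ℕₚ.m≤n+m j i) p

  *ₛ-cong : ∀ {a b c d} → a ≈ₛ b → c ≈ₛ d → (a *ₛ c) ≈ₛ (b *ₛ d)
  *ₛ-cong p q n n<K = A.diag-cong n (λ i j e → A.*-cong (p i (proj₁ (below {i} {j} e n<K))) (q j (proj₂ (below {i} {j} e n<K))))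

  seriesRing : Ring 0ℓ 0ℓ
  seriesRing = record
    { Carrier = C ; _≈_ = _≈ₛ_ ; _+_ = λ a b n → a n A.+ b n ; _*_ = _*ₛ_
    ; -_ = λ a n → A.- a n ; 0# = λ _ → A.0# ; 1# = one
    ; isRing = record
      { +-isAbelianGroup = record
        { isGroup = record
          { isMonoid = record
            { isSemigroup = record
              { isMagma = record
                { isEquivalence = record
                  { refl = λ _ _ → A.≈-refl ; sym = λ p n q → A.≈-sym (p n q) ; trans = λ p q n r → A.≈-trans (p n r) (q n r) }
                ; ∙-cong = λ p q n r → A.+-cong (p n r) (q n r) }
              ; assoc = λ a b c n _ → A.+-assoc _ _ _ }
            ; identity = (λ a n _ → A.+-identityˡ _) , (λ a n _ → A.+-identityʳ _) }
          ; inverse = (λ a n _ → A.-‿inverseˡ _) , (λ a n _ → A.-‿inverseʳ _)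
          ; ⁻¹-cong = λ p n q → A.-‿cong (p n q) }
        ; comm = λ a b n _ → A.+-comm _ _ }
      ; *-cong = *ₛ-cong
      ; *-assoc = λ a b c n _ → A.≈-trans (A.diag-cong n (λ s k _ → A.*-diagʳ (c k) s _))
          (A.≈-trans (A.diag-cong n (λ s k _ → A.diag-cong s (λ i j _ → A.*-assoc (a i) (b j) (c k))))
          (A.≈-trans (A.diag-assoc n (λ i j k → a i A.* (b j A.* c k)))
          (A.diag-cong n (λ i s _ → A.≈-sym (A.*-diagˡ (a i) s _)))))
      ; *-identity = (λ a n _ → A.≈-trans (A.diag-single 0 n (λ i j → one i A.* a j) one-zero) (A.*-identityˡ _))
          , (λ a n _ → A.≈-trans (A.diag-flip n (λ i j → a i A.* one j))
               (A.≈-trans (A.diag-single 0 n (λ i j → a j A.* one i) one-zero′) (A.*-identityʳ _)))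
      ; distrib = (λ a b c n _ → A.≈-trans (A.diag-cong n (λ i j _ → A.distribˡ (a i) (b j) (c j))) (A.diag-+ n _ _))
          , (λ a b c n _ → A.≈-trans (A.diag-cong n (λ i j _ → A.distribʳ (a j) (b i) (c i))) (A.diag-+ n _ _)) } }
    where
    one-zero : ∀ {a : C} i j → (i ≡ 0 → ⊥) → one i A.* a j A.≈ A.0#
    one-zero zero    j e = ⊥-elim (e refl)
    one-zero (suc i) j e = A.zeroˡ _
    one-zero′ : ∀ {a : C} i j → (i ≡ 0 → ⊥) → a j A.* one i A.≈ A.0#
    one-zero′ zero    j e = ⊥-elim (e refl)
    one-zero′ (suc i) j e = A.zeroʳ _

  seriesAlgebra : QAlgebra
  seriesAlgebra = record
    { ring = seriesRing ; _·_ = λ c a n → c A.· a n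
    ; ·-cong = λ c p n q → A.·-cong c (p n q)
    ; ·-distˡ = λ c a b n _ → A.·-distˡ c _ _
    ; ·-distʳ = λ c d a n _ → A.·-distʳ c d _
    ; ·-assoc = λ c d a n _ → A.·-assoc c d _
    ; ·-1 = λ a n _ → A.·-1 _
    ; ·-*ˡ = λ c a b n _ → A.≈-trans (A.·-diag c n _) (A.diag-cong n (λ i j _ → A.·-*ˡ c _ _))
    ; ·-*ʳ = λ c a b n _ → A.≈-trans (A.·-diag c n _) (A.diag-cong n (λ i j _ → A.·-*ʳ c _ _)) }

  order : ℕ → C → Set
  order k a = ∀ n → n < k → n < K → a n A.≈ A.0#

  series : FilteredAlgebra K
  series = record
    { algebra = seriesAlgebra
    ; filtration = record
      { F = order
      ; F-cong = λ e p n q r → A.≈-trans (A.≈-sym (e n r)) (p n q r)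
      ; F-0 = λ a n ()
      ; F-+ = λ p q n r s → A.≈-trans (A.+-cong (p n r s) (q n r s)) (A.+-identityˡ _)
      ; F-neg = λ p n q r → A.≈-trans (A.-‿cong (p n q r)) A.GP.ε⁻¹≈ε
      ; F-· = λ c p n q r → A.·-0 c (p n q r)
      ; F-zero = λ k n _ _ → A.≈-refl
      ; F-top = λ K≤k p n n<K → p n (ℕₚ.<-≤-trans n<K K≤k) n<K }
    ; F-* = λ {i} {j} p q n n< n<K → A.diag-zero n (λ r s e → case i j p q r s (≡.subst (_< i ℕ.+ j) (≡.sym e) n<) (below {r} {s} e n<K)) }
    where
    case : ∀ i j {a b : C} → order i a → order j b → ∀ r s → r ℕ.+ s < i ℕ.+ j → (r < K) × (s < K) → a r A.* b s A.≈ A.0#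
    case i j p q r s lt (r<K , s<K) with r ℕ.<? i
    ... | yes r<i = A.≈-trans (A.*-cong (p r r<i r<K) A.≈-refl) (A.zeroˡ _)
    ... | no  r≮i = A.≈-trans (A.*-cong A.≈-refl (q s (ℕₚ.+-cancelˡ-< i s j (ℕₚ.≤-<-trans (ℕₚ.+-monoˡ-≤ s (ℕₚ.≮⇒≥ r≮i)) lt)) s<K)) (A.zeroʳ _)

  euler : Derivation seriesAlgebra
  euler = record
    { δ = λ a n → ι n A.· a n
    ; δ-cong = λ p n q → A.·-cong _ (p n q)
    ; δ-+ = λ a b n _ → A.·-distˡ _ _ _
    ; δ-· = λ c a n _ → A.≈-trans (A.≈-sym (A.·-assoc _ _ _)) (A.≈-trans (A.·-congˡ _ (ℚₚ.*-comm (ι n) c)) (A.·-assoc _ _ _))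
    ; δ-* = λ a b n _ → A.≈-trans (A.ι·diag n _) (A.+-cong (A.diag-cong n (λ i j _ → A.·-*ˡ _ _ _)) (A.diag-cong n (λ i j _ → A.·-*ʳ _ _ _))) }

  -- The coefficient of t^n is multiplied by n, which is invertible over the rationals for n ≥ 1.
  -- Only the constant term is lost, and order 1 fixes it.
  euler-injective : ∀ {a b} → order 1 a → order 1 b →
    Derivation.δ euler a ≈ₛ Derivation.δ euler b → a ≈ₛ b
  euler-injective p q e zero    n<K = A.≈-trans (p 0 (s≤s z≤n) n<K) (A.≈-sym (q 0 (s≤s z≤n) n<K))
  euler-injective p q e (suc n) n<K = A.≈-trans (A.≈-sym (A.inv·ι n _)) (A.≈-trans (A.·-cong _ (e (suc n) n<K)) (A.inv·ι n _))

  monomial : A.Carrier → C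
  monomial x (suc zero) = x
  monomial x _          = A.0#

  monomial-order : ∀ x → order 1 (monomial x)
  monomial-order x zero _ _ = A.≈-refl
  monomial-order x (suc n) (s≤s ()) _

  euler-monomial : ∀ x → Derivation.δ euler (monomial x) ≈ₛ monomial x
  euler-monomial x zero          _ = A.·0 _
  euler-monomial x (suc zero)    _ = A.≈-trans (A.·-congˡ x ι-1) (A.·-1 x)
  euler-monomial x (suc (suc n)) _ = A.·0 _

  monomial-* : ∀ x a n → (monomial x *ₛ a) (suc n) A.≈ x A.* a n
  monomial-* x a n = A.≈-trans (A.+-cong (A.zeroˡ _) (A.diag-single 0 n (λ i j → monomial x (suc i) A.* a j)
    (λ { zero j e → ⊥-elim (e refl) ; (suc i) j e → A.zeroˡ _ }))) (A.+-identityˡ _)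

ℚalgebra : QAlgebra
ℚalgebra = record
  { ring = ℚₚ.+-*-ring ; _·_ = ℚ._*_ ; ·-cong = λ c → ≡.cong (c ℚ.*_)
  ; ·-distˡ = ℚₚ.*-distribˡ-+ ; ·-distʳ = λ c d a → ℚₚ.*-distribʳ-+ a c d ; ·-assoc = ℚₚ.*-assoc
  ; ·-1 = ℚₚ.*-identityˡ ; ·-*ˡ = λ c a b → ≡.sym (ℚₚ.*-assoc c a b)
  ; ·-*ʳ = λ c a b → ≡.trans (≡.sym (ℚₚ.*-assoc c a b)) (≡.trans (≡.cong (ℚ._* b) (ℚₚ.*-comm c a)) (ℚₚ.*-assoc a c b)) }

-- coefficients of log (1 + s)
θ : ℕ → ℚ
θ zero    = 0ℚ
θ (suc k) = ιℤ (sgn k) ℚ.* inv (suc k)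

bin : ℚ → ℕ → ℚ
bin q zero    = 1ℚ
bin q (suc k) = inv (suc k) ℚ.* ((q ℚ.- ι k) ℚ.* bin q k)

module ScalarSeries {K l : ℕ} (K≡ : K ≡ suc l) where
  open Series ℚalgebra K public
  open FilteredAlgebra series public
  open Exp K≡ series public
  open Derivation euler public renaming (δ to ∂; δ-cong to ∂-cong; δ-+ to ∂-+; δ-· to ∂-·; δ-* to ∂-*; δ-1 to ∂-1; δ-sum to ∂-sum)
  private module R = QAlgebra ℚalgebra
  open import Relation.Binary.Reasoning.Setoid setoid

  *-comm : ∀ a b → a * b ≈ b * a
  *-comm a b n _ = ≡.trans (R.diag-flip n _) (R.diag-cong n (λ i j _ → ℚₚ.*-comm (a j) (b i)))

  ∂-order : ∀ {a} → F 1 a → F 1 (∂ a)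
  ∂-order p n q r = ≡.trans (≡.cong (ι n ℚ.*_) (p n q r)) (ℚₚ.*-zeroʳ (ι n))

  ad-zero : ∀ z h → ad z h ≈ 0#
  ad-zero z h = ≈-trans (+-cong (≈-refl {z * h}) (-‿cong (*-comm h z))) (-‿inverseʳ (z * h))

  ∂-exp : ∀ {z} → F 1 z → ∂ (exp z) ≈ ∂ z * exp z
  ∂-exp {z} p = ≈-trans (derivation-exp euler p (∂-order p)) (*-cong (begin
    sum K (λ k → φ k · Ad.pow p k (∂ z))    ≈⟨ sum-peel K≡ _ ⟩
    φ 0 · ∂ z + sum l (λ k → φ (suc k) · ad z (Ad.pow p k (∂ z)))
      ≈⟨ +-cong (≈-trans (·-congˡ (∂ z) inv-1) (·-1 (∂ z))) (sum-zero l (λ k _ → ·-0 (φ (suc k)) (ad-zero z _))) ⟩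
    ∂ z + 0#                                ≈⟨ +-identityʳ (∂ z) ⟩
    ∂ z ∎) ≈-refl)

  s : Carrier
  s = monomial 1ℚ

  s*-suc : ∀ a n → (s * a) (suc n) ≡ a n
  s*-suc a n = ≡.trans (monomial-* 1ℚ a n) (ℚₚ.*-identityˡ _)

  s*-zero : ∀ a → (s * a) 0 ≡ 0ℚ
  s*-zero a = ℚₚ.*-zeroˡ (a 0)

  sum-at : ∀ m (f : ℕ → Carrier) n → sum m f n ≡ R.sum m (λ k → f k n)
  sum-at zero    f n = refl
  sum-at (suc m) f n = ≡.cong (f 0 n ℚ.+_) (sum-at m _ n)

  s-order : F 1 s
  s-order = monomial-order 1ℚ

  -- F = exp (c log (1 + s)) satisfies (1 + s) s F′ = c s F, which is the recursion defining bin c.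
  module _ (c : ℚ) where
    private
      cθ : Carrier
      cθ = c · θ
      cθ-order : F 1 cθ
      cθ-order zero    _ _ = ℚₚ.*-zeroʳ c
      cθ-order (suc n) (s≤s ()) _
      E : Carrier
      E = exp cθ
      ∂θ-suc : ∀ k → ∂ θ (suc k) ≡ ιℤ (sgn k)
      ∂θ-suc k = ≡.trans (lem (ι (suc k)) (ιℤ (sgn k)) (inv (suc k)))
                         (≡.trans (≡.cong (ιℤ (sgn k) ℚ.*_) (ι-inv k)) (ℚₚ.*-identityʳ _))
        where lem : ∀ a b c → a ℚ.* (b ℚ.* c) ≡ b ℚ.* (a ℚ.* c)
              lem = solve-∀ ℚring
      θ-ode : ∂ θ + s * ∂ θ ≈ s
      θ-ode zero _ = ≡.trans (≡.cong₂ ℚ._+_ (ℚₚ.*-zeroʳ (ι 0)) (s*-zero (∂ θ))) refl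
      θ-ode (suc zero) _ = ≡.trans (≡.cong₂ ℚ._+_ (≡.trans (∂θ-suc 0) ιℤ-1) (≡.trans (s*-suc (∂ θ) 0) (ℚₚ.*-zeroʳ (ι 0)))) refl
      θ-ode (suc (suc k)) _ = ≡.trans (≡.cong₂ ℚ._+_ (≡.trans (∂θ-suc (suc k)) (ιℤ-neg (sgn k))) (≡.trans (s*-suc (∂ θ) (suc k)) (∂θ-suc k)))
                                      (ℚₚ.+-inverseˡ (ιℤ (sgn k)))
      ode : ∂ E + s * ∂ E ≈ c · (s * E)
      ode = begin
        ∂ E + s * ∂ E                            ≈⟨ +-cong (∂-exp cθ-order) (*-cong (≈-refl {s}) (∂-exp cθ-order)) ⟩
        ∂ cθ * E + s * (∂ cθ * E)                ≈⟨ +-cong (≈-refl {∂ cθ * E}) (≈-sym (*-assoc s (∂ cθ) E)) ⟩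
        ∂ cθ * E + s * ∂ cθ * E                  ≈⟨ ≈-sym (distribʳ E (∂ cθ) (s * ∂ cθ)) ⟩
        (∂ cθ + s * ∂ cθ) * E                    ≈⟨ *-cong (+-cong (∂-· c θ) (≈-trans (*-cong (≈-refl {s}) (∂-· c θ)) (≈-sym (·-*ʳ c s (∂ θ))))) (≈-refl {E}) ⟩
        (c · ∂ θ + c · (s * ∂ θ)) * E            ≈⟨ *-cong (≈-sym (·-distˡ c (∂ θ) (s * ∂ θ))) (≈-refl {E}) ⟩
        (c · (∂ θ + s * ∂ θ)) * E                ≈⟨ *-cong (·-cong c θ-ode) (≈-refl {E}) ⟩
        (c · s) * E                              ≈⟨ ≈-sym (·-*ˡ c s E) ⟩
        c · (s * E) ∎

    exp-log : ∀ n → n < K → exp (c · θ) n ≡ bin c n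
    exp-log zero n<K = ≡.trans (sum-peel K≡ (dp algebra cθ) 0 n<K) (≡.trans (≡.cong (1ℚ ℚ.+_)
      (≡.trans (sum-at l _ 0) (R.sum-zero l (λ k _ → exp-zero k)))) (ℚₚ.+-identityʳ 1ℚ))
      where
      exp-zero : ∀ k → dp algebra cθ (suc k) 0 ≡ 0ℚ
      exp-zero k = dp-F cθ-order (suc k) 0 (s≤s z≤n) n<K
    exp-log (suc n) n<K = ≡.trans (≡.sym (inv-ι n (E (suc n)))) (≡.cong (inv (suc n) ℚ.*_) (begin-ℚ))
      where
      eq : ι (suc n) ℚ.* E (suc n) ℚ.+ ι n ℚ.* E n ≡ c ℚ.* E n
      eq = ≡.trans (≡.cong (ι (suc n) ℚ.* E (suc n) ℚ.+_) (≡.sym (s*-suc (∂ E) n)))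
             (≡.trans (ode (suc n) n<K) (≡.cong (c ℚ.*_) (s*-suc E n)))
      lem : ∀ x y c e → x ℚ.+ y ℚ.* e ≡ c ℚ.* e → x ≡ (c ℚ.- y) ℚ.* e
      lem x y c e q = ≡.trans (aux x y e) (≡.trans (≡.cong (ℚ._- y ℚ.* e) q) (aux2 c y e))
        where aux : ∀ x y e → x ≡ x ℚ.+ y ℚ.* e ℚ.- y ℚ.* e
              aux = solve-∀ ℚring
              aux2 : ∀ c y e → c ℚ.* e ℚ.- y ℚ.* e ≡ (c ℚ.- y) ℚ.* e
              aux2 = solve-∀ ℚring
      begin-ℚ : ι (suc n) ℚ.* E (suc n) ≡ (c ℚ.- ι n) ℚ.* bin c n
      begin-ℚ = ≡.trans (lem _ (ι n) c (E n) eq) (≡.cong ((c ℚ.- ι n) ℚ.*_) (exp-log n (ℕₚ.<-trans (ℕₚ.n<1+n n) n<K)))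

  -- E = e^s - 1
  E : Carrier
  E zero    = 0ℚ
  E (suc n) = expCoeff (suc n)

  E-order : F 1 E
  E-order zero _ _ = refl
  E-order (suc n) (s≤s ()) _

  private
    point : ℚ → ℕ → ℚ
    point q zero    = q
    point q (suc n) = 0ℚ

    dp-s : ∀ k n → dp algebra s k n ≡ R.shift k (point (expCoeff k)) n
    dp-s zero zero    = ≡.sym inv-1
    dp-s zero (suc n) = refl
    dp-s (suc k) zero    = ≡.trans (≡.cong (inv (suc k) ℚ.*_) (s*-zero (dp algebra s k))) (ℚₚ.*-zeroʳ (inv (suc k)))
    dp-s (suc k) (suc n) = ≡.trans (≡.cong (inv (suc k) ℚ.*_) (≡.trans (s*-suc (dp algebra s k) n) (dp-s k n)))
      (≡.trans (SumHom.hom-shift ℚ⁺ ℚ⁺ (inv (suc k) ℚ.*_) (ℚₚ.*-zeroʳ (inv (suc k))) (ℚₚ.*-distribˡ-+ (inv (suc k))) k n _)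
               (R.shift-cong k n (λ { zero _ → ≡.sym (inv-* (suc k) (k !)) ; (suc _) _ → ℚₚ.*-zeroʳ (inv (suc k)) })))

  exp-s : exp s ≈ 1# + E
  exp-s n n<K = ≡.trans (sum-at K (dp algebra s) n) (≡.trans
    (R.sum-single n (λ k → dp algebra s k n) n<K other)
    (≡.trans (dp-s n n) (≡.trans (≡.cong (R.shift n (point (expCoeff n))) (≡.sym (ℕₚ.+-identityʳ n))) (≡.trans (R.shift-at n 0 _) (value n)))))
    where
    shift-point : ∀ k n q → (k ≡ n → ⊥) → R.shift k (point q) n ≡ 0ℚ
    shift-point zero zero q e = ⊥-elim (e refl)
    shift-point zero (suc n) q e = refl
    shift-point (suc k) zero q e = refl
    shift-point (suc k) (suc n) q e = shift-point k n q (λ r → e (≡.cong suc r))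
    other : ∀ k → (k ≡ n → ⊥) → dp algebra s k n ≡ 0ℚ
    other k e = ≡.trans (dp-s k n) (shift-point k n _ e)
    value : ∀ n → expCoeff n ≡ (1# + E) n
    value zero    = ≡.trans inv-1 (≡.sym (ℚₚ.+-identityʳ 1ℚ))
    value (suc n) = ≡.sym (ℚₚ.+-identityˡ _)

  ∂E : ∂ E ≈ s * (1# + E)
  ∂E = begin
    ∂ E             ≈⟨ ≈-sym (+-identityˡ (∂ E)) ⟩
    0# + ∂ E        ≈⟨ +-cong (≈-sym ∂-1) ≈-refl ⟩
    ∂ 1# + ∂ E      ≈⟨ ≈-sym (∂-+ 1# E) ⟩
    ∂ (1# + E)      ≈⟨ ∂-cong (≈-sym exp-s) ⟩
    ∂ (exp s)       ≈⟨ ∂-exp s-order ⟩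
    ∂ s * exp s     ≈⟨ *-cong (euler-monomial 1ℚ) exp-s ⟩
    s * (1# + E) ∎

  Epow : ℕ → Carrier
  Epow k = Mul.pow E-order k 1#

  Epow-low : ∀ k n → n < k → n < K → Epow k n ≡ 0ℚ
  Epow-low k n n<k = Mul.pow-F E-order k (F-0 1#) n (≡.subst (n <_) (≡.sym (ℕₚ.+-identityʳ k)) n<k)

  ∂-Epow : ∀ k → ∂ (Epow (suc k)) ≈ ι (suc k) · (Epow k * ∂ E)
  ∂-Epow zero = begin
    ∂ (E * 1#)         ≈⟨ ∂-cong (*-identityʳ E) ⟩
    ∂ E                ≈⟨ ≈-sym (*-identityˡ (∂ E)) ⟩
    1# * ∂ E           ≈⟨ ≈-sym (≈-trans (·-congˡ (1# * ∂ E) ι-1) (·-1 (1# * ∂ E))) ⟩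
    ι 1 · (1# * ∂ E)   ∎
  ∂-Epow (suc k) = begin
    ∂ (E * Epow (suc k))                                           ≈⟨ ∂-* E (Epow (suc k)) ⟩
    ∂ E * Epow (suc k) + E * ∂ (Epow (suc k))
      ≈⟨ +-cong (*-comm (∂ E) (Epow (suc k))) (≈-trans (*-cong (≈-refl {E}) (∂-Epow k)) (≈-sym (·-*ʳ (ι (suc k)) E (Epow k * ∂ E)))) ⟩
    Epow (suc k) * ∂ E + ι (suc k) · (E * (Epow k * ∂ E))
      ≈⟨ +-cong (≈-sym (·-1 X)) (·-cong (ι (suc k)) (≈-sym (*-assoc E (Epow k) (∂ E)))) ⟩
    1ℚ · X + ι (suc k) · X           ≈⟨ ≈-sym (·-distʳ 1ℚ (ι (suc k)) X) ⟩
    (1ℚ ℚ.+ ι (suc k)) · X           ≈⟨ ·-congˡ X (≡.sym (≡.trans (ι-+ 1 (suc k)) (≡.cong (ℚ._+ ι (suc k)) ι-1))) ⟩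
    ι (suc (suc k)) · X ∎
    where X = Epow (suc k) * ∂ E

  -- log (1 + (e^s - 1)) = s, by differentiating: the derivative telescopes.
  log-exp : sum K (λ k → θ k · Epow k) ≈ s
  log-exp = euler-injective order-lhs s-order (begin
    ∂ (sum K (λ k → θ k · Epow k))                            ≈⟨ ∂-sum K (λ k → θ k · Epow k) ⟩
    sum K (λ k → ∂ (θ k · Epow k))                            ≈⟨ sum-peel K≡ (λ k → ∂ (θ k · Epow k)) ⟩
    ∂ (0ℚ · 1#) + sum l (λ k → ∂ (θ (suc k) · Epow (suc k)))
      ≈⟨ +-cong (≈-trans (∂-· 0ℚ 1#) (0· (∂ 1#))) (sum-cong l (λ k _ → term k)) ⟩
    0# + sum l (λ k → v k + - v (suc k))                      ≈⟨ +-identityˡ _ ⟩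
    sum l (λ k → v k + - v (suc k))                           ≈⟨ telescope l v ⟩
    v 0 + - v l                                               ≈⟨ +-cong v-zero (-‿cong v-top) ⟩
    s + - 0#                                                  ≈⟨ ≈-trans (+-cong (≈-refl {s}) GP.ε⁻¹≈ε) (+-identityʳ s) ⟩
    s                                                         ≈⟨ ≈-sym (euler-monomial 1ℚ) ⟩
    ∂ s ∎)
    where
    v : ℕ → Carrier
    v k = ιℤ (sgn k) · (Epow k * s)
    v-zero : v 0 ≈ s
    v-zero = ≈-trans (·-congˡ (1# * s) ιℤ-1) (≈-trans (·-1 (1# * s)) (*-identityˡ s))
    v-top : v l ≈ 0#
    v-top = F-top {suc (l ℕ.+ 0)} (≡.subst (K ≤_) (≡.cong suc (≡.sym (ℕₚ.+-identityʳ l))) (ℕₚ.≤-reflexive K≡)) (F-· {a = Epow l * s} (ιℤ (sgn l))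
      (≡.subst (λ i → F i (Epow l * s)) (ℕₚ.+-comm (l ℕ.+ 0) 1) (F-* {a = Epow l} {b = s} (Mul.pow-F E-order l (F-0 1#)) s-order)))
    order-lhs : F 1 (sum K (λ k → θ k · Epow k))
    order-lhs = F-sum K ord
      where
      ord : ∀ k → k < K → F 1 (θ k · Epow k)
      ord zero    _ n _ _ = ℚₚ.*-zeroˡ (one n)
      ord (suc k) _ = F-· {a = Epow (suc k)} (θ (suc k)) (F-* {i = 1} {j = 0} {a = E} {b = Epow k} E-order (F-0 (Epow k)))
    term : ∀ k → ∂ (θ (suc k) · Epow (suc k)) ≈ v k + - v (suc k)
    term k = begin
      ∂ (θ (suc k) · Epow (suc k))                      ≈⟨ ≈-trans (∂-· (θ (suc k)) (Epow (suc k))) (·-cong (θ (suc k)) (∂-Epow k)) ⟩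
      θ (suc k) · (ι (suc k) · (Epow k * ∂ E))          ≈⟨ ≈-sym (·-assoc (θ (suc k)) (ι (suc k)) (Epow k * ∂ E)) ⟩
      (θ (suc k) ℚ.* ι (suc k)) · (Epow k * ∂ E)        ≈⟨ ·-congˡ {d = ιℤ (sgn k)} (Epow k * ∂ E) (≡.trans (ℚₚ.*-assoc (ιℤ (sgn k)) (inv (suc k)) (ι (suc k)))
                (≡.trans (≡.cong (ιℤ (sgn k) ℚ.*_) (≡.trans (ℚₚ.*-comm (inv (suc k)) (ι (suc k))) (ι-inv k))) (ℚₚ.*-identityʳ (ιℤ (sgn k))))) ⟩
      ιℤ (sgn k) · (Epow k * ∂ E)                       ≈⟨ ·-cong (ιℤ (sgn k)) expand ⟩
      ιℤ (sgn k) · (Epow k * s + Epow (suc k) * s)      ≈⟨ ·-distˡ (ιℤ (sgn k)) (Epow k * s) (Epow (suc k) * s) ⟩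
      v k + ιℤ (sgn k) · (Epow (suc k) * s)             ≈⟨ +-cong (≈-refl {v k}) flip-sign ⟩
      v k + - v (suc k) ∎
      where
      expand : Epow k * ∂ E ≈ Epow k * s + Epow (suc k) * s
      expand = begin
        Epow k * ∂ E                          ≈⟨ *-cong (≈-refl {Epow k}) (≈-trans ∂E (≈-trans (distribˡ s 1# E) (+-cong (*-identityʳ s) (*-comm s E)))) ⟩
        Epow k * (s + E * s)                  ≈⟨ distribˡ (Epow k) s (E * s) ⟩
        Epow k * s + Epow k * (E * s)         ≈⟨ +-cong (≈-refl {Epow k * s}) (≈-trans (≈-sym (*-assoc (Epow k) E s)) (*-cong (*-comm (Epow k) E) (≈-refl {s}))) ⟩
        Epow k * s + Epow (suc k) * s ∎
      flip-sign : ιℤ (sgn k) · (Epow (suc k) * s) ≈ - v (suc k)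
      flip-sign n _ = ≡.trans (lem (ιℤ (sgn k)) _) (≡.cong (λ q → ℚ.- (q ℚ.* (Epow (suc k) * s) n)) (≡.sym (ιℤ-neg (sgn k))))
        where lem : ∀ a b → a ℚ.* b ≡ ℚ.- ((ℚ.- a) ℚ.* b)
              lem = solve-∀ ℚring
    telescope : ∀ m v → sum m (λ k → v k + - v (suc k)) ≈ v 0 + - v m
    telescope zero    v = ≈-sym (-‿inverseʳ (v 0))
    telescope (suc m) v = begin
      (v 0 + - v 1) + sum m (λ k → v (suc k) + - v (suc (suc k)))  ≈⟨ +-cong (≈-refl {v 0 + - v 1}) (telescope m (λ k → v (suc k))) ⟩
      (v 0 + - v 1) + (v 1 + - v (suc m))                          ≈⟨ +-assoc (v 0) (- v 1) (v 1 + - v (suc m)) ⟩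
      v 0 + (- v 1 + (v 1 + - v (suc m)))                          ≈⟨ +-cong (≈-refl {v 0}) (≈-trans (≈-sym (+-assoc (- v 1) (v 1) (- v (suc m))))
                                                                        (≈-trans (+-cong (-‿inverseˡ (v 1)) (≈-refl { - v (suc m)})) (+-identityˡ (- v (suc m))))) ⟩
      v 0 + - v (suc m) ∎

-- The Baker–Campbell–Hausdorff formula

module ListSums (M : CommutativeMonoid 0ℓ 0ℓ) where
  open CommutativeMonoid M using (Carrier; _≈_; setoid)
    renaming (_∙_ to _+_; ε to 0#; ∙-cong to +-cong; assoc to +-assoc; comm to +-comm;
              identityˡ to +-identityˡ; identityʳ to +-identityʳ;
              refl to ≈-refl; sym to ≈-sym; trans to ≈-trans)
  open Sums M

  sumL : {X : Set} → List X → (X → Carrier) → Carrier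
  sumL xs f = foldr (λ x acc → f x + acc) 0# xs

  module _ {X : Set} where
    sumL-cong : ∀ (xs : List X) {f g : X → Carrier} → (∀ x → f x ≈ g x) → sumL xs f ≈ sumL xs g
    sumL-cong []       e = ≈-refl
    sumL-cong (x ∷ xs) e = +-cong (e x) (sumL-cong xs e)

    sumL-zero : ∀ (xs : List X) {f : X → Carrier} → (∀ x → f x ≈ 0#) → sumL xs f ≈ 0#
    sumL-zero []       e = ≈-refl
    sumL-zero (x ∷ xs) e = ≈-trans (+-cong (e x) (sumL-zero xs e)) (+-identityˡ 0#)

    sumL-++ : ∀ (xs ys : List X) f → sumL (xs ++ ys) f ≈ sumL xs f + sumL ys f
    sumL-++ []       ys f = ≈-sym (+-identityˡ _)
    sumL-++ (x ∷ xs) ys f = ≈-trans (+-cong ≈-refl (sumL-++ xs ys f)) (≈-sym (+-assoc _ _ _))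

    sumL-map : ∀ {Y : Set} (g : Y → X) ys f → sumL (map g ys) f ≈ sumL ys (λ y → f (g y))
    sumL-map g []       f = ≈-refl
    sumL-map g (y ∷ ys) f = +-cong ≈-refl (sumL-map g ys f)

    sumL-concatMap : ∀ {Y : Set} (g : Y → List X) ys f → sumL (concatMap g ys) f ≈ sumL ys (λ y → sumL (g y) f)
    sumL-concatMap g []       f = ≈-refl
    sumL-concatMap g (y ∷ ys) f = ≈-trans (sumL-++ (g y) (concatMap g ys) f) (+-cong ≈-refl (sumL-concatMap g ys f))

    sumL-applyUpTo : ∀ (g : ℕ → X) n f → sumL (applyUpTo g n) f ≈ sum n (λ i → f (g i))
    sumL-applyUpTo g zero    f = ≈-refl
    sumL-applyUpTo g (suc n) f = +-cong ≈-refl (sumL-applyUpTo (λ i → g (suc i)) n f)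

  sumL-grid : ∀ d (f : ℕ × ℕ → Carrier) → sumL (grid d) f ≈ sum (suc d) (λ r → sum (suc d) (λ s → f (r , s)))
  sumL-grid d f = ≈-trans (sumL-concatMap (λ r → map (r ,_) (upTo (suc d))) (upTo (suc d)) f)
    (≈-trans (sumL-applyUpTo (λ i → i) (suc d) _)
    (sum-cong (suc d) (λ r _ → ≈-trans (sumL-map (r ,_) (upTo (suc d)) f) (sumL-applyUpTo (λ i → i) (suc d) _))))

  sumL-grid′ : ∀ {K d} → K ≡ suc d → ∀ (f : ℕ × ℕ → Carrier) → sumL (grid d) f ≈ sum K (λ r → sum K (λ s → f (r , s)))
  sumL-grid′ {d = d} refl = sumL-grid d

  sumL-seqs : ∀ d k (f : List (ℕ × ℕ) → Carrier) →
    sumL (seqs d (suc k)) f ≈ sumL (grid d) (λ p → sumL (seqs d k) (λ σ → f (p ∷ σ)))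
  sumL-seqs d k f = ≈-trans (sumL-concatMap (λ p → map (p ∷_) (seqs d k)) (grid d) f)
    (sumL-cong (grid d) (λ p → sumL-map (p ∷_) (seqs d k) f))

  sumL-seqs-cong : ∀ d k {f g : List (ℕ × ℕ) → Carrier} → (∀ p σ → f (p ∷ σ) ≈ g (p ∷ σ)) →
    sumL (seqs d (suc k)) f ≈ sumL (seqs d (suc k)) g
  sumL-seqs-cong d k e = ≈-trans (sumL-seqs d k _) (≈-trans
    (sumL-cong (grid d) (λ p → sumL-cong (seqs d k) (e p))) (≈-sym (sumL-seqs d k _)))

module ListSumHom (M N : CommutativeMonoid 0ℓ 0ℓ) where
  private
    module M = CommutativeMonoid M
    module N = CommutativeMonoid N
  module _ (h : M.Carrier → N.Carrier) (h-ε : h M.ε N.≈ N.ε)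
           (h-∙ : ∀ a b → h (a M.∙ b) N.≈ (h a N.∙ h b)) {X : Set} where
    hom-sumL : ∀ (xs : List X) f → h (ListSums.sumL M xs f) N.≈ ListSums.sumL N xs (λ x → h (f x))
    hom-sumL []       f = h-ε
    hom-sumL (x ∷ xs) f = N.trans (h-∙ _ _) (N.∙-cong N.refl (hom-sumL xs f))

ψ : ℕ → ℚ
ψ k = θ (suc k)

nonZero : List (ℕ × ℕ) → Bool
nonZero σ = and (map (λ p → 1 ℕ.≤ᵇ deg p) σ)

-- ψ (e^s - 1) φ (s) = 1
module LogInverse (K : ℕ) where
  private
    module S = ScalarSeries {suc K} {K} refl
    module R = QAlgebra ℚalgebra

  ψE : ℕ → ℚ
  ψE n = R.sum K (λ k → ψ k ℚ.* S.Epow k n)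

  E-φ : S.E S.≈ₛ (S.s S.*ₛ φ)
  E-φ zero    _ = ≡.sym (S.s*-zero φ)
  E-φ (suc n) _ = ≡.sym (S.s*-suc φ n)

  private
    Epow-suc : ∀ k n → suc n < suc K → S.Epow (suc k) (suc n) ≡ (φ S.*ₛ S.Epow k) n
    Epow-suc k n n<K = ≡.trans (S.*-cong {x = S.E} {y = S.s S.*ₛ φ} {u = S.Epow k} {v = S.Epow k} E-φ (λ _ _ → refl) (suc n) n<K)
      (≡.trans (S.*-assoc S.s φ (S.Epow k) (suc n) n<K) (S.s*-suc (φ S.*ₛ S.Epow k) n))

  -- A factor s is cancelled from log (1 + E) = s, using E = s φ. The cancellation costs one
  -- coefficient, which is why the series here are truncated at K + 1.
  ψE-φ : ∀ n → n < K → (ψE ⊛ φ) n ≡ S.one n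
  ψE-φ n n<K = begin
    (ψE ⊛ φ) n
      ≡⟨ R.diag-flip n (λ i j → ψE i ℚ.* φ j) ⟩
    R.diag (λ i j → ψE j ℚ.* φ i) n
      ≡⟨ R.diag-cong n (λ i j _ → ≡.trans (R.*-sumʳ (φ i) K _) (R.sum-cong K (λ k _ → lem (ψ k) (S.Epow k j) (φ i)))) ⟩
    R.diag (λ i j → R.sum K (λ k → ψ k ℚ.* (φ i ℚ.* S.Epow k j))) n
      ≡⟨ Sums.diag-sum-exchange ℚ⁺ n K (λ i j k → ψ k ℚ.* (φ i ℚ.* S.Epow k j)) ⟩
    R.sum K (λ k → R.diag (λ i j → ψ k ℚ.* (φ i ℚ.* S.Epow k j)) n)
      ≡⟨ R.sum-cong K (λ k _ → ≡.sym (R.·-diag (ψ k) n (λ i j → φ i ℚ.* S.Epow k j))) ⟩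
    R.sum K (λ k → ψ k ℚ.* (φ S.*ₛ S.Epow k) n)
      ≡⟨ R.sum-cong K (λ k _ → ≡.cong (ψ k ℚ.*_) (≡.sym (Epow-suc k n (s≤s n<K)))) ⟩
    R.sum K (λ k → θ (suc k) ℚ.* S.Epow (suc k) (suc n))
      ≡⟨ ≡.sym (≡.trans (≡.cong (ℚ._+ R.sum K (λ k → θ (suc k) ℚ.* S.Epow (suc k) (suc n))) (ℚₚ.*-zeroˡ (S.Epow 0 (suc n)))) (ℚₚ.+-identityˡ _)) ⟩
    R.sum (suc K) (λ k → θ k ℚ.* S.Epow k (suc n))
      ≡⟨ ≡.sym (S.sum-at (suc K) (λ k m → θ k ℚ.* S.Epow k m) (suc n)) ⟩
    S.sum (suc K) (λ k m → θ k ℚ.* S.Epow k m) (suc n)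
      ≡⟨ S.log-exp (suc n) (s≤s n<K) ⟩
    S.s (suc n)
      ≡⟨ s-one n ⟩
    S.one n ∎
    where
    open ≡.≡-Reasoning
    lem : ∀ a b c → (a ℚ.* b) ℚ.* c ≡ a ℚ.* (c ℚ.* b)
    lem = solve-∀ ℚring
    s-one : ∀ n → S.s (suc n) ≡ S.one n
    s-one zero    = refl
    s-one (suc n) = refl

module BCH {K l : ℕ} (K≡ : K ≡ suc l) (𝔹 : FilteredAlgebra K) where
  open FilteredAlgebra 𝔹
  open Exp K≡ 𝔹
  open ListSums +-commutativeMonoid
  open import Relation.Binary.Reasoning.Setoid setoid
  private
    module R = QAlgebra ℚalgebra
    module S = ScalarSeries K≡

  module _ {n : Carrier} (p : F 1 n) where
    open Mul p using (ev; pow; pow-F; pow-cong; ev-⊛)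

    -- log (1 + n). The factor `1ℚ` puts it in the form of `exp-log` at exponent 1, whose binomial
    -- series is 1 + s.
    logarithm : Carrier
    logarithm = ev (1ℚ S.· θ) 1#

    logarithm-F : F 1 logarithm
    logarithm-F = F-sum K go
      where
      go : ∀ k → k < K → F 1 ((1ℚ S.· θ) k · pow k 1#)
      go zero    _ = F-cong (≈-sym (≈-trans (·-congˡ 1# (ℚₚ.*-zeroʳ 1ℚ)) (0· 1#))) (F-zero 1)
      go (suc k) _ = F-· _ (F-* p (F-0 (pow k 1#)))

    pow-mul : ∀ k h → pow k h ≈ pow k 1# * h
    pow-mul zero    h = ≈-sym (*-identityˡ h)
    pow-mul (suc k) h = ≈-trans (*-cong ≈-refl (pow-mul k h)) (≈-sym (*-assoc _ _ _))

    ev-mul : ∀ c h → ev c h ≈ ev c 1# * h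
    ev-mul c h = ≈-trans (sum-cong K (λ k _ → ≈-trans (·-cong (c k) (pow-mul k h)) (·-*ˡ _ _ _))) (≈-sym (*-sumʳ h K _))

    dp-logarithm : ∀ k → dp algebra logarithm k ≈ ev (dp S.algebra (1ℚ S.· θ) k) 1#
    dp-logarithm zero = ≈-sym (≈-trans (sum-peel K≡ _) (≈-trans
      (+-cong (·-1 1#) (sum-zero l (λ k _ → 0· (pow (suc k) 1#)))) (+-identityʳ 1#)))
    dp-logarithm (suc k) = begin
      inv (suc k) · (logarithm * dp algebra logarithm k)
        ≈⟨ ·-cong _ (*-cong ≈-refl (dp-logarithm k)) ⟩
      inv (suc k) · (ev (1ℚ S.· θ) 1# * ev (dp S.algebra (1ℚ S.· θ) k) 1#)
        ≈⟨ ·-cong _ (≈-sym (ev-mul (1ℚ S.· θ) _)) ⟩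
      inv (suc k) · ev (1ℚ S.· θ) (ev (dp S.algebra (1ℚ S.· θ) k) 1#)
        ≈⟨ ·-cong _ (ev-⊛ (1ℚ S.· θ) (dp S.algebra (1ℚ S.· θ) k) 1#) ⟩
      inv (suc k) · ev ((1ℚ S.· θ) ⊛ dp S.algebra (1ℚ S.· θ) k) 1#
        ≈⟨ ≈-trans (·-sum _ K _) (sum-cong K (λ i _ → ≈-sym (·-assoc _ _ _))) ⟩
      ev (dp S.algebra (1ℚ S.· θ) (suc k)) 1# ∎

    ev-bin-1 : ev (bin 1ℚ) 1# ≈ 1# + n
    ev-bin-1 = ≈-trans (sum-peel K≡ _) (+-cong (·-1 1#) (rest l K≡))
      where
      bin-1-1 : bin 1ℚ 1 ≡ 1ℚ
      bin-1-1 = ≡.trans (≡.cong₂ (λ a b → a ℚ.* ((1ℚ ℚ.- b) ℚ.* 1ℚ)) inv-1 ι-0) refl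
      bin-1-big : ∀ k → bin 1ℚ (suc (suc k)) ≡ 0ℚ
      bin-1-big zero    = ≡.trans (≡.cong (λ b → inv 2 ℚ.* ((1ℚ ℚ.- b) ℚ.* bin 1ℚ 1)) ι-1)
        (≡.trans (≡.cong (inv 2 ℚ.*_) (ℚₚ.*-zeroˡ (bin 1ℚ 1))) (ℚₚ.*-zeroʳ (inv 2)))
      bin-1-big (suc k) = ≡.trans (≡.cong (λ b → inv (suc (suc (suc k))) ℚ.* ((1ℚ ℚ.- ι (suc (suc k))) ℚ.* b)) (bin-1-big k))
        (≡.trans (≡.cong (inv (suc (suc (suc k))) ℚ.*_) (ℚₚ.*-zeroʳ (1ℚ ℚ.- ι (suc (suc k))))) (ℚₚ.*-zeroʳ (inv (suc (suc (suc k))))))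
      rest : ∀ l → K ≡ suc l → sum l (λ k → bin 1ℚ (suc k) · pow (suc k) 1#) ≈ n
      rest zero    e = ≈-sym (F-top {1} (ℕₚ.≤-reflexive e) p)
      rest (suc l) e = ≈-trans (+-cong (≈-trans (·-congˡ (pow 1 1#) bin-1-1) (≈-trans (·-1 _) (*-identityʳ n)))
        (sum-zero l (λ k _ → ≈-trans (·-congˡ (pow (suc (suc k)) 1#) (bin-1-big k)) (0· _)))) (+-identityʳ n)

    -- The scalar identity exp (log (1 + s)) = 1 + s evaluated at n: multiplicativity of `ev`
    -- carries the divided powers of the scalar series to those of `logarithm`.
    exp-logarithm : exp logarithm ≈ 1# + n
    exp-logarithm = begin
      sum K (dp algebra logarithm)                            ≈⟨ sum-cong K (λ k _ → dp-logarithm k) ⟩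
      sum K (λ k → sum K (λ i → d k i · pow i 1#))            ≈⟨ sum-swap K K _ ⟩
      sum K (λ i → sum K (λ k → d k i · pow i 1#))            ≈⟨ sum-cong K (λ i _ → sum·-sum (pow i 1#) K (λ k → d k i)) ⟩
      sum K (λ i → R.sum K (λ k → d k i) · pow i 1#)
        ≈⟨ sum-cong K (λ i i<K → ·-congˡ (pow i 1#) (≡.trans (≡.sym (S.sum-at K d i)) (S.exp-log 1ℚ i i<K))) ⟩
      ev (bin 1ℚ) 1#                                          ≈⟨ ev-bin-1 ⟩
      1# + n ∎
      where
      d : ℕ → ℕ → ℚ
      d = dp S.algebra (1ℚ S.· θ)

  nestᴬ : List Carrier → Carrier
  nestᴬ []            = 0#
  nestᴬ (Z ∷ [])      = Z
  nestᴬ (Z ∷ W ∷ Zs)  = ad Z (nestᴬ (W ∷ Zs))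

  wordᴬ : Carrier → Carrier → List (ℕ × ℕ) → List Carrier
  wordᴬ x y σ = concatMap (λ p → replicate (proj₁ p) x ++ replicate (proj₂ p) y) σ

  dynkin : Carrier → Carrier → Carrier
  dynkin x y = sum l (λ k → sumL (seqs l (suc k)) (λ σ →
    if valid l σ then dynkinCoeff (suc k) σ · nestᴬ (wordᴬ x y σ) else 0#))

  module _ (D : Derivation algebra) where
   open Derivation D renaming (δ to ∂; δ-cong to ∂-cong; δ-+ to ∂-+; δ-· to ∂-·; δ-* to ∂-*; δ-sum to ∂-sum; δ-0 to ∂-0)

   -- When ∂ fixes x and y, a nested bracket of r letters is an eigenvector with eigenvalue r.
   -- Applying ∂ to Dynkin's sum therefore removes the denominators `total σ`, and injectivity of ∂
   -- reduces the theorem to a formula for ∂ b.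
   module _ (∂-F : ∀ {a} → F 1 a → F 1 (∂ a))
           (∂-injective : ∀ {a b} → F 1 a → F 1 b → ∂ a ≈ ∂ b → a ≈ b)
           {x y : Carrier} (px : F 1 x) (py : F 1 y) (∂x : ∂ x ≈ x) (∂y : ∂ y ≈ y) where
    private
      nx ny n a : Carrier
      nx = sum l (λ k → dp algebra x (suc k))
      ny = sum l (λ k → dp algebra y (suc k))
      n  = ny + nx * (1# + ny)
      a  = exp x * exp y

      F-nx : F 1 nx
      F-nx = exp-1+F px
      F-ny : F 1 ny
      F-ny = exp-1+F py
      n∈ : F 1 n
      n∈ = F-+ F-ny (F-* F-nx (F-0 _))

      a≈ : a ≈ 1# + n
      a≈ = begin
        exp x * exp y              ≈⟨ *-cong (sum-peel K≡ _) (sum-peel K≡ _) ⟩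
        (1# + nx) * (1# + ny)      ≈⟨ distribʳ _ _ _ ⟩
        1# * (1# + ny) + nx * (1# + ny) ≈⟨ +-cong (*-identityˡ _) ≈-refl ⟩
        (1# + ny) + nx * (1# + ny) ≈⟨ +-assoc _ _ _ ⟩
        1# + n ∎

      b : Carrier
      b = logarithm n∈
      pb : F 1 b
      pb = logarithm-F n∈
      exp-b : exp b ≈ a
      exp-b = ≈-trans (exp-logarithm n∈) (≈-sym a≈)

      cancel-a : ∀ {w v} → w * a ≈ v * a → w ≈ v
      cancel-a e = cancel n∈ (≈-trans (*-cong ≈-refl (≈-sym a≈)) (≈-trans e (*-cong ≈-refl a≈)))

      -- `C` is conjugation by a, written through adjoint exponentials. `N` is `C` minus the
      -- identity; its expansion is what produces the blocks of Dynkin's formula.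
      C N : Carrier → Carrier
      C h = expAd px (expAd py h)
      N h = C h + - h

      C-a : ∀ h → a * h ≈ C h * a
      C-a h = begin
        exp x * exp y * h                    ≈⟨ *-assoc _ _ _ ⟩
        exp x * (exp y * h)                  ≈⟨ *-cong ≈-refl (hadamard py h) ⟩
        exp x * (expAd py h * exp y)         ≈⟨ ≈-sym (*-assoc _ _ _) ⟩
        exp x * expAd py h * exp y           ≈⟨ *-cong (hadamard px _) ≈-refl ⟩
        C h * exp x * exp y                  ≈⟨ *-assoc _ _ _ ⟩
        C h * a ∎

      -- Both sides are conjugation by a = exp b, and a can be cancelled because it is 1 plus an
      -- element of order 1.
      C-b : ∀ h → C h ≈ expAd pb h
      C-b h = cancel-a (begin
        C h * a           ≈⟨ ≈-sym (C-a h) ⟩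
        a * h             ≈⟨ *-cong (≈-sym exp-b) ≈-refl ⟩
        exp b * h         ≈⟨ hadamard pb h ⟩
        expAd pb h * exp b ≈⟨ *-cong ≈-refl exp-b ⟩
        expAd pb h * a ∎)

      g : Carrier
      g = x + expAd px y

      module Qb = Ad pb

      ∂-exp-x : ∀ {z} (p : F 1 z) → ∂ z ≈ z → ∂ (exp z) ≈ z * exp z
      ∂-exp-x {z} p e = ≈-trans (derivation-exp D p (∂-F p)) (*-cong (begin
        Ad.ev p φ (∂ z)      ≈⟨ Ad.ev-cong p (λ _ _ → refl) e ⟩
        Ad.ev p φ z          ≈⟨ sum-peel K≡ _ ⟩
        φ 0 · z + sum l (λ k → φ (suc k) · Ad.pow p (suc k) z)
          ≈⟨ +-cong (≈-trans (·-congˡ z inv-1) (·-1 z)) (sum-zero l (λ k _ → ·-0 _ (vanish k))) ⟩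
        z + 0#               ≈⟨ +-identityʳ z ⟩
        z ∎) ≈-refl)
        where
        vanish : ∀ k → Ad.pow p (suc k) z ≈ 0#
        vanish zero    = ad-self z
        vanish (suc k) = ≈-trans (ad-cong ≈-refl (vanish k)) (ad-0 z)

      ∂a : ∂ a ≈ g * a
      ∂a = begin
        ∂ (exp x * exp y)                           ≈⟨ ∂-* _ _ ⟩
        ∂ (exp x) * exp y + exp x * ∂ (exp y)       ≈⟨ +-cong (*-cong (∂-exp-x px ∂x) ≈-refl) (*-cong ≈-refl (∂-exp-x py ∂y)) ⟩
        x * exp x * exp y + exp x * (y * exp y)     ≈⟨ +-cong (*-assoc _ _ _) (≈-sym (*-assoc _ _ _)) ⟩
        x * a + exp x * y * exp y                   ≈⟨ +-cong ≈-refl (*-cong (hadamard px y) ≈-refl) ⟩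
        x * a + expAd px y * exp x * exp y          ≈⟨ +-cong ≈-refl (*-assoc _ _ _) ⟩
        x * a + expAd px y * a                      ≈⟨ ≈-sym (distribʳ _ _ _) ⟩
        g * a ∎

      -- ∂ a is computed twice, from the product `exp x * exp y` and from `exp b`.
      g≈ : g ≈ Qb.ev φ (∂ b)
      g≈ = cancel-a (begin
        g * a                        ≈⟨ ≈-sym ∂a ⟩
        ∂ a                          ≈⟨ ∂-cong (≈-sym exp-b) ⟩
        ∂ (exp b)                    ≈⟨ derivation-exp D pb (∂-F pb) ⟩
        Qb.ev φ (∂ b) * exp b        ≈⟨ *-cong ≈-refl exp-b ⟩
        Qb.ev φ (∂ b) * a ∎)

      module S⁺ = ScalarSeries {suc K} {K} refl
      module LI = LogInverse K

      N-b : ∀ h → N h ≈ Qb.ev S⁺.E h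
      N-b h = begin
        C h + - h                 ≈⟨ +-cong (≈-trans (C-b h) (sum-peel K≡ _)) ≈-refl ⟩
        (expCoeff 0 · h + W) + - h ≈⟨ +-cong (≈-trans (+-cong (≈-trans (·-congˡ h inv-1) (·-1 h)) ≈-refl) (+-comm _ _)) ≈-refl ⟩
        (W + h) + - h             ≈⟨ ≈-trans (+-assoc _ _ _) (≈-trans (+-cong ≈-refl (-‿inverseʳ h)) (+-identityʳ W)) ⟩
        W                         ≈⟨ ≈-sym (≈-trans (+-cong (0· h) ≈-refl) (+-identityˡ W)) ⟩
        0ℚ · h + W                ≈⟨ ≈-sym (sum-peel K≡ _) ⟩
        Qb.ev S⁺.E h ∎
        where W = sum l (λ k → expCoeff (suc k) · Qb.pow (suc k) h)

      Npow : ℕ → Carrier → Carrier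
      Npow zero    h = h
      Npow (suc k) h = N (Npow k h)

      N-cong : ∀ {h h′} → h ≈ h′ → N h ≈ N h′
      N-cong e = +-cong (Ad.ev-cong px (λ _ _ → refl) (Ad.ev-cong py (λ _ _ → refl) e)) (-‿cong e)

      Npow-b : ∀ k h → Npow k h ≈ Qb.ev (S⁺.Epow k) h
      Npow-b zero h = ≈-sym (≈-trans (sum-peel K≡ _) (≈-trans
        (+-cong (·-1 h) (sum-zero l (λ k _ → 0· (Qb.pow (suc k) h)))) (+-identityʳ h)))
      Npow-b (suc k) h = ≈-trans (N-cong (Npow-b k h)) (≈-trans (N-b _) (Qb.ev-⊛ S⁺.E (S⁺.Epow k) h))

      -- Solves `g≈` for ∂ b: N acts as e^(ad b) - 1, so ψ(N) inverts φ(ad b) by `LogInverse`.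
      ∂b : ∂ b ≈ sum K (λ k → ψ k · Npow k g)
      ∂b = ≈-sym (begin
        sum K (λ k → ψ k · Npow k g)
          ≈⟨ sum-cong K (λ k _ → ≈-trans (·-cong _ (Npow-b k g)) (≈-trans (·-sum _ K _) (sum-cong K (λ i _ → ≈-sym (·-assoc _ _ _))))) ⟩
        sum K (λ k → sum K (λ i → (ψ k ℚ.* S⁺.Epow k i) · Qb.pow i g))
          ≈⟨ sum-swap K K _ ⟩
        sum K (λ i → sum K (λ k → (ψ k ℚ.* S⁺.Epow k i) · Qb.pow i g))
          ≈⟨ sum-cong K (λ i _ → sum·-sum (Qb.pow i g) K (λ k → ψ k ℚ.* S⁺.Epow k i)) ⟩
        Qb.ev LI.ψE g
          ≈⟨ Qb.ev-cong {LI.ψE} {LI.ψE} (λ _ _ → refl) g≈ ⟩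
        Qb.ev LI.ψE (Qb.ev φ (∂ b))
          ≈⟨ Qb.ev-⊛ LI.ψE φ (∂ b) ⟩
        Qb.ev (LI.ψE ⊛ φ) (∂ b)
          ≈⟨ Qb.ev-cong {LI.ψE ⊛ φ} {S⁺.one} LI.ψE-φ ≈-refl ⟩
        Qb.ev S⁺.one (∂ b)
          ≈⟨ ≈-sym (Npow-b 0 (∂ b)) ⟩
        ∂ b ∎)

      pow-replicate : ∀ {z} (p : F 1 z) r w ws → nestᴬ (replicate r z ++ w ∷ ws) ≈ Ad.pow p r (nestᴬ (w ∷ ws))
      pow-replicate p zero    w ws = ≈-refl
      pow-replicate p (suc zero) w ws = ≈-refl
      pow-replicate {z} p (suc (suc r)) w ws = ad-cong ≈-refl (pow-replicate p (suc r) w ws)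

      nest-self : ∀ z r → nestᴬ (replicate (suc (suc r)) z) ≈ 0#
      nest-self z zero    = ad-self z
      nest-self z (suc r) = ≈-trans (ad-cong ≈-refl (nest-self z r)) (ad-0 z)

      powx = Ad.pow px
      powy = Ad.pow py

      block : ℕ → ℕ → List Carrier
      block r s = replicate r x ++ replicate s y

      nest-block : ∀ r s w ws → nestᴬ (block r s ++ w ∷ ws) ≈ powx r (powy s (nestᴬ (w ∷ ws)))
      nest-block r s w ws = ≈-trans (reflexive (≡.cong nestᴬ (Listₚ.++-assoc (replicate r x) (replicate s y) (w ∷ ws)))) (go s)
        where
        reflexive : ∀ {u v : Carrier} → u ≡ v → u ≈ v
        reflexive refl = ≈-refl
        go : ∀ s → nestᴬ (replicate r x ++ (replicate s y ++ w ∷ ws)) ≈ powx r (powy s (nestᴬ (w ∷ ws)))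
        go zero    = pow-replicate px r w ws
        go (suc s) = ≈-trans (pow-replicate px r y (replicate s y ++ w ∷ ws)) (Ad.pow-cong px r (pow-replicate py (suc s) w ws))

      term tnz : List (ℕ × ℕ) → Carrier
      term σ = inv (factProd σ) · nestᴬ (wordᴬ x y σ)
      tnz σ = if nonZero σ then term σ else 0#

      term-step : ∀ r s q τ → nonZero (q ∷ τ) ≡ true →
        term ((r , s) ∷ q ∷ τ) ≈ (expCoeff r ℚ.* expCoeff s) · powx r (powy s (term (q ∷ τ)))
      term-step r s q τ nz = begin
        inv (r ! ℕ.* (s ! ℕ.* factProd (q ∷ τ))) · nestᴬ (wordᴬ x y ((r , s) ∷ q ∷ τ))
          ≈⟨ ·-cong _ (nonempty q nz) ⟩
        inv (r ! ℕ.* (s ! ℕ.* factProd (q ∷ τ))) · powx r (powy s W)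
          ≈⟨ ·-congˡ _ (≡.trans (inv-* (r !) _) (≡.trans (≡.cong (inv (r !) ℚ.*_) (inv-* (s !) _)) (≡.sym (ℚₚ.*-assoc (inv (r !)) (inv (s !)) _)))) ⟩
        ((expCoeff r ℚ.* expCoeff s) ℚ.* inv (factProd (q ∷ τ))) · powx r (powy s W)
          ≈⟨ ·-assoc _ _ _ ⟩
        (expCoeff r ℚ.* expCoeff s) · (inv (factProd (q ∷ τ)) · powx r (powy s W))
          ≈⟨ ·-cong _ (≈-sym (≈-trans (Ad.pow-cong px r (Ad.pow-· py s _ _)) (Ad.pow-· px r _ _))) ⟩
        (expCoeff r ℚ.* expCoeff s) · powx r (powy s (term (q ∷ τ))) ∎
        where
        W = nestᴬ (wordᴬ x y (q ∷ τ))
        nonempty : ∀ q → nonZero (q ∷ τ) ≡ true → nestᴬ (block r s ++ wordᴬ x y (q ∷ τ)) ≈ powx r (powy s (nestᴬ (wordᴬ x y (q ∷ τ))))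
        nonempty (zero  , zero)  ()
        nonempty (zero  , suc j) _ = nest-block r s y _
        nonempty (suc i , j)     _ = nest-block r s x _

      step : Carrier → ℕ → ℕ → Carrier
      step h r s = (expCoeff r ℚ.* expCoeff s) · powx r (powy s h)

      -- Dropping the block (0, 0) is the subtraction of the identity in `N`. This is the origin of
      -- the condition r + s ≥ 1 in Dynkin's formula.
      step⁺ : Carrier → ℕ → ℕ → Carrier
      step⁺ h r s = if 1 ℕ.≤ᵇ r ℕ.+ s then step h r s else 0#

      C-grid : ∀ h → C h ≈ sum K (λ r → sum K (step h r))
      C-grid h = sum-cong K (λ r _ → ≈-trans (·-cong _ (Ad.pow-sum px r K _)) (≈-trans (·-sum _ K _)
        (sum-cong K (λ s _ → ≈-trans (·-cong _ (Ad.pow-· px r _ _)) (≈-sym (·-assoc _ _ _))))))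

      N-grid : ∀ h → N h ≈ sum K (λ r → sum K (step⁺ h r))
      N-grid h = begin
        C h + - h                                         ≈⟨ +-cong (C-grid h) ≈-refl ⟩
        sum K (λ r → sum K (step h r)) + - h              ≈⟨ +-cong (≈-trans (sum-peel K≡ _) (+-cong (sum-peel K≡ _) ≈-refl)) ≈-refl ⟩
        ((step h 0 0 + U) + V) + - h                      ≈⟨ +-cong (+-cong (+-cong step-00 ≈-refl) ≈-refl) ≈-refl ⟩
        ((h + U) + V) + - h                               ≈⟨ +-cong (≈-trans (+-assoc _ _ _) (+-comm _ _)) ≈-refl ⟩
        ((U + V) + h) + - h                               ≈⟨ ≈-trans (+-assoc _ _ _) (≈-trans (+-cong ≈-refl (-‿inverseʳ h)) (+-identityʳ _)) ⟩
        U + V                                             ≈⟨ +-cong (≈-sym (+-identityˡ U)) ≈-refl ⟩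
        (0# + U) + V                                      ≈⟨ ≈-sym (≈-trans (sum-peel K≡ _) (+-cong (sum-peel K≡ _) ≈-refl)) ⟩
        sum K (λ r → sum K (step⁺ h r)) ∎
        where
        U = sum l (λ s → step h 0 (suc s))
        V = sum l (λ r → sum K (step h (suc r)))
        step-00 : step h 0 0 ≈ h
        step-00 = ≈-trans (·-congˡ h (≡.trans (≡.cong₂ ℚ._*_ inv-1 inv-1) refl)) (·-1 h)

      open ListSumHom +-commutativeMonoid +-commutativeMonoid

      -- Each application of N prepends one block. In the base case, all nested words x^r y^s vanish
      -- except x and (ad x)^r y, whose weighted sum is g.
      Npow-list : ∀ k → Npow k g ≈ sumL (seqs l (suc k)) tnz
      Npow-list zero = ≈-sym (≈-trans (sumL-seqs l 0 tnz) (≈-trans (sumL-cong (grid l) (λ p → +-identityʳ (tnz (p ∷ []))))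
        (≈-trans (sumL-grid′ K≡ _) (base l K≡))))
        where
        Tm : ℕ → ℕ → Carrier
        Tm r s = tnz ((r , s) ∷ [])
        ev0 : ∀ {h} → h ≈ 0# → expAd px h ≈ 0#
        ev0 e = ≈-trans (Ad.ev-cong px (λ _ _ → refl) e) (sum-zero K (λ k _ → ·-0 _ (Ad.pow-0 px k)))
        T0 : ∀ r → (r ≡ 1 → ⊥) → Tm r 0 ≈ 0#
        T0 zero e = ≈-refl
        T0 (suc zero) e = ⊥-elim (e refl)
        T0 (suc (suc r)) e = ·-0 _ (≈-trans (reflexive (≡.cong nestᴬ (≡.trans (Listₚ.++-identityʳ (block (suc (suc r)) 0)) (Listₚ.++-identityʳ (replicate (suc (suc r)) x))))) (nest-self x r))
          where
          reflexive : ∀ {u v : Carrier} → u ≡ v → u ≈ v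
          reflexive refl = ≈-refl
        T0-1 : Tm 1 0 ≈ x
        T0-1 = ≈-trans (·-congˡ x inv-1) (·-1 x)
        unnil : ∀ r s → nestᴬ (block r s ++ []) ≈ nestᴬ (block r s)
        unnil r s = reflexive (≡.cong nestᴬ (Listₚ.++-identityʳ (block r s)))
          where
          reflexive : ∀ {u v : Carrier} → u ≡ v → u ≈ v
          reflexive refl = ≈-refl
        T1 : ∀ r → Tm r 1 ≈ expCoeff r · powx r y
        T1 r = ≈-trans (reflexive (≡.cong (λ b → if b then term ((r , 1) ∷ []) else 0#) (nz r)))
          (≈-trans (·-congˡ _ (≡.cong inv (ℕₚ.*-identityʳ (r !)))) (·-cong _ (≈-trans (unnil r 1) (pow-replicate px r y []))))
          where
          reflexive : ∀ {u v : Carrier} → u ≡ v → u ≈ v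
          reflexive refl = ≈-refl
          nz : ∀ r → nonZero ((r , 1) ∷ []) ≡ true
          nz zero = refl
          nz (suc r) = refl
        T2 : ∀ r s → Tm r (suc (suc s)) ≈ 0#
        T2 r s with nonZero ((r , suc (suc s)) ∷ [])
        ... | false = ≈-refl
        ... | true  = ·-0 _ (≈-trans (unnil r (suc (suc s))) (≈-trans (pow-replicate px r y _)
                        (≈-trans (Ad.pow-cong px r (nest-self y s)) (Ad.pow-0 px r))))
        base : ∀ l → K ≡ suc l → sum K (λ r → sum K (Tm r)) ≈ g
        base zero e = ≈-trans (≈-trans (sum-peel e _) (≈-trans (+-identityʳ _) (≈-trans (sum-peel e _) (+-identityʳ _))))
          (≈-sym (≈-trans (+-cong (F-top {1} (ℕₚ.≤-reflexive e) px) (ev0 (F-top {1} (ℕₚ.≤-reflexive e) py))) (+-identityˡ _)))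
        base (suc l′) e = begin
          sum K (λ r → sum K (Tm r))
            ≈⟨ sum-cong K (λ r _ → ≈-trans (sum-peel e _) (+-cong ≈-refl (≈-trans (+-cong (T1 r) (sum-zero l′ (λ s _ → T2 r s))) (+-identityʳ _)))) ⟩
          sum K (λ r → Tm r 0 + expCoeff r · powx r y)
            ≈⟨ sum-+ K _ _ ⟩
          sum K (λ r → Tm r 0) + expAd px y
            ≈⟨ +-cong (≈-trans (sum-single 1 _ (≡.subst (1 <_) (≡.sym e) (s≤s (s≤s z≤n))) T0) T0-1) ≈-refl ⟩
          g ∎
      Npow-list (suc k) = begin
        N (Npow k g)                                          ≈⟨ N-cong (Npow-list k) ⟩
        N Sk                                                  ≈⟨ N-grid Sk ⟩
        sum K (λ r → sum K (step⁺ Sk r))                      ≈⟨ sum-cong K (λ r _ → sum-cong K (λ s _ → ≈-sym (cell r s))) ⟩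
        sum K (λ r → sum K (λ s → sumL (seqs l (suc k)) (λ σ → tnz ((r , s) ∷ σ)))) ≈⟨ ≈-sym (sumL-grid′ K≡ _) ⟩
        sumL (grid l) (λ p → sumL (seqs l (suc k)) (λ σ → tnz (p ∷ σ))) ≈⟨ ≈-sym (sumL-seqs l (suc k) tnz) ⟩
        sumL (seqs l (suc (suc k))) tnz ∎
        where
        Sk = sumL (seqs l (suc k)) tnz
        cell : ∀ r s → sumL (seqs l (suc k)) (λ σ → tnz ((r , s) ∷ σ)) ≈ step⁺ Sk r s
        cell r s with 1 ℕ.≤ᵇ r ℕ.+ s
        ... | false = sumL-zero (seqs l (suc k)) (λ σ → ≈-refl)
        ... | true  = ≈-sym (≈-trans (hom-sumL (λ h → step h r s)
            (·-0 _ (≈-trans (Ad.pow-cong px r (Ad.pow-0 py s)) (Ad.pow-0 px r)))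
            (λ u v → ≈-trans (·-cong _ (≈-trans (Ad.pow-cong px r (Ad.pow-+ py s u v)) (Ad.pow-+ px r _ _))) (·-distˡ _ _ _))
            (seqs l (suc k)) tnz)
            (sumL-seqs-cong l k (λ q τ → one-term q τ)))
          where
          one-term : ∀ q τ → step (tnz (q ∷ τ)) r s ≈ (if nonZero (q ∷ τ) then term ((r , s) ∷ q ∷ τ) else 0#)
          one-term q τ with nonZero (q ∷ τ) in eq
          ... | false = ·-0 _ (≈-trans (Ad.pow-cong px r (Ad.pow-0 py s)) (Ad.pow-0 px r))
          ... | true  = ≈-sym (term-step r s q τ eq)

      g∈ : F 1 g
      g∈ = F-+ px (F-sum K go)
        where
        go : ∀ k → k < K → F 1 (expCoeff k · powx k y)
        go zero    _ = F-· _ py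
        go (suc k) _ = F-· _ (ad-F px (F-0 _))

      -- N^l g has order l + 1. So Dynkin's range k < l loses nothing against the range k < K in
      -- `∂b`.
      Npow-top : Npow l g ≈ 0#
      Npow-top = ≈-trans (Npow-b l g) (sum-zero K small)
        where
        small : ∀ i → i < K → S⁺.Epow l i · Qb.pow i g ≈ 0#
        small i i<K = [ low , high ]′ (ℕₚ.<-≤-connex i l)
          where
          low : i < l → S⁺.Epow l i · Qb.pow i g ≈ 0#
          low i<l = ≈-trans (·-congˡ _ (S⁺.Epow-low l i i<l (ℕₚ.m<n⇒m<1+n i<K))) (0· _)
          high : l ≤ i → S⁺.Epow l i · Qb.pow i g ≈ 0#
          high l≤i = ·-0 _ (F-top (≡.subst (K ≤_) (ℕₚ.+-comm 1 i) (ℕₚ.≤-trans (ℕₚ.≤-reflexive K≡) (s≤s l≤i))) (Qb.pow-F i g∈))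

      ∂-neg : ∀ u → ∂ (- u) ≈ - ∂ u
      ∂-neg u = GP.inverseʳ-unique (∂ u) (∂ (- u)) (≈-trans (≈-sym (∂-+ u (- u))) (≈-trans (∂-cong (-‿inverseʳ u)) ∂-0))

      ∂-ad : ∀ u v → ∂ (ad u v) ≈ ad (∂ u) v + ad u (∂ v)
      ∂-ad u v = begin
        ∂ (u * v + - (v * u))                             ≈⟨ ≈-trans (∂-+ _ _) (+-cong (∂-* u v) (≈-trans (∂-neg _) (-‿cong (∂-* v u)))) ⟩
        (∂ u * v + u * ∂ v) + - (∂ v * u + v * ∂ u)       ≈⟨ +-cong ≈-refl (≈-trans (-‿cong (+-comm _ _)) (neg-+ _ _)) ⟩
        (∂ u * v + u * ∂ v) + (- (v * ∂ u) + - (∂ v * u)) ≈⟨ +-interchange _ _ _ _ ⟩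
        ad (∂ u) v + ad u (∂ v) ∎

      ∂-nest : ∀ {ws} → All (λ w → ∂ w ≈ w) ws → ∂ (nestᴬ ws) ≈ ι (length ws) · nestᴬ ws
      ∂-nest [] = ≈-trans ∂-0 (≈-sym (·0 _))
      ∂-nest (e ∷ []) = ≈-trans e (≈-sym (≈-trans (·-congˡ _ ι-1) (·-1 _)))
      ∂-nest {w ∷ ws@(_ ∷ ws′)} (e ∷ es@(_ ∷ _)) = begin
        ∂ (ad w (nestᴬ ws))                                   ≈⟨ ∂-ad w _ ⟩
        ad (∂ w) (nestᴬ ws) + ad w (∂ (nestᴬ ws))              ≈⟨ +-cong (ad-cong e ≈-refl) (≈-trans (ad-cong ≈-refl (∂-nest es)) (ad-· w _ _)) ⟩
        ad w (nestᴬ ws) + ι (length ws) · ad w (nestᴬ ws)      ≈⟨ +-cong (≈-sym (·-1 _)) ≈-refl ⟩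
        1ℚ · ad w (nestᴬ ws) + ι (length ws) · ad w (nestᴬ ws) ≈⟨ ≈-sym (·-distʳ _ _ _) ⟩
        (1ℚ ℚ.+ ι (length ws)) · ad w (nestᴬ ws)
          ≈⟨ ·-congˡ _ (≡.sym (≡.trans (ι-+ 1 (length ws)) (≡.cong (ℚ._+ ι (length ws)) ι-1))) ⟩
        ι (suc (length ws)) · ad w (nestᴬ ws) ∎

      nest-F : ∀ {ws} → All (F 1) ws → F (length ws) (nestᴬ ws)
      nest-F [] = F-0 _
      nest-F (p ∷ []) = p
      nest-F (p ∷ ps@(_ ∷ _)) = ad-F p (nest-F ps)

      nest-F1 : ∀ {ws} → All (F 1) ws → F 1 (nestᴬ ws)
      nest-F1 [] = F-zero 1
      nest-F1 (p ∷ []) = p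
      nest-F1 (p ∷ _ ∷ _) = ad-F p (F-0 _)

      All-word : ∀ {P : Carrier → Set} → P x → P y → ∀ σ → All P (wordᴬ x y σ)
      All-word u v []            = []
      All-word u v ((r , s) ∷ σ) = Allₚ.++⁺ (Allₚ.++⁺ (Allₚ.replicate⁺ r u) (Allₚ.replicate⁺ s v)) (All-word u v σ)

      length-word : ∀ σ → length (wordᴬ x y σ) ≡ total σ
      length-word []            = refl
      length-word ((r , s) ∷ σ) = ≡.trans (Listₚ.length-++ (block r s)) (≡.cong₂ ℕ._+_
        (≡.trans (Listₚ.length-++ (replicate r x)) (≡.cong₂ ℕ._+_ (Listₚ.length-replicate r) (Listₚ.length-replicate s))) (length-word σ))

      summand : ℕ → List (ℕ × ℕ) → Carrier
      summand k σ = if valid l σ then dynkinCoeff (suc k) σ · nestᴬ (wordᴬ x y σ) else 0#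

      coeff-total : ∀ σ → total σ ≡ 0 → nestᴬ (wordᴬ x y σ) ≈ 0#
      coeff-total σ e with wordᴬ x y σ | ≡.trans (length-word σ) e
      ... | [] | _ = ≈-refl

      -- The eigenvalue of the word cancels the factor `total σ` of the denominator. If the total is
      -- 0, the word is empty and its nested bracket is 0.
      coeff : ∀ k σ → ι (total σ) · (dynkinCoeff (suc k) σ · nestᴬ (wordᴬ x y σ)) ≈ ψ k · term σ
      coeff k σ with total σ in eq
      ... | zero  = ≈-trans (·-0 _ (·-0 _ (coeff-total σ eq))) (≈-sym (·-0 _ (·-0 _ (coeff-total σ eq))))
      ... | suc t = ≈-trans (≈-sym (·-assoc _ _ _)) (≈-trans (·-congˡ _ eqn) (·-assoc _ _ _))
        where
        lem : ∀ a b c d e → a ℚ.* (b ℚ.* (c ℚ.* (d ℚ.* e))) ≡ (a ℚ.* d) ℚ.* ((b ℚ.* c) ℚ.* e)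
        lem = solve-∀ ℚring
        eqn : ι (suc t) ℚ.* frac (sgn k) (suc k ℕ.* (suc t ℕ.* factProd σ)) ≡ ψ k ℚ.* inv (factProd σ)
        eqn = ≡.trans (≡.cong (ι (suc t) ℚ.*_) (≡.trans (frac-inv (sgn k) (suc k ℕ.* (suc t ℕ.* factProd σ)))
                (≡.cong (ιℤ (sgn k) ℚ.*_) (≡.trans (inv-* (suc k) (suc t ℕ.* factProd σ)) (≡.cong (inv (suc k) ℚ.*_) (inv-* (suc t) (factProd σ)))))))
              (≡.trans (lem (ι (suc t)) (ιℤ (sgn k)) (inv (suc k)) (inv (suc t)) (inv (factProd σ)))
              (≡.trans (≡.cong (ℚ._* (ψ k ℚ.* inv (factProd σ))) (ι-inv t)) (ℚₚ.*-identityˡ _)))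

      ∂-summand : ∀ k σ → ∂ (summand k σ) ≈ ψ k · tnz σ
      ∂-summand k σ with nonZero σ
      ... | false = ≈-trans ∂-0 (≈-sym (·0 _))
      ... | true with total σ ℕ.≤ᵇ l in eq
      ...   | true  = ≈-trans (∂-· _ _) (≈-trans (·-cong _ (∂-nest (All-word ∂x ∂y σ)))
                        (≈-trans (≈-sym (·-assoc _ _ _)) (≈-trans (·-congˡ _ (≡.trans (ℚₚ.*-comm (dynkinCoeff (suc k) σ) _) (≡.cong (λ t → ι t ℚ.* dynkinCoeff (suc k) σ) (length-word σ))))
                        (≈-trans (·-assoc _ _ _) (coeff k σ)))))
      -- Sequences with admissible blocks that are discarded for their total have words of length at
      -- least K, whose brackets lie in `F K`.
      ...   | false = ≈-trans ∂-0 (≈-sym (·-0 _ (·-0 _ (F-top big (nest-F (All-word px py σ))))))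
        where
        big : K ≤ length (wordᴬ x y σ)
        big = ℕₚ.≤-trans (ℕₚ.≤-reflexive K≡) (≡.subst (suc l ≤_) (≡.sym (length-word σ))
                (ℕₚ.≰⇒> (λ p → ≡.subst True eq (ℕₚ.≤⇒≤ᵇ p))))

      dynkin-F : F 1 (dynkin x y)
      dynkin-F = F-sum l (λ k _ → F-sumL (seqs l (suc k)) (λ σ → summand-F k σ))
        where
        F-sumL : ∀ {X : Set} (xs : List X) {f : X → Carrier} → (∀ i → F 1 (f i)) → F 1 (sumL xs f)
        F-sumL []       e = F-zero 1
        F-sumL (i ∷ xs) e = F-+ (e i) (F-sumL xs e)
        summand-F : ∀ k σ → F 1 (summand k σ)
        summand-F k σ with valid l σ
        ... | true  = F-· _ (nest-F1 (All-word px py σ))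
        ... | false = F-zero 1

      dynkin≈b : dynkin x y ≈ b
      dynkin≈b = ∂-injective dynkin-F pb (begin
        ∂ (dynkin x y)                                                    ≈⟨ ∂-sum l _ ⟩
        sum l (λ k → ∂ (sumL (seqs l (suc k)) (summand k)))
          ≈⟨ sum-cong l (λ k _ → ≈-trans (hom-sumL ∂ ∂-0 ∂-+ (seqs l (suc k)) (summand k))
               (≈-trans (sumL-cong (seqs l (suc k)) (∂-summand k))
               (≈-trans (≈-sym (hom-sumL (ψ k ·_) (·0 _) (·-distˡ _) (seqs l (suc k)) tnz)) (·-cong _ (≈-sym (Npow-list k)))))) ⟩
        sum l (λ k → ψ k · Npow k g)                                      ≈⟨ ≈-sym (+-identityʳ _) ⟩
        sum l (λ k → ψ k · Npow k g) + 0#                                 ≈⟨ +-cong ≈-refl (≈-sym (·-0 _ Npow-top)) ⟩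
        sum l (λ k → ψ k · Npow k g) + ψ l · Npow l g                     ≈⟨ ≈-sym (sum-peel-last K≡ _) ⟩
        sum K (λ k → ψ k · Npow k g)                                      ≈⟨ ≈-sym ∂b ⟩
        ∂ b ∎)

    exp-dynkin : exp (dynkin x y) ≈ exp x * exp y
    exp-dynkin = ≈-trans (exp-cong dynkin≈b) exp-b

-- Setting t = 1 in the series algebra deduces the theorem for x , y from the one for t x , t y,
-- where the Euler derivation is available.
module Specialisation {K l : ℕ} (K≡ : K ≡ suc l) (𝔸 : FilteredAlgebra K) where
  private
    module A = FilteredAlgebra 𝔸
    module AE = Exp K≡ 𝔸
    module AB = BCH K≡ 𝔸
    module B = Series A.algebra K
    module BF = FilteredAlgebra B.series
    module BE = Exp K≡ B.series
    module BB = BCH K≡ B.series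
    module AL = ListSums A.+-commutativeMonoid
    module BL = ListSums BF.+-commutativeMonoid
  open import Relation.Binary.Reasoning.Setoid A.setoid

  at1 : B.C → A.Carrier
  at1 c = A.sum K c

  -- The coefficient of t^n has order n, as for t x with x of order 1. Then the terms i + j ≥ K lost
  -- by truncation in t vanish in the algebra as well, and evaluation at t = 1 is multiplicative on
  -- such series.
  Tame : B.C → Set
  Tame c = ∀ n → A.F n (c n)

  at1-cong : ∀ {c d} → c B.≈ₛ d → at1 c A.≈ at1 d
  at1-cong e = A.sum-cong K e

  at1-+ : ∀ c d → at1 (c BF.+ d) A.≈ (at1 c A.+ at1 d)
  at1-+ c d = A.sum-+ K c d

  at1-0 : at1 BF.0# A.≈ A.0#
  at1-0 = A.sum-zero K (λ _ _ → A.≈-refl)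

  at1-· : ∀ q c → at1 (q BF.· c) A.≈ (q A.· at1 c)
  at1-· q c = A.≈-sym (A.·-sum q K c)

  at1-neg : ∀ c → at1 (BF.- c) A.≈ (A.- at1 c)
  at1-neg c = A.GP.inverseʳ-unique (at1 c) (at1 (BF.- c))
    (A.≈-trans (A.≈-sym (at1-+ c (BF.- c))) (A.≈-trans (A.sum-cong K (λ n _ → A.-‿inverseʳ (c n))) at1-0))

  at1-1 : at1 BF.1# A.≈ A.1#
  at1-1 = A.≈-trans (A.sum-peel K≡ BF.1#) (A.≈-trans (A.+-cong A.≈-refl (A.sum-zero l (λ _ _ → A.≈-refl))) (A.+-identityʳ _))

  at1-* : ∀ {c d} → Tame c → Tame d → at1 (c B.*ₛ d) A.≈ (at1 c A.* at1 d)
  at1-* {c} {d} p q = A.≈-sym (begin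
    A.sum K c A.* A.sum K d                              ≈⟨ A.*-sumʳ (A.sum K d) K c ⟩
    A.sum K (λ i → c i A.* A.sum K d)                    ≈⟨ A.sum-cong K (λ i _ → A.*-sumˡ (c i) K d) ⟩
    A.sum K (λ i → A.sum K (λ j → c i A.* d j))          ≈⟨ A.sum-diag K _ (λ i j K≤ → A.F-top K≤ (A.F-* (p i) (q j))) ⟩
    A.sum K (c B.*ₛ d) ∎)

  tame-diag : ∀ n {G : ℕ → ℕ → A.Carrier} {k} → (∀ i j → i ℕ.+ j ≡ n → A.F k (G i j)) → A.F k (A.diag G n)
  tame-diag zero    e = e 0 0 refl
  tame-diag (suc n) e = A.F-+ (e 0 (suc n) refl) (tame-diag n (λ i j q → e (suc i) j (≡.cong suc q)))

  tame-* : ∀ {c d} → Tame c → Tame d → Tame (c B.*ₛ d)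
  tame-* {c} {d} p q n = tame-diag n (λ i j e → ≡.subst (λ m → A.F m (c i A.* d j)) e (A.F-* (p i) (q j)))

  tame-1 : Tame BF.1#
  tame-1 zero    = A.F-0 _
  tame-1 (suc n) = A.F-zero _

  tame-ad : ∀ {c d} → Tame c → Tame d → Tame (BF.ad c d)
  tame-ad p q n = A.F-+ (tame-* p q n) (A.F-neg (tame-* q p n))

  at1-ad : ∀ {c d} → Tame c → Tame d → at1 (BF.ad c d) A.≈ A.ad (at1 c) (at1 d)
  at1-ad {c} {d} p q = A.≈-trans (at1-+ (c B.*ₛ d) (BF.- (d B.*ₛ c))) (A.+-cong (at1-* p q) (A.≈-trans (at1-neg (d B.*ₛ c)) (A.-‿cong (at1-* q p))))

  tame-dp : ∀ {c} → Tame c → ∀ k → Tame (dp BF.algebra c k)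
  tame-dp p zero    = tame-1
  tame-dp p (suc k) n = A.F-· _ (tame-* p (tame-dp p k) n)

  at1-dp : ∀ {c} → Tame c → ∀ k → at1 (dp BF.algebra c k) A.≈ dp A.algebra (at1 c) k
  at1-dp p zero    = at1-1
  at1-dp {c} p (suc k) = A.≈-trans (at1-· _ (c B.*ₛ dp BF.algebra c k))
    (A.·-cong _ (A.≈-trans (at1-* p (tame-dp p k)) (A.*-cong A.≈-refl (at1-dp p k))))

  at1-sum : ∀ n f → at1 (BF.sum n f) A.≈ A.sum n (λ i → at1 (f i))
  at1-sum = SumHom.hom-sum BF.+-commutativeMonoid A.+-commutativeMonoid at1 at1-0 at1-+

  at1-exp : ∀ {c} → Tame c → at1 (BE.exp c) A.≈ AE.exp (at1 c)
  at1-exp {c} p = A.≈-trans (at1-sum K (dp BF.algebra c)) (A.sum-cong K (λ k _ → at1-dp p k))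

  tame-sum : ∀ m (f : ℕ → B.C) → (∀ k → Tame (f k)) → Tame (BF.sum m f)
  tame-sum zero    f t n = A.F-zero n
  tame-sum (suc m) f t n = A.F-+ (t 0 n) (tame-sum m (λ i → f (suc i)) (λ k → t (suc k)) n)

  tame-exp : ∀ {c} → Tame c → Tame (BE.exp c)
  tame-exp {c} p = tame-sum K (dp BF.algebra c) (tame-dp p)

  module _ {x y : A.Carrier} (px : A.F 1 x) (py : A.F 1 y) where
    private
      tame-monomial : ∀ {z} → A.F 1 z → Tame (B.monomial z)
      tame-monomial p zero          = A.F-0 _
      tame-monomial p (suc zero)    = p
      tame-monomial p (suc (suc n)) = A.F-zero _

      at1-monomial : ∀ {z} → A.F 1 z → at1 (B.monomial z) A.≈ z
      at1-monomial {z} p = go l K≡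
        where
        go : ∀ l → K ≡ suc l → at1 (B.monomial z) A.≈ z
        go zero    e = A.≈-trans (A.sum-peel e (B.monomial z)) (A.≈-trans (A.+-identityˡ _) (A.≈-sym (A.F-top {1} (ℕₚ.≤-reflexive e) p)))
        go (suc l) e = A.sum-single 1 (B.monomial z) (≡.subst (1 <_) (≡.sym e) (s≤s (s≤s z≤n)))
          (λ { zero _ → A.≈-refl ; (suc zero) q → ⊥-elim (q refl) ; (suc (suc i)) _ → A.≈-refl })

      x̂ ŷ : B.C
      x̂ = B.monomial x
      ŷ = B.monomial y

      Lift : B.C → A.Carrier → Set
      Lift c a = Tame c × at1 c A.≈ a

      lift-nest : ∀ {ws vs} → Pointwise Lift ws vs → Lift (BB.nestᴬ ws) (AB.nestᴬ vs)
      lift-nest [] = (λ n → A.F-zero n) , at1-0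
      lift-nest (p ∷ []) = p
      lift-nest ((t , e) ∷ ps@(_ ∷ _)) = tame-ad t (proj₁ (lift-nest ps)) ,
        A.≈-trans (at1-ad t (proj₁ (lift-nest ps))) (A.ad-cong e (proj₂ (lift-nest ps)))

      lift-word : ∀ σ → Pointwise Lift (BB.wordᴬ x̂ ŷ σ) (AB.wordᴬ x y σ)
      lift-word []            = []
      lift-word ((r , s) ∷ σ) = PW.++⁺ (PW.++⁺ (PW.replicate⁺ (tame-monomial px , at1-monomial px) r)
        (PW.replicate⁺ (tame-monomial py , at1-monomial py) s)) (lift-word σ)

      at1-dynkin : at1 (BB.dynkin x̂ ŷ) A.≈ AB.dynkin x y
      at1-dynkin = A.≈-trans (at1-sum l _) (A.sum-cong l (λ k _ → A.≈-trans
        (ListSumHom.hom-sumL BF.+-commutativeMonoid A.+-commutativeMonoid at1 at1-0 at1-+ (seqs l (suc k)) _)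
        (AL.sumL-cong (seqs l (suc k)) (λ σ → one k σ))))
        where
        one : ∀ k σ → at1 (if valid l σ then dynkinCoeff (suc k) σ BF.· BB.nestᴬ (BB.wordᴬ x̂ ŷ σ) else BF.0#)
                A.≈ (if valid l σ then dynkinCoeff (suc k) σ A.· AB.nestᴬ (AB.wordᴬ x y σ) else A.0#)
        one k σ with valid l σ
        ... | true  = A.≈-trans (at1-· _ (BB.nestᴬ (BB.wordᴬ x̂ ŷ σ))) (A.·-cong _ (proj₂ (lift-nest (lift-word σ))))
        ... | false = at1-0

      tame-sumL : ∀ {X : Set} (xs : List X) (f : X → B.C) → (∀ k → Tame (f k)) → Tame (BL.sumL xs f)
      tame-sumL []       f t n = A.F-zero n
      tame-sumL (i ∷ xs) f t n = A.F-+ (t i n) (tame-sumL xs f t n)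

      tame-dynkin : Tame (BB.dynkin x̂ ŷ)
      tame-dynkin = tame-sum l _ (λ k → tame-sumL (seqs l (suc k)) _ (one k))
        where
        one : ∀ k σ → Tame (if valid l σ then dynkinCoeff (suc k) σ BF.· BB.nestᴬ (BB.wordᴬ x̂ ŷ σ) else BF.0#)
        one k σ n with valid l σ
        ... | true  = A.F-· _ (proj₁ (lift-nest (lift-word σ)) n)
        ... | false = A.F-zero n

    exp-dynkin : AE.exp (AB.dynkin x y) A.≈ (AE.exp x A.* AE.exp y)
    exp-dynkin = begin
      AE.exp (AB.dynkin x y)               ≈⟨ AE.exp-cong (A.≈-sym at1-dynkin) ⟩
      AE.exp (at1 (BB.dynkin x̂ ŷ))         ≈⟨ A.≈-sym (at1-exp tame-dynkin) ⟩
      at1 (BE.exp (BB.dynkin x̂ ŷ))         ≈⟨ at1-cong (BB.exp-dynkin B.euler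
        (λ p n q r → A.·-0 _ (p n q r)) B.euler-injective (B.monomial-order x) (B.monomial-order y)
        (B.euler-monomial x) (B.euler-monomial y)) ⟩
      at1 (BE.exp x̂ B.*ₛ BE.exp ŷ)         ≈⟨ at1-* (tame-exp (tame-monomial px)) (tame-exp (tame-monomial py)) ⟩
      at1 (BE.exp x̂) A.* at1 (BE.exp ŷ)    ≈⟨ A.*-cong (at1-exp (tame-monomial px)) (at1-exp (tame-monomial py)) ⟩
      AE.exp (at1 x̂) A.* AE.exp (at1 ŷ)    ≈⟨ A.*-cong (AE.exp-cong (at1-monomial px)) (AE.exp-cong (at1-monomial py)) ⟩
      AE.exp x A.* AE.exp y ∎

-- The action of the structure group

module R = QAlgebra ℚalgebra
module RL = ListSums ℚ⁺

-- The Cauchy product in two variables: a sum over (i, j) + (i′, j′) = (a, b).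
D2 : (ℕ → ℕ → ℕ → ℕ → ℚ) → ℕ → ℕ → ℚ
D2 F a b = R.diag (λ i i′ → R.diag (λ j j′ → F i j i′ j′) b) a

module _ (a b : ℕ) where
  D2-cong : ∀ {F G : ℕ → ℕ → ℕ → ℕ → ℚ} → (∀ i j i′ j′ → i ℕ.+ i′ ≡ a → j ℕ.+ j′ ≡ b → F i j i′ j′ ≡ G i j i′ j′) →
            D2 F a b ≡ D2 G a b
  D2-cong e = R.diag-cong a (λ i i′ p → R.diag-cong b (λ j j′ q → e i j i′ j′ p q))

  D2-zero : ∀ {F : ℕ → ℕ → ℕ → ℕ → ℚ} → (∀ i j i′ j′ → i ℕ.+ i′ ≡ a → j ℕ.+ j′ ≡ b → F i j i′ j′ ≡ 0ℚ) →
            D2 F a b ≡ 0ℚ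
  D2-zero e = R.diag-zero a (λ i i′ p → R.diag-zero b (λ j j′ q → e i j i′ j′ p q))

  D2-+ : ∀ F G → D2 (λ i j i′ j′ → F i j i′ j′ ℚ.+ G i j i′ j′) a b ≡ D2 F a b ℚ.+ D2 G a b
  D2-+ F G = trans (R.diag-cong a (λ i i′ _ → R.diag-+ b _ _)) (R.diag-+ a _ _)

  D2-*ˡ : ∀ c F → c ℚ.* D2 F a b ≡ D2 (λ i j i′ j′ → c ℚ.* F i j i′ j′) a b
  D2-*ˡ c F = trans (R.*-diagˡ c a _) (R.diag-cong a (λ i i′ _ → R.*-diagˡ c b _))

  D2-flip : ∀ F → D2 F a b ≡ D2 (λ i j i′ j′ → F i′ j′ i j) a b
  D2-flip F = trans (R.diag-cong a (λ i i′ _ → R.diag-flip b _)) (R.diag-flip a _)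

  D2-assoc : ∀ (F : ℕ → ℕ → ℕ → ℕ → ℕ → ℕ → ℚ) →
    D2 (λ s t k k′ → D2 (λ i j i′ j′ → F i j i′ j′ k k′) s t) a b ≡
    D2 (λ i j s t → D2 (λ i′ j′ k k′ → F i j i′ j′ k k′) s t) a b
  D2-assoc F = trans (R.diag-cong a (λ s k _ → R.diag-exchange b s (λ t k′ i i′ → R.diag (λ j j′ → F i j i′ j′ k k′) t)))
    (trans (R.diag-cong a (λ s k _ → R.diag-cong s (λ i i′ _ → R.diag-assoc b (λ j j′ k′ → F i j i′ j′ k k′))))
    (trans (R.diag-assoc a (λ i i′ k → R.diag (λ j t → R.diag (λ j′ k′ → F i j i′ j′ k k′) t) b))
    (R.diag-cong a (λ i s _ → R.diag-exchange s b (λ i′ k j t → R.diag (λ j′ k′ → F i j i′ j′ k k′) t)))))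

sum1-sum : ∀ n f → sum1 n f ≡ R.sum n (λ i → f (suc i))
sum1-sum zero    f = refl
sum1-sum (suc n) f = trans (cong (ℚ._+ f (suc n)) (sum1-sum n f)) (sym (R.sum-last n (λ i → f (suc i))))

sum0-diag : ∀ n (G : ℕ → ℕ → ℚ) → sum0 n (λ i → G i (n ∸ i)) ≡ R.diag G n
sum0-diag n G = trans (cong (G 0 n ℚ.+_) (sum1-sum n (λ i → G i (n ∸ i)))) (sym (go n G))
  where
  go : ∀ n G → R.diag G n ≡ R.sum (suc n) (λ i → G i (n ∸ i))
  go zero    G = sym (ℚₚ.+-identityʳ _)
  go (suc n) G = cong (G 0 (suc n) ℚ.+_) (go n (λ i → G (suc i)))

sum0-cong : ∀ n {f g : ℕ → ℚ} → (∀ i → f i ≡ g i) → sum0 n f ≡ sum0 n g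
sum0-cong n {f} {g} e = trans (cong (f 0 ℚ.+_) (sum1-sum n f)) (trans (cong₂ ℚ._+_ (e 0) (R.sum-cong n (λ i _ → e (suc i)))) (cong (g 0 ℚ.+_) (sym (sum1-sum n g))))

pr : ℕ → ℕ → ℕ → ℕ → ℚ
pr i j c d = ι j ℚ.* ι c ℚ.- ι i ℚ.* ι d

frac-pairing : ∀ i j c d → frac (pairing (i , j) (c , d)) 1 ≡ pr i j c d
frac-pairing i j c d = trans (sym (ιℤ-def _)) (trans (ιℤ-+ (+ (j ℕ.* c)) (ℤ.- (+ (i ℕ.* d))))
  (cong₂ ℚ._+_ (trans (ιℤ-pos _) (ι-* j c)) (trans (ιℤ-neg (+ (i ℕ.* d))) (cong ℚ.-_ (trans (ιℤ-pos _) (ι-* i d))))))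

pr-00 : ∀ c d → pr 0 0 c d ≡ 0ℚ
pr-00 c d = trans (cong (λ z → z ℚ.* ι c ℚ.- z ℚ.* ι d) ι-0) (lem (ι c) (ι d))
  where lem : ∀ x y → 0ℚ ℚ.* x ℚ.- 0ℚ ℚ.* y ≡ 0ℚ
        lem = solve-∀ ℚring

pr-00ʳ : ∀ i j → pr i j 0 0 ≡ 0ℚ
pr-00ʳ i j = trans (cong (λ z → ι j ℚ.* z ℚ.- ι i ℚ.* z) ι-0) (lem (ι j) (ι i))
  where lem : ∀ x y → x ℚ.* 0ℚ ℚ.- y ℚ.* 0ℚ ≡ 0ℚ
        lem = solve-∀ ℚring

bracket-D2 : ∀ X Y a b → bracket X Y a b ≡ D2 (λ i j i′ j′ → pr i j i′ j′ ℚ.* (X i j ℚ.* Y i′ j′)) a b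
bracket-D2 X Y a b = trans
  (sum0-cong a (λ i → trans (sum0-cong b (λ j → cong (ℚ._* (X i j ℚ.* Y (a ∸ i) (b ∸ j))) (frac-pairing i j (a ∸ i) (b ∸ j))))
                            (sum0-diag b (λ j j′ → pr i j (a ∸ i) j′ ℚ.* (X i j ℚ.* Y (a ∸ i) j′)))))
  (sum0-diag a (λ i i′ → R.diag (λ j j′ → pr i j i′ j′ ℚ.* (X i j ℚ.* Y i′ j′)) b))

module Truncated (K : ℕ) where
  infix 4 _≃_
  _≃_ : Elt → Elt → Set
  f ≃ g = ∀ a b → a ℕ.+ b < K → f a b ≡ g a b

  Vanish : ℕ → Elt → Set
  Vanish d f = ∀ a b → a ℕ.+ b < d → a ℕ.+ b < K → f a b ≡ 0ℚ

  -- Linear operators on series modulo degree K. The field `op-F` places each of them in `F 0` of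
  -- the filtered algebra `endo`.
  record Endo : Set where
    no-eta-equality
    field
      op      : Elt → Elt
      op-cong : ∀ {f g} → f ≃ g → op f ≃ op g
      op-+    : ∀ f g → op (λ a b → f a b ℚ.+ g a b) ≃ (λ a b → op f a b ℚ.+ op g a b)
      op-·    : ∀ c f → op (λ a b → c ℚ.* f a b) ≃ (λ a b → c ℚ.* op f a b)
      op-F    : ∀ d {f} → Vanish d f → Vanish d (op f)
  open Endo public

  infix 4 _≋_
  record _≋_ (S T : Endo) : Set where
    constructor pointwise
    field at : ∀ f → op S f ≃ op T f
  open _≋_ public

  private
    lem+ : ∀ w x y z → (w ℚ.+ x) ℚ.+ (y ℚ.+ z) ≡ (w ℚ.+ y) ℚ.+ (x ℚ.+ z)
    lem+ = solve-∀ ℚring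
    lem : ∀ c d x → c ℚ.* (d ℚ.* x) ≡ d ℚ.* (c ℚ.* x)
    lem = solve-∀ ℚring

  infixl 6 _⊞_
  infixl 7 _⊡_
  infix 8 ⊟_
  infixr 8 _∙_

  _⊞_ : Endo → Endo → Endo
  op (S ⊞ T) = λ f a b → op S f a b ℚ.+ op T f a b
  op-cong (S ⊞ T) = λ e a b p → cong₂ ℚ._+_ (op-cong S e a b p) (op-cong T e a b p)
  op-+ (S ⊞ T) = λ f g a b p → trans (cong₂ ℚ._+_ (op-+ S f g a b p) (op-+ T f g a b p)) (lem+ (op S f a b) (op S g a b) (op T f a b) (op T g a b))
  op-· (S ⊞ T) = λ c f a b p → trans (cong₂ ℚ._+_ (op-· S c f a b p) (op-· T c f a b p)) (sym (ℚₚ.*-distribˡ-+ c (op S f a b) (op T f a b)))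
  op-F (S ⊞ T) = λ d v a b p q → trans (cong₂ ℚ._+_ (op-F S d v a b p q) (op-F T d v a b p q)) refl

  _⊡_ : Endo → Endo → Endo
  op (S ⊡ T) = λ f → op S (op T f)
  op-cong (S ⊡ T) = λ e → op-cong S (op-cong T e)
  op-+ (S ⊡ T) = λ f g a b p → trans (op-cong S (op-+ T f g) a b p) (op-+ S (op T f) (op T g) a b p)
  op-· (S ⊡ T) = λ c f a b p → trans (op-cong S (op-· T c f) a b p) (op-· S c (op T f) a b p)
  op-F (S ⊡ T) = λ d v → op-F S d (op-F T d v)

  ⊟_ : Endo → Endo
  op (⊟ S) = λ f a b → ℚ.- op S f a b
  op-cong (⊟ S) = λ e a b p → cong ℚ.-_ (op-cong S e a b p)
  op-+ (⊟ S) = λ f g a b p → trans (cong ℚ.-_ (op-+ S f g a b p)) (ℚₚ.neg-distrib-+ (op S f a b) (op S g a b))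
  op-· (⊟ S) = λ c f a b p → trans (cong ℚ.-_ (op-· S c f a b p)) (ℚₚ.neg-distribʳ-* c (op S f a b))
  op-F (⊟ S) = λ d v a b p q → trans (cong ℚ.-_ (op-F S d v a b p q)) refl

  𝟘 : Endo
  op 𝟘 = λ f a b → 0ℚ
  op-cong 𝟘 = λ _ _ _ _ → refl
  op-+ 𝟘 = λ _ _ _ _ _ → refl
  op-· 𝟘 = λ c f a b p → sym (ℚₚ.*-zeroʳ c)
  op-F 𝟘 = λ _ _ _ _ _ _ → refl

  𝟙 : Endo
  op 𝟙 = λ f → f
  op-cong 𝟙 = λ e → e
  op-+ 𝟙 = λ _ _ _ _ _ → refl
  op-· 𝟙 = λ _ _ _ _ _ → refl
  op-F 𝟙 = λ _ v → v

  _∙_ : ℚ → Endo → Endo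
  op (c ∙ S) = λ f a b → c ℚ.* op S f a b
  op-cong (c ∙ S) = λ e a b p → cong (c ℚ.*_) (op-cong S e a b p)
  op-+ (c ∙ S) = λ f g a b p → trans (cong (c ℚ.*_) (op-+ S f g a b p)) (ℚₚ.*-distribˡ-+ c (op S f a b) (op S g a b))
  op-· (c ∙ S) = λ d f a b p → trans (cong (c ℚ.*_) (op-· S d f a b p)) (lem c d (op S f a b))
  op-F (c ∙ S) = λ d v a b p q → trans (cong (c ℚ.*_) (op-F S d v a b p q)) (ℚₚ.*-zeroʳ c)

  endoRing : Ring 0ℓ 0ℓ
  endoRing = record
    { Carrier = Endo ; _≈_ = _≋_
    ; _+_ = _⊞_
    ; _*_ = _⊡_
    ; -_ = ⊟_
    ; 0# = 𝟘
    ; 1# = 𝟙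
    ; isRing = record
      { +-isAbelianGroup = record
        { isGroup = record
          { isMonoid = record
            { isSemigroup = record
              { isMagma = record
                { isEquivalence = record
                  { refl = pointwise λ _ _ _ _ → refl ; sym = λ e → pointwise λ f a b p → sym (at e f a b p)
                  ; trans = λ e e′ → pointwise λ f a b p → trans (at e f a b p) (at e′ f a b p) }
                ; ∙-cong = λ e e′ → pointwise λ f a b p → cong₂ ℚ._+_ (at e f a b p) (at e′ f a b p) }
              ; assoc = λ S T U → pointwise λ f a b p → ℚₚ.+-assoc (op S f a b) (op T f a b) (op U f a b) }
            ; identity = (λ S → pointwise λ f a b p → ℚₚ.+-identityˡ (op S f a b)) , (λ S → pointwise λ f a b p → ℚₚ.+-identityʳ (op S f a b)) }
          ; inverse = (λ S → pointwise λ f a b p → ℚₚ.+-inverseˡ (op S f a b)) , (λ S → pointwise λ f a b p → ℚₚ.+-inverseʳ (op S f a b))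
          ; ⁻¹-cong = λ e → pointwise λ f a b p → cong ℚ.-_ (at e f a b p) }
        ; comm = λ S T → pointwise λ f a b p → ℚₚ.+-comm (op S f a b) (op T f a b) }
      ; *-cong = λ {S} {S′} {T} {T′} e e′ → pointwise λ f a b p → trans (op-cong S (at e′ f) a b p) (at e (op T′ f) a b p)
      ; *-assoc = λ _ _ _ → pointwise λ _ _ _ _ → refl
      ; *-identity = (λ _ → pointwise λ _ _ _ _ → refl) , (λ _ → pointwise λ _ _ _ _ → refl)
      ; distrib = (λ S T U → pointwise λ f a b p → op-+ S (op T f) (op U f) a b p) , (λ S T U → pointwise λ f a b p → refl) } }

  endoAlgebra : QAlgebra
  endoAlgebra = record
    { ring = endoRing
    ; _·_ = _∙_
    ; ·-cong = λ c e → pointwise λ f a b p → cong (c ℚ.*_) (at e f a b p)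
    ; ·-distˡ = λ c S T → pointwise λ f a b p → ℚₚ.*-distribˡ-+ c (op S f a b) (op T f a b)
    ; ·-distʳ = λ c d S → pointwise λ f a b p → ℚₚ.*-distribʳ-+ (op S f a b) c d
    ; ·-assoc = λ c d S → pointwise λ f a b p → ℚₚ.*-assoc c d (op S f a b)
    ; ·-1 = λ S → pointwise λ f a b p → ℚₚ.*-identityˡ (op S f a b)
    ; ·-*ˡ = λ _ _ _ → pointwise λ _ _ _ _ → refl
    ; ·-*ʳ = λ c S T → pointwise λ f a b p → sym (op-· S c (op T f) a b p) }

  endo : FilteredAlgebra K
  endo = record
    { algebra = endoAlgebra
    ; filtration = record
      { F = λ k S → ∀ d {f} → Vanish d f → Vanish (k ℕ.+ d) (op S f)
      ; F-cong = λ e p d {f} v a b q r → trans (sym (at e f a b r)) (p d v a b q r)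
      ; F-0 = λ S d v → op-F S d v
      ; F-+ = λ p q d v a b r s → trans (cong₂ ℚ._+_ (p d v a b r s) (q d v a b r s)) refl
      ; F-neg = λ p d v a b r s → trans (cong ℚ.-_ (p d v a b r s)) refl
      ; F-· = λ c p d v a b r s → trans (cong (c ℚ.*_) (p d v a b r s)) (ℚₚ.*-zeroʳ c)
      ; F-zero = λ _ _ _ _ _ _ _ → refl
      ; F-top = λ {k} K≤k p → pointwise λ f a b q → p 0 {f} (λ _ _ ()) a b (ℕₚ.<-≤-trans q (ℕₚ.≤-trans K≤k (ℕₚ.m≤m+n k 0))) q }
    ; F-* = λ {i} {j} {S} {T} p q d {f} v → ≡.subst (λ m → Vanish m (op S (op T f))) (sym (ℕₚ.+-assoc i j d)) (p (j ℕ.+ d) (q d v)) }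

private
  -- For n = (I, J), n′ = (I′, J′) and v = (W, V) + (K, L) this is {n,n′} {n+n′,v} = {n,n′+v} {n′,v}
  -- - {n′,n+v} {n,v}, with each form written at its target exponent as in `ρop`.
  jacobi : ∀ I J I′ J′ K L W V X Y f →
    ((J ℚ.+ J′) ℚ.* (W ℚ.+ ((I ℚ.+ I′) ℚ.+ K)) ℚ.- (I ℚ.+ I′) ℚ.* (V ℚ.+ ((J ℚ.+ J′) ℚ.+ L))) ℚ.* f ℚ.* ((J ℚ.* I′ ℚ.- I ℚ.* J′) ℚ.* (X ℚ.* Y)) ≡
    (J ℚ.* (W ℚ.+ ((I ℚ.+ I′) ℚ.+ K)) ℚ.- I ℚ.* (V ℚ.+ ((J ℚ.+ J′) ℚ.+ L))) ℚ.* X ℚ.* ((J′ ℚ.* (W ℚ.+ (I′ ℚ.+ K)) ℚ.- I′ ℚ.* (V ℚ.+ (J′ ℚ.+ L))) ℚ.* (Y ℚ.* f))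
    ℚ.+ ℚ.- ((J′ ℚ.* (W ℚ.+ ((I′ ℚ.+ I) ℚ.+ K)) ℚ.- I′ ℚ.* (V ℚ.+ ((J′ ℚ.+ J) ℚ.+ L))) ℚ.* Y ℚ.* ((J ℚ.* (W ℚ.+ (I ℚ.+ K)) ℚ.- I ℚ.* (V ℚ.+ (J ℚ.+ L))) ℚ.* (X ℚ.* f)))
  jacobi = solve-∀ ℚring

module Action {K l : ℕ} (K≡ : K ≡ suc l) (w₁ w₂ : ℕ) where
  open Truncated K public
  open FilteredAlgebra endo public
  open Exp K≡ endo public
  private
    module B = BCH K≡ endo
    module L = ListSums +-commutativeMonoid

  pw : ℕ → ℕ → ℕ → ℕ → ℚ
  pw i j a b = pr i j (w₁ ℕ.+ a) (w₂ ℕ.+ b)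

  -- The action of X on y^w f in terms of coefficients. The form is evaluated at the target (a, b)
  -- instead of the source (i′, j′); the two agree because {n, n} = 0.
  ρop : Elt → Elt → Elt
  ρop X f a b = D2 (λ i j i′ j′ → pw i j a b ℚ.* (X i j ℚ.* f i′ j′)) a b

  private
    le : ∀ {i j i′ j′ a b} → i ℕ.+ i′ ≡ a → j ℕ.+ j′ ≡ b → i′ ℕ.+ j′ ≤ a ℕ.+ b
    le {i} {j} {i′} {j′} refl refl = ℕₚ.+-mono-≤ (ℕₚ.m≤n+m i′ i) (ℕₚ.m≤n+m j′ j)

    le′ : ∀ {i j i′ j′ a b} → i ℕ.+ i′ ≡ a → j ℕ.+ j′ ≡ b → i ℕ.+ j ≤ a ℕ.+ b
    le′ {i} {j} {i′} {j′} refl refl = ℕₚ.+-mono-≤ (ℕₚ.m≤m+n i i′) (ℕₚ.m≤m+n j j′)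

    zero-left : ∀ {i j i′ j′ a b} → i ℕ.+ i′ ≡ a → j ℕ.+ j′ ≡ b → a ℕ.+ b ≤ i′ ℕ.+ j′ → (i ≡ 0) × (j ≡ 0)
    zero-left {i} {j} {i′} {j′} refl refl p = ℕₚ.m+n≡0⇒m≡0 i i+j≡0 , ℕₚ.m+n≡0⇒n≡0 i i+j≡0
      where
      swap4 : (i ℕ.+ i′) ℕ.+ (j ℕ.+ j′) ≡ (i ℕ.+ j) ℕ.+ (i′ ℕ.+ j′)
      swap4 = R+.+-interchange i i′ j j′
        where module R+ = Sums ℕₚ.+-0-commutativeMonoid
      i+j≡0 : i ℕ.+ j ≡ 0
      i+j≡0 = ℕₚ.n≤0⇒n≡0 (ℕₚ.+-cancelʳ-≤ (i′ ℕ.+ j′) (i ℕ.+ j) 0 (≡.subst (_≤ i′ ℕ.+ j′) swap4 p))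

  -- Only the index (0, 0) of X would fail to raise the degree, and its coefficient, which carries
  -- no meaning, is multiplied by {0, v} = 0.
  ρ-raises : ∀ X d {f} → Vanish d f → Vanish (suc d) (ρop X f)
  ρ-raises X d {f} v a b (s≤s p) q = D2-zero a b term
    where
    term : ∀ i j i′ j′ → i ℕ.+ i′ ≡ a → j ℕ.+ j′ ≡ b → pw i j a b ℚ.* (X i j ℚ.* f i′ j′) ≡ 0ℚ
    term i j i′ j′ e e′ with i′ ℕ.+ j′ ℕ.<? d
    ... | yes lt = trans (cong (λ z → pw i j a b ℚ.* (X i j ℚ.* z)) (v i′ j′ lt (ℕₚ.≤-<-trans (le {i} {j} e e′) q)))
                     (trans (cong (pw i j a b ℚ.*_) (ℚₚ.*-zeroʳ (X i j))) (ℚₚ.*-zeroʳ (pw i j a b)))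
    ... | no nlt with zero-left {i} {j} e e′ (ℕₚ.≤-trans p (ℕₚ.≮⇒≥ nlt))
    ...   | refl , refl = trans (cong (ℚ._* (X 0 0 ℚ.* f i′ j′)) (pr-00 (w₁ ℕ.+ a) (w₂ ℕ.+ b))) (ℚₚ.*-zeroˡ (X 0 0 ℚ.* f i′ j′))

  private
    ρ-lem+ : ∀ p x f g → p ℚ.* (x ℚ.* (f ℚ.+ g)) ≡ p ℚ.* (x ℚ.* f) ℚ.+ p ℚ.* (x ℚ.* g)
    ρ-lem+ = solve-∀ ℚring
    ρ-lem· : ∀ c p x f → p ℚ.* (x ℚ.* (c ℚ.* f)) ≡ c ℚ.* (p ℚ.* (x ℚ.* f))
    ρ-lem· = solve-∀ ℚring

  ρ : Elt → Endo
  op (ρ X) = ρop X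
  op-cong (ρ X) {f} {g} e a b p = D2-cong a b (λ i j i′ j′ q q′ →
        cong (λ z → pw i j a b ℚ.* (X i j ℚ.* z)) (e i′ j′ (ℕₚ.≤-<-trans (le {i} {j} q q′) p)))
  op-+ (ρ X) = λ f g a b p → trans (D2-cong a b (λ i j i′ j′ _ _ → ρ-lem+ (pw i j a b) (X i j) (f i′ j′) (g i′ j′))) (D2-+ a b _ _)
  op-· (ρ X) = λ c f a b p → trans (D2-cong a b (λ i j i′ j′ _ _ → ρ-lem· c (pw i j a b) (X i j) (f i′ j′))) (sym (D2-*ˡ a b c _))
  op-F (ρ X) = λ d v a b p q → ρ-raises X d v a b (ℕₚ.m<n⇒m<1+n p) q

  ρ-F : ∀ X → F 1 (ρ X)
  ρ-F X d v = ρ-raises X d v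

  ρ-cong : ∀ {X Y} → (∀ a b → 1 ≤ a ℕ.+ b → a ℕ.+ b < K → X a b ≡ Y a b) → ρ X ≈ ρ Y
  ρ-cong {X} {Y} e = pointwise λ f a b p → D2-cong a b (term f a b p)
    where
    term : ∀ f a b → a ℕ.+ b < K → ∀ i j i′ j′ → i ℕ.+ i′ ≡ a → j ℕ.+ j′ ≡ b → pw i j a b ℚ.* (X i j ℚ.* f i′ j′) ≡ pw i j a b ℚ.* (Y i j ℚ.* f i′ j′)
    term f a b p zero zero i′ j′ _ _ = trans (cong (ℚ._* (X 0 0 ℚ.* f i′ j′)) (pr-00 (w₁ ℕ.+ a) (w₂ ℕ.+ b))) (trans (ℚₚ.*-zeroˡ (X 0 0 ℚ.* f i′ j′))
       (sym (trans (cong (ℚ._* (Y 0 0 ℚ.* f i′ j′)) (pr-00 (w₁ ℕ.+ a) (w₂ ℕ.+ b))) (ℚₚ.*-zeroˡ (Y 0 0 ℚ.* f i′ j′)))))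
    term f a b p zero (suc j) i′ j′ q q′ = cong (λ z → pw 0 (suc j) a b ℚ.* (z ℚ.* f i′ j′)) (e 0 (suc j) (s≤s z≤n) (ℕₚ.≤-<-trans (le′ {0} {suc j} q q′) p))
    term f a b p (suc i) j i′ j′ q q′ = cong (λ z → pw (suc i) j a b ℚ.* (z ℚ.* f i′ j′)) (e (suc i) j (s≤s z≤n) (ℕₚ.≤-<-trans (le′ {suc i} {j} q q′) p))

  ρ-+ : ∀ X Y → ρ (λ a b → X a b ℚ.+ Y a b) ≈ ρ X + ρ Y
  ρ-+ X Y = pointwise λ f a b p → trans (D2-cong a b (λ i j i′ j′ _ _ → lem (pw i j a b) (X i j) (Y i j) (f i′ j′))) (D2-+ a b _ _)
    where lem : ∀ p x y f → p ℚ.* ((x ℚ.+ y) ℚ.* f) ≡ p ℚ.* (x ℚ.* f) ℚ.+ p ℚ.* (y ℚ.* f)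
          lem = solve-∀ ℚring

  ρ-· : ∀ c X → ρ (λ a b → c ℚ.* X a b) ≈ c · ρ X
  ρ-· c X = pointwise λ f a b p → trans (D2-cong a b (λ i j i′ j′ _ _ → lem c (pw i j a b) (X i j) (f i′ j′))) (sym (D2-*ˡ a b c _))
    where lem : ∀ c p x f → p ℚ.* ((c ℚ.* x) ℚ.* f) ≡ c ℚ.* (p ℚ.* (x ℚ.* f))
          lem = solve-∀ ℚring

  ρ-0 : ρ zeroElt ≈ 0#
  ρ-0 = pointwise λ f a b p → D2-zero a b (λ i j i′ j′ _ _ → lem (pw i j a b) (f i′ j′))
    where lem : ∀ p f → p ℚ.* (0ℚ ℚ.* f) ≡ 0ℚ
          lem = solve-∀ ℚring

  -- `D2-assoc` writes both composites as sums over the same triples of indices, after a flip of the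
  -- inner pair in the second one. There the claim is `jacobi`.
  ρ-bracket : ∀ X Y → ρ (bracket X Y) ≈ ad (ρ X) (ρ Y)
  ρ-bracket X Y = pointwise λ f a b p → ρ-bracket-at f a b
    where
    ρ-bracket-at : ∀ f a b → ρop (bracket X Y) f a b ≡ ρop X (ρop Y f) a b ℚ.+ ℚ.- ρop Y (ρop X f) a b
    ρ-bracket-at f a b = trans lhs (trans (D2-cong a b (λ s t k k′ q q′ → trans (D2-cong s t (λ i j i′ j′ r r′ → jacobi-at i j i′ j′ k k′))
      (trans (D2-+ s t _ _) (cong (D2 (λ i j i′ j′ → G X Y i j i′ j′ k k′) s t ℚ.+_) (sym (D2-neg s t _))))))
      (trans (D2-+ a b _ _) (cong₂ ℚ._+_ (sym (double X Y)) (trans (sym (D2-neg a b _)) (cong ℚ.-_ (sym (trans (double Y X)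
         (D2-cong a b (λ s t k k′ _ _ → D2-flip s t _)))))))))
      where
      D2-neg : ∀ a b F → ℚ.- D2 F a b ≡ D2 (λ i j i′ j′ → ℚ.- F i j i′ j′) a b
      D2-neg a b F = trans (SumHom.hom-diag ℚ⁺ ℚ⁺ ℚ.-_ refl ℚₚ.neg-distrib-+ a _) (R.diag-cong a (λ i i′ _ → SumHom.hom-diag ℚ⁺ ℚ⁺ ℚ.-_ refl ℚₚ.neg-distrib-+ b _))
      G : Elt → Elt → ℕ → ℕ → ℕ → ℕ → ℕ → ℕ → ℚ
      G X Y i j i′ j′ k k′ = pw i j ((i ℕ.+ i′) ℕ.+ k) ((j ℕ.+ j′) ℕ.+ k′) ℚ.* X i j ℚ.* (pw i′ j′ (i′ ℕ.+ k) (j′ ℕ.+ k′) ℚ.* (Y i′ j′ ℚ.* f k k′))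
      H : ℕ → ℕ → ℕ → ℕ → ℕ → ℕ → ℚ
      H i j i′ j′ k k′ = pw (i ℕ.+ i′) (j ℕ.+ j′) ((i ℕ.+ i′) ℕ.+ k) ((j ℕ.+ j′) ℕ.+ k′) ℚ.* f k k′ ℚ.* (pr i j i′ j′ ℚ.* (X i j ℚ.* Y i′ j′))
      lhs : ρop (bracket X Y) f a b ≡ D2 (λ s t k k′ → D2 (λ i j i′ j′ → H i j i′ j′ k k′) s t) a b
      lhs = D2-cong a b (λ { s t k k′ refl refl → trans (cong (λ z → pw s t (s ℕ.+ k) (t ℕ.+ k′) ℚ.* (z ℚ.* f k k′)) (bracket-D2 X Y s t))
        (trans (lem (pw s t (s ℕ.+ k) (t ℕ.+ k′)) (D2 (λ i j i′ j′ → pr i j i′ j′ ℚ.* (X i j ℚ.* Y i′ j′)) s t) (f k k′)) (trans (D2-*ˡ s t (pw s t (s ℕ.+ k) (t ℕ.+ k′) ℚ.* f k k′) (λ i j i′ j′ → pr i j i′ j′ ℚ.* (X i j ℚ.* Y i′ j′))) (D2-cong s t (λ { i j i′ j′ refl refl → refl })))) })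
        where lem : ∀ p z f → p ℚ.* (z ℚ.* f) ≡ p ℚ.* f ℚ.* z
              lem = solve-∀ ℚring
      double : ∀ X Y → ρop X (ρop Y f) a b ≡ D2 (λ s t k k′ → D2 (λ i j i′ j′ → G X Y i j i′ j′ k k′) s t) a b
      double X Y = trans (D2-cong a b (λ { i j s t refl refl → trans (sym (ℚₚ.*-assoc (pw i j (i ℕ.+ s) (j ℕ.+ t)) (X i j) _)) (trans (D2-*ˡ s t (pw i j (i ℕ.+ s) (j ℕ.+ t) ℚ.* X i j) (λ i′ j′ k k′ → pw i′ j′ s t ℚ.* (Y i′ j′ ℚ.* f k k′)))
        (D2-cong s t (λ { i′ j′ k k′ refl refl → cong₂ (λ u v → pw i j u v ℚ.* X i j ℚ.* (pw i′ j′ (i′ ℕ.+ k) (j′ ℕ.+ k′) ℚ.* (Y i′ j′ ℚ.* f k k′)))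
          (sym (ℕₚ.+-assoc i i′ k)) (sym (ℕₚ.+-assoc j j′ k′)) }))) }))
        (sym (D2-assoc a b (λ i j i′ j′ k k′ → G X Y i j i′ j′ k k′)))
      ι3 : ∀ w i i′ k → ι (w ℕ.+ ((i ℕ.+ i′) ℕ.+ k)) ≡ ι w ℚ.+ ((ι i ℚ.+ ι i′) ℚ.+ ι k)
      ι3 w i i′ k = trans (ι-+ w _) (cong (ι w ℚ.+_) (trans (ι-+ (i ℕ.+ i′) k) (cong (ℚ._+ ι k) (ι-+ i i′))))
      ι2 : ∀ w i k → ι (w ℕ.+ (i ℕ.+ k)) ≡ ι w ℚ.+ (ι i ℚ.+ ι k)
      ι2 w i k = trans (ι-+ w _) (cong (ι w ℚ.+_) (ι-+ i k))
      jacobi-at : ∀ i j i′ j′ k k′ → H i j i′ j′ k k′ ≡ G X Y i j i′ j′ k k′ ℚ.+ ℚ.- G Y X i′ j′ i j k k′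
      jacobi-at i j i′ j′ k k′
        rewrite ι3 w₁ i i′ k | ι3 w₂ j j′ k′ | ι3 w₁ i′ i k | ι3 w₂ j′ j k′ | ι2 w₁ i k | ι2 w₂ j k′ | ι2 w₁ i′ k | ι2 w₂ j′ k′
              | ι-+ i i′ | ι-+ j j′
        = jacobi (ι i) (ι j) (ι i′) (ι j′) (ι k) (ι k′) (ι w₁) (ι w₂) (X i j) (Y i′ j′) (f k k′)

  ρ-sum : ∀ n (X : ℕ → Elt) → ρ (λ a b → R.sum n (λ k → X k a b)) ≈ sum n (λ k → ρ (X k))
  ρ-sum zero    X = ρ-0
  ρ-sum (suc n) X = ≈-trans (ρ-+ (X 0) (λ a b → R.sum n (λ k → X (suc k) a b))) (+-cong ≈-refl (ρ-sum n (λ k → X (suc k))))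

  ρ-sumL : ∀ {I : Set} (is : List I) (X : I → Elt) → ρ (λ a b → RL.sumL is (λ i → X i a b)) ≈ L.sumL is (λ i → ρ (X i))
  ρ-sumL []       X = ρ-0
  ρ-sumL (i ∷ is) X = ≈-trans (ρ-+ (X i) (λ a b → RL.sumL is (λ i → X i a b))) (+-cong ≈-refl (ρ-sumL is X))

  ρ-nest : ∀ Zs → ρ (nest Zs) ≈ B.nestᴬ (map ρ Zs)
  ρ-nest []           = ρ-0
  ρ-nest (Z ∷ [])     = ≈-refl
  ρ-nest (Z ∷ W ∷ Zs) = ≈-trans (ρ-bracket Z (nest (W ∷ Zs))) (ad-cong ≈-refl (ρ-nest (W ∷ Zs)))

  map-ρ-word : ∀ X Y σ → map ρ (word X Y σ) ≡ B.wordᴬ (ρ X) (ρ Y) σ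
  map-ρ-word X Y []            = refl
  map-ρ-word X Y ((r , s) ∷ σ) = trans (Listₚ.map-++ ρ (replicate r X ++ replicate s Y) (word X Y σ))
    (cong₂ _++_ (trans (Listₚ.map-++ ρ (replicate r X) (replicate s Y)) (cong₂ _++_ (Listₚ.map-replicate ρ r X) (Listₚ.map-replicate ρ s Y)))
                (map-ρ-word X Y σ))

-- The form vanishes when one argument is (0, 0), so both factors of a bracket contribute from
-- positive degree only. A nested bracket of r elements therefore starts in degree r.
nest-small : ∀ Zs a b → 1 ≤ a ℕ.+ b → a ℕ.+ b < length Zs → nest Zs a b ≡ 0ℚ
nest-small [] a b p ()
nest-small (Z ∷ []) a b p q = ⊥-elim (ℕₚ.<⇒≱ q p)
nest-small (Z ∷ W ∷ Zs) a b p (s≤s q) = trans (bracket-D2 Z (nest (W ∷ Zs)) a b) (D2-zero a b (term (nest-small (W ∷ Zs))))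
  where
  N = nest (W ∷ Zs)
  term : (∀ a b → 1 ≤ a ℕ.+ b → a ℕ.+ b < length (W ∷ Zs) → N a b ≡ 0ℚ) → ∀ i j i′ j′ → i ℕ.+ i′ ≡ a → j ℕ.+ j′ ≡ b → pr i j i′ j′ ℚ.* (Z i j ℚ.* N i′ j′) ≡ 0ℚ
  term ih i j i′ j′ e e′ with i ℕ.+ j in eq | i′ ℕ.+ j′ in eq′
  ... | zero | _ with ℕₚ.m+n≡0⇒m≡0 i eq | ℕₚ.m+n≡0⇒n≡0 i eq
  ...   | refl | refl = trans (cong (ℚ._* (Z 0 0 ℚ.* N i′ j′)) (pr-00 i′ j′)) (ℚₚ.*-zeroˡ (Z 0 0 ℚ.* N i′ j′))
  term ih i j i′ j′ e e′ | suc _ | zero with ℕₚ.m+n≡0⇒m≡0 i′ eq′ | ℕₚ.m+n≡0⇒n≡0 i′ eq′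
  ...   | refl | refl = trans (cong (ℚ._* (Z i j ℚ.* N 0 0)) (pr-00ʳ i j)) (ℚₚ.*-zeroˡ (Z i j ℚ.* N 0 0))
  term ih i j i′ j′ refl refl | suc u | suc v = trans (cong (λ z → pr i j i′ j′ ℚ.* (Z i j ℚ.* z)) small)
    (trans (cong (pr i j i′ j′ ℚ.*_) (ℚₚ.*-zeroʳ (Z i j))) (ℚₚ.*-zeroʳ (pr i j i′ j′)))
    where
    total≡ : (i ℕ.+ i′) ℕ.+ (j ℕ.+ j′) ≡ suc u ℕ.+ suc v
    total≡ = trans (Sums.+-interchange ℕₚ.+-0-commutativeMonoid i i′ j j′) (cong₂ ℕ._+_ eq eq′)
    small : N i′ j′ ≡ 0ℚ
    small = ih i′ j′ (ℕₚ.≤-trans (s≤s z≤n) (ℕₚ.≤-reflexive (sym eq′)))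
      (ℕₚ.<-≤-trans (≡.subst (_< (i ℕ.+ i′) ℕ.+ (j ℕ.+ j′)) (sym eq′) (≡.subst (suc v <_) (sym total≡) (ℕₚ.m<n+m (suc v) (s≤s z≤n)))) q)

sumL-seqs-zero : ∀ d k (h : List (ℕ × ℕ) → ℚ) → (∀ σ → length σ ≡ k → h σ ≡ 0ℚ) → RL.sumL (seqs d k) h ≡ 0ℚ
sumL-seqs-zero d zero    h e = trans (cong (ℚ._+ 0ℚ) (e [] refl)) refl
sumL-seqs-zero d (suc k) h e = trans (RL.sumL-seqs d k h)
  (RL.sumL-zero (grid d) (λ p → sumL-seqs-zero d k (λ σ → h (p ∷ σ)) (λ σ q → e (p ∷ σ) (cong suc q))))

sumL-seqs-extend : ∀ {d l} → d ≤ l → ∀ k (h : List (ℕ × ℕ) → ℚ) → (∀ σ → d < total σ → h σ ≡ 0ℚ) →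
  RL.sumL (seqs l k) h ≡ RL.sumL (seqs d k) h
sumL-seqs-extend         d≤l zero    h e = refl
sumL-seqs-extend {d} {l} d≤l (suc k) h e = begin
  RL.sumL (seqs l (suc k)) h
    ≡⟨ trans (RL.sumL-seqs l k h) (RL.sumL-grid l (H l)) ⟩
  R.sum (suc l) (λ r → R.sum (suc l) (λ s → H l (r , s)))
    ≡⟨ R.sum-extend (λ r → R.sum (suc l) (λ s → H l (r , s))) (s≤s d≤l) (λ r d<r → R.sum-zero (suc l) (λ s _ → vanish (r , s) (ℕₚ.m≤n⇒m≤n+o s d<r))) ⟩
  R.sum (suc d) (λ r → R.sum (suc l) (λ s → H l (r , s)))
    ≡⟨ R.sum-cong (suc d) (λ r _ → R.sum-extend (λ s → H l (r , s)) (s≤s d≤l) (λ s d<s → vanish (r , s) (ℕₚ.m≤n⇒m≤o+n r d<s))) ⟩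
  R.sum (suc d) (λ r → R.sum (suc d) (λ s → H l (r , s)))
    ≡⟨ R.sum-cong (suc d) (λ r _ → R.sum-cong (suc d) (λ s _ → sumL-seqs-extend d≤l k _
         (λ σ p → e ((r , s) ∷ σ) (ℕₚ.<-≤-trans p (ℕₚ.m≤n+m (total σ) (r ℕ.+ s)))))) ⟩
  R.sum (suc d) (λ r → R.sum (suc d) (λ s → H d (r , s)))
    ≡⟨ sym (trans (RL.sumL-seqs d k h) (RL.sumL-grid d (H d))) ⟩
  RL.sumL (seqs d (suc k)) h ∎
  where
  open ≡.≡-Reasoning
  H : ℕ → ℕ × ℕ → ℚ
  H m p = RL.sumL (seqs m k) (λ σ → h (p ∷ σ))
  vanish : ∀ p → d < deg p → H l p ≡ 0ℚ
  vanish p q = RL.sumL-zero (seqs l k) (λ σ → e (p ∷ σ) (ℕₚ.<-≤-trans q (ℕₚ.m≤m+n (deg p) (total σ))))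

length-word : ∀ X Y σ → length (word X Y σ) ≡ total σ
length-word X Y []            = refl
length-word X Y ((r , s) ∷ σ) = trans (Listₚ.length-++ (replicate r X ++ replicate s Y)) (cong₂ ℕ._+_
  (trans (Listₚ.length-++ (replicate r X)) (cong₂ ℕ._+_ (Listₚ.length-replicate r) (Listₚ.length-replicate s))) (length-word X Y σ))

length≤total : ∀ σ → nonZero σ ≡ true → length σ ≤ total σ
length≤total []                  _  = z≤n
length≤total ((zero  , zero)  ∷ σ) ()
length≤total ((zero  , suc s) ∷ σ) nz = s≤s (ℕₚ.≤-trans (length≤total σ nz) (ℕₚ.m≤n+m _ s))
length≤total ((suc r , s)     ∷ σ) nz = s≤s (ℕₚ.≤-trans (length≤total σ nz) (ℕₚ.m≤n+m _ (r ℕ.+ s)))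

module _ (X Y : Elt) where
  dynkinTerm : ℕ → ℕ → List (ℕ × ℕ) → Elt
  dynkinTerm l k σ a b = if valid l σ then dynkinCoeff k σ ℚ.* nest (word X Y σ) a b else 0ℚ

  -- `bch` cuts Dynkin's sum at the degree of the coefficient computed, while `dynkin` uses one
  -- bound l for all coefficients. The difference consists of words longer than a + b, killed by
  -- `nest-small`; more than a + b blocks also force such a word, since each block has at least one
  -- letter.
  bch-truncate : ∀ l a b → 1 ≤ a ℕ.+ b → a ℕ.+ b ≤ l →
    bch X Y a b ≡ R.sum l (λ k → RL.sumL (seqs l (suc k)) (λ σ → dynkinTerm l (suc k) σ a b))
  bch-truncate l a b p d≤l = trans (sum1-sum d _) (trans (R.sum-cong d (λ k _ → trans
      (RL.sumL-cong (seqs d (suc k)) (λ σ → agree (suc k) σ))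
      (sym (sumL-seqs-extend d≤l (suc k) (λ σ → dynkinTerm l (suc k) σ a b) (big (suc k))))))
      (sym (R.sum-extend (λ k → RL.sumL (seqs l (suc k)) (λ σ → dynkinTerm l (suc k) σ a b)) d≤l
        (λ k d≤k → sumL-seqs-zero l (suc k) _ (λ σ e → long (suc k) σ (ℕₚ.≤-trans (s≤s d≤k) (ℕₚ.≤-reflexive (sym e))))))))
    where
    d = a ℕ.+ b
    nest-zero : ∀ k σ → d < total σ → dynkinCoeff k σ ℚ.* nest (word X Y σ) a b ≡ 0ℚ
    nest-zero k σ q = trans (cong (dynkinCoeff k σ ℚ.*_) (nest-small (word X Y σ) a b p (≡.subst (d <_) (sym (length-word X Y σ)) q))) (ℚₚ.*-zeroʳ (dynkinCoeff k σ))
    big : ∀ k σ → d < total σ → dynkinTerm l k σ a b ≡ 0ℚ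
    big k σ q with valid l σ
    ... | true  = nest-zero k σ q
    ... | false = refl
    long : ∀ k σ → d < length σ → dynkinTerm l k σ a b ≡ 0ℚ
    long k σ q with nonZero σ in eq | total σ ℕ.≤ᵇ l
    ... | true  | true  = nest-zero k σ (ℕₚ.<-≤-trans q (length≤total σ eq))
    ... | true  | false = refl
    ... | false | _     = refl
    agree : ∀ k σ → dynkinTerm d k σ a b ≡ dynkinTerm l k σ a b
    agree k σ with nonZero σ
    ... | false = refl
    ... | true with total σ ℕ.≤ᵇ d in eq | total σ ℕ.≤ᵇ l in eq′
    ...   | true  | true  = refl
    ...   | false | false = refl
    ...   | false | true  = sym (nest-zero k σ (ℕₚ.≰⇒> (λ q → ≡.subst True eq (ℕₚ.≤⇒≤ᵇ q))))
    ...   | true  | false = ⊥-elim (≡.subst True eq′ (ℕₚ.≤⇒≤ᵇ (ℕₚ.≤-trans (ℕₚ.≤ᵇ⇒≤ (total σ) d (≡.subst True (sym eq) _)) d≤l)))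

module Exponential {K l : ℕ} (K≡ : K ≡ suc l) (w₁ w₂ : ℕ) where
  open Action K≡ w₁ w₂ public
  private
    module B = BCH K≡ endo
    module L = ListSums +-commutativeMonoid

  ρ-bch : ∀ X Y → ρ (bch X Y) ≈ B.dynkin (ρ X) (ρ Y)
  ρ-bch X Y = ≈-trans (ρ-cong (λ a b p q → bch-truncate X Y l a b p (ℕₚ.≤-pred (≡.subst (a ℕ.+ b <_) K≡ q))))
    (≈-trans (ρ-sum l (λ k a b → RL.sumL (seqs l (suc k)) (λ σ → dynkinTerm X Y l (suc k) σ a b)))
    (sum-cong l (λ k _ → ≈-trans (ρ-sumL (seqs l (suc k)) (dynkinTerm X Y l (suc k))) (L.sumL-cong (seqs l (suc k)) (one k)))))
    where
    reflexive : ∀ {S T} → S ≡ T → S ≈ T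
    reflexive refl = ≈-refl
    one : ∀ k σ → ρ (dynkinTerm X Y l (suc k) σ) ≈ (if valid l σ then dynkinCoeff (suc k) σ · B.nestᴬ (B.wordᴬ (ρ X) (ρ Y) σ) else 0#)
    one k σ with valid l σ
    ... | true  = ≈-trans (ρ-· (dynkinCoeff (suc k) σ) (nest (word X Y σ))) (·-cong _ (≈-trans (ρ-nest (word X Y σ)) (reflexive (cong B.nestᴬ (map-ρ-word X Y σ)))))
    ... | false = ρ-0

  Φ : Elt → Endo
  Φ X = exp (ρ X)

  Φ-bch : ∀ X Y → Φ (bch X Y) ≈ Φ X * Φ Y
  Φ-bch X Y = ≈-trans (exp-cong (ρ-bch X Y)) (Specialisation.exp-dynkin K≡ endo (ρ-F X) (ρ-F Y))

  Φ-cong : ∀ {X Y} → (∀ a b → 1 ≤ a ℕ.+ b → a ℕ.+ b < K → X a b ≡ Y a b) → Φ X ≈ Φ Y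
  Φ-cong e = exp-cong (ρ-cong e)

  Φ-0 : Φ zeroElt ≈ 1#
  Φ-0 = ≈-trans (exp-cong ρ-0) (≈-trans (sum-peel K≡ (dp algebra 0#)) (≈-trans (+-cong ≈-refl (sum-zero l (λ k _ → ·-0 _ (zeroˡ _)))) (+-identityʳ _)))

-- Multiplication by y^(p,q) on coefficients, and the action of a dilogarithm element

sh : ℕ → ℕ → Elt → Elt
sh p q f a b = R.shift p (λ a′ → R.shift q (f a′) b) a

sh-at : ∀ p q f a b → sh p q f (p ℕ.+ a) (q ℕ.+ b) ≡ f a b
sh-at p q f a b = trans (R.shift-at p a _) (R.shift-at q b (f a))

data ShView (p q a b : ℕ) : Set where
  inside  : ∀ a′ b′ → p ℕ.+ a′ ≡ a → q ℕ.+ b′ ≡ b → ShView p q a b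
  outside : (∀ f → sh p q f a b ≡ 0ℚ) → ShView p q a b

shView : ∀ p q a b → ShView p q a b
shView p q a b with p ℕ.≤? a | q ℕ.≤? b
... | yes p≤a | yes q≤b = inside (a ∸ p) (b ∸ q) (ℕₚ.m+[n∸m]≡n p≤a) (ℕₚ.m+[n∸m]≡n q≤b)
... | no p≰a  | _       = outside (λ f → R.shift-big p a _ (ℕₚ.≰⇒> p≰a))
... | yes p≤a | no q≰b  = outside (λ f → trans (R.shift-cong p a (λ k _ → R.shift-big q b (f k) (ℕₚ.≰⇒> q≰b))) (shift-zero p a))
  where
  shift-zero : ∀ p a → R.shift p (λ _ → 0ℚ) a ≡ 0ℚ
  shift-zero zero    a       = refl
  shift-zero (suc p) zero    = refl
  shift-zero (suc p) (suc a) = shift-zero p a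

sh-cong : ∀ p q {f g : Elt} a b → (∀ a′ b′ → p ℕ.+ a′ ≡ a → q ℕ.+ b′ ≡ b → f a′ b′ ≡ g a′ b′) → sh p q f a b ≡ sh p q g a b
sh-cong p q a b e = R.shift-cong p a (λ a′ r → R.shift-cong q b (λ b′ s → e a′ b′ r s))

sh-big : ∀ p q f a b → a ℕ.+ b < p ℕ.+ q → sh p q f a b ≡ 0ℚ
sh-big p q f a b lt with shView p q a b
... | outside z = z f
... | inside a′ b′ refl refl = ⊥-elim (ℕₚ.<⇒≱ lt (ℕₚ.+-mono-≤ (ℕₚ.m≤m+n p a′) (ℕₚ.m≤m+n q b′)))

sh-sh : ∀ p q p′ q′ f a b → sh p q (sh p′ q′ f) a b ≡ sh (p ℕ.+ p′) (q ℕ.+ q′) f a b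
sh-sh p q p′ q′ f a b = trans (R.shift-cong p a (λ a′ _ → hom q p′ (λ a″ → R.shift q′ (f a″)) b a′))
  (trans (R.shift-shift p p′ a _) (R.shift-cong (p ℕ.+ p′) a (λ a′ _ → R.shift-shift q q′ b (f a′))))
  where
  hom : ∀ q p′ (g : ℕ → ℕ → ℚ) b a → R.shift q (λ b′ → R.shift p′ (λ a″ → g a″ b′) a) b ≡ R.shift p′ (λ a″ → R.shift q (g a″) b) a
  hom q zero    g b a       = refl
  hom q (suc p) g b (suc a) = hom q p g b a
  hom zero    (suc p) g b zero = refl
  hom (suc q) (suc p) g zero zero = refl
  hom (suc q) (suc p) g (suc b) zero = hom q (suc p) g b zero

sh-linear : ∀ p q c d f g a b → sh p q (λ a b → c ℚ.* f a b ℚ.+ d ℚ.* g a b) a b ≡ c ℚ.* sh p q f a b ℚ.+ d ℚ.* sh p q g a b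
sh-linear p q c d f g a b with shView p q a b
... | inside a′ b′ refl refl = trans (sh-at p q _ a′ b′) (sym (cong₂ (λ x y → c ℚ.* x ℚ.+ d ℚ.* y) (sh-at p q f a′ b′) (sh-at p q g a′ b′)))
... | outside z = trans (z _) (sym (trans (cong₂ (λ x y → c ℚ.* x ℚ.+ d ℚ.* y) (z f) (z g)) (lem c d)))
  where lem : ∀ c d → c ℚ.* 0ℚ ℚ.+ d ℚ.* 0ℚ ≡ 0ℚ
        lem = solve-∀ ℚring

sh-+ : ∀ p q f g a b → sh p q (λ a b → f a b ℚ.+ g a b) a b ≡ sh p q f a b ℚ.+ sh p q g a b
sh-+ p q f g a b = trans (sh-cong p q a b (λ a′ b′ _ _ → lem (f a′ b′) (g a′ b′))) (trans (sh-linear p q 1ℚ 1ℚ f g a b) (sym (lem (sh p q f a b) (sh p q g a b))))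
  where lem : ∀ x y → x ℚ.+ y ≡ 1ℚ ℚ.* x ℚ.+ 1ℚ ℚ.* y
        lem = solve-∀ ℚring

sh-0 : ∀ p q a b → sh p q zeroElt a b ≡ 0ℚ
sh-0 p q a b with shView p q a b
... | inside a′ b′ refl refl = sh-at p q zeroElt a′ b′
... | outside z = z zeroElt

sh-· : ∀ p q c f a b → sh p q (λ a b → c ℚ.* f a b) a b ≡ c ℚ.* sh p q f a b
sh-· p q c f a b with shView p q a b
... | inside a′ b′ refl refl = trans (sh-at p q _ a′ b′) (cong (c ℚ.*_) (sym (sh-at p q f a′ b′)))
... | outside z = trans (z _) (sym (trans (cong (c ℚ.*_) (z f)) (ℚₚ.*-zeroʳ c)))

sh-sum : ∀ p q n (f : ℕ → Elt) a b → sh p q (λ a b → R.sum n (λ k → f k a b)) a b ≡ R.sum n (λ k → sh p q (f k) a b)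
sh-sum p q zero    f a b = sh-0 p q a b
sh-sum p q (suc n) f a b = trans (sh-+ p q (f 0) (λ a b → R.sum n (λ k → f (suc k) a b)) a b) (cong (sh p q (f 0) a b ℚ.+_) (sh-sum p q n (λ k → f (suc k)) a b))

pr-*ˡ : ∀ k p q c d → pr (k ℕ.* p) (k ℕ.* q) c d ≡ ι k ℚ.* pr p q c d
pr-*ˡ k p q c d = trans (cong₂ (λ x y → y ℚ.* ι c ℚ.- x ℚ.* ι d) (ι-* k p) (ι-* k q)) (lem (ι k) (ι p) (ι q) (ι c) (ι d))
  where lem : ∀ k p q c d → (k ℚ.* q) ℚ.* c ℚ.- (k ℚ.* p) ℚ.* d ≡ k ℚ.* (q ℚ.* c ℚ.- p ℚ.* d)
        lem = solve-∀ ℚring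

pr-*ʳ : ∀ k p q c d → pr p q (k ℕ.* c) (k ℕ.* d) ≡ ι k ℚ.* pr p q c d
pr-*ʳ k p q c d = trans (cong₂ (λ x y → ι q ℚ.* x ℚ.- ι p ℚ.* y) (ι-* k c) (ι-* k d)) (lem (ι k) (ι p) (ι q) (ι c) (ι d))
  where lem : ∀ k p q c d → q ℚ.* (k ℚ.* c) ℚ.- p ℚ.* (k ℚ.* d) ≡ k ℚ.* (q ℚ.* c ℚ.- p ℚ.* d)
        lem = solve-∀ ℚring

pr-self : ∀ p q → pr p q p q ≡ 0ℚ
pr-self p q = lem (ι p) (ι q)
  where lem : ∀ p q → q ℚ.* p ℚ.- p ℚ.* q ≡ 0ℚ
        lem = solve-∀ ℚring

private
  degree-multiple : ∀ k p q → 1 ≤ p ℕ.+ q → k ≤ k ℕ.* p ℕ.+ k ℕ.* q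
  degree-multiple k p q 1≤ = ℕₚ.≤-trans (ℕₚ.≤-reflexive (sym (ℕₚ.*-identityʳ k)))
    (ℕₚ.≤-trans (ℕₚ.*-monoʳ-≤ k 1≤) (ℕₚ.≤-reflexive (ℕₚ.*-distribˡ-+ k p q)))

module Dilogarithm {K l : ℕ} (K≡ : K ≡ suc l) (w₁ w₂ : ℕ) where
  open Exponential K≡ w₁ w₂ public

  pw-shift : ∀ r s p q a b → pw r s (p ℕ.+ a) (q ℕ.+ b) ≡ pw r s a b ℚ.+ pr r s p q
  pw-shift r s p q a b = trans (cong₂ (λ x y → ι s ℚ.* x ℚ.- ι r ℚ.* y) (ι3 w₁ p a) (ι3 w₂ q b))
    (trans (lem (ι r) (ι s) (ι w₁) (ι p) (ι a) (ι w₂) (ι q) (ι b)) (sym (cong (ℚ._+ pr r s p q) (cong₂ (λ x y → ι s ℚ.* x ℚ.- ι r ℚ.* y) (ι-+ w₁ a) (ι-+ w₂ b)))))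
    where
    ι3 : ∀ w p a → ι (w ℕ.+ (p ℕ.+ a)) ≡ ι w ℚ.+ (ι p ℚ.+ ι a)
    ι3 w p a = trans (ι-+ w (p ℕ.+ a)) (cong (ι w ℚ.+_) (ι-+ p a))
    lem : ∀ r s w p a v q b → s ℚ.* (w ℚ.+ (p ℚ.+ a)) ℚ.- r ℚ.* (v ℚ.+ (q ℚ.+ b)) ≡ (s ℚ.* (w ℚ.+ a) ℚ.- r ℚ.* (v ℚ.+ b)) ℚ.+ (s ℚ.* p ℚ.- r ℚ.* q)
    lem = solve-∀ ℚring

  -- A position-dependent weight moves past multiplication by y^(p,q) at the cost of {(r,s), (p,q)}.
  -- These corrections are all that distinguishes the two orders of a pair of letters.
  sh-weight : ∀ p q r s (G : ℚ → ℚ) g a b →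
    sh p q (λ a b → G (pw r s a b) ℚ.* g a b) a b ≡ G (pw r s a b ℚ.- pr r s p q) ℚ.* sh p q g a b
  sh-weight p q r s G g a b with shView p q a b
  ... | outside z = trans (z _) (sym (trans (cong (G (pw r s a b ℚ.- pr r s p q) ℚ.*_) (z g)) (ℚₚ.*-zeroʳ (G (pw r s a b ℚ.- pr r s p q)))))
  ... | inside a′ b′ refl refl = trans (sh-at p q _ a′ b′) (cong₂ (λ x y → G x ℚ.* y)
      (trans (lem (pw r s a′ b′) (pr r s p q)) (cong (ℚ._- pr r s p q) (sym (pw-shift r s p q a′ b′)))) (sym (sh-at p q g a′ b′)))
    where lem : ∀ x y → x ≡ (x ℚ.+ y) ℚ.- y
          lem = solve-∀ ℚring

  -- The action of [p , q]^x: y^w ↦ y^w (1 + y^(p,q))^(x {(p,q),w}).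
  K-op : ℕ → ℕ → ℚ → Elt → Elt
  K-op p q x f a b = R.sum K (λ k → bin (x ℚ.* pw p q a b) k ℚ.* sh (k ℕ.* p) (k ℕ.* q) f a b)

  private
    inner : ∀ {P Q a b a′ b′ n} → P ℕ.+ a′ ≡ a → Q ℕ.+ b′ ≡ b → a ℕ.+ b < n → a′ ℕ.+ b′ < n
    inner {P} {Q} {a′ = a′} {b′} refl refl p = ℕₚ.≤-<-trans (ℕₚ.+-mono-≤ (ℕₚ.m≤n+m a′ P) (ℕₚ.m≤n+m b′ Q)) p
    K-lem+ : ∀ c x y → c ℚ.* (x ℚ.+ y) ≡ c ℚ.* x ℚ.+ c ℚ.* y
    K-lem+ = solve-∀ ℚring
    K-lem· : ∀ c d x → c ℚ.* (d ℚ.* x) ≡ d ℚ.* (c ℚ.* x)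
    K-lem· = solve-∀ ℚring

  Kᴱ : ℕ → ℕ → ℚ → Endo
  op (Kᴱ p q x) = K-op p q x
  op-cong (Kᴱ p q x) {f} {g} e a b r = R.sum-cong K (λ k _ → cong (bin (x ℚ.* pw p q a b) k ℚ.*_)
    (sh-cong (k ℕ.* p) (k ℕ.* q) a b (λ a′ b′ s t → e a′ b′ (inner {k ℕ.* p} {k ℕ.* q} s t r))))
  op-+ (Kᴱ p q x) f g a b r = trans (R.sum-cong K (λ k _ → trans (cong (bin (x ℚ.* pw p q a b) k ℚ.*_) (sh-+ (k ℕ.* p) (k ℕ.* q) f g a b))
    (K-lem+ (bin (x ℚ.* pw p q a b) k) (sh (k ℕ.* p) (k ℕ.* q) f a b) (sh (k ℕ.* p) (k ℕ.* q) g a b)))) (R.sum-+ K _ _)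
  op-· (Kᴱ p q x) c f a b r = trans (R.sum-cong K (λ k _ → trans (cong (bin (x ℚ.* pw p q a b) k ℚ.*_) (sh-· (k ℕ.* p) (k ℕ.* q) c f a b))
    (K-lem· (bin (x ℚ.* pw p q a b) k) c (sh (k ℕ.* p) (k ℕ.* q) f a b)))) (sym (R.·-sum c K _))
  op-F (Kᴱ p q x) d {f} v a b r s = R.sum-zero K (λ k _ → trans (cong (bin (x ℚ.* pw p q a b) k ℚ.*_)
    (trans (sh-cong (k ℕ.* p) (k ℕ.* q) a b (λ a′ b′ e e′ → v a′ b′ (inner {k ℕ.* p} {k ℕ.* q} e e′ r) (inner {k ℕ.* p} {k ℕ.* q} e e′ s))) (sh-0 (k ℕ.* p) (k ℕ.* q) a b)))
    (ℚₚ.*-zeroʳ (bin (x ℚ.* pw p q a b) k)))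

  op-sum : ∀ n (S : ℕ → Endo) f a b → op (sum n S) f a b ≡ R.sum n (λ k → op (S k) f a b)
  op-sum zero    S f a b = refl
  op-sum (suc n) S f a b = cong (op (S 0) f a b ℚ.+_) (op-sum n (λ k → S (suc k)) f a b)

  module _ (p q : ℕ) (1≤ : 1 ≤ p ℕ.+ q) (u : ℚ) where
    private
      module S = ScalarSeries K≡
      shk : ℕ → Elt → Elt
      shk k = sh (k ℕ.* p) (k ℕ.* q)

    shk-big : ∀ k f a b → a ℕ.+ b < K → K ≤ k → shk k f a b ≡ 0ℚ
    shk-big k f a b lt K≤k = sh-big (k ℕ.* p) (k ℕ.* q) f a b (ℕₚ.<-≤-trans lt (ℕₚ.≤-trans K≤k (degree-multiple k p q 1≤)))

    evS : (ℕ → ℚ) → Elt → Elt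
    evS c f a b = R.sum K (λ j → c j ℚ.* shk j f a b)

    shk-shk : ∀ i j f a b → shk i (shk j f) a b ≡ shk (i ℕ.+ j) f a b
    shk-shk i j f a b = trans (sh-sh (i ℕ.* p) (i ℕ.* q) (j ℕ.* p) (j ℕ.* q) f a b)
      (cong₂ (λ x y → sh x y f a b) (sym (ℕₚ.*-distribʳ-+ p i j)) (sym (ℕₚ.*-distribʳ-+ q i j)))

    evS-⊛ : ∀ c d f a b → a ℕ.+ b < K → evS c (evS d f) a b ≡ evS (c ⊛ d) f a b
    evS-⊛ c d f a b lt = begin
      R.sum K (λ i → c i ℚ.* shk i (evS d f) a b)
        ≡⟨ R.sum-cong K (λ i _ → trans (cong (c i ℚ.*_) (trans (sh-sum (i ℕ.* p) (i ℕ.* q) K (λ j a b → d j ℚ.* shk j f a b) a b)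
             (R.sum-cong K (λ j _ → trans (sh-· (i ℕ.* p) (i ℕ.* q) (d j) (shk j f) a b) (cong (d j ℚ.*_) (shk-shk i j f a b))))))
             (trans (R.·-sum (c i) K _) (R.sum-cong K (λ j _ → sym (ℚₚ.*-assoc (c i) (d j) (shk (i ℕ.+ j) f a b)))))) ⟩
      R.sum K (λ i → R.sum K (λ j → (c i ℚ.* d j) ℚ.* shk (i ℕ.+ j) f a b))
        ≡⟨ R.sum-diag K _ (λ i j K≤ → trans (cong ((c i ℚ.* d j) ℚ.*_) (shk-big (i ℕ.+ j) f a b lt K≤)) (ℚₚ.*-zeroʳ (c i ℚ.* d j))) ⟩
      R.sum K (R.diag (λ i j → (c i ℚ.* d j) ℚ.* shk (i ℕ.+ j) f a b))
        ≡⟨ R.sum-cong K (λ k _ → trans (R.diag-cong k (λ i j e → cong (λ m → (c i ℚ.* d j) ℚ.* shk m f a b) e)) (R.sum·-diag (shk k f a b) k (λ i j → c i ℚ.* d j))) ⟩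
      evS (c ⊛ d) f a b ∎
      where open ≡.≡-Reasoning

    private
      ind : ℕ → ℕ → ℕ → Bool
      ind m i j = (suc m ℕ.* p ℕ.≡ᵇ i) ∧ (suc m ℕ.* q ℕ.≡ᵇ j)

      coef : ℕ → ℚ
      coef m = u ℚ.* frac (sgn m) (suc m ℕ.* suc m)

      ind-true : ∀ m i j → ind m i j ≡ true → (suc m ℕ.* p ≡ i) × (suc m ℕ.* q ≡ j)
      ind-true m i j e with suc m ℕ.* p ℕ.≡ᵇ i in e₁ | suc m ℕ.* q ℕ.≡ᵇ j in e₂
      ind-true m i j refl | true | true = ℕₚ.≡ᵇ⇒≡ _ _ (≡.subst True (sym e₁) _) , ℕₚ.≡ᵇ⇒≡ _ _ (≡.subst True (sym e₂) _)

      ind-self : ∀ m → ind m (suc m ℕ.* p) (suc m ℕ.* q) ≡ true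
      ind-self m = cong₂ _∧_ (self (suc m ℕ.* p)) (self (suc m ℕ.* q))
        where self : ∀ n → (n ℕ.≡ᵇ n) ≡ true
              self zero    = refl
              self (suc n) = self n

      dilog-sum : ∀ i j → i ℕ.+ j < K → dilog (p , q) u i j ≡ R.sum K (λ m → if ind m i j then coef m else 0ℚ)
      dilog-sum i j lt = trans (cong (g 0 ℚ.+_) (sum1-sum (i ℕ.+ j) g)) (sym (R.sum-extend g lt large))
        where
        g : ℕ → ℚ
        g m = if ind m i j then coef m else 0ℚ
        large : ∀ m → suc (i ℕ.+ j) ≤ m → g m ≡ 0ℚ
        large m le with ind m i j in e
        ... | false = refl
        ... | true with ind-true m i j e
        ...   | refl , refl = ⊥-elim (ℕₚ.<⇒≱ (ℕₚ.≤-trans le (ℕₚ.n≤1+n m)) (degree-multiple (suc m) p q 1≤))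

    D2-sum : ∀ n (F : ℕ → ℕ → ℕ → ℕ → ℕ → ℚ) a b →
      D2 (λ i j i′ j′ → R.sum n (λ m → F m i j i′ j′)) a b ≡ R.sum n (λ m → D2 (F m) a b)
    D2-sum n F a b = trans (R.diag-cong a (λ i i′ _ → Sums.diag-sum-exchange ℚ⁺ b n (λ j j′ m → F m i j i′ j′)))
      (Sums.diag-sum-exchange ℚ⁺ a n (λ i i′ m → R.diag (λ j j′ → F m i j i′ j′) b))

    -- Since {j (p,q), v} = j {(p,q), v}, one factor of the 1/j² in the dilogarithm cancels, which
    -- leaves the coefficients of the logarithm.
    ρ-dilog : ∀ f a b → a ℕ.+ b < K → ρop (dilog (p , q) u) f a b ≡ evS ((u ℚ.* pw p q a b) S.· θ) f a b
    ρ-dilog f a b lt = begin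
      ρop (dilog (p , q) u) f a b
        ≡⟨ D2-cong a b (λ i j i′ j′ e e′ → trans (cong (λ z → pw i j a b ℚ.* (z ℚ.* f i′ j′)) (dilog-sum i j (le i j i′ j′ e e′)))
             (trans (cong (pw i j a b ℚ.*_) (R.*-sumʳ (f i′ j′) K _)) (R.·-sum (pw i j a b) K _))) ⟩
      D2 (λ i j i′ j′ → R.sum K (λ m → Fₘ m i j i′ j′)) a b
        ≡⟨ D2-sum K Fₘ a b ⟩
      R.sum K (λ m → D2 (Fₘ m) a b)
        ≡⟨ R.sum-cong K (λ m _ → single m) ⟩
      R.sum K (λ m → t (suc m))
        ≡⟨ R.sum-peel-last K≡ (λ m → t (suc m)) ⟩
      R.sum l (λ m → t (suc m)) ℚ.+ t (suc l)
        ≡⟨ cong (R.sum l (λ m → t (suc m)) ℚ.+_) (trans (cong (((u ℚ.* pw p q a b) ℚ.* θ (suc l)) ℚ.*_) (shk-big (suc l) f a b lt (ℕₚ.≤-reflexive K≡))) (ℚₚ.*-zeroʳ ((u ℚ.* pw p q a b) ℚ.* θ (suc l)))) ⟩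
      R.sum l (λ m → t (suc m)) ℚ.+ 0ℚ
        ≡⟨ trans (ℚₚ.+-comm (R.sum l (λ m → t (suc m))) 0ℚ) (cong (ℚ._+ R.sum l (λ m → t (suc m))) (sym (lem0 (u ℚ.* pw p q a b) (shk 0 f a b)))) ⟩
      t 0 ℚ.+ R.sum l (λ m → t (suc m))
        ≡⟨ sym (R.sum-peel K≡ t) ⟩
      R.sum K t ∎
      where
      open ≡.≡-Reasoning
      lem0 : ∀ x y → (x ℚ.* 0ℚ) ℚ.* y ≡ 0ℚ
      lem0 = solve-∀ ℚring
      t : ℕ → ℚ
      t j = ((u ℚ.* pw p q a b) ℚ.* θ j) ℚ.* shk j f a b
      Fₘ : ℕ → ℕ → ℕ → ℕ → ℕ → ℚ
      Fₘ m i j i′ j′ = pw i j a b ℚ.* ((if ind m i j then coef m else 0ℚ) ℚ.* f i′ j′)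
      le : ∀ i j i′ j′ → i ℕ.+ i′ ≡ a → j ℕ.+ j′ ≡ b → i ℕ.+ j < K
      le i j i′ j′ refl refl = ℕₚ.≤-<-trans (ℕₚ.+-mono-≤ (ℕₚ.m≤m+n i i′) (ℕₚ.m≤m+n j j′)) lt
      single : ∀ m → D2 (Fₘ m) a b ≡ t (suc m)
      single m = begin
        D2 (Fₘ m) a b
          ≡⟨ R.diag-single P a _ (λ i i′ i≢ → R.diag-zero b (λ j j′ _ → zero-F i j i′ j′ (λ e → i≢ (sym (proj₁ e))))) ⟩
        R.shift P (λ i′ → R.diag (λ j j′ → Fₘ m P j i′ j′) b) a
          ≡⟨ R.shift-cong P a (λ i′ _ → R.diag-single Q b (λ j j′ → Fₘ m P j i′ j′) (λ j j′ j≢ → zero-F P j i′ j′ (λ e → j≢ (sym (proj₂ e))))) ⟩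
        sh P Q (Fₘ m P Q) a b
          ≡⟨ sh-cong P Q a b (λ a′ b′ _ _ → trans (cong (λ z → pw P Q a b ℚ.* ((if z then coef m else 0ℚ) ℚ.* f a′ b′)) (ind-self m)) (sym (ℚₚ.*-assoc (pw P Q a b) (coef m) (f a′ b′)))) ⟩
        sh P Q (λ a′ b′ → (pw P Q a b ℚ.* coef m) ℚ.* f a′ b′) a b
          ≡⟨ sh-· P Q (pw P Q a b ℚ.* coef m) f a b ⟩
        (pw P Q a b ℚ.* coef m) ℚ.* shk (suc m) f a b
          ≡⟨ cong (ℚ._* shk (suc m) f a b) coefficient ⟩
        t (suc m) ∎
        where
        P = suc m ℕ.* p
        Q = suc m ℕ.* q
        zero-F : ∀ i j i′ j′ → ¬ (P ≡ i × Q ≡ j) → Fₘ m i j i′ j′ ≡ 0ℚ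
        zero-F i j i′ j′ ne with ind m i j in e
        ... | true  = ⊥-elim (ne (ind-true m i j e))
        ... | false = lem (pw i j a b) (f i′ j′)
          where lem : ∀ x y → x ℚ.* (0ℚ ℚ.* y) ≡ 0ℚ
                lem = solve-∀ ℚring
        coefficient : pw P Q a b ℚ.* coef m ≡ (u ℚ.* pw p q a b) ℚ.* θ (suc m)
        coefficient = trans (cong₂ (λ x y → x ℚ.* (u ℚ.* y)) (pr-*ˡ (suc m) p q (w₁ ℕ.+ a) (w₂ ℕ.+ b))
            (trans (frac-inv (sgn m) (suc m ℕ.* suc m)) (cong (ιℤ (sgn m) ℚ.*_) (inv-* (suc m) (suc m)))))
          (trans (lem (ι (suc m)) (pw p q a b) u (ιℤ (sgn m)) (inv (suc m)))
          (trans (cong (ℚ._* ((u ℚ.* pw p q a b) ℚ.* θ (suc m))) (ι-inv m)) (ℚₚ.*-identityˡ _)))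
          where lem : ∀ k w u s i → (k ℚ.* w) ℚ.* (u ℚ.* (s ℚ.* (i ℚ.* i))) ≡ (k ℚ.* i) ℚ.* ((u ℚ.* w) ℚ.* (s ℚ.* i))
                lem = solve-∀ ℚring

    private
      -- The form against (p,q) is constant in the direction (p,q). On each such line the operator
      -- is thus one scalar series in the shift, and its powers are the powers of that series.
      pw-line : ∀ k a b → pw p q (k ℕ.* p ℕ.+ a) (k ℕ.* q ℕ.+ b) ≡ pw p q a b
      pw-line k a b = trans (pw-shift p q (k ℕ.* p) (k ℕ.* q) a b)
        (trans (cong (pw p q a b ℚ.+_) (trans (pr-*ʳ k p q p q) (trans (cong (ι k ℚ.*_) (pr-self p q)) (ℚₚ.*-zeroʳ (ι k))))) (ℚₚ.+-identityʳ (pw p q a b)))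

      cθ : ℕ → ℕ → ℕ → ℚ
      cθ a b = (u ℚ.* pw p q a b) S.· θ

    dp-dilog : ∀ k f a b → a ℕ.+ b < K →
      op (dp algebra (ρ (dilog (p , q) u)) k) f a b ≡ evS (dp S.algebra (cθ a b) k) f a b
    dp-dilog zero f a b lt = sym (trans (R.sum-peel K≡ (λ j → S.one j ℚ.* shk j f a b))
      (trans (cong₂ ℚ._+_ (ℚₚ.*-identityˡ (f a b)) (R.sum-zero l (λ j _ → ℚₚ.*-zeroˡ (shk (suc j) f a b)))) (ℚₚ.+-identityʳ (f a b))))
    dp-dilog (suc k) f a b lt = begin
      inv (suc k) ℚ.* ρop (dilog (p , q) u) g a b
        ≡⟨ cong (inv (suc k) ℚ.*_) (ρ-dilog g a b lt) ⟩
      inv (suc k) ℚ.* evS (cθ a b) g a b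
        ≡⟨ cong (inv (suc k) ℚ.*_) (R.sum-cong K (λ j _ → cong (cθ a b j ℚ.*_) (sh-cong (j ℕ.* p) (j ℕ.* q) a b (λ { a′ b′ refl refl →
             trans (dp-dilog k f a′ b′ (ℕₚ.≤-<-trans (ℕₚ.+-mono-≤ (ℕₚ.m≤n+m a′ (j ℕ.* p)) (ℕₚ.m≤n+m b′ (j ℕ.* q))) lt))
                   (cong (λ z → evS (dp S.algebra ((u ℚ.* z) S.· θ) k) f a′ b′) (sym (pw-line j a′ b′))) })))) ⟩
      inv (suc k) ℚ.* evS (cθ a b) (evS (dp S.algebra (cθ a b) k) f) a b
        ≡⟨ cong (inv (suc k) ℚ.*_) (evS-⊛ (cθ a b) (dp S.algebra (cθ a b) k) f a b lt) ⟩
      inv (suc k) ℚ.* evS (cθ a b ⊛ dp S.algebra (cθ a b) k) f a b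
        ≡⟨ trans (R.·-sum (inv (suc k)) K _) (R.sum-cong K (λ j _ → sym (ℚₚ.*-assoc (inv (suc k)) _ (shk j f a b)))) ⟩
      evS (dp S.algebra (cθ a b) (suc k)) f a b ∎
      where
      open ≡.≡-Reasoning
      g = op (dp algebra (ρ (dilog (p , q) u)) k) f

    Φ-dilog : Φ (dilog (p , q) u) ≈ Kᴱ p q u
    Φ-dilog = pointwise λ f a b lt → trans (op-sum K (dp algebra (ρ (dilog (p , q) u))) f a b)
      (trans (R.sum-cong K (λ k _ → dp-dilog k f a b lt))
      (trans (R.sum-swap K K (λ k j → dp S.algebra (cθ a b) k j ℚ.* shk j f a b))
      (R.sum-cong K (λ j j<K → trans (R.sum·-sum (shk j f a b) K (λ k → dp S.algebra (cθ a b) k j))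
        (cong (ℚ._* shk j f a b) (trans (sym (S.sum-at K (dp S.algebra (cθ a b)) j)) (S.exp-log (u ℚ.* pw p q a b) j j<K)))))))

-- Words and the pentagon relation

ι-bin : ∀ x k → ι (suc k) ℚ.* bin x (suc k) ≡ (x ℚ.- ι k) ℚ.* bin x k
ι-bin x k = trans (sym (ℚₚ.*-assoc (ι (suc k)) (inv (suc k)) _)) (trans (cong (ℚ._* ((x ℚ.- ι k) ℚ.* bin x k)) (ι-inv k)) (ℚₚ.*-identityˡ _))

-- Both sides satisfy (n + 1) c(n + 1) = (x + y - n) c(n). For the convolution, n + 1 is split as i
-- + j and `ι-bin` is applied to each factor.
vandermonde : ∀ x y n → bin (x ℚ.+ y) n ≡ R.diag (λ i j → bin x i ℚ.* bin y j) n
vandermonde x y zero    = refl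
vandermonde x y (suc n) = ι-cancel n (trans (ι-bin (x ℚ.+ y) n) (trans (cong ((x ℚ.+ y ℚ.- ι n) ℚ.*_) (vandermonde x y n)) (sym recursion)))
  where
  open ≡.≡-Reasoning
  B : ℕ → ℕ → ℚ
  B i j = bin x i ℚ.* bin y j
  lem1 : ∀ a b c → a ℚ.* (b ℚ.* c) ≡ (a ℚ.* b) ℚ.* c
  lem1 = solve-∀ ℚring
  lem2 : ∀ a b c → a ℚ.* (b ℚ.* c) ≡ b ℚ.* (a ℚ.* c)
  lem2 = solve-∀ ℚring
  lem3 : ∀ x y i j b c → ((x ℚ.- i) ℚ.* b) ℚ.* c ℚ.+ b ℚ.* ((y ℚ.- j) ℚ.* c) ≡ (x ℚ.+ y ℚ.- (i ℚ.+ j)) ℚ.* (b ℚ.* c)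
  lem3 = solve-∀ ℚring
  recursion : ι (suc n) ℚ.* R.diag B (suc n) ≡ (x ℚ.+ y ℚ.- ι n) ℚ.* R.diag B n
  recursion = begin
    ι (suc n) ℚ.* R.diag B (suc n)
      ≡⟨ R.ι·diag (suc n) B ⟩
    R.diag (λ i j → ι i ℚ.* B i j) (suc n) ℚ.+ R.diag (λ i j → ι j ℚ.* B i j) (suc n)
      ≡⟨ cong₂ ℚ._+_
           (trans (cong (ℚ._+ R.diag (λ i j → ι (suc i) ℚ.* B (suc i) j) n) (trans (cong (ℚ._* B 0 (suc n)) ι-0) (ℚₚ.*-zeroˡ (B 0 (suc n))))) (ℚₚ.+-identityˡ (R.diag (λ i j → ι (suc i) ℚ.* B (suc i) j) n)))
           (trans (R.diag-last n (λ i j → ι j ℚ.* B i j)) (trans (cong (R.diag (λ i j → ι (suc j) ℚ.* B i (suc j)) n ℚ.+_) (trans (cong (ℚ._* B (suc n) 0) ι-0) (ℚₚ.*-zeroˡ (B (suc n) 0)))) (ℚₚ.+-identityʳ (R.diag (λ i j → ι (suc j) ℚ.* B i (suc j)) n)))) ⟩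
    R.diag (λ i j → ι (suc i) ℚ.* B (suc i) j) n ℚ.+ R.diag (λ i j → ι (suc j) ℚ.* B i (suc j)) n
      ≡⟨ sym (R.diag-+ n _ _) ⟩
    R.diag (λ i j → ι (suc i) ℚ.* B (suc i) j ℚ.+ ι (suc j) ℚ.* B i (suc j)) n
      ≡⟨ R.diag-cong n (λ i j e → trans (cong₂ ℚ._+_ (trans (lem1 (ι (suc i)) (bin x (suc i)) (bin y j)) (cong (ℚ._* bin y j) (ι-bin x i)))
             (trans (lem2 (ι (suc j)) (bin x i) (bin y (suc j))) (cong (bin x i ℚ.*_) (ι-bin y j))))
           (trans (lem3 x y (ι i) (ι j) (bin x i) (bin y j)) (cong (λ z → (x ℚ.+ y ℚ.- z) ℚ.* B i j) (trans (sym (ι-+ i j)) (cong ι e))))) ⟩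
    R.diag (λ i j → (x ℚ.+ y ℚ.- ι n) ℚ.* B i j) n
      ≡⟨ sym (R.·-diag (x ℚ.+ y ℚ.- ι n) n B) ⟩
    (x ℚ.+ y ℚ.- ι n) ℚ.* R.diag B n ∎

falling : ℚ → ℕ → ℚ
falling x zero    = 1ℚ
falling x (suc k) = (x ℚ.- ι k) ℚ.* falling x k

bin-falling : ∀ x k → bin x k ≡ falling x k ℚ.* inv (k !)
bin-falling x zero    = trans (sym (ℚₚ.*-identityˡ 1ℚ)) (cong (1ℚ ℚ.*_) (sym inv-1))
bin-falling x (suc k) = trans (cong (λ z → inv (suc k) ℚ.* ((x ℚ.- ι k) ℚ.* z)) (bin-falling x k))
  (trans (lem (inv (suc k)) (x ℚ.- ι k) (falling x k) (inv (k !))) (cong (falling x (suc k) ℚ.*_) (sym (inv-* (suc k) (k !)))))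
  where lem : ∀ i c f g → i ℚ.* (c ℚ.* (f ℚ.* g)) ≡ (c ℚ.* f) ℚ.* (i ℚ.* g)
        lem = solve-∀ ℚring

falling-+ : ∀ x u t → falling x (u ℕ.+ t) ≡ falling x u ℚ.* falling (x ℚ.- ι u) t
falling-+ x u zero    = trans (cong (falling x) (ℕₚ.+-identityʳ u)) (sym (ℚₚ.*-identityʳ (falling x u)))
falling-+ x u (suc t) = trans (cong (falling x) (ℕₚ.+-suc u t)) (trans (cong₂ (λ z w → (x ℚ.- z) ℚ.* w) (ι-+ u t) (falling-+ x u t))
  (lem x (ι u) (ι t) (falling x u) (falling (x ℚ.- ι u) t)))
  where lem : ∀ x u t f g → (x ℚ.- (u ℚ.+ t)) ℚ.* (f ℚ.* g) ≡ f ℚ.* (((x ℚ.- u) ℚ.- t) ℚ.* g)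
        lem = solve-∀ ℚring

falling-self : ∀ n → falling (ι n) n ≡ ι (n !)
falling-self zero    = sym ι-1
falling-self (suc n) = trans (falling-+ (ι (suc n)) 1 n) (trans (cong₂ (λ a b → ((ι (suc n) ℚ.- a) ℚ.* 1ℚ) ℚ.* falling b n) ι-0 step)
  (trans (cong₂ ℚ._*_ (lem (ι (suc n))) (falling-self n)) (sym (ι-* (suc n) (n !)))))
  where
  lem : ∀ x → (x ℚ.- 0ℚ) ℚ.* 1ℚ ≡ x
  lem = solve-∀ ℚring
  lem2 : ∀ a b → (a ℚ.+ b) ℚ.- a ≡ b
  lem2 = solve-∀ ℚring
  step : ι (suc n) ℚ.- ι 1 ≡ ι n
  step = trans (cong (ℚ._- ι 1) (ι-+ 1 n)) (lem2 (ι 1) (ι n))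

-- The binomial coefficient of u + t over u, in factorials so that the symmetry in u and t is plain.
multi : ℕ → ℕ → ℚ
multi u t = ι ((u ℕ.+ t) !) ℚ.* (inv (u !) ℚ.* inv (t !))

multi-comm : ∀ u t → multi u t ≡ multi t u
multi-comm u t = cong₂ ℚ._*_ (cong (λ n → ι (n !)) (ℕₚ.+-comm u t)) (ℚₚ.*-comm (inv (u !)) (inv (t !)))

private
  fact-inv : ∀ n → ι (n !) ℚ.* inv (n !) ≡ 1ℚ
  fact-inv n with n ! | n ℕₚ.!≢0
  ... | suc m | _ = ι-inv m

bin-bin : ∀ x u t → bin x u ℚ.* bin (x ℚ.- ι u) t ≡ bin x (u ℕ.+ t) ℚ.* multi u t
bin-bin x u t = trans (cong₂ ℚ._*_ (bin-falling x u) (bin-falling (x ℚ.- ι u) t))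
  (trans (lem (falling x u) (inv (u !)) (falling (x ℚ.- ι u) t) (inv (t !)))
  (trans (cong₂ ℚ._*_ (trans (sym (falling-+ x u t)) (trans (sym (ℚₚ.*-identityʳ (falling x (u ℕ.+ t)))) (cong (falling x (u ℕ.+ t) ℚ.*_) (sym (trans (ℚₚ.*-comm (inv n!) (ι n!)) (fact-inv (u ℕ.+ t))))))) refl)
  (trans (lem2 (falling x (u ℕ.+ t)) (inv n!) (ι n!) (inv (u !) ℚ.* inv (t !))) (cong (ℚ._* multi u t) (sym (bin-falling x (u ℕ.+ t)))))))
  where
  n! = (u ℕ.+ t) !
  lem : ∀ a b c d → (a ℚ.* b) ℚ.* (c ℚ.* d) ≡ (a ℚ.* c) ℚ.* (b ℚ.* d)
  lem = solve-∀ ℚring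
  lem2 : ∀ a b c d → (a ℚ.* (b ℚ.* c)) ℚ.* d ≡ (a ℚ.* b) ℚ.* (c ℚ.* d)
  lem2 = solve-∀ ℚring

bin-self : ∀ n → bin (ι n) n ≡ 1ℚ
bin-self n = trans (bin-falling (ι n) n) (trans (cong (ℚ._* inv (n !)) (falling-self n)) (fact-inv n))

bin-multi : ∀ u t → bin (ι (u ℕ.+ t)) u ≡ multi u t
bin-multi u t = trans (sym (ℚₚ.*-identityʳ _)) (trans (cong (bin (ι (u ℕ.+ t)) u ℚ.*_) (sym (trans (cong (λ z → bin z t) sub) (bin-self t))))
  (trans (bin-bin (ι (u ℕ.+ t)) u t) (trans (cong (ℚ._* multi u t) (bin-self (u ℕ.+ t))) (ℚₚ.*-identityˡ _))))
  where
  lem2 : ∀ a b → (a ℚ.+ b) ℚ.- a ≡ b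
  lem2 = solve-∀ ℚring
  sub : ι (u ℕ.+ t) ℚ.- ι u ≡ ι t
  sub = trans (cong (ℚ._- ι u) (ι-+ u t)) (lem2 (ι u) (ι t))

bin-ι-big : ∀ n k → n < k → bin (ι n) k ≡ 0ℚ
bin-ι-big n (suc k) (s≤s n≤k) with n ℕ.≟ k
... | yes refl = trans (cong (λ z → inv (suc n) ℚ.* (z ℚ.* bin (ι n) n)) (ℚₚ.+-inverseʳ (ι n))) (lem (inv (suc n)) (bin (ι n) n))
  where lem : ∀ i b → i ℚ.* (0ℚ ℚ.* b) ≡ 0ℚ
        lem = solve-∀ ℚring
... | no n≢k = trans (cong (λ z → inv (suc k) ℚ.* ((ι n ℚ.- ι k) ℚ.* z)) (bin-ι-big n k (ℕₚ.≤∧≢⇒< n≤k n≢k))) (lem (inv (suc k)) (ι n ℚ.- ι k))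
  where lem : ∀ i b → i ℚ.* (b ℚ.* 0ℚ) ≡ 0ℚ
        lem = solve-∀ ℚring

module BinomialSums (K : ℕ) where
  ∑ : (ℕ → ℚ) → ℚ
  ∑ = R.sum K

  ∑-cong : ∀ {f g : ℕ → ℚ} → (∀ i → i < K → f i ≡ g i) → ∑ f ≡ ∑ g
  ∑-cong = R.sum-cong K

  ∑-*ˡ : ∀ c f → c ℚ.* ∑ f ≡ ∑ (λ i → c ℚ.* f i)
  ∑-*ˡ c f = R.·-sum c K f

  ∑-swap : ∀ (G : ℕ → ℕ → ℚ) → ∑ (λ i → ∑ (G i)) ≡ ∑ (λ j → ∑ (λ i → G i j))
  ∑-swap = R.sum-swap K K

  *-zero : ∀ c {x} → x ≡ 0ℚ → c ℚ.* x ≡ 0ℚ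
  *-zero c refl = ℚₚ.*-zeroʳ c

  ∑-vandermonde : ∀ x y (g : ℕ → ℚ) → (∀ r → K ≤ r → g r ≡ 0ℚ) →
    ∑ (λ r → bin (x ℚ.+ y) r ℚ.* g r) ≡ ∑ (λ t → bin x t ℚ.* ∑ (λ s → bin y s ℚ.* g (t ℕ.+ s)))
  ∑-vandermonde x y g v = sym (begin
    ∑ (λ t → bin x t ℚ.* ∑ (λ s → bin y s ℚ.* g (t ℕ.+ s)))
      ≡⟨ ∑-cong (λ t _ → trans (∑-*ˡ (bin x t) (λ s → bin y s ℚ.* g (t ℕ.+ s))) (∑-cong (λ s _ → sym (ℚₚ.*-assoc (bin x t) (bin y s) (g (t ℕ.+ s)))))) ⟩
    ∑ (λ t → ∑ (λ s → (bin x t ℚ.* bin y s) ℚ.* g (t ℕ.+ s)))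
      ≡⟨ R.sum-diag K (λ t s → (bin x t ℚ.* bin y s) ℚ.* g (t ℕ.+ s)) (λ t s K≤ → *-zero (bin x t ℚ.* bin y s) (v (t ℕ.+ s) K≤)) ⟩
    ∑ (R.diag (λ t s → (bin x t ℚ.* bin y s) ℚ.* g (t ℕ.+ s)))
      ≡⟨ ∑-cong (λ r _ → trans (R.diag-cong r (λ t s e → cong (λ m → (bin x t ℚ.* bin y s) ℚ.* g m) e))
           (trans (R.sum·-diag (g r) r (λ t s → bin x t ℚ.* bin y s)) (cong (ℚ._* g r) (sym (vandermonde x y r))))) ⟩
    ∑ (λ r → bin (x ℚ.+ y) r ℚ.* g r) ∎)
    where open ≡.≡-Reasoning

  ∑-trinomial : ∀ x (g : ℕ → ℕ → ℚ) → (∀ u t → K ≤ u ℕ.+ t → g u t ≡ 0ℚ) →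
    ∑ (λ u → bin x u ℚ.* ∑ (λ t → bin (x ℚ.- ι u) t ℚ.* g u t)) ≡ ∑ (λ n → bin x n ℚ.* R.diag (λ u t → bin (ι n) u ℚ.* g u t) n)
  ∑-trinomial x g v = begin
    ∑ (λ u → bin x u ℚ.* ∑ (λ t → bin (x ℚ.- ι u) t ℚ.* g u t))
      ≡⟨ ∑-cong (λ u _ → trans (∑-*ˡ (bin x u) (λ t → bin (x ℚ.- ι u) t ℚ.* g u t)) (∑-cong (λ t _ →
           trans (sym (ℚₚ.*-assoc (bin x u) (bin (x ℚ.- ι u) t) (g u t))) (cong (ℚ._* g u t) (bin-bin x u t))))) ⟩
    ∑ (λ u → ∑ (λ t → (bin x (u ℕ.+ t) ℚ.* multi u t) ℚ.* g u t))
      ≡⟨ R.sum-diag K (λ u t → (bin x (u ℕ.+ t) ℚ.* multi u t) ℚ.* g u t) (λ u t K≤ → *-zero (bin x (u ℕ.+ t) ℚ.* multi u t) (v u t K≤)) ⟩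
    ∑ (R.diag (λ u t → (bin x (u ℕ.+ t) ℚ.* multi u t) ℚ.* g u t))
      ≡⟨ ∑-cong (λ n _ → trans (R.diag-cong n (λ { u t refl → trans (ℚₚ.*-assoc (bin x (u ℕ.+ t)) (multi u t) (g u t))
            (cong (λ z → bin x (u ℕ.+ t) ℚ.* (z ℚ.* g u t)) (sym (bin-multi u t))) })) (sym (R.·-diag (bin x n) n (λ u t → bin (ι n) u ℚ.* g u t)))) ⟩
    ∑ (λ n → bin x n ℚ.* R.diag (λ u t → bin (ι n) u ℚ.* g u t) n) ∎
    where open ≡.≡-Reasoning

  diag-first : ∀ n (h : ℕ → ℚ) → R.diag (λ u t → h u) n ≡ R.sum (suc n) h
  diag-first zero    h = sym (ℚₚ.+-identityʳ (h 0))
  diag-first (suc n) h = cong (h 0 ℚ.+_) (diag-first n (λ i → h (suc i)))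

  diag-binomial : ∀ n → n < K → ∀ (g : ℕ → ℚ) → R.diag (λ u t → bin (ι n) u ℚ.* g u) n ≡ ∑ (λ u → bin (ι n) u ℚ.* g u)
  diag-binomial n n<K g = trans (diag-first n (λ u → bin (ι n) u ℚ.* g u)) (sym (R.sum-extend (λ u → bin (ι n) u ℚ.* g u) n<K
    (λ u n<u → trans (cong (ℚ._* g u) (bin-ι-big n u n<u)) (ℚₚ.*-zeroˡ (g u)))))

  -- The coefficient identity behind the pentagon relation: three applications of Vandermonde's identity.
  module _ (P Q : ℚ) (H : ℕ → ℕ → ℚ) (H-zero : ∀ x y → K ≤ x ℕ.+ y → H x y ≡ 0ℚ) where
    private
      H-x : ∀ x y → K ≤ x → H x y ≡ 0ℚ
      H-x x y p = H-zero x y (ℕₚ.m≤n⇒m≤n+o y p)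
      H-y : ∀ x y → K ≤ y → H x y ≡ 0ℚ
      H-y x y p = H-zero x y (ℕₚ.m≤n⇒m≤o+n x p)
      zeros : ∀ (c : ℕ → ℚ) {g : ℕ → ℚ} → (∀ k → g k ≡ 0ℚ) → ∑ (λ k → c k ℚ.* g k) ≡ 0ℚ
      zeros c e = R.sum-zero K (λ k _ → *-zero (c k) (e k))

    pentagon-sum :
      ∑ (λ u → bin Q u ℚ.* ∑ (λ r → bin (P ℚ.+ Q ℚ.- ι u) r ℚ.* ∑ (λ k → bin (P ℚ.- ι u ℚ.- ι r) k ℚ.* H (u ℕ.+ r) (r ℕ.+ k)))) ≡
      ∑ (λ b → bin P b ℚ.* ∑ (λ a → bin (Q ℚ.+ ι b) a ℚ.* H a b))
    pentagon-sum = begin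
      ∑ (λ u → bin Q u ℚ.* ∑ (λ r → bin (P ℚ.+ Q ℚ.- ι u) r ℚ.* g u r))
        ≡⟨ ∑-cong (λ u _ → cong (bin Q u ℚ.*_) (trans (∑-cong (λ r _ → cong (λ z → bin z r ℚ.* g u r) (lem P Q (ι u))))
             (∑-vandermonde (Q ℚ.- ι u) P (g u) (g-zero u)))) ⟩
      ∑ (λ u → bin Q u ℚ.* ∑ (λ t → bin (Q ℚ.- ι u) t ℚ.* ∑ (λ s → bin P s ℚ.* g u (t ℕ.+ s))))
        ≡⟨ ∑-trinomial Q (λ u t → ∑ (λ s → bin P s ℚ.* g u (t ℕ.+ s)))
             (λ u t K≤ → zeros (bin P) (λ s → g-zero′ u (t ℕ.+ s) (ℕₚ.≤-trans K≤ (ℕₚ.+-monoʳ-≤ u (ℕₚ.m≤m+n t s))))) ⟩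
      ∑ (λ n → bin Q n ℚ.* R.diag (λ u t → bin (ι n) u ℚ.* ∑ (λ s → bin P s ℚ.* g u (t ℕ.+ s))) n)
        ≡⟨ ∑-cong (λ n n<K → cong (bin Q n ℚ.*_) (middle n n<K)) ⟩
      ∑ (λ n → bin Q n ℚ.* ∑ (λ s → bin P s ℚ.* ∑ (λ m → bin (P ℚ.- ι s) m ℚ.* H (n ℕ.+ s) (s ℕ.+ m))))
        ≡⟨ ∑-cong (λ n _ → cong (bin Q n ℚ.*_) (trans (∑-trinomial P (λ s m → H (n ℕ.+ s) (s ℕ.+ m)) (λ s m K≤ → H-y (n ℕ.+ s) (s ℕ.+ m) K≤))
             (∑-cong (λ b b<K → cong (bin P b ℚ.*_) (trans (R.diag-cong b (λ s m e → cong (λ z → bin (ι b) s ℚ.* H (n ℕ.+ s) z) e))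
               (diag-binomial b b<K (λ s → H (n ℕ.+ s) b))))))) ⟩
      ∑ (λ n → bin Q n ℚ.* ∑ (λ b → bin P b ℚ.* ∑ (λ s → bin (ι b) s ℚ.* H (n ℕ.+ s) b)))
        ≡⟨ trans (∑-cong (λ n _ → trans (∑-*ˡ (bin Q n) _) (∑-cong (λ b _ → lem2 (bin Q n) (bin P b) _)))) (trans (∑-swap _) (∑-cong (λ b _ → sym (∑-*ˡ (bin P b) _)))) ⟩
      ∑ (λ b → bin P b ℚ.* ∑ (λ n → bin Q n ℚ.* ∑ (λ s → bin (ι b) s ℚ.* H (n ℕ.+ s) b)))
        ≡⟨ ∑-cong (λ b _ → cong (bin P b ℚ.*_) (sym (∑-vandermonde Q (ι b) (λ a → H a b) (λ a K≤a → H-x a b K≤a)))) ⟩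
      ∑ (λ b → bin P b ℚ.* ∑ (λ a → bin (Q ℚ.+ ι b) a ℚ.* H a b)) ∎
      where
      open ≡.≡-Reasoning
      g : ℕ → ℕ → ℚ
      g u r = ∑ (λ k → bin (P ℚ.- ι u ℚ.- ι r) k ℚ.* H (u ℕ.+ r) (r ℕ.+ k))
      g-zero′ : ∀ u r → K ≤ u ℕ.+ r → g u r ≡ 0ℚ
      g-zero′ u r K≤ = zeros (bin (P ℚ.- ι u ℚ.- ι r)) (λ k → H-x (u ℕ.+ r) (r ℕ.+ k) K≤)
      g-zero : ∀ u r → K ≤ r → g u r ≡ 0ℚ
      g-zero u r K≤r = g-zero′ u r (ℕₚ.m≤n⇒m≤o+n u K≤r)
      lem : ∀ P Q u → P ℚ.+ Q ℚ.- u ≡ (Q ℚ.- u) ℚ.+ P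
      lem = solve-∀ ℚring
      lem2 : ∀ a b c → a ℚ.* (b ℚ.* c) ≡ b ℚ.* (a ℚ.* c)
      lem2 = solve-∀ ℚring
      lem3 : ∀ P u t s → P ℚ.- u ℚ.- (t ℚ.+ s) ≡ (P ℚ.- s) ℚ.- (u ℚ.+ t)
      lem3 = solve-∀ ℚring
      lem4 : ∀ P s n → (P ℚ.- s ℚ.- n) ℚ.+ n ≡ P ℚ.- s
      lem4 = solve-∀ ℚring
      -- For u + t = n the binomials of n over u and over t agree. After the sums are exchanged, t
      -- runs freely against k, and Vandermonde with upper indices n and P - s - n merges them into
      -- one index m with upper index P - s.
      middle : ∀ n → n < K → R.diag (λ u t → bin (ι n) u ℚ.* ∑ (λ s → bin P s ℚ.* g u (t ℕ.+ s))) n ≡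
        ∑ (λ s → bin P s ℚ.* ∑ (λ m → bin (P ℚ.- ι s) m ℚ.* H (n ℕ.+ s) (s ℕ.+ m)))
      middle n n<K = begin
        R.diag (λ u t → bin (ι n) u ℚ.* ∑ (λ s → bin P s ℚ.* g u (t ℕ.+ s))) n
          ≡⟨ R.diag-cong n (λ { u t refl → cong₂ ℚ._*_ (trans (bin-multi u t) (trans (multi-comm u t) (trans (sym (bin-multi t u)) (cong (λ z → bin (ι z) t) (ℕₚ.+-comm t u)))))
               (∑-cong (λ s _ → cong (bin P s ℚ.*_) (∑-cong (λ k _ → cong₂ ℚ._*_
                  (cong (λ z → bin z k) (trans (cong (λ z → P ℚ.- ι u ℚ.- z) (ι-+ t s)) (trans (lem3 P (ι u) (ι t) (ι s)) (cong (λ z → P ℚ.- ι s ℚ.- z) (sym (ι-+ u t))))))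
                  (cong₂ H (sym (ℕₚ.+-assoc u t s)) (ℕₚ.+-assoc t s k)))))) }) ⟩
        R.diag (λ u t → bin (ι n) t ℚ.* G t) n
          ≡⟨ trans (R.diag-flip n (λ u t → bin (ι n) t ℚ.* G t)) (diag-binomial n n<K G) ⟩
        ∑ (λ t → bin (ι n) t ℚ.* G t)
          ≡⟨ trans (∑-cong (λ t _ → trans (∑-*ˡ (bin (ι n) t) _) (∑-cong (λ s _ → lem2 (bin (ι n) t) (bin P s) _)))) (trans (∑-swap _) (∑-cong (λ s _ → sym (∑-*ˡ (bin P s) _)))) ⟩
        ∑ (λ s → bin P s ℚ.* ∑ (λ t → bin (ι n) t ℚ.* ∑ (λ k → bin (P ℚ.- ι s ℚ.- ι n) k ℚ.* H (n ℕ.+ s) (t ℕ.+ (s ℕ.+ k)))))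
          ≡⟨ ∑-cong (λ s _ → cong (bin P s ℚ.*_) (trans
               (∑-cong (λ t _ → cong (bin (ι n) t ℚ.*_) (∑-cong (λ k _ → cong (λ z → bin (P ℚ.- ι s ℚ.- ι n) k ℚ.* H (n ℕ.+ s) z) (re t s k)))))
               (trans (sym (∑-vandermonde (ι n) (P ℚ.- ι s ℚ.- ι n) (λ m → H (n ℕ.+ s) (s ℕ.+ m)) (λ m K≤m → H-y (n ℕ.+ s) (s ℕ.+ m) (ℕₚ.m≤n⇒m≤o+n s K≤m))))
                 (∑-cong (λ m _ → cong (λ z → bin z m ℚ.* H (n ℕ.+ s) (s ℕ.+ m)) (trans (ℚₚ.+-comm (ι n) _) (lem4 P (ι s) (ι n)))))))) ⟩
        ∑ (λ s → bin P s ℚ.* ∑ (λ m → bin (P ℚ.- ι s) m ℚ.* H (n ℕ.+ s) (s ℕ.+ m))) ∎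
        where
        G : ℕ → ℚ
        G t = ∑ (λ s → bin P s ℚ.* ∑ (λ k → bin (P ℚ.- ι s ℚ.- ι n) k ℚ.* H (n ℕ.+ s) (t ℕ.+ (s ℕ.+ k))))
        re : ∀ t s k → t ℕ.+ (s ℕ.+ k) ≡ s ℕ.+ (t ℕ.+ k)
        re t s k = trans (sym (ℕₚ.+-assoc t s k)) (trans (cong (ℕ._+ k) (ℕₚ.+-comm t s)) (ℕₚ.+-assoc s t k))

Pt : Set
Pt = ℕ × ℕ

Letter : Set
Letter = Pt × ℚ

Word : Set
Word = List Letter

_⊕_ : Pt → Pt → Pt
(a , b) ⊕ (c , d) = (a ℕ.+ c , b ℕ.+ d)

Interior : Pt → Set
Interior (a , b) = (1 ≤ a) × (1 ≤ b)

-- {p , q} = D, without subtraction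
Det : Pt → Pt → ℕ → Set
Det (a , b) (c , d) D = b ℕ.* c ≡ a ℕ.* d ℕ.+ D

-- A letter (p , x) stands for [p]^x, and _~[ l ]_ is an equality in G^{≤l}. Letters on the axes are never
-- truncated: this makes the relation at l carry over to l + 1 under the similarity transformations below.
infix 4 _~[_]_
data _~[_]_ : Word → ℕ → Word → Set where
  ~refl   : ∀ {l W} → W ~[ l ] W
  ~sym    : ∀ {l V W} → V ~[ l ] W → W ~[ l ] V
  ~trans  : ∀ {l U V W} → U ~[ l ] V → V ~[ l ] W → U ~[ l ] W
  ~++     : ∀ {l U U′ V V′} → U ~[ l ] U′ → V ~[ l ] V′ → U ++ V ~[ l ] U′ ++ V′
  merge   : ∀ {l} p x y → 1 ≤ deg p → (p , x) ∷ (p , y) ∷ [] ~[ l ] (p , x ℚ.+ y) ∷ []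
  unit    : ∀ {l} p → (p , 0ℚ) ∷ [] ~[ l ] []
  parallel : ∀ {l} p q x y → Det p q 0 → (p , x) ∷ (q , y) ∷ [] ~[ l ] (q , y) ∷ (p , x) ∷ []
  truncate : ∀ {l} p x → Interior p → l < deg p → (p , x) ∷ [] ~[ l ] []
  central : ∀ {l} p q x y → Interior (p ⊕ q) → l < deg (p ⊕ q) → (p , x) ∷ (q , y) ∷ [] ~[ l ] (q , y) ∷ (p , x) ∷ []
  pentagon : ∀ {l} p q D → 1 ≤ D → Det p q D →
    (p , inv D) ∷ (q , inv D) ∷ [] ~[ l ] (q , inv D) ∷ (p ⊕ q , inv D) ∷ (p , inv D) ∷ []

pr-Det : ∀ p q D → Det p q D → pr (proj₁ p) (proj₂ p) (proj₁ q) (proj₂ q) ≡ ι D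
pr-Det (a , b) (c , d) D e = trans (cong₂ ℚ._-_ (trans (sym (ι-* b c)) (trans (cong ι e) (ι-+ (a ℕ.* d) D))) (sym (ι-* a d))) (lem (ι (a ℕ.* d)) (ι D))
  where lem : ∀ x y → (x ℚ.+ y) ℚ.- x ≡ y
        lem = solve-∀ ℚring

pr-anti : ∀ a b c d → pr c d a b ≡ ℚ.- pr a b c d
pr-anti a b c d = lem (ι a) (ι b) (ι c) (ι d)
  where lem : ∀ a b c d → d ℚ.* a ℚ.- c ℚ.* b ≡ ℚ.- (b ℚ.* c ℚ.- a ℚ.* d)
        lem = solve-∀ ℚring

module Soundness {K l : ℕ} (K≡ : K ≡ suc l) (w₁ w₂ : ℕ) where
  open Dilogarithm K≡ w₁ w₂ public
  open BinomialSums K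

  ⟦_⟧ : Word → Endo
  ⟦ [] ⟧              = 1#
  ⟦ ((p , q) , x) ∷ W ⟧ = Kᴱ p q x * ⟦ W ⟧

  ⟦++⟧ : ∀ U V → ⟦ U ++ V ⟧ ≈ ⟦ U ⟧ * ⟦ V ⟧
  ⟦++⟧ []                V = ≈-sym (*-identityˡ _)
  ⟦++⟧ (((p , q) , x) ∷ U) V = ≈-trans (*-cong ≈-refl (⟦++⟧ U V)) (≈-sym (*-assoc _ _ _))

  K-sh : ∀ P Q p q x f a b → sh P Q (K-op p q x f) a b ≡
    ∑ (λ k → bin (x ℚ.* (pw p q a b ℚ.- pr p q P Q)) k ℚ.* sh (P ℕ.+ k ℕ.* p) (Q ℕ.+ k ℕ.* q) f a b)
  K-sh P Q p q x f a b = trans (sh-sum P Q K (λ k a b → bin (x ℚ.* pw p q a b) k ℚ.* sh (k ℕ.* p) (k ℕ.* q) f a b) a b)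
    (∑-cong (λ k _ → trans (sh-weight P Q p q (λ z → bin (x ℚ.* z) k) (sh (k ℕ.* p) (k ℕ.* q) f) a b)
      (cong (bin (x ℚ.* (pw p q a b ℚ.- pr p q P Q)) k ℚ.*_) (sh-sh P Q (k ℕ.* p) (k ℕ.* q) f a b))))

  -- The second letter reads its weight after a shift by k (p,q), hence the correction by k
  -- {(p′,q′), (p,q)}.
  KK : ∀ p q x p′ q′ y f a b → K-op p q x (K-op p′ q′ y f) a b ≡
    ∑ (λ k → bin (x ℚ.* pw p q a b) k ℚ.* ∑ (λ j → bin (y ℚ.* (pw p′ q′ a b ℚ.- ι k ℚ.* pr p′ q′ p q)) j
      ℚ.* sh (k ℕ.* p ℕ.+ j ℕ.* p′) (k ℕ.* q ℕ.+ j ℕ.* q′) f a b))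
  KK p q x p′ q′ y f a b = ∑-cong (λ k _ → cong (bin (x ℚ.* pw p q a b) k ℚ.*_) (trans (K-sh (k ℕ.* p) (k ℕ.* q) p′ q′ y f a b)
    (∑-cong (λ j _ → cong (λ z → bin (y ℚ.* (pw p′ q′ a b ℚ.- z)) j ℚ.* sh (k ℕ.* p ℕ.+ j ℕ.* p′) (k ℕ.* q ℕ.+ j ℕ.* q′) f a b) (pr-*ʳ k p′ q′ p q)))))

  K-merge : ∀ p q x y → 1 ≤ p ℕ.+ q → Kᴱ p q x * Kᴱ p q y ≈ Kᴱ p q (x ℚ.+ y)
  K-merge p q x y 1≤ = pointwise λ f a b lt → trans (KK p q x p q y f a b)
    (trans (∑-cong (λ k _ → cong (bin (x ℚ.* pw p q a b) k ℚ.*_) (∑-cong (λ j _ → cong₂ ℚ._*_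
        (cong (λ z → bin z j) (trans (cong (λ z → y ℚ.* (pw p q a b ℚ.- ι k ℚ.* z)) (pr-self p q)) (lem y (pw p q a b) (ι k))))
        (cong₂ (λ u v → sh u v f a b) (sym (ℕₚ.*-distribʳ-+ p k j)) (sym (ℕₚ.*-distribʳ-+ q k j)))))))
    (trans (sym (∑-vandermonde (x ℚ.* pw p q a b) (y ℚ.* pw p q a b) (λ r → sh (r ℕ.* p) (r ℕ.* q) f a b)
        (λ r K≤r → shk-big p q 1≤ 0ℚ r f a b lt K≤r)))
      (∑-cong (λ r _ → cong (λ z → bin z r ℚ.* sh (r ℕ.* p) (r ℕ.* q) f a b) (sym (ℚₚ.*-distribʳ-+ (pw p q a b) x y))))))
    where lem : ∀ y w k → y ℚ.* (w ℚ.- k ℚ.* 0ℚ) ≡ y ℚ.* w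
          lem = solve-∀ ℚring

  private
    bin-0 : ∀ k → bin 0ℚ (suc k) ≡ 0ℚ
    bin-0 k = trans (cong (λ z → bin z (suc k)) (sym ι-0)) (bin-ι-big 0 (suc k) (s≤s z≤n))

    head-only : ∀ (c : ℕ → ℚ) (g : ℕ → ℚ) → c 0 ≡ 1ℚ → (∀ k → c (suc k) ℚ.* g (suc k) ≡ 0ℚ) → ∑ (λ k → c k ℚ.* g k) ≡ g 0
    head-only c g c0 e = trans (R.sum-peel K≡ (λ k → c k ℚ.* g k)) (trans (cong₂ ℚ._+_ (trans (cong (ℚ._* g 0) c0) (ℚₚ.*-identityˡ (g 0))) (R.sum-zero l (λ k _ → e k))) (ℚₚ.+-identityʳ (g 0)))

  K-unit : ∀ p q → Kᴱ p q 0ℚ ≈ 1#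
  K-unit p q = pointwise λ f a b lt → head-only (bin (0ℚ ℚ.* pw p q a b)) (λ k → sh (k ℕ.* p) (k ℕ.* q) f a b) refl
    (λ k → trans (cong (ℚ._* sh (suc k ℕ.* p) (suc k ℕ.* q) f a b) (trans (cong (λ z → bin z (suc k)) (ℚₚ.*-zeroˡ (pw p q a b))) (bin-0 k))) (ℚₚ.*-zeroˡ (sh (suc k ℕ.* p) (suc k ℕ.* q) f a b)))

  private
    degree-suc : ∀ k p q → p ℕ.+ q ≤ suc k ℕ.* p ℕ.+ suc k ℕ.* q
    degree-suc k p q = ℕₚ.+-mono-≤ (ℕₚ.m≤m+n p (k ℕ.* p)) (ℕₚ.m≤m+n q (k ℕ.* q))

  K-truncate : ∀ p q x → K ≤ p ℕ.+ q → Kᴱ p q x ≈ 1#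
  K-truncate p q x K≤ = pointwise λ f a b lt → head-only (bin (x ℚ.* pw p q a b)) (λ k → sh (k ℕ.* p) (k ℕ.* q) f a b) refl
    (λ k → *-zero (bin (x ℚ.* pw p q a b) (suc k)) (sh-big (suc k ℕ.* p) (suc k ℕ.* q) f a b (ℕₚ.<-≤-trans lt (ℕₚ.≤-trans K≤ (degree-suc k p q)))))

  -- Terms with a zero index agree in both orders. For two positive indices, either the combined
  -- shift leaves the truncation range, or the form vanishes and no weight is corrected.
  K-comm : ∀ p q x p′ q′ y →
    (∀ f a b → a ℕ.+ b < K → ∀ k j → sh (suc k ℕ.* p ℕ.+ suc j ℕ.* p′) (suc k ℕ.* q ℕ.+ suc j ℕ.* q′) f a b ≡ 0ℚ) ⊎ pr p q p′ q′ ≡ 0ℚ →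
    Kᴱ p q x * Kᴱ p′ q′ y ≈ Kᴱ p′ q′ y * Kᴱ p q x
  K-comm p q x p′ q′ y h = pointwise λ f a b lt → begin
    K-op p q x (K-op p′ q′ y f) a b
      ≡⟨ trans (KK p q x p′ q′ y f a b) (∑-cong (λ k _ → ∑-*ˡ (bin (x ℚ.* pw p q a b) k) (λ j → bin (y ℚ.* (pw p′ q′ a b ℚ.- ι k ℚ.* pr p′ q′ p q)) j ℚ.* S f a b k j))) ⟩
    ∑ (λ k → ∑ (λ j → bin (x ℚ.* pw p q a b) k ℚ.* (bin (y ℚ.* (pw p′ q′ a b ℚ.- ι k ℚ.* pr p′ q′ p q)) j ℚ.* S f a b k j)))
      ≡⟨ ∑-cong (λ k _ → ∑-cong (λ j _ → cell f a b lt k j)) ⟩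
    ∑ (λ k → ∑ (λ j → bin (y ℚ.* pw p′ q′ a b) j ℚ.* (bin (x ℚ.* (pw p q a b ℚ.- ι j ℚ.* pr p q p′ q′)) k ℚ.* S f a b k j)))
      ≡⟨ ∑-swap (λ k j → bin (y ℚ.* pw p′ q′ a b) j ℚ.* (bin (x ℚ.* (pw p q a b ℚ.- ι j ℚ.* pr p q p′ q′)) k ℚ.* S f a b k j)) ⟩
    ∑ (λ j → ∑ (λ k → bin (y ℚ.* pw p′ q′ a b) j ℚ.* (bin (x ℚ.* (pw p q a b ℚ.- ι j ℚ.* pr p q p′ q′)) k ℚ.* S f a b k j)))
      ≡⟨ sym (trans (KK p′ q′ y p q x f a b) (∑-cong (λ j _ → trans (∑-*ˡ (bin (y ℚ.* pw p′ q′ a b) j) (λ k → bin (x ℚ.* (pw p q a b ℚ.- ι j ℚ.* pr p q p′ q′)) k ℚ.* sh (j ℕ.* p′ ℕ.+ k ℕ.* p) (j ℕ.* q′ ℕ.+ k ℕ.* q) f a b))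
           (∑-cong (λ k _ → cong (λ z → bin (y ℚ.* pw p′ q′ a b) j ℚ.* (bin (x ℚ.* (pw p q a b ℚ.- ι j ℚ.* pr p q p′ q′)) k ℚ.* z)) (cong₂ (λ u v → sh u v f a b) (ℕₚ.+-comm (j ℕ.* p′) (k ℕ.* p)) (ℕₚ.+-comm (j ℕ.* q′) (k ℕ.* q)))))))) ⟩
    K-op p′ q′ y (K-op p q x f) a b ∎
    where
    open ≡.≡-Reasoning
    S : Elt → ℕ → ℕ → ℕ → ℕ → ℚ
    S f a b k j = sh (k ℕ.* p ℕ.+ j ℕ.* p′) (k ℕ.* q ℕ.+ j ℕ.* q′) f a b
    lem0 : ∀ x w c → x ℚ.* (w ℚ.- 0ℚ ℚ.* c) ≡ x ℚ.* w
    lem0 = solve-∀ ℚring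
    lemz : ∀ x w c → x ℚ.* (w ℚ.- c ℚ.* 0ℚ) ≡ x ℚ.* w
    lemz = solve-∀ ℚring
    lem1 : ∀ b s → 1ℚ ℚ.* (b ℚ.* s) ≡ b ℚ.* (1ℚ ℚ.* s)
    lem1 = solve-∀ ℚring
    lem2 : ∀ b s → b ℚ.* (1ℚ ℚ.* s) ≡ 1ℚ ℚ.* (b ℚ.* s)
    lem2 = solve-∀ ℚring
    lem3 : ∀ b c s → b ℚ.* (c ℚ.* s) ≡ c ℚ.* (b ℚ.* s)
    lem3 = solve-∀ ℚring
    lem4 : ∀ b c → b ℚ.* (c ℚ.* 0ℚ) ≡ 0ℚ
    lem4 = solve-∀ ℚring
    cell : ∀ f a b → a ℕ.+ b < K → ∀ k j →
      bin (x ℚ.* pw p q a b) k ℚ.* (bin (y ℚ.* (pw p′ q′ a b ℚ.- ι k ℚ.* pr p′ q′ p q)) j ℚ.* S f a b k j) ≡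
      bin (y ℚ.* pw p′ q′ a b) j ℚ.* (bin (x ℚ.* (pw p q a b ℚ.- ι j ℚ.* pr p q p′ q′)) k ℚ.* S f a b k j)
    cell f a b lt zero j = trans (cong (λ z → 1ℚ ℚ.* (bin z j ℚ.* S f a b 0 j)) (trans (cong (λ z → y ℚ.* (pw p′ q′ a b ℚ.- z ℚ.* pr p′ q′ p q)) ι-0) (lem0 y (pw p′ q′ a b) (pr p′ q′ p q))))
      (lem1 (bin (y ℚ.* pw p′ q′ a b) j) (S f a b 0 j))
    cell f a b lt (suc k) zero = trans (lem2 (bin (x ℚ.* pw p q a b) (suc k)) (S f a b (suc k) 0))
      (cong (λ z → 1ℚ ℚ.* (bin z (suc k) ℚ.* S f a b (suc k) 0)) (sym (trans (cong (λ z → x ℚ.* (pw p q a b ℚ.- z ℚ.* pr p q p′ q′)) ι-0) (lem0 x (pw p q a b) (pr p q p′ q′)))))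
    cell f a b lt (suc k) (suc j) = [ (λ v → trans (cong (λ z → bin (x ℚ.* pw p q a b) (suc k) ℚ.* (bin (y ℚ.* (pw p′ q′ a b ℚ.- ι (suc k) ℚ.* pr p′ q′ p q)) (suc j) ℚ.* z)) (v f a b lt k j))
        (trans (lem4 (bin (x ℚ.* pw p q a b) (suc k)) (bin (y ℚ.* (pw p′ q′ a b ℚ.- ι (suc k) ℚ.* pr p′ q′ p q)) (suc j))) (sym (trans (cong (λ z → bin (y ℚ.* pw p′ q′ a b) (suc j) ℚ.* (bin (x ℚ.* (pw p q a b ℚ.- ι (suc j) ℚ.* pr p q p′ q′)) (suc k) ℚ.* z)) (v f a b lt k j))
          (lem4 (bin (y ℚ.* pw p′ q′ a b) (suc j)) (bin (x ℚ.* (pw p q a b ℚ.- ι (suc j) ℚ.* pr p q p′ q′)) (suc k)))))))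
      , (λ e → trans (cong (λ z → bin (x ℚ.* pw p q a b) (suc k) ℚ.* (bin z (suc j) ℚ.* S f a b (suc k) (suc j)))
            (trans (cong (λ z → y ℚ.* (pw p′ q′ a b ℚ.- ι (suc k) ℚ.* z)) (trans (pr-anti p q p′ q′) (cong ℚ.-_ e))) (lemz y (pw p′ q′ a b) (ι (suc k)))))
        (trans (lem3 (bin (x ℚ.* pw p q a b) (suc k)) (bin (y ℚ.* pw p′ q′ a b) (suc j)) (S f a b (suc k) (suc j)))
          (cong (λ z → bin (y ℚ.* pw p′ q′ a b) (suc j) ℚ.* (bin z (suc k) ℚ.* S f a b (suc k) (suc j))) (sym (trans (cong (λ z → x ℚ.* (pw p q a b ℚ.- ι (suc j) ℚ.* z)) e) (lemz x (pw p q a b) (ι (suc j)))))))) ]′ h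

  -- The exponents 1/D make every correction of a weight an integer, because {p,q} = D. Both
  -- products then take the shape of `pentagon-sum`, with P and Q the weights of p and q divided by
  -- D.
  K-pentagon : ∀ p q D → 1 ≤ D → Det p q D →
    Kᴱ (proj₁ p) (proj₂ p) (inv D) * Kᴱ (proj₁ q) (proj₂ q) (inv D) ≈
    Kᴱ (proj₁ q) (proj₂ q) (inv D) * (Kᴱ (proj₁ (p ⊕ q)) (proj₂ (p ⊕ q)) (inv D) * Kᴱ (proj₁ p) (proj₂ p) (inv D))
  K-pentagon pp@(p₁ , p₂) qq@(q₁ , q₂) (suc D′) 1≤D det = pointwise λ f a b lt → trans (left f a b) (trans (sym (pentagon-sum (P a b) (Q a b) (H f a b) (H-zero f a b lt))) (sym (right f a b)))
    where
    D = suc D′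
    i = inv D
    P Q : ℕ → ℕ → ℚ
    P a b = i ℚ.* pw p₁ p₂ a b
    Q a b = i ℚ.* pw q₁ q₂ a b
    H : Elt → ℕ → ℕ → ℕ → ℕ → ℚ
    H f a b x y = sh (x ℕ.* q₁ ℕ.+ y ℕ.* p₁) (x ℕ.* q₂ ℕ.+ y ℕ.* p₂) f a b
    prpq : pr p₁ p₂ q₁ q₂ ≡ ι D
    prpq = pr-Det pp qq D det
    prqp : pr q₁ q₂ p₁ p₂ ≡ ℚ.- ι D
    prqp = trans (pr-anti p₁ p₂ q₁ q₂) (cong ℚ.-_ prpq)
    iD : i ℚ.* ι D ≡ 1ℚ
    iD = trans (ℚₚ.*-comm i (ι D)) (ι-inv D′)
    nonzero-p : 1 ≤ p₁ ℕ.+ p₂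
    nonzero-p = pos p₁ p₂ det
      where
      pos : ∀ p₁ p₂ → p₂ ℕ.* q₁ ≡ p₁ ℕ.* q₂ ℕ.+ D → 1 ≤ p₁ ℕ.+ p₂
      pos zero    zero    ()
      pos zero    (suc _) _ = s≤s z≤n
      pos (suc _) _       _ = s≤s z≤n
    nonzero-q : 1 ≤ q₁ ℕ.+ q₂
    nonzero-q = pos q₁ q₂ det
      where
      pos : ∀ q₁ q₂ → p₂ ℕ.* q₁ ≡ p₁ ℕ.* q₂ ℕ.+ D → 1 ≤ q₁ ℕ.+ q₂
      pos zero    zero    e = ⊥-elim (contra (trans (sym (ℕₚ.*-zeroʳ p₂)) e))
        where contra : ¬ (0 ≡ p₁ ℕ.* 0 ℕ.+ D)
              contra e with trans e (cong (ℕ._+ D) (ℕₚ.*-zeroʳ p₁))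
              ... | ()
      pos zero    (suc _) _ = s≤s z≤n
      pos (suc _) _       _ = s≤s z≤n
    H-zero : ∀ f a b → a ℕ.+ b < K → ∀ x y → K ≤ x ℕ.+ y → H f a b x y ≡ 0ℚ
    H-zero f a b lt x y K≤ = sh-big (x ℕ.* q₁ ℕ.+ y ℕ.* p₁) (x ℕ.* q₂ ℕ.+ y ℕ.* p₂) f a b (ℕₚ.<-≤-trans lt (ℕₚ.≤-trans K≤ (ℕₚ.≤-trans (ℕₚ.+-mono-≤ (mult x nonzero-q) (mult y nonzero-p))
      (ℕₚ.≤-reflexive (Sums.+-interchange ℕₚ.+-0-commutativeMonoid (x ℕ.* q₁) (x ℕ.* q₂) (y ℕ.* p₁) (y ℕ.* p₂))))))
      where
      mult : ∀ k {p q} → 1 ≤ p ℕ.+ q → k ≤ k ℕ.* p ℕ.+ k ℕ.* q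
      mult k {p} {q} 1≤ = ℕₚ.≤-trans (ℕₚ.≤-reflexive (sym (ℕₚ.*-identityʳ k))) (ℕₚ.≤-trans (ℕₚ.*-monoʳ-≤ k 1≤) (ℕₚ.≤-reflexive (ℕₚ.*-distribˡ-+ k p q)))
    left : ∀ f a b → K-op p₁ p₂ i (K-op q₁ q₂ i f) a b ≡ ∑ (λ y → bin (P a b) y ℚ.* ∑ (λ x → bin (Q a b ℚ.+ ι y) x ℚ.* H f a b x y))
    left f a b = trans (KK p₁ p₂ i q₁ q₂ i f a b) (∑-cong (λ y _ → cong (bin (P a b) y ℚ.*_) (∑-cong (λ x _ → cong₂ ℚ._*_
      (cong (λ z → bin z x) (trans (cong (λ z → i ℚ.* (pw q₁ q₂ a b ℚ.- ι y ℚ.* z)) prqp) (trans (lem i (pw q₁ q₂ a b) (ι y) (ι D)) (trans (cong (λ z → Q a b ℚ.+ ι y ℚ.* z) iD) (cong (Q a b ℚ.+_) (ℚₚ.*-identityʳ (ι y)))))))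
      (cong₂ (λ u v → sh u v f a b) (ℕₚ.+-comm (y ℕ.* p₁) (x ℕ.* q₁)) (ℕₚ.+-comm (y ℕ.* p₂) (x ℕ.* q₂)))))))
      where lem : ∀ i w y d → i ℚ.* (w ℚ.- y ℚ.* (ℚ.- d)) ≡ i ℚ.* w ℚ.+ y ℚ.* (i ℚ.* d)
            lem = solve-∀ ℚring
    right : ∀ f a b → K-op q₁ q₂ i (K-op (p₁ ℕ.+ q₁) (p₂ ℕ.+ q₂) i (K-op p₁ p₂ i f)) a b ≡
      ∑ (λ u → bin (Q a b) u ℚ.* ∑ (λ r → bin (P a b ℚ.+ Q a b ℚ.- ι u) r ℚ.* ∑ (λ k → bin (P a b ℚ.- ι u ℚ.- ι r) k ℚ.* H f a b (u ℕ.+ r) (r ℕ.+ k))))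
    right f a b = trans (KK q₁ q₂ i (p₁ ℕ.+ q₁) (p₂ ℕ.+ q₂) i (K-op p₁ p₂ i f) a b)
      (∑-cong (λ u _ → cong (bin (Q a b) u ℚ.*_) (∑-cong (λ r _ → cong₂ ℚ._*_ (cong (λ z → bin z r) (weight u))
        (trans (K-sh (u ℕ.* q₁ ℕ.+ r ℕ.* (p₁ ℕ.+ q₁)) (u ℕ.* q₂ ℕ.+ r ℕ.* (p₂ ℕ.+ q₂)) p₁ p₂ i f a b)
          (∑-cong (λ k _ → cong₂ ℚ._*_ (cong (λ z → bin z k) (weight′ u r)) (cong₂ (λ x y → sh x y f a b) (index u r k p₁ q₁) (index u r k p₂ q₂)))))))))
      where
      lem : ∀ i p q u d → i ℚ.* (p ℚ.+ q ℚ.- u ℚ.* d) ≡ i ℚ.* p ℚ.+ i ℚ.* q ℚ.- u ℚ.* (i ℚ.* d)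
      lem = solve-∀ ℚring
      pw-+ : pw (p₁ ℕ.+ q₁) (p₂ ℕ.+ q₂) a b ≡ pw p₁ p₂ a b ℚ.+ pw q₁ q₂ a b
      pw-+ = trans (cong₂ (λ x y → y ℚ.* ι (w₁ ℕ.+ a) ℚ.- x ℚ.* ι (w₂ ℕ.+ b)) (ι-+ p₁ q₁) (ι-+ p₂ q₂)) (eq₁ (ι p₁) (ι q₁) (ι p₂) (ι q₂) (ι (w₁ ℕ.+ a)) (ι (w₂ ℕ.+ b)))
        where eq₁ : ∀ a b c d x y → (c ℚ.+ d) ℚ.* x ℚ.- (a ℚ.+ b) ℚ.* y ≡ (c ℚ.* x ℚ.- a ℚ.* y) ℚ.+ (d ℚ.* x ℚ.- b ℚ.* y)
              eq₁ = solve-∀ ℚring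
      pr-sum : pr (p₁ ℕ.+ q₁) (p₂ ℕ.+ q₂) q₁ q₂ ≡ ι D
      pr-sum = trans (cong₂ (λ x y → y ℚ.* ι q₁ ℚ.- x ℚ.* ι q₂) (ι-+ p₁ q₁) (ι-+ p₂ q₂)) (trans (eq₁ (ι p₁) (ι q₁) (ι p₂) (ι q₂)) prpq)
        where eq₁ : ∀ a b c d → (c ℚ.+ d) ℚ.* b ℚ.- (a ℚ.+ b) ℚ.* d ≡ c ℚ.* b ℚ.- a ℚ.* d
              eq₁ = solve-∀ ℚring
      weight : ∀ u → i ℚ.* (pw (p₁ ℕ.+ q₁) (p₂ ℕ.+ q₂) a b ℚ.- ι u ℚ.* pr (p₁ ℕ.+ q₁) (p₂ ℕ.+ q₂) q₁ q₂) ≡ P a b ℚ.+ Q a b ℚ.- ι u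
      weight u = trans (cong₂ (λ x y → i ℚ.* (x ℚ.- ι u ℚ.* y)) pw-+ pr-sum) (trans (lem i (pw p₁ p₂ a b) (pw q₁ q₂ a b) (ι u) (ι D))
        (trans (cong (λ z → P a b ℚ.+ Q a b ℚ.- ι u ℚ.* z) iD) (cong (λ z → P a b ℚ.+ Q a b ℚ.- z) (ℚₚ.*-identityʳ (ι u)))))
      pr-index : ∀ u r → pr p₁ p₂ (u ℕ.* q₁ ℕ.+ r ℕ.* (p₁ ℕ.+ q₁)) (u ℕ.* q₂ ℕ.+ r ℕ.* (p₂ ℕ.+ q₂)) ≡ (ι u ℚ.+ ι r) ℚ.* pr p₁ p₂ q₁ q₂
      pr-index u r = trans (cong₂ (λ x y → ι p₂ ℚ.* x ℚ.- ι p₁ ℚ.* y) (e u r p₁ q₁) (e u r p₂ q₂)) (eq₁ (ι u) (ι r) (ι p₁) (ι q₁) (ι p₂) (ι q₂))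
        where
        e : ∀ u r p q → ι (u ℕ.* q ℕ.+ r ℕ.* (p ℕ.+ q)) ≡ ι u ℚ.* ι q ℚ.+ ι r ℚ.* (ι p ℚ.+ ι q)
        e u r p q = trans (ι-+ (u ℕ.* q) (r ℕ.* (p ℕ.+ q))) (cong₂ ℚ._+_ (ι-* u q) (trans (ι-* r (p ℕ.+ q)) (cong (ι r ℚ.*_) (ι-+ p q))))
        eq₁ : ∀ u r a b c d → c ℚ.* (u ℚ.* b ℚ.+ r ℚ.* (a ℚ.+ b)) ℚ.- a ℚ.* (u ℚ.* d ℚ.+ r ℚ.* (c ℚ.+ d)) ≡ (u ℚ.+ r) ℚ.* (c ℚ.* b ℚ.- a ℚ.* d)
        eq₁ = solve-∀ ℚring
      weight′ : ∀ u r → i ℚ.* (pw p₁ p₂ a b ℚ.- pr p₁ p₂ (u ℕ.* q₁ ℕ.+ r ℕ.* (p₁ ℕ.+ q₁)) (u ℕ.* q₂ ℕ.+ r ℕ.* (p₂ ℕ.+ q₂))) ≡ P a b ℚ.- ι u ℚ.- ι r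
      weight′ u r = trans (cong (λ z → i ℚ.* (pw p₁ p₂ a b ℚ.- z)) (trans (pr-index u r) (cong ((ι u ℚ.+ ι r) ℚ.*_) prpq)))
        (trans (eq₁ i (pw p₁ p₂ a b) (ι u) (ι r) (ι D)) (trans (cong (λ z → P a b ℚ.- (ι u ℚ.+ ι r) ℚ.* z) iD) (eq₂ (P a b) (ι u) (ι r))))
        where eq₁ : ∀ i w u r d → i ℚ.* (w ℚ.- (u ℚ.+ r) ℚ.* d) ≡ i ℚ.* w ℚ.- (u ℚ.+ r) ℚ.* (i ℚ.* d)
              eq₁ = solve-∀ ℚring
              eq₂ : ∀ p u r → p ℚ.- (u ℚ.+ r) ℚ.* 1ℚ ≡ p ℚ.- u ℚ.- r
              eq₂ = solve-∀ ℚring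
      index : ∀ u r k p q → (u ℕ.* q ℕ.+ r ℕ.* (p ℕ.+ q)) ℕ.+ k ℕ.* p ≡ (u ℕ.+ r) ℕ.* q ℕ.+ (r ℕ.+ k) ℕ.* p
      index = ℕSolver.solve-∀

  sound : ∀ {V W} → V ~[ l ] W → ⟦ V ⟧ ≈ ⟦ W ⟧
  sound ~refl = ≈-refl
  sound (~sym e) = ≈-sym (sound e)
  sound (~trans e e′) = ≈-trans (sound e) (sound e′)
  sound (~++ {U = U} {U′} {V} {V′} e e′) = ≈-trans (⟦++⟧ U V) (≈-trans (*-cong (sound e) (sound e′)) (≈-sym (⟦++⟧ U′ V′)))
  sound (merge (p , q) x y 1≤) = ≈-trans (≈-sym (*-assoc _ _ _)) (*-cong (K-merge p q x y 1≤) ≈-refl)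
  sound (unit (p , q)) = ≈-trans (*-identityʳ _) (K-unit p q)
  sound (parallel (p , q) (p′ , q′) x y det) = ≈-trans (≈-sym (*-assoc _ _ _)) (≈-trans
    (*-cong (K-comm p q x p′ q′ y (inj₂ (trans (pr-Det (p , q) (p′ , q′) 0 det) ι-0))) ≈-refl) (*-assoc _ _ _))
  sound (truncate (p , q) x _ big) = ≈-trans (*-identityʳ _) (K-truncate p q x (ℕₚ.≤-trans (ℕₚ.≤-reflexive K≡) big))
  sound (central (p , q) (p′ , q′) x y _ big) = ≈-trans (≈-sym (*-assoc _ _ _)) (≈-trans
    (*-cong (K-comm p q x p′ q′ y (inj₁ (λ f a b lt k j → sh-big (suc k ℕ.* p ℕ.+ suc j ℕ.* p′) (suc k ℕ.* q ℕ.+ suc j ℕ.* q′) f a b (ℕₚ.<-≤-trans lt (ℕₚ.≤-trans (ℕₚ.≤-reflexive K≡)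
       (ℕₚ.≤-trans big (ℕₚ.+-mono-≤ (ℕₚ.+-mono-≤ (ℕₚ.m≤m+n p (k ℕ.* p)) (ℕₚ.m≤m+n p′ (j ℕ.* p′))) (ℕₚ.+-mono-≤ (ℕₚ.m≤m+n q (k ℕ.* q)) (ℕₚ.m≤m+n q′ (j ℕ.* q′)))))))))) ≈-refl) (*-assoc _ _ _))
  sound (pentagon p q D 1≤D det) = ≈-trans (≈-sym (*-assoc _ _ _)) (≈-trans (*-cong (K-pentagon p q D 1≤D det) ≈-refl)
    (≈-trans (*-assoc _ _ _) (*-cong ≈-refl (*-assoc _ _ _))))

-- Uniqueness and integrality of exponents

_≟ᴾ_ : (p q : Pt) → Dec (p ≡ q)
_≟ᴾ_ = ≡-dec ℕ._≟_ ℕ._≟_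

pick : Pt → Pt → ℚ → ℚ
pick v p x with p ≟ᴾ v
... | yes _ = x
... | no  _ = 0ℚ

pick-yes : ∀ v x → pick v v x ≡ x
pick-yes v x with v ≟ᴾ v
... | yes _ = refl
... | no n  = ⊥-elim (n refl)

pick-no : ∀ v p x → ¬ p ≡ v → pick v p x ≡ 0ℚ
pick-no v p x ne with p ≟ᴾ v
... | yes e = ⊥-elim (ne e)
... | no _  = refl

-- For comparing words with the same points and different exponents. With `I` the type of letters
-- and `pos` the first projection, a word can index itself.
module _ {I : Set} (pos : I → Pt) where
  letters : (I → ℚ) → List I → Word
  letters e = map (λ i → (pos i , e i))

  coefAt : Pt → (I → ℚ) → List I → ℚ
  coefAt v e []       = 0ℚ
  coefAt v e (i ∷ is) = pick v (pos i) (e i) ℚ.+ coefAt v e is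

  coefAt-absent : ∀ v e is → All (λ i → ¬ pos i ≡ v) is → coefAt v e is ≡ 0ℚ
  coefAt-absent v e []       []         = refl
  coefAt-absent v e (i ∷ is) (ne ∷ nes) = trans (cong₂ ℚ._+_ (pick-no v (pos i) (e i) ne) (coefAt-absent v e is nes)) refl

  coefAt-zero : ∀ v e is → All (λ i → pos i ≡ v → e i ≡ 0ℚ) is → coefAt v e is ≡ 0ℚ
  coefAt-zero v e []       []       = refl
  coefAt-zero v e (i ∷ is) (z ∷ zs) = trans (cong₂ ℚ._+_ head (coefAt-zero v e is zs)) refl
    where
    head : pick v (pos i) (e i) ≡ 0ℚ
    head with pos i ≟ᴾ v
    ... | yes q = z q
    ... | no  _ = refl

  coefAt-unique : ∀ e is → Unique (map pos is) → ∀ {i} → i ∈ is → coefAt (pos i) e is ≡ e i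
  coefAt-unique e (i ∷ is) (ne ∷ u) (here refl) = trans (cong₂ ℚ._+_ (pick-yes (pos i) (e i)) (coefAt-absent (pos i) e is (unmap is ne))) (ℚₚ.+-identityʳ (e i))
    where
    unmap : ∀ is → All (λ q → ¬ pos i ≡ q) (map pos is) → All (λ j → ¬ pos j ≡ pos i) is
    unmap []       []       = []
    unmap (j ∷ js) (n ∷ ns) = (λ q → n (sym q)) ∷ unmap js ns
  coefAt-unique e (j ∷ is) (ne ∷ u) {i} (there m) = trans (cong₂ ℚ._+_ (pick-no (pos i) (pos j) (e j) (differ is ne m)) (coefAt-unique e is u m)) (ℚₚ.+-identityˡ (e i))
    where
    differ : ∀ is → All (λ q → ¬ pos j ≡ q) (map pos is) → i ∈ is → ¬ pos j ≡ pos i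
    differ (k ∷ is) (n ∷ _)  (here refl) = n
    differ (k ∷ is) (_ ∷ ns) (there m)   = differ is ns m

-- The constant series 1, which stands for y^w.
δ₀ : Elt
δ₀ zero zero = 1ℚ
δ₀ _    _    = 0ℚ

module LeadingCoefficient {K l : ℕ} (K≡ : K ≡ suc l) (w₁ w₂ : ℕ) where
  open Soundness K≡ w₁ w₂ public

  K-tail : ℕ → ℕ → ℚ → Elt → Elt
  K-tail p q x f a b = R.sum l (λ k → bin (x ℚ.* pw p q a b) (suc k) ℚ.* sh (suc k ℕ.* p) (suc k ℕ.* q) f a b)

  K-split : ∀ p q x f a b → K-op p q x f a b ≡ f a b ℚ.+ K-tail p q x f a b
  K-split p q x f a b = trans (R.sum-peel K≡ (λ k → bin (x ℚ.* pw p q a b) k ℚ.* sh (k ℕ.* p) (k ℕ.* q) f a b))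
    (cong (ℚ._+ K-tail p q x f a b) (ℚₚ.*-identityˡ (f a b)))

  K-tail-cong : ∀ p q x {f g : Elt} a b → 1 ≤ p ℕ.+ q → (∀ a′ b′ → a′ ℕ.+ b′ < a ℕ.+ b → f a′ b′ ≡ g a′ b′) → K-tail p q x f a b ≡ K-tail p q x g a b
  K-tail-cong p q x a b 1≤ e = R.sum-cong l (λ k _ → cong (bin (x ℚ.* pw p q a b) (suc k) ℚ.*_)
    (sh-cong (suc k ℕ.* p) (suc k ℕ.* q) a b (λ { a′ b′ refl refl → e a′ b′ (smaller k a′ b′) })))
    where
    smaller : ∀ k a′ b′ → a′ ℕ.+ b′ < (suc k ℕ.* p ℕ.+ a′) ℕ.+ (suc k ℕ.* q ℕ.+ b′)
    smaller k a′ b′ = ≡.subst (a′ ℕ.+ b′ <_) (Sums.+-interchange ℕₚ.+-0-commutativeMonoid (suc k ℕ.* p) (suc k ℕ.* q) a′ b′)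
      (ℕₚ.m<n+m (a′ ℕ.+ b′) (ℕₚ.≤-trans 1≤ (ℕₚ.+-mono-≤ (ℕₚ.m≤m+n p (k ℕ.* p)) (ℕₚ.m≤m+n q (k ℕ.* q)))))

  -- If deg (p , q) ≥ deg (a , b), only the first power of the letter (p , q) can reach (a , b), and only from the origin.
  K-tail-top : ∀ p q x f a b → 1 ≤ p ℕ.+ q → a ℕ.+ b ≤ p ℕ.+ q → a ℕ.+ b < K → f 0 0 ≡ 1ℚ →
    K-tail p q x f a b ≡ pick (a , b) (p , q) x ℚ.* pw a b a b
  K-tail-top p q x f a b 1≤ le lt f0 with (p , q) ≟ᴾ (a , b)
  ... | yes refl = trans (R.sum-single 0 (λ k → bin (x ℚ.* pw p q a b) (suc k) ℚ.* sh (suc k ℕ.* p) (suc k ℕ.* q) f a b)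
        (ℕₚ.≤-pred (≡.subst (2 ≤_) K≡ (ℕₚ.≤-<-trans 1≤ lt))) other)
      (trans (cong₂ ℚ._*_ (trans (cong₂ (λ i z → i ℚ.* ((x ℚ.* pw p q p q ℚ.- z) ℚ.* 1ℚ)) inv-1 ι-0) (lem (x ℚ.* pw p q p q))) value) (ℚₚ.*-identityʳ (x ℚ.* pw p q p q)))
    where
    lem : ∀ y → 1ℚ ℚ.* ((y ℚ.- 0ℚ) ℚ.* 1ℚ) ≡ y
    lem = solve-∀ ℚring
    value : sh (1 ℕ.* p) (1 ℕ.* q) f p q ≡ 1ℚ
    value = trans (cong₂ (λ u v → sh u v f p q) (ℕₚ.+-identityʳ p) (ℕₚ.+-identityʳ q))
      (trans (cong₂ (sh p q f) (sym (ℕₚ.+-identityʳ p)) (sym (ℕₚ.+-identityʳ q))) (trans (sh-at p q f 0 0) f0))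
    other : ∀ k → ¬ k ≡ 0 → bin (x ℚ.* pw p q p q) (suc k) ℚ.* sh (suc k ℕ.* p) (suc k ℕ.* q) f p q ≡ 0ℚ
    other zero    n = ⊥-elim (n refl)
    other (suc k) _ = trans (cong (bin (x ℚ.* pw p q p q) (suc (suc k)) ℚ.*_) (sh-big (suc (suc k) ℕ.* p) (suc (suc k) ℕ.* q) f p q big)) (ℚₚ.*-zeroʳ (bin (x ℚ.* pw p q p q) (suc (suc k))))
      where
      big : p ℕ.+ q < suc (suc k) ℕ.* p ℕ.+ suc (suc k) ℕ.* q
      big = ≡.subst (p ℕ.+ q <_) (ℕₚ.*-distribˡ-+ (suc (suc k)) p q) (ℕₚ.m<m+n (p ℕ.+ q) (ℕₚ.≤-trans 1≤ (ℕₚ.m≤m+n (p ℕ.+ q) (k ℕ.* (p ℕ.+ q)))))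
  ... | no ne = trans (R.sum-zero l (λ k _ → trans (cong (bin (x ℚ.* pw p q a b) (suc k) ℚ.*_) (vanish k)) (ℚₚ.*-zeroʳ (bin (x ℚ.* pw p q a b) (suc k))))) (sym (ℚₚ.*-zeroˡ (pw a b a b)))
    where
    vanish : ∀ k → sh (suc k ℕ.* p) (suc k ℕ.* q) f a b ≡ 0ℚ
    vanish (suc k) = sh-big (suc (suc k) ℕ.* p) (suc (suc k) ℕ.* q) f a b (ℕₚ.≤-<-trans le
      (≡.subst (p ℕ.+ q <_) (ℕₚ.*-distribˡ-+ (suc (suc k)) p q) (ℕₚ.m<m+n (p ℕ.+ q) (ℕₚ.≤-trans 1≤ (ℕₚ.m≤m+n (p ℕ.+ q) (k ℕ.* (p ℕ.+ q)))))))
    vanish zero with shView (1 ℕ.* p) (1 ℕ.* q) a b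
    ... | outside z = z f
    ... | inside a′ b′ e₁ e₂ = ⊥-elim (ne (cong₂ _,_ (trans (sym (ℕₚ.+-identityʳ p)) (trans (sym (ℕₚ.+-identityʳ _)) (trans (cong (1 ℕ.* p ℕ.+_) (sym a′≡0)) e₁)))
                                                    (trans (sym (ℕₚ.+-identityʳ q)) (trans (sym (ℕₚ.+-identityʳ _)) (trans (cong (1 ℕ.* q ℕ.+_) (sym b′≡0)) e₂)))))
      where
      sum0′ : a′ ℕ.+ b′ ≡ 0
      sum0′ = ℕₚ.n≤0⇒n≡0 (ℕₚ.+-cancelˡ-≤ (p ℕ.+ q) (a′ ℕ.+ b′) 0 (ℕₚ.≤-trans (ℕₚ.≤-reflexive
        (trans (sym (Sums.+-interchange ℕₚ.+-0-commutativeMonoid p a′ q b′)) (cong₂ ℕ._+_ (trans (cong (ℕ._+ a′) (sym (ℕₚ.+-identityʳ p))) e₁) (trans (cong (ℕ._+ b′) (sym (ℕₚ.+-identityʳ q))) e₂)))) (ℕₚ.≤-trans le (ℕₚ.≤-reflexive (sym (ℕₚ.+-identityʳ (p ℕ.+ q)))))))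
      a′≡0 = ℕₚ.m+n≡0⇒m≡0 a′ sum0′
      b′≡0 = ℕₚ.m+n≡0⇒n≡0 a′ sum0′

  module _ {I : Set} (pos : I → Pt) where
    private
      val : (I → ℚ) → List I → Elt
      val e is = op ⟦ letters pos e is ⟧ δ₀

    val-origin : ∀ e is → All (λ i → 1 ≤ deg (pos i)) is → val e is 0 0 ≡ 1ℚ
    val-origin e []       []       = refl
    val-origin e (i ∷ is) (p ∷ ps) = trans (K-split _ _ (e i) (val e is) 0 0) (trans (cong₂ ℚ._+_ (val-origin e is ps)
      (trans (K-tail-cong _ _ (e i) {g = zeroElt} 0 0 p (λ _ _ ())) (R.sum-zero l (λ k _ → trans (cong (bin (e i ℚ.* pw _ _ 0 0) (suc k) ℚ.*_) (sh-0 (suc k ℕ.* proj₁ (pos i)) (suc k ℕ.* proj₂ (pos i)) 0 0)) (ℚₚ.*-zeroʳ (bin (e i ℚ.* pw _ _ 0 0) (suc k))))))) refl)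

    module _ (e e′ : I → ℚ) (d : ℕ) where
      Agree : List I → Set
      Agree = All (λ i → deg (pos i) < d → e i ≡ e′ i)

      below : ∀ is → All (λ i → 1 ≤ deg (pos i)) is → Agree is → ∀ a b → a ℕ.+ b < d → a ℕ.+ b < K → val e is a b ≡ val e′ is a b
      below []       []       []       a b _ _ = refl
      below (i ∷ is) (p ∷ ps) (q ∷ qs) a b lt ltK = trans (K-split _ _ (e i) (val e is) a b) (trans (cong₂ ℚ._+_ (below is ps qs a b lt ltK) tail) (sym (K-split _ _ (e′ i) (val e′ is) a b)))
        where
        tail : K-tail (proj₁ (pos i)) (proj₂ (pos i)) (e i) (val e is) a b ≡ K-tail (proj₁ (pos i)) (proj₂ (pos i)) (e′ i) (val e′ is) a b
        tail with deg (pos i) ℕ.<? d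
        ... | yes r = trans (cong (λ z → K-tail (proj₁ (pos i)) (proj₂ (pos i)) z (val e is) a b) (q r)) (K-tail-cong _ _ (e′ i) a b p (λ a′ b′ s → below is ps qs a′ b′ (ℕₚ.<-trans s lt) (ℕₚ.<-trans s ltK)))
        ... | no r = trans (K-tail-top _ _ (e i) (val e is) a b p le ltK (val-origin e is ps)) (trans (cong (ℚ._* pw a b a b) (trans (pick-no (a , b) (pos i) (e i) ne) (sym (pick-no (a , b) (pos i) (e′ i) ne)))) (sym (K-tail-top _ _ (e′ i) (val e′ is) a b p le ltK (val-origin e′ is ps))))
          where
          le : a ℕ.+ b ≤ deg (pos i)
          le = ℕₚ.≤-trans (ℕₚ.<⇒≤ lt) (ℕₚ.≮⇒≥ r)
          ne : ¬ pos i ≡ (a , b)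
          ne eq = r (≡.subst (_< d) (cong deg (sym eq)) lt)

      -- A letter of degree at least d reaches a point of degree d only when it sits there, linearly
      -- and from the origin (`K-tail-top`). Letters of lower degree act equally on tails that agree
      -- below d. The equation is written crosswise to avoid subtracting coefficients.
      leading : ∀ is → All (λ i → 1 ≤ deg (pos i)) is → Agree is → ∀ a b → a ℕ.+ b ≡ d → a ℕ.+ b < K →
        val e is a b ℚ.+ coefAt pos (a , b) e′ is ℚ.* pw a b a b ≡ val e′ is a b ℚ.+ coefAt pos (a , b) e is ℚ.* pw a b a b
      leading []       []       []       a b _ _ = refl
      leading (i ∷ is) (p ∷ ps) (q ∷ qs) a b eq ltK = trans (cong (ℚ._+ (c′ ℚ.+ C′) ℚ.* W) (K-split _ _ (e i) (val e is) a b))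
        (trans (lem (val e is a b) U c′ C′ W) (trans (cong₂ ℚ._+_ (leading is ps qs a b eq ltK) tail) (trans (sym (lem (val e′ is a b) U′ c C W))
          (cong (ℚ._+ (c ℚ.+ C) ℚ.* W) (sym (K-split _ _ (e′ i) (val e′ is) a b))))))
        where
        W = pw a b a b
        c = pick (a , b) (pos i) (e i)
        c′ = pick (a , b) (pos i) (e′ i)
        C = coefAt pos (a , b) e is
        C′ = coefAt pos (a , b) e′ is
        U = K-tail (proj₁ (pos i)) (proj₂ (pos i)) (e i) (val e is) a b
        U′ = K-tail (proj₁ (pos i)) (proj₂ (pos i)) (e′ i) (val e′ is) a b
        lem : ∀ v t c C w → (v ℚ.+ t) ℚ.+ (c ℚ.+ C) ℚ.* w ≡ (v ℚ.+ C ℚ.* w) ℚ.+ (t ℚ.+ c ℚ.* w)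
        lem = solve-∀ ℚring
        tail : U ℚ.+ c′ ℚ.* W ≡ U′ ℚ.+ c ℚ.* W
        tail with deg (pos i) ℕ.<? d
        ... | yes r = cong₂ ℚ._+_ (trans (cong (λ z → K-tail (proj₁ (pos i)) (proj₂ (pos i)) z (val e is) a b) (q r)) (K-tail-cong _ _ (e′ i) a b p (λ a′ b′ s → below is ps qs a′ b′ (≡.subst (a′ ℕ.+ b′ <_) eq s) (ℕₚ.<-trans s ltK))))
                        (cong (λ z → pick (a , b) (pos i) z ℚ.* W) (sym (q r)))
        ... | no r = trans (cong (ℚ._+ c′ ℚ.* W) (K-tail-top _ _ (e i) (val e is) a b p le ltK (val-origin e is ps)))
                       (trans (ℚₚ.+-comm (c ℚ.* W) (c′ ℚ.* W)) (cong (ℚ._+ c ℚ.* W) (sym (K-tail-top _ _ (e′ i) (val e′ is) a b p le ltK (val-origin e′ is ps)))))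
          where
          le : a ℕ.+ b ≤ deg (pos i)
          le = ≡.subst (_≤ deg (pos i)) (sym eq) (ℕₚ.≮⇒≥ r)

IsInt : ℚ → Set
IsInt x = Σ ℤ λ z → x ≡ ιℤ z

int-+ : ∀ {x y} → IsInt x → IsInt y → IsInt (x ℚ.+ y)
int-+ (z , refl) (w , refl) = z ℤ.+ w , sym (ιℤ-+ z w)

int-* : ∀ {x y} → IsInt x → IsInt y → IsInt (x ℚ.* y)
int-* (z , refl) (w , refl) = z ℤ.* w , sym (ιℤ-* z w)

int-neg : ∀ {x} → IsInt x → IsInt (ℚ.- x)
int-neg (z , refl) = ℤ.- z , sym (ιℤ-neg z)

int-ι : ∀ n → IsInt (ι n)
int-ι n = + n , sym (ιℤ-pos n)

int-0 : IsInt 0ℚ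
int-0 = + 0 , trans (sym ι-0) (sym (ιℤ-pos 0))

int-1 : IsInt 1ℚ
int-1 = + 1 , sym ιℤ-1

int-sum : ∀ n {f} → (∀ k → IsInt (f k)) → IsInt (R.sum n f)
int-sum zero    i = int-0
int-sum (suc n) i = int-+ (i 0) (int-sum n (λ k → i (suc k)))

-- Solved for the first summand on the right, it also reaches the negative integers in `int-bin`.
pascal : ∀ x k → bin (1ℚ ℚ.+ x) (suc k) ≡ bin x (suc k) ℚ.+ bin x k
pascal x k = ι-cancel k (trans absorb (sym (trans (ℚₚ.*-distribˡ-+ (ι (suc k)) (bin x (suc k)) (bin x k))
  (trans (cong₂ ℚ._+_ (ι-bin x k) (cong (ℚ._* bin x k) (trans (ι-+ 1 k) (cong (ℚ._+ ι k) ι-1)))) (lem x (ι k) (bin x k))))))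
  where
  lem : ∀ x k b → (x ℚ.- k) ℚ.* b ℚ.+ (1ℚ ℚ.+ k) ℚ.* b ≡ (1ℚ ℚ.+ x) ℚ.* b
  lem = solve-∀ ℚring
  lem2 : ∀ x → (1ℚ ℚ.+ x) ℚ.- 1ℚ ≡ x
  lem2 = solve-∀ ℚring
  lem3 : ∀ x f → (((1ℚ ℚ.+ x) ℚ.- 0ℚ) ℚ.* 1ℚ) ℚ.* f ≡ (1ℚ ℚ.+ x) ℚ.* f
  lem3 = solve-∀ ℚring
  lem4 : ∀ a f g → a ℚ.* (f ℚ.* g) ≡ (a ℚ.* g) ℚ.* f
  lem4 = solve-∀ ℚring
  fall : falling (1ℚ ℚ.+ x) (suc k) ≡ (1ℚ ℚ.+ x) ℚ.* falling x k
  fall = trans (falling-+ (1ℚ ℚ.+ x) 1 k) (trans (cong₂ (λ z w → (((1ℚ ℚ.+ x) ℚ.- z) ℚ.* 1ℚ) ℚ.* falling w k) ι-0 (trans (cong (λ z → (1ℚ ℚ.+ x) ℚ.- z) ι-1) (lem2 x))) (lem3 x (falling x k)))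
  fact : ι (suc k) ℚ.* inv (suc k !) ≡ inv (k !)
  fact = trans (cong (ι (suc k) ℚ.*_) (inv-* (suc k) (k !))) (trans (sym (ℚₚ.*-assoc (ι (suc k)) (inv (suc k)) (inv (k !)))) (trans (cong (ℚ._* inv (k !)) (ι-inv k)) (ℚₚ.*-identityˡ _)))
  absorb : ι (suc k) ℚ.* bin (1ℚ ℚ.+ x) (suc k) ≡ (1ℚ ℚ.+ x) ℚ.* bin x k
  absorb = trans (cong (ι (suc k) ℚ.*_) (bin-falling (1ℚ ℚ.+ x) (suc k))) (trans (lem4 (ι (suc k)) (falling (1ℚ ℚ.+ x) (suc k)) (inv (suc k !)))
    (trans (cong₂ ℚ._*_ fact fall) (trans (lem4 (inv (k !)) (1ℚ ℚ.+ x) (falling x k)) (trans (cong (ℚ._* (1ℚ ℚ.+ x)) (trans (ℚₚ.*-comm (inv (k !)) (falling x k)) (sym (bin-falling x k)))) (ℚₚ.*-comm (bin x k) (1ℚ ℚ.+ x))))))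

int-bin : ∀ {x} → IsInt x → ∀ k → IsInt (bin x k)
int-bin (z , refl) k = go z k
  where
  down : ∀ n → 1ℚ ℚ.+ ιℤ ℤ.-[1+ n ] ≡ ιℤ (ℤ.- (+ n))
  down n = trans (cong (ℚ._+ ιℤ ℤ.-[1+ n ]) (sym ιℤ-1)) (trans (sym (ιℤ-+ (+ 1) ℤ.-[1+ n ])) (cong ιℤ (ℤ⊖ n)))
    where
    ℤ⊖ : ∀ n → 1 ℤ.⊖ suc n ≡ ℤ.- (+ n)
    ℤ⊖ zero    = refl
    ℤ⊖ (suc n) = refl
  go : ∀ z k → IsInt (bin (ιℤ z) k)
  go z zero = int-1
  go (+ zero) (suc k) = ≡.subst IsInt (sym (trans (cong (λ y → bin y (suc k)) (ιℤ-pos 0)) (bin-ι-big 0 (suc k) (s≤s z≤n)))) int-0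
  go (+ suc n) (suc k) = ≡.subst IsInt (sym (trans (cong (λ y → bin y (suc k)) (trans (ιℤ-+ (+ 1) (+ n)) (cong (ℚ._+ ιℤ (+ n)) ιℤ-1))) (pascal (ιℤ (+ n)) k)))
    (int-+ (go (+ n) (suc k)) (go (+ n) k))
  go ℤ.-[1+ n ] (suc k) = ≡.subst IsInt (sym (lem _ _ _ (pascal (ιℤ ℤ.-[1+ n ]) k)))
    (int-+ (≡.subst (λ y → IsInt (bin y (suc k))) (sym (down n)) (neg n)) (int-neg (go ℤ.-[1+ n ] k)))
    where
    lem : ∀ a b c → a ≡ b ℚ.+ c → b ≡ a ℚ.+ ℚ.- c
    lem a b c e = trans (aux b c) (cong (ℚ._+ ℚ.- c) (sym e))
      where aux : ∀ b c → b ≡ (b ℚ.+ c) ℚ.+ ℚ.- c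
            aux = solve-∀ ℚring
    neg : ∀ n → IsInt (bin (ιℤ (ℤ.- (+ n))) (suc k))
    neg zero    = go (+ 0) (suc k)
    neg (suc n) = go ℤ.-[1+ n ] (suc k)

gcdᴾ : Pt → ℕ
gcdᴾ (a , b) = gcd a b

Integral : Letter → Set
Integral (p , x) = IsInt (ι (gcdᴾ p) ℚ.* x)

-- gcd(p) divides both coordinates of p, so {p, v} is gcd(p) times an integer.
int-multiple : ∀ (p : Pt) x c d → Integral (p , x) → IsInt (x ℚ.* pr (proj₁ p) (proj₂ p) c d)
int-multiple (a , b) x c d i with gcd[m,n]∣m a b | gcd[m,n]∣n a b
... | divides a′ ea | divides b′ eb = ≡.subst IsInt (sym eq) (int-* i (int-+ (int-* (int-ι b′) (int-ι c)) (int-neg (int-* (int-ι a′) (int-ι d)))))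
  where
  lem : ∀ x g a b c d → x ℚ.* ((b ℚ.* g) ℚ.* c ℚ.- (a ℚ.* g) ℚ.* d) ≡ (g ℚ.* x) ℚ.* (b ℚ.* c ℚ.+ ℚ.- (a ℚ.* d))
  lem = solve-∀ ℚring
  eq : x ℚ.* pr a b c d ≡ (ι (gcd a b) ℚ.* x) ℚ.* (ι b′ ℚ.* ι c ℚ.+ ℚ.- (ι a′ ℚ.* ι d))
  eq = trans (cong₂ (λ u v → x ℚ.* (v ℚ.* ι c ℚ.- u ℚ.* ι d)) (trans (cong ι ea) (ι-* a′ (gcd a b))) (trans (cong ι eb) (ι-* b′ (gcd a b))))
    (lem x (ι (gcd a b)) (ι a′) (ι b′) (ι c) (ι d))

int-gcd : ∀ a b x → IsInt (x ℚ.* ι a) → IsInt (x ℚ.* ι b) → IsInt (ι (gcd a b) ℚ.* x)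
int-gcd a b x ia ib with Bézout.identity (gcd-GCD a b)
... | Bézout.+- u v e = ≡.subst IsInt (sym (solve′ (ι (gcd a b)) (ι a) (ι b) (ι u) (ι v) x (eq e))) (int-+ (int-* (int-ι u) ia) (int-neg (int-* (int-ι v) ib)))
  where
  eq : gcd a b ℕ.+ v ℕ.* b ≡ u ℕ.* a → ι (gcd a b) ℚ.+ ι v ℚ.* ι b ≡ ι u ℚ.* ι a
  eq e = trans (cong (ι (gcd a b) ℚ.+_) (sym (ι-* v b))) (trans (sym (ι-+ (gcd a b) (v ℕ.* b))) (trans (cong ι e) (ι-* u a)))
  solve′ : ∀ g a b u v x → g ℚ.+ v ℚ.* b ≡ u ℚ.* a → g ℚ.* x ≡ u ℚ.* (x ℚ.* a) ℚ.+ ℚ.- (v ℚ.* (x ℚ.* b))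
  solve′ g a b u v x e = trans (l1 g b v x) (trans (cong (λ z → z ℚ.* x ℚ.+ ℚ.- (v ℚ.* (x ℚ.* b))) e) (l2 u a x (ℚ.- (v ℚ.* (x ℚ.* b)))))
    where l1 : ∀ g b v x → g ℚ.* x ≡ (g ℚ.+ v ℚ.* b) ℚ.* x ℚ.+ ℚ.- (v ℚ.* (x ℚ.* b))
          l1 = solve-∀ ℚring
          l2 : ∀ u a x y → (u ℚ.* a) ℚ.* x ℚ.+ y ≡ u ℚ.* (x ℚ.* a) ℚ.+ y
          l2 = solve-∀ ℚring
... | Bézout.-+ u v e = ≡.subst IsInt (sym (solve′ (ι (gcd a b)) (ι a) (ι b) (ι u) (ι v) x (eq e))) (int-+ (int-* (int-ι v) ib) (int-neg (int-* (int-ι u) ia)))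
  where
  eq : gcd a b ℕ.+ u ℕ.* a ≡ v ℕ.* b → ι (gcd a b) ℚ.+ ι u ℚ.* ι a ≡ ι v ℚ.* ι b
  eq e = trans (cong (ι (gcd a b) ℚ.+_) (sym (ι-* u a))) (trans (sym (ι-+ (gcd a b) (u ℕ.* a))) (trans (cong ι e) (ι-* v b)))
  solve′ : ∀ g a b u v x → g ℚ.+ u ℚ.* a ≡ v ℚ.* b → g ℚ.* x ≡ v ℚ.* (x ℚ.* b) ℚ.+ ℚ.- (u ℚ.* (x ℚ.* a))
  solve′ g a b u v x e = trans (l1 g a u x) (trans (cong (λ z → z ℚ.* x ℚ.+ ℚ.- (u ℚ.* (x ℚ.* a))) e) (l2 v b x (ℚ.- (u ℚ.* (x ℚ.* a)))))
    where l1 : ∀ g b v x → g ℚ.* x ≡ (g ℚ.+ v ℚ.* b) ℚ.* x ℚ.+ ℚ.- (v ℚ.* (x ℚ.* b))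
          l1 = solve-∀ ℚring
          l2 : ∀ u a x y → (u ℚ.* a) ℚ.* x ℚ.+ y ≡ u ℚ.* (x ℚ.* a) ℚ.+ y
          l2 = solve-∀ ℚring

IntValued : Elt → Set
IntValued f = ∀ a b → IsInt (f a b)

module Sem (l w₁ w₂ : ℕ) = LeadingCoefficient {suc l} {l} refl w₁ w₂

value : ℕ → ℕ → ℕ → Word → Elt
value l w₁ w₂ W = op ⟦ W ⟧ δ₀
  where open Sem l w₁ w₂

-- The action of an integral letter has coefficients `bin` of integers, and these are integers.
int-word : ∀ l w₁ w₂ {W} → All Integral W → IntValued (value l w₁ w₂ W)
int-word l w₁ w₂ [] zero    zero    = int-1
int-word l w₁ w₂ [] zero    (suc _) = int-0
int-word l w₁ w₂ [] (suc _) _       = int-0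
int-word l w₁ w₂ {((p , q) , x) ∷ W} (i ∷ is) a b = int-sum (suc l) (λ k → int-* (int-bin (int-multiple (p , q) x (w₁ ℕ.+ a) (w₂ ℕ.+ b) i) k) (int-sh (k ℕ.* p) (k ℕ.* q) a b))
  where
  f = value l w₁ w₂ W
  int-sh : ∀ P Q a b → IsInt (sh P Q f a b)
  int-sh P Q a b with shView P Q a b
  ... | outside z = ≡.subst IsInt (sym (z f)) int-0
  ... | inside a′ b′ refl refl = ≡.subst IsInt (sym (sh-at P Q f a′ b′)) (int-word l w₁ w₂ is a′ b′)

infix 4 _≅[_]_
-- A single weight w does not show the leading coefficient at points parallel to w, where {p, w} =
-- 0. Equality is therefore demanded at all weights; (1,0) and (0,1) are the ones exploited.
record _≅[_]_ (U : Word) (l : ℕ) (V : Word) : Set where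
  constructor equal
  field at-weight : ∀ w₁ w₂ → let open Sem l w₁ w₂ in ⟦ U ⟧ ≈ ⟦ V ⟧
open _≅[_]_ public

value-≅ : ∀ {U l V} → U ≅[ l ] V → ∀ w₁ w₂ a b → a ℕ.+ b < suc l → value l w₁ w₂ U a b ≡ value l w₁ w₂ V a b
value-≅ {l = l} e w₁ w₂ a b lt = at (at-weight e w₁ w₂) δ₀ a b lt
  where open Sem l w₁ w₂

~⇒≅ : ∀ {U l V} → U ~[ l ] V → U ≅[ l ] V
~⇒≅ {l = l} e = equal λ w₁ w₂ → Sem.sound l w₁ w₂ e

weight-10 : ∀ l a b → Sem.pw l 1 0 a b a b ≡ ι b
weight-10 l a b = trans (cong (λ z → ι b ℚ.* z ℚ.- ι a ℚ.* ι b) (trans (ι-+ 1 a) (cong (ℚ._+ ι a) ι-1))) (lem (ι a) (ι b))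
  where lem : ∀ a b → b ℚ.* (1ℚ ℚ.+ a) ℚ.- a ℚ.* b ≡ b
        lem = solve-∀ ℚring

weight-01 : ∀ l a b → Sem.pw l 0 1 a b a b ≡ ℚ.- ι a
weight-01 l a b = trans (cong (λ z → ι b ℚ.* ι a ℚ.- ι a ℚ.* z) (trans (ι-+ 1 b) (cong (ℚ._+ ι b) ι-1))) (lem (ι a) (ι b))
  where lem : ∀ a b → b ℚ.* a ℚ.- a ℚ.* (1ℚ ℚ.+ b) ≡ ℚ.- a
        lem = solve-∀ ℚring

private
  cancel-left : ∀ {x y u v} → x ≡ y → x ℚ.+ u ≡ y ℚ.+ v → u ≡ v
  cancel-left {x} {u = u} {v} refl e = trans (aux u x) (trans (cong (λ z → ℚ.- x ℚ.+ z) e) (sym (aux v x)))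
    where aux : ∀ u x → u ≡ ℚ.- x ℚ.+ (x ℚ.+ u)
          aux = solve-∀ ℚring

-- Exponents are determined degree by degree through the leading coefficient.
unique-exponents : ∀ l (L : List Pt) (e e′ : Pt → ℚ) → Unique L → All (λ p → 1 ≤ deg p) L →
  letters (λ p → p) e L ≅[ l ] letters (λ p → p) e′ L → ∀ {p} → p ∈ L → deg p ≤ l → e p ≡ e′ p
unique-exponents l L e e′ u ps eq {p} m d≤l = <-rec P step (deg p) p m refl d≤l
  where
  P : ℕ → Set
  P d = ∀ p → p ∈ L → deg p ≡ d → d ≤ l → e p ≡ e′ p
  step : ∀ d → (∀ {d′} → d′ < d → P d′) → P d
  step d ih p@(a , b) m dp d≤l = conclude a b refl refl
    where
    agree : All (λ q → deg q < d → e q ≡ e′ q) L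
    agree = All.tabulate (λ {q} mq lt → ih lt q mq refl (ℕₚ.≤-trans (ℕₚ.<⇒≤ lt) d≤l))
    same : ∀ w₁ w₂ → e′ p ℚ.* Sem.pw l w₁ w₂ a b a b ≡ e p ℚ.* Sem.pw l w₁ w₂ a b a b
    same w₁ w₂ = trans (cong (ℚ._* Sem.pw l w₁ w₂ a b a b) (sym (coefAt-unique (λ p → p) e′ L (≡.subst Unique (sym (map-id L)) u) m)))
      (trans (cancel-left (value-≅ eq w₁ w₂ a b lt) (Sem.leading l w₁ w₂ (λ p → p) e e′ d L ps agree a b dp lt))
        (cong (ℚ._* Sem.pw l w₁ w₂ a b a b) (coefAt-unique (λ p → p) e L (≡.subst Unique (sym (map-id L)) u) m)))
      where
      lt : a ℕ.+ b < suc l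
      lt = s≤s (≡.subst (_≤ l) (sym dp) d≤l)
      map-id : ∀ (L : List Pt) → map (λ p → p) L ≡ L
      map-id []      = refl
      map-id (x ∷ L) = cong (x ∷_) (map-id L)
    conclude : ∀ a′ b′ → a ≡ a′ → b ≡ b′ → e p ≡ e′ p
    conclude _ (suc b″) eqa eqb = ι-cancel b″ (trans (ℚₚ.*-comm (ι (suc b″)) (e p)) (trans (sym (trans (cong (e′ p ℚ.*_) (sym val)) (trans (same 1 0) (cong (e p ℚ.*_) val)))) (ℚₚ.*-comm (e′ p) (ι (suc b″)))))
      where val : Sem.pw l 1 0 a b a b ≡ ι (suc b″)
            val = trans (weight-10 l a b) (cong ι eqb)
    conclude (suc a″) zero eqa eqb = ι-cancel a″ (trans (l1 (ι (suc a″)) (e p)) (trans (cong ℚ.-_ (sym (trans (cong (e′ p ℚ.*_) (sym val)) (trans (same 0 1) (cong (e p ℚ.*_) val))))) (sym (l1 (ι (suc a″)) (e′ p)))))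
      where val : Sem.pw l 0 1 a b a b ≡ ℚ.- ι (suc a″)
            val = trans (weight-01 l a b) (cong (λ n → ℚ.- ι n) eqa)
            l1 : ∀ a x → a ℚ.* x ≡ ℚ.- (x ℚ.* ℚ.- a)
            l1 = solve-∀ ℚring
    conclude zero zero eqa eqb = ⊥-elim (ℕₚ.<⇒≱ (All.lookup ps m) (ℕₚ.≤-reflexive (cong₂ ℕ._+_ eqa eqb)))

-- Induction on the degree d of the letter. W is compared with the word whose exponents of degree at
-- least d are set to 0. That word is integral by induction, and W acts like the integral V, so
-- `leading` makes x {p, w} a difference of integers. The two basic weights give x a and x b, and
-- `int-gcd` concludes.
integral-exponents : ∀ l (W V : Word) → Unique (map proj₁ W) → All (λ c → 1 ≤ deg (proj₁ c)) W → All Integral V →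
  W ≅[ l ] V → ∀ {c} → c ∈ W → deg (proj₁ c) ≤ l → Integral c
integral-exponents l W V u ps iV eq {c} m d≤l = <-rec P step (deg (proj₁ c)) c m refl d≤l
  where
  P : ℕ → Set
  P d = ∀ c → c ∈ W → deg (proj₁ c) ≡ d → d ≤ l → Integral c
  step : ∀ d → (∀ {d′} → d′ < d → P d′) → P d
  step d ih c@((a , b) , x) m dp d≤l = int-gcd a b x
      (≡.subst IsInt (trans (cong (λ z → ℚ.- (x ℚ.* z)) (weight-01 l a b)) (l1 (ι a) x)) (int-neg (key 0 1)))
      (≡.subst IsInt (cong (x ℚ.*_) (weight-10 l a b)) (key 1 0))
    where
    l1 : ∀ a x → ℚ.- (x ℚ.* ℚ.- a) ≡ x ℚ.* a
    l1 = solve-∀ ℚring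
    lt : a ℕ.+ b < suc l
    lt = s≤s (≡.subst (_≤ l) (sym dp) d≤l)
    e′ : Letter → ℚ
    e′ (q , y) with deg q ℕ.<? d
    ... | yes _ = y
    ... | no  _ = 0ℚ
    e′-small : ∀ q y → deg q < d → y ≡ e′ (q , y)
    e′-small q y r with deg q ℕ.<? d
    ... | yes _ = refl
    ... | no n  = ⊥-elim (n r)
    e′-large : ∀ q y → ¬ deg q < d → e′ (q , y) ≡ 0ℚ
    e′-large q y r with deg q ℕ.<? d
    ... | yes s = ⊥-elim (r s)
    ... | no _  = refl
    integral′ : ∀ W′ → (∀ {c} → c ∈ W′ → c ∈ W) → All Integral (letters proj₁ e′ W′)
    integral′ []            s = []
    integral′ ((q , y) ∷ W′) s = head ∷ integral′ W′ (λ m → s (there m))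
      where
      head : Integral (q , e′ (q , y))
      head with deg q ℕ.<? d
      ... | yes r = ih r (q , y) (s (here refl)) refl (ℕₚ.≤-trans (ℕₚ.<⇒≤ r) d≤l)
      ... | no _  = ≡.subst IsInt (sym (ℚₚ.*-zeroʳ (ι (gcdᴾ q)))) int-0
    self : ∀ W′ → letters proj₁ proj₂ W′ ≡ W′
    self []       = refl
    self (c ∷ W′) = cong (c ∷_) (self W′)
    key : ∀ w₁ w₂ → IsInt (x ℚ.* Sem.pw l w₁ w₂ a b a b)
    key w₁ w₂ = ≡.subst IsInt (sym formula) (int-+ valW (int-neg valW′))
      where
      pv = Sem.pw l w₁ w₂ a b a b
      A = value l w₁ w₂ W a b
      A′ = value l w₁ w₂ (letters proj₁ e′ W) a b
      valW : IsInt A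
      valW = ≡.subst IsInt (sym (value-≅ eq w₁ w₂ a b lt)) (int-word l w₁ w₂ iV a b)
      valW′ : IsInt A′
      valW′ = int-word l w₁ w₂ (integral′ W (λ m → m)) a b
      lead : A ℚ.+ 0ℚ ℚ.* pv ≡ A′ ℚ.+ x ℚ.* pv
      lead = trans (cong₂ (λ V c → value l w₁ w₂ V a b ℚ.+ c ℚ.* pv) (sym (self W))
               (sym (coefAt-zero proj₁ (a , b) e′ W (All.tabulate (λ {c′} _ q → e′-large (proj₁ c′) (proj₂ c′) (λ r → ℕₚ.<-irrefl (trans (cong deg q) dp) r))))))
             (trans (Sem.leading l w₁ w₂ proj₁ proj₂ e′ d W ps (All.tabulate (λ {c′} _ r → e′-small (proj₁ c′) (proj₂ c′) r)) a b dp lt)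
               (cong (λ z → A′ ℚ.+ z ℚ.* pv) (coefAt-unique proj₁ proj₂ W u m)))
      formula : x ℚ.* pv ≡ A ℚ.+ ℚ.- A′
      formula = trans (l2 A′ (x ℚ.* pv)) (trans (cong (ℚ._+ ℚ.- A′) (sym lead)) (l3 A pv A′))
        where l2 : ∀ a y → y ≡ (a ℚ.+ y) ℚ.+ ℚ.- a
              l2 = solve-∀ ℚring
              l3 : ∀ a p b → (a ℚ.+ 0ℚ ℚ.* p) ℚ.+ ℚ.- b ≡ a ℚ.+ ℚ.- b
              l3 = solve-∀ ℚring

-- Non-negative binomial polynomials

module N = Sums ℕₚ.+-0-commutativeMonoid

-- Pascal's rule is taken as definition because it displays the finite difference in n.
ch : ℕ → ℕ → ℕ
ch n       zero    = 1
ch zero    (suc k) = 0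
ch (suc n) (suc k) = ch n k ℕ.+ ch n (suc k)

ch-vandermonde : ∀ a b n → ch (a ℕ.+ b) n ≡ N.diag (λ i j → ch a i ℕ.* ch b j) n
ch-vandermonde zero    b zero    = refl
ch-vandermonde zero    b (suc n) = sym (trans (cong₂ ℕ._+_ (ℕₚ.+-identityʳ (ch b (suc n))) (N.diag-zero n {λ i j → ch 0 (suc i) ℕ.* ch b j} (λ _ _ _ → refl))) (ℕₚ.+-identityʳ _))
ch-vandermonde (suc a) b zero    = refl
ch-vandermonde (suc a) b (suc n) = trans (cong₂ ℕ._+_ (ch-vandermonde a b n) (ch-vandermonde a b (suc n)))
  (trans (lem (N.diag (λ i j → ch a i ℕ.* ch b j) n) (ch b (suc n) ℕ.+ 0) (N.diag (λ i j → ch a (suc i) ℕ.* ch b j) n))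
  (cong ((ch b (suc n) ℕ.+ 0) ℕ.+_) (sym (trans (N.diag-cong n (λ i j _ → ℕₚ.*-distribʳ-+ (ch b j) (ch a i) (ch a (suc i)))) (N.diag-+ n _ _)))))
  where lem : ∀ x y z → x ℕ.+ (y ℕ.+ z) ≡ y ℕ.+ (x ℕ.+ z)
        lem = ℕSolver.solve-∀

-- What the coefficient functions, graded by a degree bound B, must satisfy for cones over them to
-- behave well. `ConeOver` applied to a point gives `Poly₁`, which is closed in the same sense, and
-- applied to `Poly₁` it gives `Poly₂`.
record Closed (X : Set) (Q : ℕ → (X → ℕ) → Set) : Set where
  field
    ext   : ∀ {B f g} → (∀ x → f x ≡ g x) → Q B f → Q B g
    mono  : ∀ {B B′ f} → B ≤ B′ → Q B f → Q B′ f
    const : ∀ c → Q 0 (λ _ → c)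
    add   : ∀ {B f g} → Q B f → Q B g → Q B (λ x → f x ℕ.+ g x)
    mul   : ∀ {B B′ f g} → Q B f → Q B′ g → Q (B ℕ.+ B′) (λ x → f x ℕ.* g x)
    bino  : ∀ {B f} → Q B f → ∀ k → Q (k ℕ.* B) (λ x → ch (f x) k)
    div   : ∀ {B f f′} c d → (∀ x → suc c ℕ.* f′ x ≡ d ℕ.* f x) → Q B f → Q B f′

-- Cone A B f says that f is a non-negative combination of the binomials ch m i, i ≤ A, with coefficients in Q B.
-- It is phrased by finite differences, because these make closure under products and binomials easy.
module ConeOver {X : Set} {Q : ℕ → (X → ℕ) → Set} (cl : Closed X Q) where
  private module Q = Closed cl

  data Cone : ℕ → ℕ → (ℕ → X → ℕ) → Set where
    flat : ∀ {B f} → Q B (f 0) → (∀ m x → f m x ≡ f 0 x) → Cone 0 B f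
    grow : ∀ {A B f g} → Q B (f 0) → Cone A B g → (∀ m x → f (suc m) x ≡ f m x ℕ.+ g m x) → Cone (suc A) B f

  base : ∀ {A B f} → Cone A B f → Q B (f 0)
  base (flat q _)   = q
  base (grow q _ _) = q

  ext : ∀ {A B f g} → (∀ m x → f m x ≡ g m x) → Cone A B f → Cone A B g
  ext e (flat q c)   = flat (Q.ext (e 0) q) (λ m x → trans (sym (e m x)) (trans (c m x) (e 0 x)))
  ext e (grow q p c) = grow (Q.ext (e 0) q) p (λ m x → trans (sym (e (suc m) x)) (trans (c m x) (cong (ℕ._+ _) (e m x))))

  const : ∀ c → Cone 0 0 (λ _ _ → c)
  const c = flat (Q.const c) (λ _ _ → refl)

  monoB : ∀ {A B B′ f} → B ≤ B′ → Cone A B f → Cone A B′ f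
  monoB le (flat q c)   = flat (Q.mono le q) c
  monoB le (grow q p c) = grow (Q.mono le q) (monoB le p) c

  raise : ∀ {A B f} → Cone A B f → Cone (suc A) B f
  raise (flat q c)   = grow q (monoB z≤n (const 0)) (λ m x → trans (c (suc m) x) (trans (sym (c m x)) (sym (ℕₚ.+-identityʳ _))))
  raise (grow q p c) = grow q (raise p) c

  monoA : ∀ {A A′ B f} → A ≤ A′ → Cone A B f → Cone A′ B f
  monoA {A} {A′} {B} {f} le p = ≡.subst (λ n → Cone n B f) (ℕₚ.m∸n+n≡m le) (go (A′ ∸ A))
    where
    go : ∀ k → Cone (k ℕ.+ A) B f
    go zero    = p
    go (suc k) = raise (go k)

  mono : ∀ {A A′ B B′ f} → A ≤ A′ → B ≤ B′ → Cone A B f → Cone A′ B′ f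
  mono a b p = monoA a (monoB b p)

  add : ∀ {A B f g} → Cone A B f → Cone A B g → Cone A B (λ m x → f m x ℕ.+ g m x)
  add (flat q c) (flat q′ c′) = flat (Q.add q q′) (λ m x → cong₂ ℕ._+_ (c m x) (c′ m x))
  add (grow {f = f} {g = h} q p c) (grow {f = f′} {g = h′} q′ p′ c′) = grow (Q.add q q′) (add p p′) (λ m x → trans (cong₂ ℕ._+_ (c m x) (c′ m x)) (N.+-interchange (f m x) (h m x) (f′ m x) (h′ m x)))

  mul : ∀ {A B A′ B′ f g} → Cone A B f → Cone A′ B′ g → Cone (A ℕ.+ A′) (B ℕ.+ B′) (λ m x → f m x ℕ.* g m x)
  mul (flat q c) (flat q′ c′) = flat (Q.mul q q′) (λ m x → cong₂ ℕ._*_ (c m x) (c′ m x))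
  mul {f = f} p@(flat q c) (grow {f = g} {g = h} q′ p′ c′) = grow (Q.mul q q′) (mul p p′)
    (λ m x → trans (cong₂ ℕ._*_ (trans (c (suc m) x) (sym (c m x))) (c′ m x)) (ℕₚ.*-distribˡ-+ (f m x) (g m x) (h m x)))
  mul {g = g} (grow {f = f} {g = h} q p c) p′@(flat q′ c′) = grow (Q.mul q q′) (mul p p′)
    (λ m x → trans (cong₂ ℕ._*_ (c m x) (trans (c′ (suc m) x) (sym (c′ m x)))) (ℕₚ.*-distribʳ-+ (g m x) (f m x) (h m x)))
  -- The product rule for finite differences: Δ(fg) = Δf g + f Δg + Δf Δg.
  mul pf@(grow {A} {B} {f} {f′} q p c) pg@(grow {A′} {B′} {g} {g′} q′ p′ c′) = grow (Q.mul q q′)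
    (add (add (mul p pg) (≡.subst (λ n → Cone n (B ℕ.+ B′) (λ m x → f m x ℕ.* g′ m x)) (sym (ℕₚ.+-suc A A′)) (mul pf p′)))
         (monoA (ℕₚ.+-monoʳ-≤ A (ℕₚ.n≤1+n A′)) (mul p p′)))
    (λ m x → trans (cong₂ ℕ._*_ (c m x) (c′ m x)) (lem (f m x) (f′ m x) (g m x) (g′ m x)))
    where lem : ∀ a b c d → (a ℕ.+ b) ℕ.* (c ℕ.+ d) ≡ a ℕ.* c ℕ.+ (b ℕ.* c ℕ.+ a ℕ.* d ℕ.+ b ℕ.* d)
          lem = ℕSolver.solve-∀

  addDiag : ∀ {A B} n (F : ℕ → ℕ → ℕ → X → ℕ) → (∀ i j → i ℕ.+ j ≡ n → Cone A B (F i j)) → Cone A B (λ m x → N.diag (λ i j → F i j m x) n)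
  addDiag zero    F p = p 0 0 refl
  addDiag (suc n) F p = add (p 0 (suc n) refl) (addDiag n (λ i → F (suc i)) (λ i j e → p (suc i) j (cong suc e)))

  addSum : ∀ {A B} n (F : ℕ → ℕ → X → ℕ) → (∀ i → i < n → Cone A B (F i)) → Cone A B (λ m x → N.sum n (λ i → F i m x))
  addSum zero    F p = mono z≤n z≤n (const 0)
  addSum (suc n) F p = add (p 0 (s≤s z≤n)) (addSum n (λ i → F (suc i)) (λ i lt → p (suc i) (s≤s lt)))

  -- By Vandermonde the difference of ch(f, k + 1) is the sum of ch(f, i) ch(Δf, j + 1) over i + j =
  -- k. The second factor is handled through the cone of Δf. The first has i ≤ k, whence the bounded
  -- induction `upto`.
  bino : ∀ {A B f} → Cone A B f → ∀ k → Cone (k ℕ.* A) (k ℕ.* B) (λ m x → ch (f m x) k)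
  bino {B = B} {f} (flat q c) k = ≡.subst (λ n → Cone n (k ℕ.* B) (λ m x → ch (f m x) k)) (sym (ℕₚ.*-zeroʳ k)) (flat (Q.bino q k) (λ m x → cong (λ n → ch n k) (c m x)))
  bino (grow {A} {B} {f} {g} q p c) k = upto k k ℕₚ.≤-refl
    where
    upto : ∀ n k → k ≤ n → Cone (k ℕ.* suc A) (k ℕ.* B) (λ m x → ch (f m x) k)
    upto n       zero    _ = const 1
    upto (suc n) (suc k) (s≤s le) = grow (Q.bino q (suc k))
      (addDiag k (λ i j m x → ch (f m x) i ℕ.* ch (g m x) (suc j)) (λ i j e → mono (degA i j e) (degB i j e) (mul (upto n i (ℕₚ.≤-trans (ℕₚ.m+n≤o⇒m≤o i (ℕₚ.≤-reflexive e)) le)) (bino p (suc j)))))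
      (λ m x → trans (cong (λ z → ch z (suc k)) (c m x)) (trans (ch-vandermonde (f m x) (g m x) (suc k)) (trans (N.diag-last k (λ i j → ch (f m x) i ℕ.* ch (g m x) j))
        (trans (ℕₚ.+-comm (N.diag (λ i j → ch (f m x) i ℕ.* ch (g m x) (suc j)) k) (ch (f m x) (suc k) ℕ.* 1)) (cong (ℕ._+ N.diag (λ i j → ch (f m x) i ℕ.* ch (g m x) (suc j)) k) (ℕₚ.*-identityʳ _))))))
      where
      degA : ∀ i j → i ℕ.+ j ≡ k → i ℕ.* suc A ℕ.+ suc j ℕ.* A ≤ A ℕ.+ k ℕ.* suc A
      degA i j refl = ≡.subst₂ _≤_ (sym (l1 i j A)) (sym (l2 i j A)) (ℕₚ.m≤m+n (A ℕ.+ i ℕ.* A ℕ.+ j ℕ.* A ℕ.+ i) j)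
        where l1 : ∀ i j A → i ℕ.* suc A ℕ.+ suc j ℕ.* A ≡ A ℕ.+ i ℕ.* A ℕ.+ j ℕ.* A ℕ.+ i
              l1 = ℕSolver.solve-∀
              l2 : ∀ i j A → A ℕ.+ (i ℕ.+ j) ℕ.* suc A ≡ A ℕ.+ i ℕ.* A ℕ.+ j ℕ.* A ℕ.+ i ℕ.+ j
              l2 = ℕSolver.solve-∀
      degB : ∀ i j → i ℕ.+ j ≡ k → i ℕ.* B ℕ.+ suc j ℕ.* B ≤ suc k ℕ.* B
      degB i j refl = ℕₚ.≤-reflexive (l1 i j B)
        where l1 : ∀ i j B → i ℕ.* B ℕ.+ suc j ℕ.* B ≡ suc (i ℕ.+ j) ℕ.* B
              l1 = ℕSolver.solve-∀

  -- f is nondecreasing in m, hence so is f′, and the differences of f′ are natural numbers in the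
  -- same proportion to those of f. Exactness at all arguments thus passes to the coefficients.
  div : ∀ {A B f f′} c d → (∀ m x → suc c ℕ.* f′ m x ≡ d ℕ.* f m x) → Cone A B f → Cone A B f′
  div {f′ = f′} c d e (flat q k) = flat (Q.div c d (e 0) q) (λ m x → ℕₚ.*-cancelˡ-≡ (f′ m x) (f′ 0 x) (suc c) (trans (e m x) (trans (cong (d ℕ.*_) (k m x)) (sym (e 0 x)))))
  div {f = f} {f′ = f′} c d e (grow {g = g} q p k) = grow (Q.div c d (e 0) q)
    (div c d (λ m x → difference m x) p) (λ m x → sym (ℕₚ.m+[n∸m]≡n (le m x)))
    where
    le : ∀ m x → f′ m x ≤ f′ (suc m) x
    le m x = ℕₚ.*-cancelˡ-≤ (suc c) (≡.subst₂ _≤_ (sym (e m x)) (sym (e (suc m) x)) (ℕₚ.*-monoʳ-≤ d (≡.subst (f m x ≤_) (sym (k m x)) (ℕₚ.m≤m+n _ _))))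
    difference : ∀ m x → suc c ℕ.* (f′ (suc m) x ∸ f′ m x) ≡ d ℕ.* g m x
    difference m x = trans (ℕₚ.*-distribˡ-∸ (suc c) (f′ (suc m) x) (f′ m x)) (trans (cong₂ _∸_ (trans (e (suc m) x) (trans (cong (d ℕ.*_) (k m x)) (ℕₚ.*-distribˡ-+ d (f m x) (g m x)))) (e m x))
      (ℕₚ.m+n∸m≡n (d ℕ.* f m x) (d ℕ.* g m x)))

  -- Newton's forward difference formula: α i is the i-th difference at 0.
  expand : ∀ {A B f} → Cone A B f → Σ (ℕ → X → ℕ) λ α → (∀ i → Q B (α i)) × (∀ m x → f m x ≡ N.sum (suc A) (λ i → ch m i ℕ.* α i x))
  expand {f = f} (flat q c) = (λ _ → f 0) , (λ _ → q) , (λ m x → trans (c m x) (sym (trans (ℕₚ.+-identityʳ _) (ℕₚ.+-identityʳ _))))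
  expand {A = suc A} {f = f} (grow {g = g} q p c) with expand p
  ... | α , αq , αe = α′ , αq′ , formula
    where
    α′ : ℕ → X → ℕ
    α′ zero    = f 0
    α′ (suc i) = α i
    αq′ : ∀ i → Q _ (α′ i)
    αq′ zero    = q
    αq′ (suc i) = αq i
    formula : ∀ m x → f m x ≡ N.sum (suc (suc A)) (λ i → ch m i ℕ.* α′ i x)
    formula zero    x = sym (trans (cong₂ ℕ._+_ (ℕₚ.+-identityʳ _) (N.sum-zero (suc A) {λ i → ch 0 (suc i) ℕ.* α i x} (λ _ _ → refl))) (ℕₚ.+-identityʳ _))
    formula (suc m) x = trans (c m x) (trans (cong₂ ℕ._+_ (formula m x) (αe m x)) (trans (ℕₚ.+-assoc (ch m 0 ℕ.* f 0 x) _ _)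
      (cong (ch m 0 ℕ.* f 0 x ℕ.+_) (trans (ℕₚ.+-comm (N.sum (suc A) (λ i → ch m (suc i) ℕ.* α i x)) (N.sum (suc A) (λ i → ch m i ℕ.* α i x)))
        (trans (sym (N.sum-+ (suc A) (λ i → ch m i ℕ.* α i x) (λ i → ch m (suc i) ℕ.* α i x))) (N.sum-cong (suc A) (λ i _ → sym (ℕₚ.*-distribʳ-+ (α i x) (ch m i) (ch m (suc i))))))))))

trivial-closed : Closed ⊤ (λ _ _ → ⊤)
trivial-closed = record
  { ext = λ _ _ → tt ; mono = λ _ _ → tt ; const = λ _ → tt ; add = λ _ _ → tt ; mul = λ _ _ → tt ; bino = λ _ _ → tt ; div = λ _ _ _ _ → tt }

module Cone₁ = ConeOver trivial-closed

Poly₁ : ℕ → (ℕ → ℕ) → Set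
Poly₁ B h = Cone₁.Cone B 0 (λ n _ → h n)

poly₁-closed : Closed ℕ Poly₁
poly₁-closed = record
  { ext = λ e → Cone₁.ext (λ m _ → e m)
  ; mono = Cone₁.monoA
  ; const = Cone₁.const
  ; add = Cone₁.add
  ; mul = Cone₁.mul
  ; bino = λ {B} {f} p k → ≡.subst (λ z → Cone₁.Cone (k ℕ.* B) z (λ n _ → ch (f n) k)) (ℕₚ.*-zeroʳ k) (Cone₁.bino p k)
  ; div = λ c d e → Cone₁.div c d (λ m _ → e m) }

module Cone₂ = ConeOver poly₁-closed
open Cone₂ public using () renaming (Cone to Poly₂)

expand₂ : ∀ {A B f} → Poly₂ A B f → Σ (ℕ → ℕ → ℕ) λ α →
  ∀ m n → f m n ≡ N.sum (suc A) (λ i → ch m i ℕ.* N.sum (suc B) (λ j → ch n j ℕ.* α i j))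
expand₂ {A} p with Cone₂.expand p
... | β , βq , βe = (λ i j → proj₁ (Cone₁.expand (βq i)) j tt) ,
  (λ m n → trans (βe m n) (N.sum-cong (suc A) (λ i _ → cong (ch m i ℕ.*_) (proj₂ (proj₂ (Cone₁.expand (βq i))) n tt))))

scale₂ : ∀ {A B f} c → Poly₂ A B f → Poly₂ A B (λ m n → c ℕ.* f m n)
scale₂ c p = Cone₂.mul (Cone₂.const c) p

-- Z is expanded in products of binomials of orders r ≤ i and s ≤ j, and the arguments are
-- substituted there. `bino` multiplies their degrees by r and s.
compose₂ : ∀ {i j Z A B A′ B′ M N′} → Poly₂ i j Z → Poly₂ A B M → Poly₂ A′ B′ N′ →
  Poly₂ (i ℕ.* A ℕ.+ j ℕ.* A′) (i ℕ.* B ℕ.+ j ℕ.* B′) (λ m n → Z (M m n) (N′ m n))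
compose₂ {i} {j} {Z} {A} {B} {A′} {B′} {M} {N′} z p q with expand₂ z
... | α , e = Cone₂.ext (λ m n → sym (e (M m n) (N′ m n)))
  (Cone₂.addSum (suc i) _ (λ r r<i → Cone₂.mono (bound r r<i A A′) (bound r r<i B B′)
    (Cone₂.mul (Cone₂.bino p r) (Cone₂.addSum {j ℕ.* A′} {j ℕ.* B′} (suc j) (λ s m n → ch (N′ m n) s ℕ.* α r s) (λ s s<j →
      Cone₂.mono (bound′ s s<j A′) (bound′ s s<j B′) (Cone₂.mul (Cone₂.bino q s) (Cone₂.const (α r s))))))))
  where
  bound : ∀ r → r < suc i → ∀ A A′ → r ℕ.* A ℕ.+ j ℕ.* A′ ≤ i ℕ.* A ℕ.+ j ℕ.* A′
  bound r (s≤s r≤i) A A′ = ℕₚ.+-monoˡ-≤ (j ℕ.* A′) (ℕₚ.*-monoˡ-≤ A r≤i)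
  bound′ : ∀ s → s < suc j → ∀ A′ → s ℕ.* A′ ℕ.+ 0 ≤ j ℕ.* A′
  bound′ s (s≤s s≤j) A′ = ℕₚ.≤-trans (ℕₚ.≤-reflexive (ℕₚ.+-identityʳ _)) (ℕₚ.*-monoˡ-≤ A′ s≤j)

slice₂ : ∀ {A B f} → Poly₂ A B f → ∀ m → Poly₁ B (f m)
slice₂ (Cone₂.flat q c) m = Closed.ext poly₁-closed (λ n → sym (c m n)) q
slice₂ (Cone₂.grow q p c) zero = q
slice₂ pf@(Cone₂.grow q p c) (suc m) = Closed.ext poly₁-closed (λ n → sym (c m n)) (Closed.add poly₁-closed (slice₂ pf m) (slice₂ p m))

constant₂ : ∀ {B h} → Poly₁ B h → Poly₂ 0 B (λ _ n → h n)
constant₂ p = Cone₂.flat p (λ _ _ → refl)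

-- The finite difference of the partial sums is f, so summation over m costs one degree in m.
accumulate₂ : ∀ {A B f} → Poly₂ A B f → Poly₂ (suc A) B (λ m n → N.sum m (λ k → f k n))
accumulate₂ {f = f} p = Cone₂.grow (Closed.mono poly₁-closed z≤n (Closed.const poly₁-closed 0)) p (λ m n → N.sum-last m (λ k → f k n))

accumulate₁ : ∀ {B h} → Poly₁ B h → Poly₁ (suc B) (λ n → N.sum n h)
accumulate₁ {h = h} p = Cone₁.grow tt p (λ n _ → N.sum-last n h)

-- The order on lattice points

infix 4 _≺_
data _≺_ : Pt → Pt → Set where
  steeper : ∀ {a b c d} → b ℕ.* c < a ℕ.* d → (a , b) ≺ (c , d)
  longer  : ∀ {a b c d} → b ℕ.* c ≡ a ℕ.* d → a ℕ.+ b < c ℕ.+ d → (a , b) ≺ (c , d)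

private
  true⇒True : ∀ {b} → b ≡ true → True b
  true⇒True refl = _
  True⇒true : ∀ {b} → True b → b ≡ true
  True⇒true {true} _ = refl

<ₒ⇒≺ : ∀ p q → (p <ₒ q) ≡ true → p ≺ q
<ₒ⇒≺ (a , b) (c , d) e with b ℕ.* c ℕ.<ᵇ a ℕ.* d in e₁
... | true = steeper (ℕₚ.<ᵇ⇒< _ _ (true⇒True e₁))
... | false with b ℕ.* c ℕ.≡ᵇ a ℕ.* d in e₂ | a ℕ.+ b ℕ.<ᵇ c ℕ.+ d in e₃
<ₒ⇒≺ (a , b) (c , d) refl | false | true | true = longer (ℕₚ.≡ᵇ⇒≡ _ _ (true⇒True e₂)) (ℕₚ.<ᵇ⇒< _ _ (true⇒True e₃))

≺⇒<ₒ : ∀ p q → p ≺ q → (p <ₒ q) ≡ true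
≺⇒<ₒ (a , b) (c , d) (steeper lt) rewrite True⇒true (ℕₚ.<⇒<ᵇ lt) = refl
≺⇒<ₒ (a , b) (c , d) (longer e lt) rewrite True⇒true (ℕₚ.≡⇒≡ᵇ _ _ e) | True⇒true (ℕₚ.<⇒<ᵇ lt) with b ℕ.* c ℕ.<ᵇ a ℕ.* d
... | true  = refl
... | false = refl

≺-irrefl : ∀ {p} → ¬ p ≺ p
≺-irrefl {a , b} (steeper lt)  = ℕₚ.<-irrefl (ℕₚ.*-comm b a) lt
≺-irrefl {a , b} (longer _ lt) = ℕₚ.<-irrefl refl lt

≺-asym : ∀ {p q} → p ≺ q → ¬ q ≺ p
≺-asym {a , b} {c , d} (steeper lt) (steeper lt′) = ℕₚ.<-asym lt (≡.subst₂ _<_ (ℕₚ.*-comm d a) (ℕₚ.*-comm c b) lt′)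
≺-asym {a , b} {c , d} (steeper lt) (longer e _)  = ℕₚ.<-irrefl (trans (ℕₚ.*-comm b c) (trans (sym e) (ℕₚ.*-comm d a))) lt
≺-asym {a , b} {c , d} (longer e _) (steeper lt)  = ℕₚ.<-irrefl (trans (ℕₚ.*-comm d a) (trans (sym e) (ℕₚ.*-comm b c))) lt
≺-asym (longer _ lt) (longer _ lt′) = ℕₚ.<-asym lt lt′

parallel-equal : ∀ {a b c d} → 1 ≤ a ℕ.+ b → b ℕ.* c ≡ a ℕ.* d → a ℕ.+ b ≡ c ℕ.+ d → (a , b) ≡ (c , d)
parallel-equal {a} {b} {c} {d} 1≤ e s = cong₂ _,_ a≡c b≡d
  where
  same : (a ℕ.+ b) ℕ.* d ≡ (a ℕ.+ b) ℕ.* b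
  same = trans (ℕₚ.*-distribʳ-+ d a b) (trans (cong (ℕ._+ b ℕ.* d) (sym e)) (trans (sym (ℕₚ.*-distribˡ-+ b c d)) (trans (cong (b ℕ.*_) (sym s)) (ℕₚ.*-comm b (a ℕ.+ b)))))
  b≡d : b ≡ d
  b≡d = sym (ℕₚ.*-cancelˡ-≡ d b (a ℕ.+ b) {{ℕ.>-nonZero 1≤}} same)
  a≡c : a ≡ c
  a≡c = ℕₚ.+-cancelʳ-≡ b a c (trans s (cong (c ℕ.+_) (sym b≡d)))

≺-trichotomy : ∀ p q → 1 ≤ deg p → p ≺ q ⊎ p ≡ q ⊎ q ≺ p
≺-trichotomy (a , b) (c , d) 1≤ with ℕₚ.<-cmp (b ℕ.* c) (a ℕ.* d)
... | tri< lt _ _ = inj₁ (steeper lt)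
... | tri> _ _ gt = inj₂ (inj₂ (steeper (≡.subst₂ _<_ (ℕₚ.*-comm a d) (ℕₚ.*-comm b c) gt)))
... | tri≈ _ e _ with ℕₚ.<-cmp (a ℕ.+ b) (c ℕ.+ d)
...   | tri< lt _ _ = inj₁ (longer e lt)
...   | tri> _ _ gt = inj₂ (inj₂ (longer (trans (ℕₚ.*-comm d a) (trans (sym e) (ℕₚ.*-comm b c))) gt))
...   | tri≈ _ s _ = inj₂ (inj₁ (parallel-equal 1≤ e s))

private
  c1 : ∀ b e c → b ℕ.* e ℕ.* c ≡ b ℕ.* c ℕ.* e
  c1 = ℕSolver.solve-∀
  c2 : ∀ a d e → a ℕ.* d ℕ.* e ≡ a ℕ.* (d ℕ.* e)
  c2 = ℕSolver.solve-∀
  c3 : ∀ a c f → a ℕ.* (c ℕ.* f) ≡ a ℕ.* f ℕ.* c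
  c3 = ℕSolver.solve-∀
  d1 : ∀ b e d → b ℕ.* e ℕ.* d ≡ b ℕ.* (d ℕ.* e)
  d1 = ℕSolver.solve-∀
  d2 : ∀ b c f → b ℕ.* (c ℕ.* f) ≡ b ℕ.* c ℕ.* f
  d2 = ℕSolver.solve-∀
  d3 : ∀ a d f → a ℕ.* d ℕ.* f ≡ a ℕ.* f ℕ.* d
  d3 = ℕSolver.solve-∀

  -- The two inequalities are cross-multiplied by the coordinate of the middle vector that is
  -- positive, which is then cancelled.
  slope-≤ : ∀ a b c d e f → 1 ≤ c ℕ.+ d → b ℕ.* c ≤ a ℕ.* d → d ℕ.* e ≤ c ℕ.* f → b ℕ.* e ≤ a ℕ.* f
  slope-≤ a b (suc c) d e f _ p q = ℕₚ.*-cancelʳ-≤ (b ℕ.* e) (a ℕ.* f) (suc c)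
    (≡.subst₂ _≤_ (sym (c1 b e (suc c))) (c3 a (suc c) f) (ℕₚ.≤-trans (ℕₚ.*-monoˡ-≤ e p) (≡.subst (_≤ a ℕ.* (suc c ℕ.* f)) (sym (c2 a d e)) (ℕₚ.*-monoʳ-≤ a q))))
  slope-≤ a b zero (suc d) e f _ p q = ℕₚ.*-cancelʳ-≤ (b ℕ.* e) (a ℕ.* f) (suc d)
    (≡.subst₂ _≤_ (sym (d1 b e (suc d))) (d3 a (suc d) f) (ℕₚ.≤-trans (ℕₚ.*-monoʳ-≤ b q) (≡.subst (_≤ a ℕ.* suc d ℕ.* f) (sym (d2 b 0 f)) (ℕₚ.*-monoˡ-≤ f p))))

≺-trans : ∀ {p q r} → 1 ≤ deg p → 1 ≤ deg q → 1 ≤ deg r → p ≺ q → q ≺ r → p ≺ r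
≺-trans {a , b} {c , d} {e , f} 1p 1q 1r u v with ℕₚ.<-cmp (b ℕ.* e) (a ℕ.* f)
... | tri< lt _ _ = steeper lt
... | tri> _ _ gt = ⊥-elim (ℕₚ.<⇒≱ gt (slope-≤ a b c d e f 1q (weak u) (weak v)))
  where
  weak : ∀ {a b c d} → (a , b) ≺ (c , d) → b ℕ.* c ≤ a ℕ.* d
  weak (steeper lt)  = ℕₚ.<⇒≤ lt
  weak (longer eq _) = ℕₚ.≤-reflexive eq
... | tri≈ _ eq _ = combine u v
  where
  weak : ∀ {a b c d} → (a , b) ≺ (c , d) → b ℕ.* c ≤ a ℕ.* d
  weak (steeper lt)  = ℕₚ.<⇒≤ lt
  weak (longer eq _) = ℕₚ.≤-reflexive eq
  back : d ℕ.* e ≤ c ℕ.* f → a ℕ.* d ≤ b ℕ.* c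
  back q = ≡.subst₂ _≤_ (ℕₚ.*-comm d a) (ℕₚ.*-comm c b) (slope-≤ c d e f a b 1r q (ℕₚ.≤-reflexive (trans (ℕₚ.*-comm f a) (trans (sym eq) (ℕₚ.*-comm b e)))))
  back′ : b ℕ.* c ≤ a ℕ.* d → c ℕ.* f ≤ d ℕ.* e
  back′ p = ≡.subst₂ _≤_ (ℕₚ.*-comm f c) (ℕₚ.*-comm e d) (slope-≤ e f a b c d 1p (ℕₚ.≤-reflexive (trans (ℕₚ.*-comm f a) (trans (sym eq) (ℕₚ.*-comm b e)))) p)
  combine : (a , b) ≺ (c , d) → (c , d) ≺ (e , f) → (a , b) ≺ (e , f)
  combine (steeper lt) v = ⊥-elim (ℕₚ.<⇒≱ lt (back (weak v)))
  combine (longer e₁ s) (steeper lt) = ⊥-elim (ℕₚ.<⇒≱ lt (back′ (ℕₚ.≤-reflexive e₁)))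
  combine (longer _ s) (longer _ s′) = longer eq (ℕₚ.<-trans s s′)

∈-insert : ∀ x ys {z} → z ∈ insert x ys → z ≡ x ⊎ z ∈ ys
∈-insert x []       (here e) = inj₁ e
∈-insert x (y ∷ ys) m with x <ₒ y
∈-insert x (y ∷ ys) (here e)  | true  = inj₁ e
∈-insert x (y ∷ ys) (there m) | true  = inj₂ m
∈-insert x (y ∷ ys) (here e)  | false = inj₂ (here e)
∈-insert x (y ∷ ys) (there m) | false with ∈-insert x ys m
... | inj₁ e = inj₁ e
... | inj₂ n = inj₂ (there n)

insert-∈ : ∀ x ys {z} → z ≡ x ⊎ z ∈ ys → z ∈ insert x ys
insert-∈ x []       (inj₁ e) = here e
insert-∈ x (y ∷ ys) m with x <ₒ y
insert-∈ x (y ∷ ys) (inj₁ e)         | true  = here e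
insert-∈ x (y ∷ ys) (inj₂ m)         | true  = there m
insert-∈ x (y ∷ ys) (inj₁ e)         | false = there (insert-∈ x ys (inj₁ e))
insert-∈ x (y ∷ ys) (inj₂ (here e))  | false = here e
insert-∈ x (y ∷ ys) (inj₂ (there m)) | false = there (insert-∈ x ys (inj₂ m))

Sorted : List Pt → Set
Sorted = AllPairs _≺_

insert-sorted : ∀ x ys → 1 ≤ deg x → All (λ y → 1 ≤ deg y) ys → x ∉ ys → Sorted ys → Sorted (insert x ys)
insert-sorted x []       1x []        _ []       = [] ∷ []
insert-sorted x (y ∷ ys) 1x (1y ∷ 1ys) x∉ (h ∷ s) with x <ₒ y in eq
... | true  = (x≺y ∷ All.tabulate (λ {z} m → ≺-trans 1x 1y (All.lookup 1ys m) x≺y (All.lookup h m))) ∷ (h ∷ s)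
  where x≺y = <ₒ⇒≺ x y eq
... | false = All.tabulate (λ {z} m → bound z (∈-insert x ys m)) ∷ insert-sorted x ys 1x 1ys (λ m → x∉ (there m)) s
  where
  y≺x : y ≺ x
  y≺x with ≺-trichotomy x y 1x
  ... | inj₁ lt with trans (sym eq) (≺⇒<ₒ x y lt)
  ...   | ()
  y≺x | inj₂ (inj₁ e)  = ⊥-elim (x∉ (here e))
  y≺x | inj₂ (inj₂ gt) = gt
  bound : ∀ z → z ≡ x ⊎ z ∈ ys → y ≺ z
  bound z (inj₁ refl) = y≺x
  bound z (inj₂ m)    = All.lookup h m

∈-sort : ∀ xs {z} → z ∈ sortₒ xs → z ∈ xs
∈-sort (x ∷ xs) m with ∈-insert x (sortₒ xs) m
... | inj₁ e = here e
... | inj₂ n = there (∈-sort xs n)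

sort-∈ : ∀ xs {z} → z ∈ xs → z ∈ sortₒ xs
sort-∈ (x ∷ xs) (here e)  = insert-∈ x (sortₒ xs) (inj₁ e)
sort-∈ (x ∷ xs) (there m) = insert-∈ x (sortₒ xs) (inj₂ (sort-∈ xs m))

sort-sorted : ∀ xs → All (λ y → 1 ≤ deg y) xs → Unique xs → Sorted (sortₒ xs)
sort-sorted []       []        []       = []
sort-sorted (x ∷ xs) (1x ∷ 1xs) (h ∷ u) = insert-sorted x (sortₒ xs) 1x (All.tabulate (λ m → All.lookup 1xs (∈-sort xs m)))
  (λ m → All.lookup h (∈-sort xs m) refl) (sort-sorted xs 1xs u)

∈-filterᵇ : ∀ {A : Set} (P : A → Bool) xs {z} → z ∈ filterᵇ P xs → z ∈ xs × P z ≡ true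
∈-filterᵇ P (x ∷ xs) m with P x in eq
∈-filterᵇ P (x ∷ xs) (here refl) | true  = here refl , eq
∈-filterᵇ P (x ∷ xs) (there m)   | true  = there (proj₁ (∈-filterᵇ P xs m)) , proj₂ (∈-filterᵇ P xs m)
∈-filterᵇ P (x ∷ xs) m           | false = there (proj₁ (∈-filterᵇ P xs m)) , proj₂ (∈-filterᵇ P xs m)

filterᵇ-∈ : ∀ {A : Set} (P : A → Bool) xs {z} → z ∈ xs → P z ≡ true → z ∈ filterᵇ P xs
filterᵇ-∈ P (x ∷ xs) (here refl) e rewrite e = here refl
filterᵇ-∈ P (x ∷ xs) (there m)   e with P x
... | true  = there (filterᵇ-∈ P xs m e)
... | false = filterᵇ-∈ P xs m e

filterᵇ-AllPairs : ∀ {A : Set} {R : A → A → Set} (P : A → Bool) {xs} → AllPairs R xs → AllPairs R (filterᵇ P xs)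
filterᵇ-AllPairs P []      = []
filterᵇ-AllPairs P {x ∷ xs} (h ∷ s) with P x
... | true  = All.tabulate (λ m → All.lookup h (proj₁ (∈-filterᵇ P xs m))) ∷ filterᵇ-AllPairs P s
... | false = filterᵇ-AllPairs P s

grid≡ : ∀ d → grid d ≡ cartesianProduct (upTo (suc d)) (upTo (suc d))
grid≡ d = go (upTo (suc d)) (upTo (suc d))
  where
  go : ∀ xs (ys : List ℕ) → concatMap (λ r → map (r ,_) ys) xs ≡ cartesianProduct xs ys
  go []       ys = refl
  go (x ∷ xs) ys = cong (map (x ,_) ys ++_) (go xs ys)

private
  inRange : ℕ → Pt → Bool
  inRange l p = (1 ℕ.≤ᵇ deg p) ∧ (deg p ℕ.≤ᵇ l)

  inRange-true : ∀ l p → inRange l p ≡ true → (1 ≤ deg p) × (deg p ≤ l)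
  inRange-true l p e with 1 ℕ.≤ᵇ deg p in e₁ | deg p ℕ.≤ᵇ l in e₂
  inRange-true l p refl | true | true = ℕₚ.≤ᵇ⇒≤ 1 (deg p) (true⇒True e₁) , ℕₚ.≤ᵇ⇒≤ (deg p) l (true⇒True e₂)

  true-inRange : ∀ l p → 1 ≤ deg p → deg p ≤ l → inRange l p ≡ true
  true-inRange l p u v rewrite True⇒true (ℕₚ.≤⇒≤ᵇ u) | True⇒true (ℕₚ.≤⇒≤ᵇ v) = refl

posPairs-range : ∀ l {p} → p ∈ posPairs l → (1 ≤ deg p) × (deg p ≤ l)
posPairs-range l {p} m = inRange-true l p (proj₂ (∈-filterᵇ (inRange l) (grid l) (∈-sort (filterᵇ (inRange l) (grid l)) m)))

posPairs-complete : ∀ l p → 1 ≤ deg p → deg p ≤ l → p ∈ posPairs l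
posPairs-complete l p@(a , b) u v = sort-∈ (filterᵇ (inRange l) (grid l)) (filterᵇ-∈ (inRange l) (grid l)
  (≡.subst (p ∈_) (sym (grid≡ l)) (Memₚ.∈-cartesianProduct⁺ (Memₚ.∈-upTo⁺ (s≤s (ℕₚ.≤-trans (ℕₚ.m≤m+n a b) v))) (Memₚ.∈-upTo⁺ (s≤s (ℕₚ.≤-trans (ℕₚ.m≤n+m b a) v)))))
  (true-inRange l p u v))

posPairs-sorted : ∀ l → Sorted (posPairs l)
posPairs-sorted l = sort-sorted (filterᵇ (inRange l) (grid l))
  (All.tabulate (λ {p} m → proj₁ (inRange-true l p (proj₂ (∈-filterᵇ (inRange l) (grid l) m)))))
  (filterᵇ-AllPairs (inRange l) (≡.subst Unique (sym (grid≡ l)) (Uniqueₚ.cartesianProduct⁺ (Uniqueₚ.upTo⁺ (suc l)) (Uniqueₚ.upTo⁺ (suc l)))))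

sorted-unique : ∀ {L} → Sorted L → Unique L
sorted-unique = AllPairs.map (λ { lt refl → ≺-irrefl lt })

onX onY interiorᵇ : Pt → Bool
onX (_ , zero)  = true
onX (_ , suc _) = false
onY (zero  , suc _) = true
onY _               = false
interiorᵇ (suc _ , suc _) = true
interiorᵇ _               = false

interior : ℕ → List Pt
interior l = filterᵇ interiorᵇ (posPairs l)

interiorᵇ-true : ∀ p → interiorᵇ p ≡ true → Interior p
interiorᵇ-true (suc _ , suc _) _ = s≤s z≤n , s≤s z≤n
interiorᵇ-true (zero  , _)     ()
interiorᵇ-true (suc _ , zero)  ()

interior-true : ∀ p → Interior p → interiorᵇ p ≡ true
interior-true (suc _ , suc _) _ = refl
interior-true (zero  , _)     (() , _)
interior-true (suc _ , zero)  (_ , ())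

interior-range : ∀ l {p} → p ∈ interior l → Interior p × (deg p ≤ l)
interior-range l {p} m with ∈-filterᵇ interiorᵇ (posPairs l) m
... | n , e = interiorᵇ-true p e , proj₂ (posPairs-range l n)

interior-complete : ∀ l p → Interior p → deg p ≤ l → p ∈ interior l
interior-complete l p@(suc a , b) i v = filterᵇ-∈ interiorᵇ (posPairs l) (posPairs-complete l p (s≤s z≤n) v) (interior-true p i)

interior-sorted : ∀ l → Sorted (interior l)
interior-sorted l = filterᵇ-AllPairs interiorᵇ (posPairs-sorted l)

-- Under `≺` the first axis precedes all interior points and the second axis follows them, so
-- filtering by the three classes keeps the order.
axes-split : ∀ L → Sorted L → All (λ p → 1 ≤ deg p) L → L ≡ filterᵇ onX L ++ filterᵇ interiorᵇ L ++ filterᵇ onY L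
axes-split [] [] [] = refl
axes-split ((a , zero) ∷ L) (h ∷ s) (1p ∷ ps) = cong ((a , 0) ∷_) (trans (axes-split L s ps) (cong₂ (λ u v → filterᵇ onX L ++ u ++ v) (sym (skip a)) (sym (skip′ a))))
  where
  skip : ∀ a → filterᵇ interiorᵇ ((a , 0) ∷ L) ≡ filterᵇ interiorᵇ L
  skip zero    = refl
  skip (suc _) = refl
  skip′ : ∀ a → filterᵇ onY ((a , 0) ∷ L) ≡ filterᵇ onY L
  skip′ zero    = refl
  skip′ (suc _) = refl
axes-split ((suc a , suc b) ∷ L) (h ∷ s) (1p ∷ ps) = trans (cong ((suc a , suc b) ∷_) (trans (axes-split L s ps) (cong (_++ filterᵇ interiorᵇ L ++ filterᵇ onY L) noX)))
  (cong (_++ (suc a , suc b) ∷ filterᵇ interiorᵇ L ++ filterᵇ onY L) (sym noX))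
  where
  none : ∀ L → All ((suc a , suc b) ≺_) L → All (λ p → 1 ≤ deg p) L → filterᵇ onX L ≡ []
  none [] [] [] = refl
  none ((suc c , zero) ∷ L) (steeper lt ∷ _) _ = ⊥-elim (ℕₚ.n≮0 (≡.subst (suc b ℕ.* suc c <_) (ℕₚ.*-zeroʳ a) lt))
  none ((suc c , zero) ∷ L) (longer e _ ∷ _) _ with trans e (ℕₚ.*-zeroʳ a)
  ... | ()
  none ((c , suc d) ∷ L) (_ ∷ h) (_ ∷ ps) = none L h ps
  none ((zero , zero) ∷ L) _ (() ∷ _)
  noX : filterᵇ onX L ≡ []
  noX = none L h ps
axes-split ((zero , suc b) ∷ L) (h ∷ s) (1p ∷ ps) = trans (cong ((0 , suc b) ∷_) (proj₂ (proj₂ all))) (cong₂ (λ u v → u ++ v ++ (0 , suc b) ∷ filterᵇ onY L) (sym (proj₁ all)) (sym (proj₁ (proj₂ all))))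
  where
  only : ∀ L → All ((0 , suc b) ≺_) L → All (λ p → 1 ≤ deg p) L → filterᵇ onX L ≡ [] × filterᵇ interiorᵇ L ≡ [] × L ≡ filterᵇ onY L
  only [] [] [] = refl , refl , refl
  only ((zero , zero) ∷ L) _ (() ∷ _)
  only ((zero , suc d) ∷ L) (_ ∷ h) (_ ∷ ps) with only L h ps
  ... | u , v , w = u , v , cong ((0 , suc d) ∷_) w
  only ((suc c , d) ∷ L) (steeper () ∷ _) _
  only ((suc c , d) ∷ L) (longer () _ ∷ _) _
  all = only L h ps

-- Reordering of words

~≡ : ∀ {l U V} → U ≡ V → U ~[ l ] V
~≡ refl = ~refl

~∷ : ∀ {l} c {U V} → U ~[ l ] V → c ∷ U ~[ l ] c ∷ V
~∷ c e = ~++ (~refl {W = c ∷ []}) e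

~++ˡ : ∀ {l} U {V V′} → V ~[ l ] V′ → U ++ V ~[ l ] U ++ V′
~++ˡ U e = ~++ (~refl {W = U}) e

~++ʳ : ∀ {l U U′} V → U ~[ l ] U′ → U ++ V ~[ l ] U′ ++ V
~++ʳ V e = ~++ e (~refl {W = V})

infixr 2 _~⟨_⟩_
infix  3 _~∎
_~⟨_⟩_ : ∀ {l} U {V W} → U ~[ l ] V → V ~[ l ] W → U ~[ l ] W
U ~⟨ e ⟩ e′ = ~trans e e′
_~∎ : ∀ {l} W → W ~[ l ] W
W ~∎ = ~refl

coarsen : ∀ {l l′ U V} → l ≤ l′ → U ~[ l′ ] V → U ~[ l ] V
coarsen le ~refl = ~refl
coarsen le (~sym e) = ~sym (coarsen le e)
coarsen le (~trans e e′) = ~trans (coarsen le e) (coarsen le e′)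
coarsen le (~++ e e′) = ~++ (coarsen le e) (coarsen le e′)
coarsen le (merge p x y i) = merge p x y i
coarsen le (unit p) = unit p
coarsen le (parallel p q x y d) = parallel p q x y d
coarsen le (truncate p x i lt) = truncate p x i (ℕₚ.≤-<-trans le lt)
coarsen le (central p q x y i lt) = central p q x y i (ℕₚ.≤-<-trans le lt)
coarsen le (pentagon p q D i d) = pentagon p q D i d

-- The similarity transformation (i , j) ↦ i q + j p, which multiplies the form by D = {p , q}.
module Similarity (p q : Pt) (D : ℕ) (1≤D : 1 ≤ D) (det : Det p q D) (3≤ : 3 ≤ deg p ℕ.+ deg q) where
  private
    p₁ = proj₁ p
    p₂ = proj₂ p
    q₁ = proj₁ q
    q₂ = proj₂ q

  Fm : Pt → Pt
  Fm (i , j) = (i ℕ.* q₁ ℕ.+ j ℕ.* p₁ , i ℕ.* q₂ ℕ.+ j ℕ.* p₂)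

  Fletter : Letter → Letter
  Fletter (r , x) = (Fm r , x ℚ.* inv D)

  Fword : Word → Word
  Fword = map Fletter

  private
    p₂q₁≥1 : 1 ≤ p₂ ℕ.* q₁
    p₂q₁≥1 = ℕₚ.≤-trans 1≤D (≡.subst (D ≤_) (sym det) (ℕₚ.m≤n+m D (p₁ ℕ.* q₂)))

  p₂≥1 : 1 ≤ p₂
  p₂≥1 = pos p₂ p₂q₁≥1
    where pos : ∀ n → 1 ≤ n ℕ.* q₁ → 1 ≤ n
          pos (suc n) _ = s≤s z≤n

  q₁≥1 : 1 ≤ q₁
  q₁≥1 = pos q₁ p₂q₁≥1
    where pos : ∀ n → 1 ≤ p₂ ℕ.* n → 1 ≤ n
          pos zero    h = ⊥-elim (ℕₚ.<⇒≱ h (ℕₚ.≤-reflexive (ℕₚ.*-zeroʳ p₂)))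
          pos (suc n) _ = s≤s z≤n

  deg-p≥1 : 1 ≤ deg p
  deg-p≥1 = ℕₚ.≤-trans p₂≥1 (ℕₚ.m≤n+m p₂ p₁)

  deg-q≥1 : 1 ≤ deg q
  deg-q≥1 = ℕₚ.≤-trans q₁≥1 (ℕₚ.m≤m+n q₁ q₂)

  deg-Fm : ∀ i j → deg (Fm (i , j)) ≡ i ℕ.* deg q ℕ.+ j ℕ.* deg p
  deg-Fm i j = lem i j p₁ p₂ q₁ q₂
    where lem : ∀ i j a b c d → (i ℕ.* c ℕ.+ j ℕ.* a) ℕ.+ (i ℕ.* d ℕ.+ j ℕ.* b) ≡ i ℕ.* (c ℕ.+ d) ℕ.+ j ℕ.* (a ℕ.+ b)
          lem = ℕSolver.solve-∀

  deg-Fm-≥ : ∀ r → deg r ≤ deg (Fm r)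
  deg-Fm-≥ (i , j) = ≡.subst (i ℕ.+ j ≤_) (sym (deg-Fm i j)) (ℕₚ.+-mono-≤ (grow i deg-q≥1) (grow j deg-p≥1))
    where grow : ∀ k {d} → 1 ≤ d → k ≤ k ℕ.* d
          grow k h = ≡.subst (_≤ k ℕ.* _) (ℕₚ.*-identityʳ k) (ℕₚ.*-monoʳ-≤ k h)

  -- One of deg p and deg q is at least 2, and since i and j are positive, its multiple grows
  -- strictly.
  deg-Fm-interior : ∀ r → Interior r → deg r < deg (Fm r)
  deg-Fm-interior (i , j) (1≤i , 1≤j) = ≡.subst (i ℕ.+ j <_) (sym (deg-Fm i j)) (go (deg p) (deg q) deg-p≥1 deg-q≥1 3≤)
    where
    grow : ∀ k {d} → 1 ≤ d → k ≤ k ℕ.* d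
    grow k h = ≡.subst (_≤ k ℕ.* _) (ℕₚ.*-identityʳ k) (ℕₚ.*-monoʳ-≤ k h)
    grow2 : ∀ k d → 1 ≤ k → k < k ℕ.* suc (suc d)
    grow2 (suc k) d _ = ℕₚ.m<m*n (suc k) (suc (suc d)) (s≤s (s≤s z≤n))
    go : ∀ P Q → 1 ≤ P → 1 ≤ Q → 3 ≤ P ℕ.+ Q → i ℕ.+ j < i ℕ.* Q ℕ.+ j ℕ.* P
    go (suc zero) (suc zero) _ _ (s≤s (s≤s ()))
    go P (suc (suc Q)) 1≤P _ _ = ℕₚ.+-mono-<-≤ (grow2 i Q 1≤i) (grow j 1≤P)
    go (suc (suc P)) Q _ 1≤Q _ = ℕₚ.+-mono-≤-< (grow i 1≤Q) (grow2 j P 1≤j)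

  deg-Fm-> : ∀ r → Interior r → (deg p < deg (Fm r)) × (deg q < deg (Fm r))
  deg-Fm-> (suc i , suc j) _ = ≡.subst (deg p <_) (sym (deg-Fm (suc i) (suc j))) (≡.subst (deg p <_) (ℕₚ.+-comm (suc j ℕ.* deg p) (suc i ℕ.* deg q)) (m<m+n′ (deg p) (ℕₚ.m≤m+n (deg p) (j ℕ.* deg p)) (ℕₚ.≤-trans deg-q≥1 (ℕₚ.m≤m+n (deg q) (i ℕ.* deg q)))))
                             , ≡.subst (deg q <_) (sym (deg-Fm (suc i) (suc j))) (m<m+n′ (deg q) (ℕₚ.m≤m+n (deg q) (i ℕ.* deg q)) (ℕₚ.≤-trans deg-p≥1 (ℕₚ.m≤m+n (deg p) (j ℕ.* deg p))))
    where
    m<m+n′ : ∀ m {a b} → m ≤ a → 1 ≤ b → m < a ℕ.+ b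
    m<m+n′ m {a} {b} h k = ℕₚ.<-≤-trans (ℕₚ.m<m+n m k) (ℕₚ.+-monoˡ-≤ b h)
  deg-Fm-> (zero  , _)    (() , _)
  deg-Fm-> (suc _ , zero) (_ , ())

  Fm-interior : ∀ r → Interior r → Interior (Fm r)
  Fm-interior (suc i , suc j) _ = ℕₚ.≤-trans q₁≥1 (ℕₚ.≤-trans (ℕₚ.m≤m+n q₁ (i ℕ.* q₁)) (ℕₚ.m≤m+n _ _))
                                , ℕₚ.≤-trans p₂≥1 (ℕₚ.≤-trans (ℕₚ.m≤m+n p₂ (j ℕ.* p₂)) (ℕₚ.m≤n+m _ (suc i ℕ.* q₂)))
  Fm-interior (zero  , _)    (() , _)
  Fm-interior (suc _ , zero) (_ , ())

  Fm-⊕ : ∀ r s → Fm (r ⊕ s) ≡ Fm r ⊕ Fm s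
  Fm-⊕ (i , j) (k , m) = cong₂ _,_ (lem i j k m q₁ p₁) (lem i j k m q₂ p₂)
    where lem : ∀ i j k m q p → (i ℕ.+ k) ℕ.* q ℕ.+ (j ℕ.+ m) ℕ.* p ≡ (i ℕ.* q ℕ.+ j ℕ.* p) ℕ.+ (k ℕ.* q ℕ.+ m ℕ.* p)
          lem = ℕSolver.solve-∀

  Fm-Det : ∀ r s E → Det r s E → Det (Fm r) (Fm s) (E ℕ.* D)
  Fm-Det (i , j) (k , m) E e = trans (l1 i j k m p₁ p₂ q₁ q₂) (trans (cong₂ (λ u v → i ℕ.* k ℕ.* (q₁ ℕ.* q₂) ℕ.+ i ℕ.* m ℕ.* (p₁ ℕ.* q₂) ℕ.+ u ℕ.* v ℕ.+ j ℕ.* m ℕ.* (p₁ ℕ.* p₂)) e det)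
      (trans (l2 i k q₁ q₂ m p₁ E D (j ℕ.* m ℕ.* (p₁ ℕ.* p₂))) (cong (ℕ._+ E ℕ.* D) (sym (trans (l3 i j k m p₁ p₂ q₁ q₂) (cong₂ (λ u v → i ℕ.* k ℕ.* (q₁ ℕ.* q₂) ℕ.+ i ℕ.* m ℕ.* v ℕ.+ u ℕ.* (p₁ ℕ.* q₂) ℕ.+ j ℕ.* m ℕ.* (p₁ ℕ.* p₂)) e det))))))
    where
    l1 : ∀ i j k m a b c d → (i ℕ.* d ℕ.+ j ℕ.* b) ℕ.* (k ℕ.* c ℕ.+ m ℕ.* a) ≡ i ℕ.* k ℕ.* (c ℕ.* d) ℕ.+ i ℕ.* m ℕ.* (a ℕ.* d) ℕ.+ (j ℕ.* k) ℕ.* (b ℕ.* c) ℕ.+ j ℕ.* m ℕ.* (a ℕ.* b)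
    l1 = ℕSolver.solve-∀
    l3 : ∀ i j k m a b c d → (i ℕ.* c ℕ.+ j ℕ.* a) ℕ.* (k ℕ.* d ℕ.+ m ℕ.* b) ≡ i ℕ.* k ℕ.* (c ℕ.* d) ℕ.+ i ℕ.* m ℕ.* (b ℕ.* c) ℕ.+ (j ℕ.* k) ℕ.* (a ℕ.* d) ℕ.+ j ℕ.* m ℕ.* (a ℕ.* b)
    l3 = ℕSolver.solve-∀
    l2 : ∀ i k c d m a E D x → i ℕ.* k ℕ.* (c ℕ.* d) ℕ.+ i ℕ.* m ℕ.* (a ℕ.* d) ℕ.+ (i ℕ.* m ℕ.+ E) ℕ.* (a ℕ.* d ℕ.+ D) ℕ.+ x ≡
         i ℕ.* k ℕ.* (c ℕ.* d) ℕ.+ i ℕ.* m ℕ.* (a ℕ.* d ℕ.+ D) ℕ.+ (i ℕ.* m ℕ.+ E) ℕ.* (a ℕ.* d) ℕ.+ x ℕ.+ E ℕ.* D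
    l2 = ℕSolver.solve-∀

  -- Generators go to generators: the form is scaled by D while the exponents acquire 1/D, so 1/E
  -- becomes 1/(E D) in the pentagon. The rules that depend on l concern interior points, whose
  -- degree rises by at least 1.
  transfer : ∀ {l U V} → U ~[ l ] V → Fword U ~[ suc l ] Fword V
  transfer ~refl = ~refl
  transfer (~sym e) = ~sym (transfer e)
  transfer (~trans e e′) = ~trans (transfer e) (transfer e′)
  transfer (~++ {U = U} {U′} {V} {V′} e e′) = ~trans (~≡ (Listₚ.map-++ Fletter U V)) (~trans (~++ (transfer e) (transfer e′)) (~≡ (sym (Listₚ.map-++ Fletter U′ V′))))
  transfer (merge r x y 1≤) = ~trans (merge (Fm r) (x ℚ.* inv D) (y ℚ.* inv D) (ℕₚ.≤-trans 1≤ (deg-Fm-≥ r)))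
    (~≡ (cong (λ z → (Fm r , z) ∷ []) (sym (ℚₚ.*-distribʳ-+ (inv D) x y))))
  transfer (unit r) = ~trans (~≡ (cong (λ z → (Fm r , z) ∷ []) (ℚₚ.*-zeroˡ (inv D)))) (unit (Fm r))
  transfer (parallel r s x y d) = parallel (Fm r) (Fm s) _ _ (Fm-Det r s 0 d)
  transfer (truncate r x i lt) = truncate (Fm r) _ (Fm-interior r i) (ℕₚ.≤-<-trans lt (deg-Fm-interior r i))
  transfer {l} (central r s x y i lt) = central (Fm r) (Fm s) _ _ (≡.subst Interior (Fm-⊕ r s) (Fm-interior (r ⊕ s) i))
    (≡.subst (λ z → suc l < deg z) (Fm-⊕ r s) (ℕₚ.≤-<-trans lt (deg-Fm-interior (r ⊕ s) i)))
  transfer (pentagon r s E 1≤E d) = ~trans (~≡ (cong₂ (λ u v → (Fm r , u) ∷ (Fm s , v) ∷ []) inv≡ inv≡))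
    (~trans (pentagon (Fm r) (Fm s) (E ℕ.* D) (ℕₚ.*-mono-≤ 1≤E 1≤D) (Fm-Det r s E d))
      (~≡ (trans (cong (λ z → (Fm s , z) ∷ (Fm r ⊕ Fm s , z) ∷ (Fm r , z) ∷ []) (sym inv≡)) (cong (λ w → (Fm s , inv E ℚ.* inv D) ∷ (w , inv E ℚ.* inv D) ∷ (Fm r , inv E ℚ.* inv D) ∷ []) (sym (Fm-⊕ r s))))))
    where inv≡ : inv E ℚ.* inv D ≡ inv (E ℕ.* D)
          inv≡ = sym (inv-* E D)

  Fm-01 : Fm (0 , 1) ≡ p
  Fm-01 = cong₂ _,_ (ℕₚ.+-identityʳ p₁) (ℕₚ.+-identityʳ p₂)

  Fm-10 : Fm (1 , 0) ≡ q
  Fm-10 = cong₂ _,_ (trans (ℕₚ.+-identityʳ _) (ℕₚ.+-identityʳ q₁)) (trans (ℕₚ.+-identityʳ _) (ℕₚ.+-identityʳ q₂))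

  -- {i q + j p , p} = - i D and {q , i q + j p} = - j D recover i and j.
  Fm-injective : ∀ r s → Fm r ≡ Fm s → r ≡ s
  Fm-injective (i , j) (k , m) e = cong₂ _,_ i≡k j≡m
    where
    instance _ = ℕ.>-nonZero 1≤D
    e₁ = cong proj₁ e
    e₂ = cong proj₂ e
    a1 : ∀ i j a b c d D → b ℕ.* c ≡ a ℕ.* d ℕ.+ D → b ℕ.* (i ℕ.* c ℕ.+ j ℕ.* a) ≡ a ℕ.* (i ℕ.* d ℕ.+ j ℕ.* b) ℕ.+ i ℕ.* D
    a1 i j a b c d D h = trans (x1 i j a b c) (trans (cong (λ z → i ℕ.* z ℕ.+ j ℕ.* (a ℕ.* b)) h) (x2 i j a b d D))
      where x1 : ∀ i j a b c → b ℕ.* (i ℕ.* c ℕ.+ j ℕ.* a) ≡ i ℕ.* (b ℕ.* c) ℕ.+ j ℕ.* (a ℕ.* b)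
            x1 = ℕSolver.solve-∀
            x2 : ∀ i j a b d D → i ℕ.* (a ℕ.* d ℕ.+ D) ℕ.+ j ℕ.* (a ℕ.* b) ≡ a ℕ.* (i ℕ.* d ℕ.+ j ℕ.* b) ℕ.+ i ℕ.* D
            x2 = ℕSolver.solve-∀
    a2 : ∀ i j a b c d D → b ℕ.* c ≡ a ℕ.* d ℕ.+ D → c ℕ.* (i ℕ.* d ℕ.+ j ℕ.* b) ≡ d ℕ.* (i ℕ.* c ℕ.+ j ℕ.* a) ℕ.+ j ℕ.* D
    a2 i j a b c d D h = trans (x1 i j b c d) (trans (cong (λ z → i ℕ.* (c ℕ.* d) ℕ.+ j ℕ.* z) h) (x2 i j a c d D))
      where x1 : ∀ i j b c d → c ℕ.* (i ℕ.* d ℕ.+ j ℕ.* b) ≡ i ℕ.* (c ℕ.* d) ℕ.+ j ℕ.* (b ℕ.* c)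
            x1 = ℕSolver.solve-∀
            x2 : ∀ i j a c d D → i ℕ.* (c ℕ.* d) ℕ.+ j ℕ.* (a ℕ.* d ℕ.+ D) ≡ d ℕ.* (i ℕ.* c ℕ.+ j ℕ.* a) ℕ.+ j ℕ.* D
            x2 = ℕSolver.solve-∀
    i≡k : i ≡ k
    i≡k = ℕₚ.*-cancelʳ-≡ i k D (ℕₚ.+-cancelˡ-≡ (p₁ ℕ.* proj₂ (Fm (i , j))) _ _ (trans (sym (a1 i j p₁ p₂ q₁ q₂ D det))
      (trans (cong (p₂ ℕ.*_) e₁) (trans (a1 k m p₁ p₂ q₁ q₂ D det) (cong (λ z → p₁ ℕ.* z ℕ.+ k ℕ.* D) (sym e₂))))))
    j≡m : j ≡ m
    j≡m = ℕₚ.*-cancelʳ-≡ j m D (ℕₚ.+-cancelˡ-≡ (q₂ ℕ.* proj₁ (Fm (i , j))) _ _ (trans (sym (a2 i j p₁ p₂ q₁ q₂ D det))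
      (trans (cong (q₁ ℕ.*_) e₂) (trans (a2 k m p₁ p₂ q₁ q₂ D det) (cong (λ z → q₂ ℕ.* z ℕ.+ m ℕ.* D) (sym e₁))))))

  q≺Fm : ∀ r → Interior r → q ≺ Fm r
  q≺Fm (i , suc j) _ = steeper (≡.subst (q₂ ℕ.* (i ℕ.* q₁ ℕ.+ suc j ℕ.* p₁) <_) (sym (trans (x1 i j p₁ p₂ q₁ q₂) (trans (cong (λ z → i ℕ.* (q₁ ℕ.* q₂) ℕ.+ suc j ℕ.* z) det) (x2 i j p₁ q₁ q₂ D))))
      (ℕₚ.m<m+n _ (ℕₚ.≤-trans 1≤D (ℕₚ.m≤m+n D (j ℕ.* D)))))
    where x1 : ∀ i j a b c d → c ℕ.* (i ℕ.* d ℕ.+ suc j ℕ.* b) ≡ i ℕ.* (c ℕ.* d) ℕ.+ suc j ℕ.* (b ℕ.* c)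
          x1 = ℕSolver.solve-∀
          x2 : ∀ i j a c d D → i ℕ.* (c ℕ.* d) ℕ.+ suc j ℕ.* (a ℕ.* d ℕ.+ D) ≡ d ℕ.* (i ℕ.* c ℕ.+ suc j ℕ.* a) ℕ.+ suc j ℕ.* D
          x2 = ℕSolver.solve-∀
  q≺Fm (i , zero) (_ , ())

-- Exponents are recorded by the natural number gcd(p) x. This is where the factor 1 / gcd(a,b) of
-- the theorem comes from.
ex : Pt → ℕ → ℚ
ex p z = ι z ℚ.* inv (gcdᴾ p)

can : List Pt → (Pt → ℕ) → Word
can V U = map (λ p → (p , ex p (U p))) V

gcd≥1 : ∀ p → 1 ≤ deg p → 1 ≤ gcdᴾ p
gcd≥1 (a , b) 1≤ with gcd a b in e
... | suc _ = s≤s z≤n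
... | zero  = ⊥-elim (ℕₚ.<⇒≱ 1≤ (ℕₚ.≤-reflexive (cong₂ ℕ._+_ (GCD.gcd[m,n]≡0⇒m≡0 e) (GCD.gcd[m,n]≡0⇒n≡0 a e))))

ι-inv′ : ∀ n → 1 ≤ n → ι n ℚ.* inv n ≡ 1ℚ
ι-inv′ (suc n) _ = ι-inv n

ex-integral : ∀ p z → 1 ≤ deg p → Integral (p , ex p z)
ex-integral p z 1≤ = + z , trans (lem (ι (gcdᴾ p)) (ι z) (inv (gcdᴾ p))) (trans (cong (ι z ℚ.*_) (ι-inv′ (gcdᴾ p) (gcd≥1 p 1≤))) (trans (ℚₚ.*-identityʳ (ι z)) (sym (ιℤ-pos z))))
  where lem : ∀ g z i → g ℚ.* (z ℚ.* i) ≡ z ℚ.* (g ℚ.* i)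
        lem = solve-∀ ℚring

ex-injective : ∀ p {z z′} → 1 ≤ deg p → ex p z ≡ ex p z′ → z ≡ z′
ex-injective p {z} {z′} 1≤ e = ι-injective (trans (sym (un z)) (trans (cong (ℚ._* ι (gcdᴾ p)) e) (un z′)))
  where
  un : ∀ z → ex p z ℚ.* ι (gcdᴾ p) ≡ ι z
  un z = trans (ℚₚ.*-assoc (ι z) (inv (gcdᴾ p)) (ι (gcdᴾ p))) (trans (cong (ι z ℚ.*_) (trans (ℚₚ.*-comm (inv (gcdᴾ p)) (ι (gcdᴾ p))) (ι-inv′ (gcdᴾ p) (gcd≥1 p 1≤)))) (ℚₚ.*-identityʳ (ι z)))

ex-+ : ∀ p x y → ex p x ℚ.+ ex p y ≡ ex p (x ℕ.+ y)
ex-+ p x y = trans (sym (ℚₚ.*-distribʳ-+ (inv (gcdᴾ p)) (ι x) (ι y))) (cong (ℚ._* inv (gcdᴾ p)) (sym (ι-+ x y)))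

ex-0 : ∀ p → ex p 0 ≡ 0ℚ
ex-0 p = trans (cong (ℚ._* inv (gcdᴾ p)) ι-0) (ℚₚ.*-zeroˡ (inv (gcdᴾ p)))

ex-10 : ∀ m → ex (1 , 0) m ≡ ι m
ex-10 m = trans (cong (ι m ℚ.*_) inv-1) (ℚₚ.*-identityʳ (ι m))

ex-01 : ∀ n → ex (0 , 1) n ≡ ι n
ex-01 n = trans (cong (ι n ℚ.*_) inv-1) (ℚₚ.*-identityʳ (ι n))

can-cong : ∀ V {U U′ : Pt → ℕ} → All (λ p → U p ≡ U′ p) V → can V U ≡ can V U′
can-cong []      []       = refl
can-cong (p ∷ V) (e ∷ es) = cong₂ _∷_ (cong (λ z → (p , ex p z)) e) (can-cong V es)

Interior⇒1≤ : ∀ {p} → Interior p → 1 ≤ deg p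
Interior⇒1≤ {a , b} (u , _) = ℕₚ.m≤n⇒m≤n+o b u

module _ {l : ℕ} where
  merge-ex : ∀ p x y → 1 ≤ deg p → (p , ex p x) ∷ (p , ex p y) ∷ [] ~[ l ] (p , ex p (x ℕ.+ y)) ∷ []
  merge-ex p x y 1≤ = ~trans (merge p (ex p x) (ex p y) 1≤) (~≡ (cong (λ z → (p , z) ∷ []) (ex-+ p x y)))

  unit-ex : ∀ p → (p , ex p 0) ∷ [] ~[ l ] []
  unit-ex p = ~trans (~≡ (cong (λ z → (p , z) ∷ []) (ex-0 p))) (unit p)

  can-truncate : ∀ V {U U′ : Pt → ℕ} → All Interior V → All (λ p → deg p ≤ l → U p ≡ U′ p) V → can V U ~[ l ] can V U′
  can-truncate []      []       []       = ~refl
  can-truncate (p ∷ V) {U} {U′} (i ∷ is) (e ∷ es) = ~++ head (can-truncate V is es)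
    where
    head : (p , ex p (U p)) ∷ [] ~[ l ] (p , ex p (U′ p)) ∷ []
    head with deg p ℕ.≤? l
    ... | yes d = ~≡ (cong (λ z → (p , ex p z) ∷ []) (e d))
    ... | no nd = ~trans (truncate p _ i (ℕₚ.≰⇒> nd)) (~sym (truncate p _ i (ℕₚ.≰⇒> nd)))

  can-zero : ∀ V {U : Pt → ℕ} → All (λ p → U p ≡ 0) V → can V U ~[ l ] []
  can-zero []      []       = ~refl
  can-zero (p ∷ V) (e ∷ es) = ~++ (~trans (~≡ (cong (λ z → (p , ex p z) ∷ []) e)) (unit-ex p)) (can-zero V es)

  private
    ⊕-interior : ∀ p q → Interior p → Interior (p ⊕ q)
    ⊕-interior (a , b) (c , d) (u , v) = ℕₚ.m≤n⇒m≤n+o c u , ℕₚ.m≤n⇒m≤n+o d v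

    ⊕-degree : ∀ p q → deg (p ⊕ q) ≡ deg p ℕ.+ deg q
    ⊕-degree (a , b) (c , d) = N.+-interchange a c b d

  -- The point p + q has degree above l, so the commutator is trivial in the truncation.
  top-central : ∀ p q x y → Interior p → 1 ≤ deg q → l ≤ deg p → (p , x) ∷ (q , y) ∷ [] ~[ l ] (q , y) ∷ (p , x) ∷ []
  top-central p q x y i 1≤ le = central p q x y (⊕-interior p q i) (≡.subst (l <_) (sym (⊕-degree p q)) (ℕₚ.≤-<-trans le (ℕₚ.m<m+n (deg p) 1≤)))

  top-past : ∀ p x W → Interior p → l ≤ deg p → All (λ c → 1 ≤ deg (proj₁ c)) W → (p , x) ∷ W ~[ l ] W ++ (p , x) ∷ []
  top-past p x []            i le []       = ~refl
  top-past p x ((q , y) ∷ W) i le (1≤ ∷ ps) = ~trans (~++ʳ W (top-central p q x y i 1≤ le)) (~∷ (q , y) (top-past p x W i le ps))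

  past-top : ∀ q y V {U : Pt → ℕ} → 1 ≤ deg q → All Interior V → All (λ p → deg p < l → U p ≡ 0) V → (q , y) ∷ can V U ~[ l ] can V U ++ (q , y) ∷ []
  past-top q y []      1≤ []       []       = ~refl
  past-top q y (p ∷ V) {U} 1≤ (i ∷ is) (z ∷ zs) = ~trans (~++ʳ (can V U) head) (~∷ (p , ex p (U p)) (past-top q y V 1≤ is zs))
    where
    head : (q , y) ∷ (p , ex p (U p)) ∷ [] ~[ l ] (p , ex p (U p)) ∷ (q , y) ∷ []
    head with deg p ℕ.<? l
    ... | yes d = ~trans (~∷ (q , y) unitp) (~sym (~++ʳ ((q , y) ∷ []) unitp))
      where unitp : (p , ex p (U p)) ∷ [] ~[ l ] []
            unitp = ~trans (~≡ (cong (λ z → (p , ex p z) ∷ []) (z d))) (unit-ex p)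
    ... | no nd = ~sym (top-central p q _ y i 1≤ (ℕₚ.≮⇒≥ nd))

  can-positive : ∀ V {U : Pt → ℕ} → All Interior V → All (λ c → 1 ≤ deg (proj₁ c)) (can V U)
  can-positive []      []       = []
  can-positive (p ∷ V) (i ∷ is) = Interior⇒1≤ i ∷ can-positive V is

  -- The exponents τ sit on central letters, which can be gathered at the end of the word. In
  -- degrees below l they are 0 and their letters disappear.
  split-top : ∀ V (U τ : Pt → ℕ) → All Interior V → All (λ p → deg p < l → τ p ≡ 0) V → can V (λ p → U p ℕ.+ τ p) ~[ l ] can V U ++ can V τ
  split-top []      U τ []       []       = ~refl
  split-top (p ∷ V) U τ (i ∷ is) (z ∷ zs) =
    (p , ex p (U p ℕ.+ τ p)) ∷ can V (λ p → U p ℕ.+ τ p)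
      ~⟨ ~++ (~sym (merge-ex p (U p) (τ p) (Interior⇒1≤ i))) (split-top V U τ is zs) ⟩
    (p , ex p (U p)) ∷ (p , ex p (τ p)) ∷ (can V U ++ can V τ)
      ~⟨ ~∷ (p , ex p (U p)) (~++ʳ (can V τ) move) ⟩
    (p , ex p (U p)) ∷ ((can V U ++ (p , ex p (τ p)) ∷ []) ++ can V τ)
      ~⟨ ~≡ (cong ((p , ex p (U p)) ∷_) (Listₚ.++-assoc (can V U) ((p , ex p (τ p)) ∷ []) (can V τ))) ⟩
    (p , ex p (U p)) ∷ (can V U ++ (p , ex p (τ p)) ∷ can V τ) ~∎
    where
    move : (p , ex p (τ p)) ∷ can V U ~[ l ] can V U ++ (p , ex p (τ p)) ∷ []
    move with deg p ℕ.<? l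
    ... | no nd = top-past p _ (can V U) i (ℕₚ.≮⇒≥ nd) (can-positive V is)
    ... | yes d = ~trans (~++ʳ (can V U) unitp) (~trans (~≡ (sym (Listₚ.++-identityʳ (can V U)))) (~sym (~++ˡ (can V U) unitp)))
      where unitp : (p , ex p (τ p)) ∷ [] ~[ l ] []
            unitp = ~trans (~≡ (cong (λ z → (p , ex p z) ∷ []) (z d))) (unit-ex p)

gcd∣D : ∀ p q D → Det p q D → (gcdᴾ p ∣ D) × (gcdᴾ q ∣ D)
gcd∣D (a , b) (c , d) D det =
    ∣m+n∣m⇒∣n (≡.subst (gcd a b ∣_) det (∣m⇒∣m*n c (GCD.gcd[m,n]∣n a b))) (∣m⇒∣m*n d (GCD.gcd[m,n]∣m a b))
  , ∣m+n∣m⇒∣n (≡.subst (gcd c d ∣_) det (∣n⇒∣m*n b (GCD.gcd[m,n]∣m c d))) (∣n⇒∣m*n a (GCD.gcd[m,n]∣n c d))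

-- Shows [p]^(z / gcd p) to be the image, under the similarity, of an integral power of an axis
-- letter; k = D / gcd p is the factor between the two exponents.
ex-rescale : ∀ p D k z → 1 ≤ D → D ≡ k ℕ.* gcdᴾ p → ι (z ℕ.* k) ℚ.* inv D ≡ ex p z
ex-rescale p D zero    z 1≤ e = ⊥-elim (ℕₚ.<⇒≱ 1≤ (ℕₚ.≤-reflexive e))
ex-rescale p D (suc k) z 1≤ e = trans (cong₂ ℚ._*_ (ι-* z (suc k)) (trans (cong inv e) (inv-* (suc k) (gcdᴾ p))))
  (trans (lem (ι z) (ι (suc k)) (inv (suc k)) (inv (gcdᴾ p))) (trans (cong (ex p z ℚ.*_) (ι-inv k)) (ℚₚ.*-identityʳ _)))
  where lem : ∀ a b c d → (a ℚ.* b) ℚ.* (c ℚ.* d) ≡ (a ℚ.* d) ℚ.* (b ℚ.* c)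
        lem = solve-∀ ℚring

integral-quotient : ∀ g Z c → 1 ≤ c → IsInt (ι g ℚ.* (ι Z ℚ.* inv c)) → c ∣ g ℕ.* Z
integral-quotient g Z (suc c) _ (z , e) = nonneg z (ιℤ-injective (trans (ιℤ-* z (+ suc c)) (trans (cong₂ ℚ._*_ (sym e) (ιℤ-pos (suc c)))
    (trans (lem (ι g) (ι Z) (inv (suc c)) (ι (suc c))) (trans (cong ((ι g ℚ.* ι Z) ℚ.*_) (ι-inv c)) (trans (ℚₚ.*-identityʳ _) (trans (sym (ι-* g Z)) (sym (ιℤ-pos (g ℕ.* Z))))))))))
  where
  lem : ∀ g Z i c → (g ℚ.* (Z ℚ.* i)) ℚ.* c ≡ (g ℚ.* Z) ℚ.* (c ℚ.* i)
  lem = solve-∀ ℚring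
  nonneg : ∀ z → z ℤ.* + suc c ≡ + (g ℕ.* Z) → suc c ∣ g ℕ.* Z
  nonneg (+ n) h = divides n (sym (ℤₚ.+-injective (trans (ℤₚ.pos-* n (suc c)) h)))
  nonneg ℤ.-[1+ n ] ()

-- Canonical words and the inductive statement

module Fixed (Λ : ℕ) where
  -- The list depends on Λ and not on l, so words of different stages have the same shape; the
  -- relation at l ignores the letters of degree above l.
  Int : List Pt
  Int = interior Λ

  Int-interior : All Interior Int
  Int-interior = All.tabulate (λ m → proj₁ (interior-range Λ m))

  canon : ℕ → ℕ → (Pt → ℕ) → Word
  canon m n U = ((1 , 0) , ι m) ∷ can Int U ++ ((0 , 1) , ι n) ∷ []

  private
    ends : List Pt
    ends = (1 , 0) ∷ Int ++ (0 , 1) ∷ []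

    extend : ℕ → ℕ → (Pt → ℕ) → Pt → ℚ
    extend m n U (zero  , _)     = ι n
    extend m n U (suc _ , zero)  = ι m
    extend m n U p@(suc _ , suc _) = ex p (U p)

    extend-can : ∀ m n U V → All Interior V → map (λ p → (p , extend m n U p)) V ≡ can V U
    extend-can m n U [] [] = refl
    extend-can m n U ((suc a , suc b) ∷ V) (_ ∷ is) = cong (_ ∷_) (extend-can m n U V is)
    extend-can m n U ((zero , b) ∷ V) ((() , _) ∷ is)
    extend-can m n U ((suc a , zero) ∷ V) ((_ , ()) ∷ is)

    canon≡ : ∀ m n U → letters (λ p → p) (extend m n U) ends ≡ canon m n U
    canon≡ m n U = cong (((1 , 0) , ι m) ∷_) (trans (Listₚ.map-++ _ Int ((0 , 1) ∷ [])) (cong (_++ ((0 , 1) , ι n) ∷ []) (extend-can m n U Int Int-interior)))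

    ends-unique : Unique ends
    ends-unique = All.tabulate (λ {p} m e → notX p (≡.subst (_∈ Int ++ (0 , 1) ∷ []) (sym e) m)) ∷ snoc Int (λ m → noY (interior-range Λ m)) (sorted-unique (interior-sorted Λ))
      where
      noY : Interior (0 , 1) × _ → ⊥
      noY ((() , _) , _)
      notX : ∀ p → (1 , 0) ∈ Int ++ (0 , 1) ∷ [] → ⊥
      notX _ m with Memₚ.∈-++⁻ Int m
      ... | inj₁ k with proj₁ (interior-range Λ k)
      ...   | (_ , ())
      notX _ m | inj₂ (here ())
      notX _ m | inj₂ (there ())
      snoc : ∀ V → ¬ (0 , 1) ∈ V → Unique V → Unique (V ++ (0 , 1) ∷ [])
      snoc []      _ []      = [] ∷ []
      snoc (v ∷ V) n (h ∷ u) = All.tabulate (λ m e → distinct (Memₚ.∈-++⁻ V m) e) ∷ snoc V (λ m → n (there m)) u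
        where
        distinct : ∀ {x} → x ∈ V ⊎ x ∈ ((0 , 1) ∷ []) → ¬ v ≡ x
        distinct (inj₁ k)           e = All.lookup h k e
        distinct (inj₂ (here refl)) e = n (here (sym e))
        distinct (inj₂ (there ()))

    ends-positive : All (λ p → 1 ≤ deg p) ends
    ends-positive = s≤s z≤n ∷ Allₚ.++⁺ (All.map (λ {p} i → Interior⇒1≤ i) Int-interior) (s≤s z≤n ∷ [])

  unique-canonical : ∀ l m n U U′ → canon m n U ≅[ l ] canon m n U′ → ∀ {p} → p ∈ Int → deg p ≤ l → U p ≡ U′ p
  unique-canonical l m n U U′ e {p@(suc a , suc b)} k d = ex-injective p (s≤s z≤n) (unique-exponents l ends (extend m n U) (extend m n U′) ends-unique ends-positive
    (≡.subst₂ (_≅[ l ]_) (sym (canon≡ m n U)) (sym (canon≡ m n U′)) e) (there (Memₚ.∈-++⁺ˡ k)) d)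
  unique-canonical l m n U U′ e {zero , b} k d with proj₁ (interior-range Λ k)
  ... | (() , _)
  unique-canonical l m n U U′ e {suc a , zero} k d with proj₁ (interior-range Λ k)
  ... | (_ , ())

  -- The exponent at p is Z p m n / gcd p, and the bound in `cone` is the degree asserted by the
  -- theorem. The two vanishing statements supply the starting values m = 0 and n = 0 for the
  -- summations of the next stage.
  record Stage (l : ℕ) : Set where
    field
      Z     : Pt → ℕ → ℕ → ℕ
      rel   : ∀ m n → ((0 , 1) , ι n) ∷ ((1 , 0) , ι m) ∷ [] ~[ l ] canon m n (λ p → Z p m n)
      cone  : ∀ p → Interior p → Poly₂ (proj₁ p) (proj₂ p) (Z p)
      zeroˡ : ∀ {p} → p ∈ Int → deg p ≤ l → ∀ n → Z p 0 n ≡ 0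
      zeroʳ : ∀ {p} → p ∈ Int → deg p ≤ l → ∀ m → Z p m 0 ≡ 0

divide : ℕ → ℕ → ℕ
divide m zero    = 0
divide m (suc n) = m / suc n

divide-exact : ∀ m n → 1 ≤ n → n ∣ m → divide m n ℕ.* n ≡ m
divide-exact m (suc n) _ d = m/n*n≡m d

exact-ratio : ∀ Z c ζ g → 1 ≤ c → 1 ≤ g → ζ ℕ.* c ≡ g ℕ.* Z → ι Z ℚ.* inv c ≡ ι ζ ℚ.* inv g
exact-ratio Z (suc c) ζ (suc g) _ _ e = trans (sym (ℚₚ.*-identityˡ _)) (trans (cong (ℚ._* (ι Z ℚ.* inv (suc c))) (sym (ι-inv g)))
  (trans (l1 (ι (suc g)) (inv (suc g)) (ι Z) (inv (suc c))) (trans (cong (ℚ._* (inv (suc g) ℚ.* inv (suc c))) (trans (sym (ι-* (suc g) Z)) (trans (cong ι (sym e)) (ι-* ζ (suc c)))))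
  (trans (l2 (ι ζ) (ι (suc c)) (inv (suc g)) (inv (suc c))) (trans (cong ((ι ζ ℚ.* inv (suc g)) ℚ.*_) (ι-inv c)) (ℚₚ.*-identityʳ _))))))
  where
  l1 : ∀ a b c d → (a ℚ.* b) ℚ.* (c ℚ.* d) ≡ (a ℚ.* c) ℚ.* (b ℚ.* d)
  l1 = solve-∀ ℚring
  l2 : ∀ a b c d → (a ℚ.* b) ℚ.* (c ℚ.* d) ≡ (a ℚ.* c) ℚ.* (b ℚ.* d)
  l2 = solve-∀ ℚring

Fn : Set
Fn = ℕ → ℕ → ℕ

newsWord : List (Pt × Fn) → ℕ → ℕ → Word
newsWord Ns m n = map (λ s → (proj₁ s , ex (proj₁ s) (proj₂ s m n))) Ns

-- Crossing two letters and collecting the letters created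

module Reorder (Λ : ℕ) {l : ℕ} (stage : Fixed.Stage Λ l) where
  open Fixed Λ
  open Stage stage

  module Swap (p q : Pt) (D : ℕ) (1≤D : 1 ≤ D) (det : Det p q D) (3≤ : 3 ≤ deg p ℕ.+ deg q) where
    open Similarity p q D 1≤D det 3≤ public
    private
      kp kq : ℕ
      kp = Div.quotient (proj₁ (gcd∣D p q D det))
      kq = Div.quotient (proj₂ (gcd∣D p q D det))
      D≡p : D ≡ kp ℕ.* gcdᴾ p
      D≡p = Div._∣_.equality (proj₁ (gcd∣D p q D det))
      D≡q : D ≡ kq ℕ.* gcdᴾ q
      D≡q = Div._∣_.equality (proj₂ (gcd∣D p q D det))

    Zat : Pt → ℕ → ℕ → ℕ
    Zat r zp zq = Z r (zq ℕ.* kq) (zp ℕ.* kp)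

    mid : ℕ → ℕ → List Pt → Word
    mid zp zq = map (λ r → (Fm r , ex r (Zat r zp zq) ℚ.* inv D))

    -- The image under the similarity of the factorization at level l, with the exponents of the
    -- axis letters rescaled by `ex-rescale`.
    swap-rel : ∀ zp zq → (p , ex p zp) ∷ (q , ex q zq) ∷ [] ~[ suc l ] (q , ex q zq) ∷ mid zp zq Int ++ (p , ex p zp) ∷ []
    swap-rel zp zq = ~trans (~≡ (sym (cong₂ (λ u v → u ∷ v ∷ []) eqp eqq))) (~trans (transfer (rel (zq ℕ.* kq) (zp ℕ.* kp)))
      (~≡ (cong₂ _∷_ eqq (trans (Listₚ.map-++ Fletter (can Int (λ r → Zat r zp zq)) _) (cong₂ _++_ (sym (Listₚ.map-∘ Int)) (cong (_∷ []) eqp))))))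
      where
      eqp : (Fm (0 , 1) , ι (zp ℕ.* kp) ℚ.* inv D) ≡ (p , ex p zp)
      eqp = cong₂ _,_ Fm-01 (ex-rescale p D kp zp 1≤D D≡p)
      eqq : (Fm (1 , 0) , ι (zq ℕ.* kq) ℚ.* inv D) ≡ (q , ex q zq)
      eqq = cong₂ _,_ Fm-10 (ex-rescale q D kq zq 1≤D D≡q)

    -- Chosen so that Zat / (gcd(r) D) equals ζ / gcd(Fm r), which gives the created letter the form
    -- `ex` again. `ζ-exact` shows the division to be exact in the relevant degrees.
    ζ : Pt → ℕ → ℕ → ℕ
    ζ r zp zq = divide (gcdᴾ (Fm r) ℕ.* Zat r zp zq) (gcdᴾ r ℕ.* D)

    private
      p≢q : ¬ q ≡ p
      p≢q e = ℕₚ.<⇒≱ 1≤D (ℕₚ.≤-reflexive (ℕₚ.+-cancelˡ-≡ (proj₁ p ℕ.* proj₂ p) D 0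
        (trans (sym (≡.subst (λ z → Det p z D) e det)) (trans (ℕₚ.*-comm (proj₂ p) (proj₁ p)) (sym (ℕₚ.+-identityʳ _))))))

      positions : ∀ zp zq R → map proj₁ (mid zp zq R) ≡ map Fm R
      positions zp zq R = sym (Listₚ.map-∘ R)

      distinct : ∀ zp zq → Unique (map proj₁ ((q , ex q zq) ∷ mid zp zq Int ++ (p , ex p zp) ∷ []))
      distinct zp zq = ≡.subst Unique (sym (cong (q ∷_) (trans (Listₚ.map-++ proj₁ (mid zp zq Int) _) (cong (_++ p ∷ []) (positions zp zq Int)))))
        (All.tabulate (λ {s} m → notq s (Memₚ.∈-++⁻ (map Fm Int) m)) ∷ Uniqueₚ.++⁺ (Uniqueₚ.map⁺ (λ {r} {s} → Fm-injective r s) (sorted-unique (interior-sorted Λ))) ([] ∷ []) disjoint)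
        where
        degree : ∀ {s} → s ∈ map Fm Int → (deg p < deg s) × (deg q < deg s)
        degree m with Memₚ.∈-map⁻ Fm m
        ... | r , k , refl = deg-Fm-> r (proj₁ (interior-range Λ k))
        notq : ∀ s → s ∈ map Fm Int ⊎ s ∈ (p ∷ []) → ¬ q ≡ s
        notq s (inj₁ m) refl = ℕₚ.<-irrefl refl (proj₂ (degree m))
        notq s (inj₂ (here refl)) e = p≢q e
        notq s (inj₂ (there ()))
        disjoint : ∀ {s} → ¬ (s ∈ map Fm Int × s ∈ (p ∷ []))
        disjoint (m , here refl) = ℕₚ.<-irrefl refl (proj₁ (degree m))
        disjoint (m , there ())

    -- The reordered word has distinct points and equals [p]^x [q]^y, a word of integral letters. So
    -- `integral-exponents` applies, although the similarity itself introduces the denominator D.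
    ζ-exact : ∀ {r} → r ∈ Int → deg (Fm r) ≤ suc l → ∀ zp zq → ζ r zp zq ℕ.* (gcdᴾ r ℕ.* D) ≡ gcdᴾ (Fm r) ℕ.* Zat r zp zq
    ζ-exact {r} k d zp zq = divide-exact (gcdᴾ (Fm r) ℕ.* Zat r zp zq) (gcdᴾ r ℕ.* D) c≥1
      (integral-quotient (gcdᴾ (Fm r)) (Zat r zp zq) (gcdᴾ r ℕ.* D) c≥1 (≡.subst (λ z → IsInt (ι (gcdᴾ (Fm r)) ℚ.* z)) letter
        (integral-exponents (suc l) ((q , ex q zq) ∷ mid zp zq Int ++ (p , ex p zp) ∷ []) ((p , ex p zp) ∷ (q , ex q zq) ∷ []) (distinct zp zq) positive
          (ex-integral p zp deg-p≥1 ∷ ex-integral q zq deg-q≥1 ∷ []) (~⇒≅ (~sym (swap-rel zp zq)))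
          (there (Memₚ.∈-++⁺ˡ (Memₚ.∈-map⁺ (λ r → (Fm r , ex r (Zat r zp zq) ℚ.* inv D)) k))) d)))
      where
      c≥1 : 1 ≤ gcdᴾ r ℕ.* D
      c≥1 = ℕₚ.*-mono-≤ (gcd≥1 r (Interior⇒1≤ (proj₁ (interior-range Λ k)))) 1≤D
      letter : ex r (Zat r zp zq) ℚ.* inv D ≡ ι (Zat r zp zq) ℚ.* inv (gcdᴾ r ℕ.* D)
      letter = trans (ℚₚ.*-assoc (ι (Zat r zp zq)) (inv (gcdᴾ r)) (inv D)) (cong (ι (Zat r zp zq) ℚ.*_) (sym (inv-* (gcdᴾ r) D)))
      positive : All (λ c → 1 ≤ deg (proj₁ c)) ((q , ex q zq) ∷ mid zp zq Int ++ (p , ex p zp) ∷ [])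
      positive = deg-q≥1 ∷ Allₚ.++⁺ (Allₚ.map⁺ (All.map (λ {r} i → ℕₚ.≤-trans (Interior⇒1≤ i) (deg-Fm-≥ r)) Int-interior)) (deg-p≥1 ∷ [])

    module _ (x y : Fn) where
      news : List Pt → List (Pt × Fn)
      news [] = []
      news (r ∷ R) with deg (Fm r) ℕ.≤? suc l
      ... | yes _ = (Fm r , λ m n → ζ r (x m n) (y m n)) ∷ news R
      ... | no  _ = news R

      mid-news : ∀ m n R → (∀ {r} → r ∈ R → r ∈ Int) → mid (x m n) (y m n) R ~[ suc l ] newsWord (news R) m n
      mid-news m n []      s = ~refl
      mid-news m n (r ∷ R) s with deg (Fm r) ℕ.≤? suc l
      ... | yes d = ~++ (~≡ (cong (λ z → (Fm r , z) ∷ []) letter)) (mid-news m n R (λ k → s (there k)))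
        where
        k = s (here refl)
        i = proj₁ (interior-range Λ k)
        letter : ex r (Zat r (x m n) (y m n)) ℚ.* inv D ≡ ex (Fm r) (ζ r (x m n) (y m n))
        letter = trans (trans (ℚₚ.*-assoc (ι (Zat r (x m n) (y m n))) (inv (gcdᴾ r)) (inv D)) (cong (ι (Zat r (x m n) (y m n)) ℚ.*_) (sym (inv-* (gcdᴾ r) D))))
          (exact-ratio (Zat r (x m n) (y m n)) (gcdᴾ r ℕ.* D) (ζ r (x m n) (y m n)) (gcdᴾ (Fm r)) (ℕₚ.*-mono-≤ (gcd≥1 r (Interior⇒1≤ i)) 1≤D)
             (gcd≥1 (Fm r) (Interior⇒1≤ (Fm-interior r i))) (ζ-exact k d (x m n) (y m n)))
      ... | no nd = ~++ (truncate (Fm r) _ (Fm-interior r (proj₁ (interior-range Λ (s (here refl))))) (ℕₚ.≰⇒> nd)) (mid-news m n R (λ k → s (there k)))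

      swap : ∀ m n → (p , ex p (x m n)) ∷ (q , ex q (y m n)) ∷ [] ~[ suc l ] (q , ex q (y m n)) ∷ newsWord (news Int) m n ++ (p , ex p (x m n)) ∷ []
      swap m n = ~trans (swap-rel (x m n) (y m n)) (~∷ (q , ex q (y m n)) (~++ʳ ((p , ex p (x m n)) ∷ []) (mid-news m n Int (λ k → k))))

      -- The first variable of `Z r` receives a multiple of the exponent of q and the second one of
      -- p, whence the degrees i A + j A′ and i B + j B′. The exact division preserves the cone by
      -- `div`.
      ζ-cone : ∀ {A B A′ B′ r} → r ∈ Int → deg (Fm r) ≤ suc l → Poly₂ A B y → Poly₂ A′ B′ x →
        Poly₂ (proj₁ r ℕ.* A ℕ.+ proj₂ r ℕ.* A′) (proj₁ r ℕ.* B ℕ.+ proj₂ r ℕ.* B′) (λ m n → ζ r (x m n) (y m n))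
      ζ-cone {A} {B} {A′} {B′} {r} k d cy cx = go (gcdᴾ r ℕ.* D) (ℕₚ.*-mono-≤ (gcd≥1 r (Interior⇒1≤ i)) 1≤D) (λ m n → trans (ℕₚ.*-comm (gcdᴾ r ℕ.* D) _) (ζ-exact k d (x m n) (y m n)))
        where
        i = proj₁ (interior-range Λ k)
        composed = compose₂ (cone r i) (Cone₂.ext (λ m n → ℕₚ.*-comm kq (y m n)) (scale₂ kq cy)) (Cone₂.ext (λ m n → ℕₚ.*-comm kp (x m n)) (scale₂ kp cx))
        go : ∀ c → 1 ≤ c → (∀ m n → c ℕ.* ζ r (x m n) (y m n) ≡ gcdᴾ (Fm r) ℕ.* Zat r (x m n) (y m n)) →
          Poly₂ (proj₁ r ℕ.* A ℕ.+ proj₂ r ℕ.* A′) (proj₁ r ℕ.* B ℕ.+ proj₂ r ℕ.* B′) (λ m n → ζ r (x m n) (y m n))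
        go (suc c) _ e = Cone₂.div c (gcdᴾ (Fm r)) e composed

  -- Guarantees a place in V for every letter created by crossing v, since such letters come after
  -- v.
  Up : Pt → List Pt → Set
  Up v V = ∀ r → Interior r → deg r ≤ Λ → v ≺ r → r ∈ V

  data Chain : List Pt → Set where
    []  : Chain []
    add : ∀ {v V} → Interior v → All (v ≺_) V → Up v V → Chain V → Chain (v ∷ V)

  Int-chain : Chain Int
  Int-chain = build Int (interior-sorted Λ) Int-interior (λ r i d → inj₁ (interior-complete Λ r i d))
    where
    build : ∀ L → Sorted L → All Interior L → (∀ r → Interior r → deg r ≤ Λ → r ∈ L ⊎ All (r ≺_) L) → Chain L
    build []      []      []       h = []
    build (v ∷ V) (s ∷ S) (i ∷ is) h = add i s up (build V S is rest)
      where
      up : Up v V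
      up r ir d lt with h r ir d
      ... | inj₁ (here refl) = ⊥-elim (≺-irrefl lt)
      ... | inj₁ (there k)   = k
      ... | inj₂ (gt ∷ _)    = ⊥-elim (≺-asym lt gt)
      rest : ∀ r → Interior r → deg r ≤ Λ → r ∈ V ⊎ All (r ≺_) V
      rest r ir d with h r ir d
      ... | inj₁ (here refl) = inj₂ s
      ... | inj₁ (there k)   = inj₁ k
      ... | inj₂ (_ ∷ gs)    = inj₂ gs

  -- `A`, `B` bound the degrees of the exponents already present, `A′`, `B′` more strictly those of
  -- the increments. Crossing an increment at p with an old letter at q creates exponents at i q + j
  -- p, with j ≥ 1, of degrees i A(q) + j A′(p) and i B(q) + j B′(p); `degA` and `degB` make these
  -- increments again. In the two applications the strict bound is one lower in n and in m
  -- respectively.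
  module Collect (L≤Λ : suc l ≤ Λ) (A B A′ B′ : Pt → ℕ) (New : Pt → Set)
    (A′≤A : ∀ p → A′ p ≤ A p) (B′≤B : ∀ p → B′ p ≤ B p) (interior-new : ∀ {p} → Interior p → New p)
    (degA : ∀ p q i j → New p → 1 ≤ j → i ℕ.* A q ℕ.+ j ℕ.* A′ p ≤ A′ (i ℕ.* proj₁ q ℕ.+ j ℕ.* proj₁ p , i ℕ.* proj₂ q ℕ.+ j ℕ.* proj₂ p))
    (degB : ∀ p q i j → New p → 1 ≤ j → i ℕ.* B q ℕ.+ j ℕ.* B′ p ≤ B′ (i ℕ.* proj₁ q ℕ.+ j ℕ.* proj₁ p , i ℕ.* proj₂ q ℕ.+ j ℕ.* proj₂ p)) where

    L : ℕ
    L = suc l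

    Old Nw : Pt → Fn → Set
    Old p f = Poly₂ (A p) (B p) f
    Nw p f = Poly₂ (A′ p) (B′ p) f

    OldAll : (Pt → Fn) → Set
    OldAll U = ∀ r → Interior r → Old r (U r)

    NwAll : (Pt → Fn) → Set
    NwAll δ = ∀ r → Nw r (δ r)

    _⊞_ : (Pt → Fn) → (Pt → Fn) → Pt → Fn
    (U ⊞ δ) r m n = U r m n ℕ.+ δ r m n

    nw-zero : ∀ r → Nw r (λ _ _ → 0)
    nw-zero r = Cone₂.mono z≤n z≤n (Cone₂.const 0)

    ⊞-old : ∀ {U δ} → OldAll U → NwAll δ → OldAll (U ⊞ δ)
    ⊞-old o w r i = Cone₂.add (o r i) (Cone₂.mono (A′≤A r) (B′≤B r) (w r))

    ⊞-nw : ∀ {δ δ′} → NwAll δ → NwAll δ′ → NwAll (δ ⊞ δ′)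
    ⊞-nw w w′ r = Cone₂.add (w r) (w′ r)

    can⟨_⟩ : List Pt → (Pt → Fn) → ℕ → ℕ → Word
    can⟨ V ⟩ U m n = can V (λ r → U r m n)

    can-assoc : ∀ V U δ δ′ m n → can⟨ V ⟩ ((U ⊞ δ) ⊞ δ′) m n ≡ can⟨ V ⟩ (U ⊞ (δ ⊞ δ′)) m n
    can-assoc V U δ δ′ m n = can-cong V (All.tabulate (λ {r} _ → ℕₚ.+-assoc (U r m n) (δ r m n) (δ′ r m n)))

    can-⊞-zero : ∀ V U m n → can⟨ V ⟩ (U ⊞ (λ _ _ _ → 0)) m n ≡ can⟨ V ⟩ U m n
    can-⊞-zero V U m n = can-cong V (All.tabulate (λ {r} _ → ℕₚ.+-identityʳ (U r m n)))

    -- Reordering changes the exponents U only by increments δ, uniformly in m and n; `pre` and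
    -- `post` hold the letters kept outside V.
    Result : List Pt → (Pt → Fn) → (ℕ → ℕ → Word) → (ℕ → ℕ → Word) → (ℕ → ℕ → Word) → Set
    Result V U lhs pre post = Σ (Pt → Fn) λ δ → NwAll δ × (∀ m n → lhs m n ~[ L ] pre m n ++ can⟨ V ⟩ (U ⊞ δ) m n ++ post m n)

    none : ℕ → ℕ → Word
    none _ _ = []

    Inserts : List Pt → Pt → Set
    Inserts V s = ∀ U → OldAll U → ∀ f → Nw s f → Result V U (λ m n → (s , ex s (f m n)) ∷ can⟨ V ⟩ U m n) none none

    insertAll : ∀ V U → OldAll U → (Ns : List (Pt × Fn)) → All (λ s → Inserts V (proj₁ s) × Nw (proj₁ s) (proj₂ s)) Ns →
      Result V U (λ m n → newsWord Ns m n ++ can⟨ V ⟩ U m n) none none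
    insertAll V U o [] [] = (λ _ _ _ → 0) , nw-zero , (λ m n → ~≡ (trans (sym (can-⊞-zero V U m n)) (sym (Listₚ.++-identityʳ _))))
    insertAll V U o ((s , f) ∷ Ns) ((ins , w) ∷ ws) with insertAll V U o Ns ws
    ... | δ , wδ , e with ins (U ⊞ δ) (⊞-old o wδ) f w
    ...   | δ′ , wδ′ , e′ = (δ ⊞ δ′) , ⊞-nw wδ wδ′ , (λ m n → ~trans (~∷ _ (~trans (e m n) (~≡ (Listₚ.++-identityʳ _))))
            (~trans (e′ m n) (~≡ (cong (_++ []) (can-assoc V U δ δ′ m n)))))

    -- Moving p to the right of v creates letters strictly between v and p only, and of larger degree.
    crossing : ∀ p v x y → New p → Nw p x → Old v y → v ≺ p → 3 ≤ deg p ℕ.+ deg v →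
      Σ (List (Pt × Fn)) λ Ns → All (λ s → Interior (proj₁ s) × deg (proj₁ s) ≤ L × deg p < deg (proj₁ s) × v ≺ proj₁ s × Nw (proj₁ s) (proj₂ s)) Ns ×
        (∀ m n → (p , ex p (x m n)) ∷ (v , ex v (y m n)) ∷ [] ~[ L ] (v , ex v (y m n)) ∷ newsWord Ns m n ++ (p , ex p (x m n)) ∷ [])
    crossing p@(a , b) v@(c , d) x y np wx oy (longer e _) 3≤ = [] , [] , (λ m n → parallel p v _ _ (trans (ℕₚ.*-comm b c) (trans (sym e) (trans (ℕₚ.*-comm d a) (sym (ℕₚ.+-identityʳ (a ℕ.* d)))))))
    crossing p@(a , b) v@(c , d) x y np wx oy (steeper lt) 3≤ = S.news x y Int , good Int (λ k → k) , S.swap x y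
      where
      lt′ : a ℕ.* d < b ℕ.* c
      lt′ = ≡.subst₂ _<_ (ℕₚ.*-comm d a) (ℕₚ.*-comm c b) lt
      D = b ℕ.* c ∸ a ℕ.* d
      module S = Swap p v D (ℕₚ.m<n⇒0<n∸m lt′) (sym (ℕₚ.m+[n∸m]≡n (ℕₚ.<⇒≤ lt′))) 3≤
      good : ∀ R → (∀ {r} → r ∈ R → r ∈ Int) → All (λ s → Interior (proj₁ s) × deg (proj₁ s) ≤ L × deg p < deg (proj₁ s) × v ≺ proj₁ s × Nw (proj₁ s) (proj₂ s)) (S.news x y R)
      good []      s = []
      good (r@(i , j) ∷ R) s with deg (S.Fm r) ℕ.≤? suc l
      ... | no _  = good R (λ k → s (there k))
      ... | yes q = (S.Fm-interior r ir , q , proj₁ (S.deg-Fm-> r ir) , S.q≺Fm r ir ,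
                      Cone₂.mono (degA p v i j np (proj₂ ir)) (degB p v i j np (proj₂ ir)) (S.ζ-cone x y (s (here refl)) q oy wx)) ∷ good R (λ k → s (there k))
        where ir = proj₁ (interior-range Λ (s (here refl)))

    -- After the crossing, p is first carried into V or beyond it by the given result. The created
    -- letters, left between v and V, are inserted afterwards; they lie after v and have larger
    -- degree than p.
    through : ∀ V v y → Up v V → 1 ≤ deg v → Old v y → ∀ p x → New p → Nw p x → v ≺ p → 3 ≤ deg p ℕ.+ deg v →
      ∀ U → OldAll U → (∀ {s} → s ∈ V → Interior s → deg p < deg s → Inserts V s) →
      (post : ℕ → ℕ → Word) → Result V U (λ m n → (p , ex p (x m n)) ∷ can⟨ V ⟩ U m n) none post →
      Result V U (λ m n → (p , ex p (x m n)) ∷ (v , ex v (y m n)) ∷ can⟨ V ⟩ U m n) (λ m n → (v , ex v (y m n)) ∷ []) post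
    through V v y up 1≤v oy p x np wx lt 3≤ U o insN post (δ , wδ , e) with crossing p v x y np wx oy lt 3≤
    ... | Ns , good , cr with insertAll V (U ⊞ δ) (⊞-old o wδ) Ns (All.map (λ { (i , d , dp , vs , w) → insN (up _ i (ℕₚ.≤-trans d L≤Λ) vs) i dp , w }) good)
    ...   | δ′ , wδ′ , e′ = (δ ⊞ δ′) , ⊞-nw wδ wδ′ , (λ m n →
      (p , ex p (x m n)) ∷ (v , ex v (y m n)) ∷ can⟨ V ⟩ U m n
        ~⟨ ~++ʳ (can⟨ V ⟩ U m n) (cr m n) ⟩
      (v , ex v (y m n)) ∷ (newsWord Ns m n ++ (p , ex p (x m n)) ∷ []) ++ can⟨ V ⟩ U m n
        ~⟨ ~≡ (cong ((v , ex v (y m n)) ∷_) (Listₚ.++-assoc (newsWord Ns m n) ((p , ex p (x m n)) ∷ []) (can⟨ V ⟩ U m n))) ⟩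
      (v , ex v (y m n)) ∷ newsWord Ns m n ++ (p , ex p (x m n)) ∷ can⟨ V ⟩ U m n
        ~⟨ ~∷ (v , ex v (y m n)) (~++ˡ (newsWord Ns m n) (e m n)) ⟩
      (v , ex v (y m n)) ∷ newsWord Ns m n ++ (can⟨ V ⟩ (U ⊞ δ) m n ++ post m n)
        ~⟨ ~≡ (cong ((v , ex v (y m n)) ∷_) (sym (Listₚ.++-assoc (newsWord Ns m n) (can⟨ V ⟩ (U ⊞ δ) m n) (post m n)))) ⟩
      (v , ex v (y m n)) ∷ (newsWord Ns m n ++ can⟨ V ⟩ (U ⊞ δ) m n) ++ post m n
        ~⟨ ~∷ (v , ex v (y m n)) (~++ʳ (post m n) (~trans (e′ m n) (~≡ (trans (Listₚ.++-identityʳ _) (can-assoc V U δ δ′ m n))))) ⟩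
      (v , ex v (y m n)) ∷ can⟨ V ⟩ (U ⊞ (δ ⊞ δ′)) m n ++ post m n ~∎)

    private
      interior-deg : ∀ {p} → Interior p → 2 ≤ deg p
      interior-deg {a , b} (u , v) = ℕₚ.+-mono-≤ u v

    -- the exponent of v is unchanged, so the change at v may be dropped
    unhead : ∀ v V U post → All (v ≺_) V → ∀ {lhs} → Result V U lhs (λ m n → (v , ex v (U v m n)) ∷ []) post → Result (v ∷ V) U lhs none post
    unhead v V U post lts (δ , wδ , e) = δ′ , wδ′ , (λ m n → ~trans (e m n) (~≡ (cong₂ (λ u w → u ∷ w ++ post m n) (cong (λ z → (v , ex v z)) (at-v m n)) (can-cong V (All.map (λ {r} lt → off r (λ { refl → ≺-irrefl lt }) m n) lts)))))
      where
      δ′ : Pt → Fn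
      δ′ r with r ≟ᴾ v
      ... | yes _ = λ _ _ → 0
      ... | no  _ = δ r
      wδ′ : NwAll δ′
      wδ′ r with r ≟ᴾ v
      ... | yes _ = nw-zero r
      ... | no  _ = wδ r
      at-v : ∀ m n → U v m n ≡ U v m n ℕ.+ δ′ v m n
      at-v m n with v ≟ᴾ v
      ... | yes _ = sym (ℕₚ.+-identityʳ _)
      ... | no n′ = ⊥-elim (n′ refl)
      off : ∀ r → ¬ r ≡ v → ∀ m n → U r m n ℕ.+ δ r m n ≡ U r m n ℕ.+ δ′ r m n
      off r n′ m n with r ≟ᴾ v
      ... | yes q = ⊥-elim (n′ q)
      ... | no _  = refl

    -- The number d bounds how far deg p is from exceeding L. Created letters have larger degree and
    -- use a smaller d, while p itself continues in the shorter list. At d = 0 the letter is already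
    -- trivial.
    collect : ∀ d V → Chain V → ∀ {p} → p ∈ V → Interior p → L < deg p ℕ.+ d → Inserts V p
    collect zero V ch {p} k i lt U o f w = (λ _ _ _ → 0) , nw-zero , (λ m n → ~trans (~++ʳ (can⟨ V ⟩ U m n) (truncate p _ i (≡.subst (L <_) (ℕₚ.+-identityʳ (deg p)) lt)))
      (~≡ (trans (sym (can-⊞-zero V U m n)) (sym (Listₚ.++-identityʳ _)))))
    collect (suc d) (v ∷ V) (add iv lts up ch) {p} (here refl) i lt U o f w = δ , wδ , (λ m n →
        ~trans (~++ʳ (can⟨ V ⟩ U m n) (merge-ex p (f m n) (U p m n) (Interior⇒1≤ i))) (~≡ (trans (cong₂ _∷_ (cong (λ z → (p , ex p z)) (head m n)) (can-cong V (tail m n))) (sym (Listₚ.++-identityʳ _)))))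
      where
      δ : Pt → Fn
      δ r with r ≟ᴾ p
      ... | yes _ = f
      ... | no  _ = λ _ _ → 0
      wδ : NwAll δ
      wδ r with r ≟ᴾ p
      ... | yes refl = w
      ... | no  _    = nw-zero r
      head : ∀ m n → f m n ℕ.+ U p m n ≡ U p m n ℕ.+ δ p m n
      head m n with p ≟ᴾ p
      ... | yes _ = ℕₚ.+-comm (f m n) (U p m n)
      ... | no ne = ⊥-elim (ne refl)
      tail : ∀ m n → All (λ r → U r m n ≡ U r m n ℕ.+ δ r m n) V
      tail m n = All.map (λ {r} lt → other r lt) lts
        where
        other : ∀ r → p ≺ r → U r m n ≡ U r m n ℕ.+ δ r m n
        other r lt with r ≟ᴾ p
        ... | yes refl = ⊥-elim (≺-irrefl lt)
        ... | no  _    = sym (ℕₚ.+-identityʳ _)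
    collect (suc d) (v ∷ V) (add iv lts up ch) {p} (there k) i lt U o f w = unhead v V U none lts
      (through V v (U v) up (Interior⇒1≤ iv) (o v iv) p f (interior-new i) w (All.lookup lts k) (ℕₚ.+-mono-≤ (interior-deg i) (Interior⇒1≤ iv)) U o
        (λ {s} ks is ds → collect d V ch ks is (ℕₚ.<-≤-trans lt (≡.subst (_≤ deg s ℕ.+ d) (sym (ℕₚ.+-suc (deg p) d)) (ℕₚ.+-monoˡ-≤ d ds))))
        none (collect (suc d) V ch k i lt U o f w))

    -- (0, 1) comes after every interior point, so its letter crosses all of V and ends at the
    -- right. Everything it creates is collected behind the letter just crossed.
    sweep : ∀ V → Chain V → New (0 , 1) → ∀ x → Nw (0 , 1) x → ∀ U → OldAll U →
      Result V U (λ m n → ((0 , 1) , ex (0 , 1) (x m n)) ∷ can⟨ V ⟩ U m n) none (λ m n → ((0 , 1) , ex (0 , 1) (x m n)) ∷ [])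
    sweep [] [] n01 x wx U o = (λ _ _ _ → 0) , nw-zero , (λ m n → ~refl)
    sweep (v@(suc a , b) ∷ V) (add iv lts up ch) n01 x wx U o = unhead v V U _ lts
      (through V v (U v) up (Interior⇒1≤ iv) (o v iv) (0 , 1) x n01 wx (steeper (≡.subst (_< suc a ℕ.* 1) (sym (ℕₚ.*-zeroʳ b)) (s≤s z≤n))) (s≤s (interior-deg iv)) U o
        (λ {s} ks is ds → collect L V ch ks is (ℕₚ.m<n+m L (Interior⇒1≤ is)))
        (λ m n → ((0 , 1) , ex (0 , 1) (x m n)) ∷ []) (sweep V ch n01 x wx U o))
    sweep ((zero , b) ∷ V) (add (() , _) _ _ _) n01 x wx U o

    chainResults : ∀ V U (pre : ℕ → ℕ → Word) (c : ℕ → ℕ → Letter) {lhs} → Result V U lhs pre none →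
      (∀ δ → NwAll δ → Result V (U ⊞ δ) (λ m n → c m n ∷ pre m n ++ can⟨ V ⟩ (U ⊞ δ) m n) pre none) → Result V U (λ m n → c m n ∷ lhs m n) pre none
    chainResults V U pre c (δ , wδ , e) next = finish (next δ wδ)
      where
      finish : Result V (U ⊞ δ) (λ m n → c m n ∷ pre m n ++ can⟨ V ⟩ (U ⊞ δ) m n) pre none → Result V U _ pre none
      finish (δ′ , wδ′ , e′) = (δ ⊞ δ′) , ⊞-nw wδ wδ′ , (λ m n → ~trans (~∷ (c m n) (~trans (e m n) (~≡ (cong (pre m n ++_) (Listₚ.++-identityʳ _)))))
        (~trans (e′ m n) (~≡ (cong (λ z → pre m n ++ z ++ []) (can-assoc V U δ δ′ m n)))))

    -- The letters to the left of [1,0] are processed from the right. Each crosses [1,0] and is then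
    -- collected in `Int`, together with the letters it created.
    throughAll : ∀ y → Old (1 , 0) y → ∀ U → OldAll U → (Ns : List (Pt × Fn)) →
      All (λ s → proj₁ s ∈ Int × Nw (proj₁ s) (proj₂ s)) Ns →
      Result Int U (λ m n → newsWord Ns m n ++ ((1 , 0) , ex (1 , 0) (y m n)) ∷ can⟨ Int ⟩ U m n) (λ m n → ((1 , 0) , ex (1 , 0) (y m n)) ∷ []) none
    throughAll y oy U o [] [] = (λ _ _ _ → 0) , nw-zero , (λ m n → ~≡ (cong (_ ∷_) (trans (sym (can-⊞-zero Int U m n)) (sym (Listₚ.++-identityʳ _)))))
    throughAll y oy U o ((s , f) ∷ Ns) ((k , w) ∷ ws) = chainResults Int U (λ m n → ((1 , 0) , ex (1 , 0) (y m n)) ∷ []) (λ m n → (s , ex s (f m n))) (throughAll y oy U o Ns ws)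
      (λ δ wδ → through Int (1 , 0) y (λ r i d _ → interior-complete Λ r i d) (s≤s z≤n) oy s f (interior-new is) w (first s is) (ℕₚ.+-mono-≤ (interior-deg is) ℕₚ.≤-refl) (U ⊞ δ) (⊞-old o wδ)
            (λ ks is′ _ → collect L Int Int-chain ks is′ (ℕₚ.m<n+m L (Interior⇒1≤ is′))) none (collect L Int Int-chain k is (ℕₚ.m<n+m L (Interior⇒1≤ is)) (U ⊞ δ) (⊞-old o wδ) f w))
      where
      is = proj₁ (interior-range Λ k)
      first : ∀ s → Interior s → (1 , 0) ≺ s
      first (c , suc d) _ = steeper (s≤s z≤n)
      first (c , zero) (_ , ())

-- Induction on the degree

X Y : ℕ → Letter
X m = ((1 , 0) , ι m)
Y n = ((0 , 1) , ι n)

private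
  one≡ : ι 1 ≡ inv 1
  one≡ = trans ι-1 (sym inv-1)

  degree-drop : ∀ i j (b d : ℕ) → 1 ≤ b → 1 ≤ j → i ℕ.* d ℕ.+ j ℕ.* (b ∸ 1) ≤ (i ℕ.* d ℕ.+ j ℕ.* b) ∸ 1
  degree-drop i (suc j) (suc b) d _ _ = ℕₚ.m+n≤o⇒m≤o∸n (i ℕ.* d ℕ.+ suc j ℕ.* b) (≡.subst (i ℕ.* d ℕ.+ suc j ℕ.* b ℕ.+ 1 ≤_) (sym (lem i j b d))
      (ℕₚ.+-monoʳ-≤ (i ℕ.* d ℕ.+ suc j ℕ.* b) (s≤s z≤n)))
    where lem : ∀ i j b d → i ℕ.* d ℕ.+ suc j ℕ.* suc b ≡ i ℕ.* d ℕ.+ suc j ℕ.* b ℕ.+ suc j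
          lem = ℕSolver.solve-∀

module _ {l : ℕ} where
  merge-X : ∀ a b → X a ∷ X b ∷ [] ~[ l ] X (a ℕ.+ b) ∷ []
  merge-X a b = ~trans (merge (1 , 0) (ι a) (ι b) (s≤s z≤n)) (~≡ (cong (λ z → ((1 , 0) , z) ∷ []) (sym (ι-+ a b))))

  merge-Y : ∀ a b → Y a ∷ Y b ∷ [] ~[ l ] Y (a ℕ.+ b) ∷ []
  merge-Y a b = ~trans (merge (0 , 1) (ι a) (ι b) (s≤s z≤n)) (~≡ (cong (λ z → ((0 , 1) , z) ∷ []) (sym (ι-+ a b))))

  unit-X : X 0 ∷ [] ~[ l ] []
  unit-X = ~trans (~≡ (cong (λ z → ((1 , 0) , z) ∷ []) ι-0)) (unit (1 , 0))

  unit-Y : Y 0 ∷ [] ~[ l ] []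
  unit-Y = ~trans (~≡ (cong (λ z → ((0 , 1) , z) ∷ []) ι-0)) (unit (0 , 1))

module Induction (Λ : ℕ) where
  open Fixed Λ

  canon-0Y : ∀ {l} m U → All (λ p → U p ≡ 0) Int → Y 0 ∷ X m ∷ [] ~[ l ] canon m 0 U
  canon-0Y m U z = ~trans (~++ʳ (X m ∷ []) unit-Y) (~∷ (X m) (~sym (~++ (can-zero Int z) unit-Y)))

  canon-0X : ∀ {l} n U → All (λ p → U p ≡ 0) Int → Y n ∷ X 0 ∷ [] ~[ l ] canon 0 n U
  canon-0X n U z = ~trans (~∷ (Y n) unit-X) (~sym (~++ unit-X (~++ʳ (Y n ∷ []) (can-zero Int z))))

  stage₁ : Stage 1
  stage₁ = record
    { Z = λ _ _ _ → 0
    -- The only possible commutator starts at (1, 1), of degree 2, so the two letters commute at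
    -- level 1.
    ; rel = λ m n → ~trans (central (0 , 1) (1 , 0) (ι n) (ι m) (s≤s z≤n , s≤s z≤n) (s≤s (s≤s z≤n)))
                      (~∷ (X m) (~sym (~++ʳ (Y n ∷ []) (can-zero Int (All.tabulate (λ _ → refl))))))
    ; cone = λ p _ → Cone₂.mono z≤n z≤n (Cone₂.const 0)
    ; zeroˡ = λ _ _ _ → refl
    ; zeroʳ = λ _ _ _ → refl }

  module Next {l : ℕ} (1≤l : 1 ≤ l) (L≤Λ : suc l ≤ Λ) (stage : Stage l) where
    open Stage stage
    open Reorder Λ stage using (Int-chain; module Collect)

    low top : Pt → Fn → Fn
    low p f with deg p ℕ.≤? l
    ... | yes _ = f
    ... | no  _ = λ _ _ → 0
    top p f with deg p ℕ.≟ suc l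
    ... | yes _ = f
    ... | no  _ = λ _ _ → 0

    low-yes : ∀ p f m n → deg p ≤ l → low p f m n ≡ f m n
    low-yes p f m n d with deg p ℕ.≤? l
    ... | yes _ = refl
    ... | no nd = ⊥-elim (nd d)

    low-no : ∀ p f m n → ¬ deg p ≤ l → low p f m n ≡ 0
    low-no p f m n nd with deg p ℕ.≤? l
    ... | yes d = ⊥-elim (nd d)
    ... | no _  = refl

    top-yes : ∀ p f m n → deg p ≡ suc l → top p f m n ≡ f m n
    top-yes p f m n d with deg p ℕ.≟ suc l
    ... | yes _ = refl
    ... | no nd = ⊥-elim (nd d)

    top-no : ∀ p f m n → ¬ deg p ≡ suc l → top p f m n ≡ 0
    top-no p f m n nd with deg p ℕ.≟ suc l
    ... | yes d = ⊥-elim (nd d)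
    ... | no _  = refl

    low-zero : ∀ p f m n → (deg p ≤ l → f m n ≡ 0) → low p f m n ≡ 0
    low-zero p f m n z with deg p ℕ.≤? l
    ... | yes d = z d
    ... | no _  = refl

    top-zero : ∀ p f m n → f m n ≡ 0 → top p f m n ≡ 0
    top-zero p f m n z with deg p ℕ.≟ suc l
    ... | yes _ = z
    ... | no _  = refl

    low-cone : ∀ {A B} p {f} → Poly₂ A B f → Poly₂ A B (low p f)
    low-cone p c with deg p ℕ.≤? l
    ... | yes _ = c
    ... | no _  = Cone₂.mono z≤n z≤n (Cone₂.const 0)

    top-cone : ∀ {A B} p {f} → Poly₂ A B f → Poly₂ A B (top p f)
    top-cone p c with deg p ℕ.≟ suc l
    ... | yes _ = c
    ... | no _  = Cone₂.mono z≤n z≤n (Cone₂.const 0)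

    -- The exponents of degree ≤ l are those of the old stage, those of degree l + 1 are accumulated.
    advance : ∀ p (f g : Fn) (h : ℕ) m n → (deg p ≤ l → h ≡ f m n) →
      (deg p ≡ suc l → h ≡ g m n) → deg p ≤ suc l → h ≡ low p f m n ℕ.+ top p g m n
    advance p f g h m n e e′ d with deg p ℕ.≤? l
    ... | yes d′ = trans (e d′) (sym (trans (cong (f m n ℕ.+_) (top-no p g m n (λ q → ℕₚ.<⇒≱ (ℕₚ.n<1+n l) (≡.subst (_≤ l) q d′)))) (ℕₚ.+-identityʳ _)))
    ... | no nd  = trans (e′ q) (sym (top-yes p g m n q))
      where q = ℕₚ.≤-antisym d (ℕₚ.≰⇒> nd)

    top-small : ∀ p (g : Fn) m n → deg p < suc l → top p g m n ≡ 0
    top-small p g m n lt = top-no p g m n (λ q → ℕₚ.<-irrefl q lt)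

    -- The case m = 1, by steps n to n + 1 that multiply by [0,1] on the left. Increments may have
    -- degree at most b - 1 in n. All functions are constant in the first variable, which is set to
    -- 0.
    module StepA where
      open Collect L≤Λ (λ _ → 0) proj₂ (λ _ → 0) (λ p → proj₂ p ∸ 1) (λ p → 1 ≤ proj₂ p)
        (λ _ → z≤n) (λ p → ℕₚ.m∸n≤m (proj₂ p) 1) proj₂
        (λ p q i j _ _ → ℕₚ.≤-reflexive (cong₂ ℕ._+_ (ℕₚ.*-zeroʳ i) (ℕₚ.*-zeroʳ j)))
        (λ p q i j b≥1 1≤j → degree-drop i j (proj₂ p) (proj₂ q) b≥1 1≤j)

      U : Pt → Fn
      U p = low p (λ _ n → Z p 1 n)

      U-old : OldAll U
      U-old p i = low-cone p (constant₂ (slice₂ (cone p i) 1))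

      private
        swept = sweep Int Int-chain (s≤s z≤n) (λ _ _ → 1) (Cone₂.const 1) U U-old
        δ₁ = proj₁ swept
        collected = collect (suc l) Int Int-chain (interior-complete Λ (1 , 1) (s≤s z≤n , s≤s z≤n) (ℕₚ.≤-trans (s≤s 1≤l) L≤Λ)) (s≤s z≤n , s≤s z≤n) (ℕₚ.m<n+m (suc l) {2} (s≤s z≤n))
          (U ⊞ δ₁) (⊞-old U-old (proj₁ (proj₂ swept))) (λ _ _ → 1) (Cone₂.const 1)
        δ₂ = proj₁ collected

      δ : Pt → Fn
      δ = δ₁ ⊞ δ₂

      δ-nw : NwAll δ
      δ-nw = ⊞-nw (proj₁ (proj₂ swept)) (proj₁ (proj₂ collected))

      C⁺ : ℕ → Word
      C⁺ n = can Int (λ p → (U ⊞ δ) p 0 n)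

      -- The pentagon with D = 1 creates one letter at (1, 1). Then [0,1] is swept through the
      -- letters of degree at most l, and the letter at (1, 1) is collected with the outcome.
      relA : ∀ n → Y 1 ∷ X 1 ∷ can Int (λ p → U p 0 n) ~[ suc l ] X 1 ∷ C⁺ n ++ Y 1 ∷ []
      relA n =
        Y 1 ∷ X 1 ∷ C
          ~⟨ ~++ʳ C (~trans (~≡ (cong₂ (λ u v → ((0 , 1) , u) ∷ ((1 , 0) , v) ∷ []) one≡ one≡)) (pentagon (0 , 1) (1 , 0) 1 ℕₚ.≤-refl refl)) ⟩
        ((1 , 0) , inv 1) ∷ ((1 , 1) , inv 1) ∷ ((0 , 1) , inv 1) ∷ C
          ~⟨ ~≡ (cong₂ _∷_ (cong ((1 , 0) ,_) (sym one≡)) (cong₂ _∷_ (cong ((1 , 1) ,_) (sym ex11)) (cong (_∷ C) (cong ((0 , 1) ,_) (trans (sym one≡) (sym (ex-01 1))))))) ⟩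
        X 1 ∷ ((1 , 1) , ex (1 , 1) 1) ∷ ((0 , 1) , ex (0 , 1) 1) ∷ C
          ~⟨ ~∷ (X 1) (~∷ ((1 , 1) , ex (1 , 1) 1) (proj₂ (proj₂ swept) 0 n)) ⟩
        X 1 ∷ (((1 , 1) , ex (1 , 1) 1) ∷ can Int (λ p → (U ⊞ δ₁) p 0 n)) ++ ((0 , 1) , ex (0 , 1) 1) ∷ []
          ~⟨ ~∷ (X 1) (~++ʳ (((0 , 1) , ex (0 , 1) 1) ∷ []) (proj₂ (proj₂ collected) 0 n)) ⟩
        X 1 ∷ (can Int (λ p → ((U ⊞ δ₁) ⊞ δ₂) p 0 n) ++ []) ++ ((0 , 1) , ex (0 , 1) 1) ∷ []
          ~⟨ ~≡ (cong₂ (λ u v → X 1 ∷ u ++ v ∷ []) (trans (Listₚ.++-identityʳ _) (can-assoc Int U δ₁ δ₂ 0 n)) (cong ((0 , 1) ,_) (ex-01 1))) ⟩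
        X 1 ∷ C⁺ n ++ Y 1 ∷ [] ~∎
        where
        C = can Int (λ p → U p 0 n)
        ex11 : ex (1 , 1) 1 ≡ inv 1
        ex11 = trans (cong (ℚ._* inv 1) ι-1) (ℚₚ.*-identityˡ (inv 1))

      -- At level l both canonical words represent [0,1]^(n+1) [1,0], so uniqueness identifies the
      -- exponents. In these degrees the increments thus lead from one known value to the next.
      lowA : ∀ n {p} → p ∈ Int → deg p ≤ l → (U ⊞ δ) p 0 n ≡ Z p 1 (suc n)
      lowA n = unique-canonical l 1 (suc n) (λ p → (U ⊞ δ) p 0 n) (λ p → Z p 1 (suc n)) (~⇒≅ (
        X 1 ∷ C⁺ n ++ Y (suc n) ∷ []
          ~⟨ ~∷ (X 1) (~++ˡ (C⁺ n) (~sym (merge-Y 1 n))) ⟩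
        X 1 ∷ C⁺ n ++ Y 1 ∷ Y n ∷ []
          ~⟨ ~≡ (cong (X 1 ∷_) (sym (Listₚ.++-assoc (C⁺ n) (Y 1 ∷ []) (Y n ∷ [])))) ⟩
        (X 1 ∷ C⁺ n ++ Y 1 ∷ []) ++ Y n ∷ []
          ~⟨ ~++ʳ (Y n ∷ []) (~sym (coarsen (ℕₚ.n≤1+n l) (relA n))) ⟩
        Y 1 ∷ X 1 ∷ can Int (λ p → U p 0 n) ++ Y n ∷ []
          ~⟨ ~∷ (Y 1) (~∷ (X 1) (~++ʳ (Y n ∷ []) (can-truncate Int Int-interior (All.tabulate (λ {p} _ d → low-yes p _ 0 n d))))) ⟩
        Y 1 ∷ canon 1 n (λ p → Z p 1 n)
          ~⟨ ~∷ (Y 1) (~sym (rel 1 n)) ⟩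
        Y 1 ∷ Y n ∷ X 1 ∷ []
          ~⟨ ~++ʳ (X 1 ∷ []) (merge-Y 1 n) ⟩
        Y (suc n) ∷ X 1 ∷ []
          ~⟨ rel 1 (suc n) ⟩
        canon 1 (suc n) (λ p → Z p 1 (suc n)) ~∎))

      -- In degree l + 1 the exponents `U` are 0 and the letters already accumulated are central, so
      -- the step from n to n + 1 adds just δ p 0 n. The sum starts at 0 because nothing has to be
      -- reordered for n = 0.
      τ : Pt → Fn
      τ p = top p (λ _ n → N.sum n (λ k → δ p 0 k))

      Z₁ : Pt → ℕ → ℕ
      Z₁ p n = U p 0 n ℕ.+ τ p 0 n

      Z₁-cone : ∀ p → Interior p → Poly₂ 0 (proj₂ p) (λ _ n → Z₁ p n)
      Z₁-cone p@(a , suc b) i = constant₂ (slice₂ (Cone₂.add (U-old p i) (top-cone p (constant₂ (accumulate₁ (slice₂ (δ-nw p) 0))))) 0)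
      Z₁-cone (a , zero) (_ , ())

      private
        top-word : ℕ → Word
        top-word n = can Int (λ p → τ p 0 n)
        small : ∀ n → All (λ p → deg p < suc l → τ p 0 n ≡ 0) Int
        small n = All.tabulate (λ {p} _ → top-small p _ 0 n)

      rel₁ : ∀ n → Y n ∷ X 1 ∷ [] ~[ suc l ] canon 1 n (λ p → Z₁ p n)
      rel₁ zero = canon-0Y 1 (λ p → Z₁ p 0) (All.tabulate (λ {p} k → cong₂ ℕ._+_ (low-zero p _ 0 0 (λ d → zeroʳ k d 1)) (top-zero p _ 0 0 refl)))
      rel₁ (suc n) =
        Y (suc n) ∷ X 1 ∷ []
          ~⟨ ~++ʳ (X 1 ∷ []) (~sym (merge-Y 1 n)) ⟩
        Y 1 ∷ Y n ∷ X 1 ∷ []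
          ~⟨ ~∷ (Y 1) (rel₁ n) ⟩
        Y 1 ∷ X 1 ∷ can Int (λ p → Z₁ p n) ++ Y n ∷ []
          ~⟨ ~∷ (Y 1) (~∷ (X 1) (~++ʳ (Y n ∷ []) (split-top Int (λ p → U p 0 n) (λ p → τ p 0 n) Int-interior (small n)))) ⟩
        Y 1 ∷ X 1 ∷ (C ++ top-word n) ++ Y n ∷ []
          ~⟨ ~≡ (cong (λ z → Y 1 ∷ X 1 ∷ z) (Listₚ.++-assoc C (top-word n) (Y n ∷ []))) ⟩
        (Y 1 ∷ X 1 ∷ C) ++ top-word n ++ Y n ∷ []
          ~⟨ ~++ʳ (top-word n ++ Y n ∷ []) (relA n) ⟩
        (X 1 ∷ C⁺ n ++ Y 1 ∷ []) ++ top-word n ++ Y n ∷ []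
          ~⟨ ~≡ (cong (X 1 ∷_) (Listₚ.++-assoc (C⁺ n) (Y 1 ∷ []) (top-word n ++ Y n ∷ []))) ⟩
        X 1 ∷ C⁺ n ++ (Y 1 ∷ top-word n) ++ Y n ∷ []
          ~⟨ ~∷ (X 1) (~++ˡ (C⁺ n) (~++ʳ (Y n ∷ []) (past-top (0 , 1) (ι 1) Int (s≤s z≤n) Int-interior (small n)))) ⟩
        X 1 ∷ C⁺ n ++ (top-word n ++ Y 1 ∷ []) ++ Y n ∷ []
          ~⟨ ~∷ (X 1) (~++ˡ (C⁺ n) (~trans (~≡ (Listₚ.++-assoc (top-word n) (Y 1 ∷ []) (Y n ∷ []))) (~++ˡ (top-word n) (merge-Y 1 n)))) ⟩
        X 1 ∷ C⁺ n ++ top-word n ++ Y (suc n) ∷ []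
          ~⟨ ~≡ (cong (X 1 ∷_) (sym (Listₚ.++-assoc (C⁺ n) (top-word n) (Y (suc n) ∷ [])))) ⟩
        X 1 ∷ (C⁺ n ++ top-word n) ++ Y (suc n) ∷ []
          ~⟨ ~∷ (X 1) (~++ʳ (Y (suc n) ∷ []) (~trans (~sym (split-top Int (λ p → (U ⊞ δ) p 0 n) (λ p → τ p 0 n) Int-interior (small n)))
               (can-truncate Int Int-interior (All.tabulate (λ {p} k d → advance p (λ _ n → Z p 1 n) (λ _ n → N.sum n (λ k → δ p 0 k)) ((U ⊞ δ) p 0 n ℕ.+ τ p 0 n) 0 (suc n) (below k) above d))))) ⟩
        canon 1 (suc n) (λ p → Z₁ p (suc n)) ~∎
        where
        C = can Int (λ p → U p 0 n)
        below : ∀ {p} → p ∈ Int → deg p ≤ l → (U ⊞ δ) p 0 n ℕ.+ τ p 0 n ≡ Z p 1 (suc n)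
        below {p} k d = trans (cong₂ ℕ._+_ (lowA n k d) (top-small p _ 0 n (s≤s d))) (ℕₚ.+-identityʳ _)
        above : ∀ {p} → deg p ≡ suc l → (U ⊞ δ) p 0 n ℕ.+ τ p 0 n ≡ N.sum (suc n) (λ k → δ p 0 k)
        above {p} q = trans (cong₂ ℕ._+_ (cong (ℕ._+ δ p 0 n) (low-no p _ 0 n (λ d → ℕₚ.<⇒≱ (ℕₚ.n<1+n l) (≡.subst (_≤ l) q d)))) (top-yes p _ 0 n q))
          (trans (ℕₚ.+-comm (δ p 0 n) _) (sym (N.sum-last n (λ k → δ p 0 k))))

    -- The step m to m + 1 splits off one [1,0] and uses the case m = 1, which leaves the letters of
    -- `C₁` to be moved past [1,0]^m. Their exponents have degree 0 in m, so they meet the stricter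
    -- bound a - 1; the bound b in n is kept.
    module StepB where
      open StepA using (Z₁; Z₁-cone; rel₁)
      open Collect L≤Λ proj₁ proj₂ (λ p → proj₁ p ∸ 1) proj₂ (λ p → 1 ≤ proj₁ p)
        (λ p → ℕₚ.m∸n≤m (proj₁ p) 1) (λ p → ℕₚ.≤-refl) proj₁
        (λ p q i j a≥1 1≤j → degree-drop i j (proj₁ p) (proj₁ q) a≥1 1≤j)
        (λ p q i j _ _ → ℕₚ.≤-refl)

      U : Pt → Fn
      U p = low p (Z p)

      U-old : OldAll U
      U-old p i = low-cone p (cone p i)

      private
        -- The letter crossed is [1,0]^m, whose exponent has degree (1, 0), as the bounds for old
        -- letters at (1, 0) require.
        passed = throughAll (λ m _ → m) (Cone₂.grow (Closed.const poly₁-closed 0) (Cone₂.const 1) (λ m _ → ℕₚ.+-comm 1 m)) U U-old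
          (map (λ p → (p , λ _ n → Z₁ p n)) Int)
          (Allₚ.map⁺ (All.tabulate (λ {p} k → k , Cone₂.mono z≤n ℕₚ.≤-refl (Z₁-cone p (proj₁ (interior-range Λ k))))))

      δ : Pt → Fn
      δ = proj₁ passed

      δ-nw : NwAll δ
      δ-nw = proj₁ (proj₂ passed)

      C₁ : ℕ → Word
      C₁ n = can Int (λ p → Z₁ p n)

      C⁺ : ℕ → ℕ → Word
      C⁺ m n = can Int (λ p → (U ⊞ δ) p m n)

      relB : ∀ m n → C₁ n ++ X m ∷ can Int (λ p → U p m n) ~[ suc l ] X m ∷ C⁺ m n
      relB m n = ~trans (~≡ (cong₂ (λ u v → u ++ ((1 , 0) , v) ∷ can Int (λ p → U p m n)) (Listₚ.map-∘ Int) (sym (ex-10 m))))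
        (~trans (proj₂ (proj₂ passed) m n) (~≡ (cong₂ (λ u v → ((1 , 0) , u) ∷ v) (ex-10 m) (Listₚ.++-identityʳ _))))

      front : ∀ {l′} m n → l′ ≤ suc l → Y n ∷ X (suc m) ∷ [] ~[ l′ ] X 1 ∷ C₁ n ++ Y n ∷ X m ∷ []
      front m n le =
        Y n ∷ X (suc m) ∷ []
          ~⟨ ~∷ (Y n) (~sym (merge-X 1 m)) ⟩
        Y n ∷ X 1 ∷ X m ∷ []
          ~⟨ ~++ʳ (X m ∷ []) (coarsen le (rel₁ n)) ⟩
        (X 1 ∷ C₁ n ++ Y n ∷ []) ++ X m ∷ []
          ~⟨ ~≡ (cong (X 1 ∷_) (Listₚ.++-assoc (C₁ n) (Y n ∷ []) (X m ∷ []))) ⟩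
        X 1 ∷ C₁ n ++ Y n ∷ X m ∷ [] ~∎

      lowB : ∀ m n {p} → p ∈ Int → deg p ≤ l → (U ⊞ δ) p m n ≡ Z p (suc m) n
      lowB m n = unique-canonical l (suc m) n (λ p → (U ⊞ δ) p m n) (λ p → Z p (suc m) n) (~⇒≅ (
        X (suc m) ∷ C⁺ m n ++ Y n ∷ []
          ~⟨ ~++ʳ (C⁺ m n ++ Y n ∷ []) (~sym (merge-X 1 m)) ⟩
        X 1 ∷ (X m ∷ C⁺ m n) ++ Y n ∷ []
          ~⟨ ~∷ (X 1) (~++ʳ (Y n ∷ []) (~sym (coarsen (ℕₚ.n≤1+n l) (relB m n)))) ⟩
        X 1 ∷ (C₁ n ++ X m ∷ can Int (λ p → U p m n)) ++ Y n ∷ []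
          ~⟨ ~≡ (cong (X 1 ∷_) (Listₚ.++-assoc (C₁ n) (X m ∷ can Int (λ p → U p m n)) (Y n ∷ []))) ⟩
        X 1 ∷ C₁ n ++ X m ∷ can Int (λ p → U p m n) ++ Y n ∷ []
          ~⟨ ~∷ (X 1) (~++ˡ (C₁ n) (~∷ (X m) (~++ʳ (Y n ∷ []) (can-truncate Int Int-interior (All.tabulate (λ {p} _ d → low-yes p (Z p) m n d)))))) ⟩
        X 1 ∷ C₁ n ++ canon m n (λ p → Z p m n)
          ~⟨ ~∷ (X 1) (~++ˡ (C₁ n) (~sym (rel m n))) ⟩
        X 1 ∷ C₁ n ++ Y n ∷ X m ∷ []
          ~⟨ ~sym (front m n (ℕₚ.n≤1+n l)) ⟩
        Y n ∷ X (suc m) ∷ []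
          ~⟨ rel (suc m) n ⟩
        canon (suc m) n (λ p → Z p (suc m) n) ~∎))

      τ : Pt → Fn
      τ p = top p (λ m n → N.sum m (λ k → δ p k n))

      Z⁺ : Pt → Fn
      Z⁺ p m n = U p m n ℕ.+ τ p m n

      Z⁺-cone : ∀ p → Interior p → Poly₂ (proj₁ p) (proj₂ p) (Z⁺ p)
      Z⁺-cone p@(suc a , b) i = Cone₂.add (U-old p i) (top-cone p (accumulate₂ (δ-nw p)))
      Z⁺-cone (zero , b) (() , _)

      private
        top-word : ℕ → ℕ → Word
        top-word m n = can Int (λ p → τ p m n)
        small : ∀ m n → All (λ p → deg p < suc l → τ p m n ≡ 0) Int
        small m n = All.tabulate (λ {p} _ → top-small p _ m n)

      Z⁺-zero : ∀ n → All (λ p → Z⁺ p 0 n ≡ 0) Int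
      Z⁺-zero n = All.tabulate (λ {p} k → cong₂ ℕ._+_ (low-zero p (Z p) 0 n (λ d → zeroˡ k d n)) (top-zero p _ 0 n refl))

      rel⁺ : ∀ m n → Y n ∷ X m ∷ [] ~[ suc l ] canon m n (λ p → Z⁺ p m n)
      rel⁺ zero    n = canon-0X n (λ p → Z⁺ p 0 n) (Z⁺-zero n)
      rel⁺ (suc m) n =
        Y n ∷ X (suc m) ∷ []
          ~⟨ front m n ℕₚ.≤-refl ⟩
        X 1 ∷ C₁ n ++ Y n ∷ X m ∷ []
          ~⟨ ~∷ (X 1) (~++ˡ (C₁ n) (rel⁺ m n)) ⟩
        X 1 ∷ C₁ n ++ X m ∷ can Int (λ p → Z⁺ p m n) ++ Y n ∷ []
          ~⟨ ~∷ (X 1) (~++ˡ (C₁ n) (~∷ (X m) (~trans (~++ʳ (Y n ∷ []) (split-top Int (λ p → U p m n) (λ p → τ p m n) Int-interior (small m n))) (~≡ (Listₚ.++-assoc C (top-word m n) (Y n ∷ [])))))) ⟩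
        X 1 ∷ C₁ n ++ (X m ∷ C) ++ top-word m n ++ Y n ∷ []
          ~⟨ ~≡ (cong (X 1 ∷_) (sym (Listₚ.++-assoc (C₁ n) (X m ∷ C) (top-word m n ++ Y n ∷ [])))) ⟩
        X 1 ∷ (C₁ n ++ X m ∷ C) ++ top-word m n ++ Y n ∷ []
          ~⟨ ~∷ (X 1) (~++ʳ (top-word m n ++ Y n ∷ []) (relB m n)) ⟩
        X 1 ∷ X m ∷ C⁺ m n ++ top-word m n ++ Y n ∷ []
          ~⟨ ~++ (merge-X 1 m) (~≡ (sym (Listₚ.++-assoc (C⁺ m n) (top-word m n) (Y n ∷ [])))) ⟩
        X (suc m) ∷ (C⁺ m n ++ top-word m n) ++ Y n ∷ []
          ~⟨ ~∷ (X (suc m)) (~++ʳ (Y n ∷ []) (~trans (~sym (split-top Int (λ p → (U ⊞ δ) p m n) (λ p → τ p m n) Int-interior (small m n)))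
               (can-truncate Int Int-interior (All.tabulate (λ {p} k d → advance p (Z p) (λ m n → N.sum m (λ k → δ p k n)) ((U ⊞ δ) p m n ℕ.+ τ p m n) (suc m) n (below k) above d))))) ⟩
        canon (suc m) n (λ p → Z⁺ p (suc m) n) ~∎
        where
        C = can Int (λ p → U p m n)
        below : ∀ {p} → p ∈ Int → deg p ≤ l → (U ⊞ δ) p m n ℕ.+ τ p m n ≡ Z p (suc m) n
        below {p} k d = trans (cong₂ ℕ._+_ (lowB m n k d) (top-small p _ m n (s≤s d))) (ℕₚ.+-identityʳ _)
        above : ∀ {p} → deg p ≡ suc l → (U ⊞ δ) p m n ℕ.+ τ p m n ≡ N.sum (suc m) (λ k → δ p k n)
        above {p} q = trans (cong₂ ℕ._+_ (cong (ℕ._+ δ p m n) (low-no p (Z p) m n (λ d → ℕₚ.<⇒≱ (ℕₚ.n<1+n l) (≡.subst (_≤ l) q d)))) (top-yes p _ m n q))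
          (trans (ℕₚ.+-comm (δ p m n) _) (sym (N.sum-last m (λ k → δ p k n))))

    next : Stage (suc l)
    next = record
      { Z = Z⁺ ; rel = rel⁺ ; cone = Z⁺-cone
      ; zeroˡ = λ k _ n → All.lookup (Z⁺-zero n) k
      -- Vanishing at n = 0 cannot be read off from the sum over m. It follows from uniqueness, as
      -- [1,0]^m is ordered by itself.
      ; zeroʳ = λ k d m → unique-canonical (suc l) m 0 (λ p → Z⁺ p m 0) (λ _ → 0)
          (~⇒≅ (~trans (~sym (rel⁺ m 0)) (canon-0Y m (λ _ → 0) (All.tabulate (λ _ → refl))))) k d }
      where open StepB

  stages : ∀ l → 1 ≤ l → l ≤ Λ → Stage l
  stages (suc zero)    _ _ = stage₁
  stages (suc (suc l)) _ p = Next.next (s≤s z≤n) p (stages (suc l) (s≤s z≤n) (ℕₚ.≤-trans (ℕₚ.n≤1+n (suc l)) p))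

-- Comparison with the ordered product

curried : (ℕ → ℕ → ℚ) → Pt → ℚ
curried u p = u (proj₁ p) (proj₂ p)

module _ (Λ : ℕ) where
  orderedProd-word : ∀ u w₁ w₂ → let open Sem Λ w₁ w₂ in Φ (orderedProd Λ u) ≈ ⟦ letters (λ p → p) (curried u) (posPairs Λ) ⟧
  orderedProd-word u w₁ w₂ = go (posPairs Λ) (All.tabulate (λ k → proj₁ (posPairs-range Λ k)))
    where
    open Sem Λ w₁ w₂
    go : ∀ L → All (λ p → 1 ≤ deg p) L →
      Φ (foldr (λ p acc → bch (dilog p (curried u p)) acc) zeroElt L) ≈ ⟦ letters (λ p → p) (curried u) L ⟧
    go []            []        = Φ-0
    go ((p , q) ∷ L) (1≤ ∷ ps) = ≈-trans (Φ-bch (dilog (p , q) (u p q)) _) (*-cong (Φ-dilog p q 1≤ (u p q)) (go L ps))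

  lhs-word : ∀ m n w₁ w₂ → let open Sem Λ w₁ w₂ in Φ (lhsElt m n) ≈ ⟦ Y n ∷ X m ∷ [] ⟧
  lhs-word m n w₁ w₂ = ≈-trans (Φ-bch (dilog (0 , 1) (ℕtoℚ n)) (dilog (1 , 0) (ℕtoℚ m)))
    (*-cong (≈-trans (Φ-dilog 0 1 (s≤s z≤n) (ℕtoℚ n)) (reflexive (cong (Kᴱ 0 1) (sym (ι-def n)))))
            (≈-trans (≈-trans (Φ-dilog 1 0 (s≤s z≤n) (ℕtoℚ m)) (reflexive (cong (Kᴱ 1 0) (sym (ι-def m))))) (≈-sym (*-identityʳ _))))
    where
    open Sem Λ w₁ w₂
    reflexive : ∀ {S T} → S ≡ T → S ≈ T
    reflexive refl = ≈-refl

  factorization-≅ : ∀ m n u → IsOrderedFactorization m n u → letters (λ p → p) (curried u) (posPairs Λ) ≅[ Λ ] Y n ∷ X m ∷ []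
  factorization-≅ m n u fact = equal λ w₁ w₂ → let open Sem Λ w₁ w₂ in
    ≈-trans (≈-sym (orderedProd-word u w₁ w₂)) (≈-trans (Φ-cong (λ a b p q → fact Λ a b p (ℕₚ.≤-pred q))) (lhs-word m n w₁ w₂))

  single-letter : ∀ {l} (e : Pt → ℚ) p L → Unique L → p ∈ L → All (λ q → ¬ q ≡ p → e q ≡ 0ℚ) L → letters (λ p → p) e L ~[ l ] (p , e p) ∷ []
  single-letter e p (q ∷ L) (h ∷ u) (here refl) (_ ∷ zs) = ~∷ (p , e p) (vanish L h zs)
    where
    vanish : ∀ {l} L → All (λ q → ¬ p ≡ q) L → All (λ q → ¬ q ≡ p → e q ≡ 0ℚ) L → letters (λ p → p) e L ~[ l ] []
    vanish []      []       []       = ~refl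
    vanish (q ∷ L) (n ∷ ns) (z ∷ zs) = ~++ (~trans (~≡ (cong (λ x → (q , x) ∷ []) (z (λ r → n (sym r))))) (unit q)) (vanish L ns zs)
  single-letter e p (q ∷ L) (h ∷ u) (there k) (z ∷ zs) =
    ~++ (~trans (~≡ (cong (λ x → (q , x) ∷ []) (z (λ r → All.lookup h k r)))) (unit q)) (single-letter e p L u k zs)

  open Fixed Λ
  open Induction Λ

  module _ (2≤Λ : 2 ≤ Λ) where
    final : Stage Λ
    final = stages Λ (ℕₚ.≤-trans (s≤s z≤n) 2≤Λ) ℕₚ.≤-refl
    open Stage final

    -- The ordered product also runs over the points k (1,0) and k (0,1) with k ≥ 2, which receive
    -- exponent 0.
    exponent : ℕ → ℕ → Pt → ℚ
    exponent m n p@(suc _ , suc _)   = ex p (Z p m n)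
    exponent m n (zero , suc zero)   = ι n
    exponent m n (suc zero , zero)   = ι m
    exponent m n _                   = 0ℚ

    exponent-interior : ∀ m n V → All Interior V → letters (λ p → p) (exponent m n) V ≡ can V (λ p → Z p m n)
    exponent-interior m n [] [] = refl
    exponent-interior m n ((suc a , suc b) ∷ V) (_ ∷ is) = cong (_ ∷_) (exponent-interior m n V is)
    exponent-interior m n ((zero , b) ∷ V) ((() , _) ∷ is)
    exponent-interior m n ((suc a , zero) ∷ V) ((_ , ()) ∷ is)

    private
      P = posPairs Λ
      P-unique = sorted-unique (posPairs-sorted Λ)
      P-positive : All (λ p → 1 ≤ deg p) P
      P-positive = All.tabulate (λ k → proj₁ (posPairs-range Λ k))

    X-part : ∀ m n → letters (λ p → p) (exponent m n) (filterᵇ onX P) ~[ Λ ] X m ∷ []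
    X-part m n = single-letter (exponent m n) (1 , 0) (filterᵇ onX P) (filterᵇ-AllPairs onX P-unique)
      (filterᵇ-∈ onX P (posPairs-complete Λ (1 , 0) (s≤s z≤n) (ℕₚ.≤-trans (s≤s z≤n) 2≤Λ)) refl)
      (All.tabulate (λ {q} k ne → zero-off q (proj₂ (∈-filterᵇ onX P k)) ne))
      where
      zero-off : ∀ q → onX q ≡ true → ¬ q ≡ (1 , 0) → exponent m n q ≡ 0ℚ
      zero-off (zero , zero) _ _ = refl
      zero-off (suc zero , zero) _ ne = ⊥-elim (ne refl)
      zero-off (suc (suc _) , zero) _ _ = refl

    Y-part : ∀ m n → letters (λ p → p) (exponent m n) (filterᵇ onY P) ~[ Λ ] Y n ∷ []
    Y-part m n = single-letter (exponent m n) (0 , 1) (filterᵇ onY P) (filterᵇ-AllPairs onY P-unique)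
      (filterᵇ-∈ onY P (posPairs-complete Λ (0 , 1) (s≤s z≤n) (ℕₚ.≤-trans (s≤s z≤n) 2≤Λ)) refl)
      (All.tabulate (λ {q} k ne → zero-off q (proj₂ (∈-filterᵇ onY P k)) ne))
      where
      zero-off : ∀ q → onY q ≡ true → ¬ q ≡ (0 , 1) → exponent m n q ≡ 0ℚ
      zero-off (zero , suc zero) _ ne = ⊥-elim (ne refl)
      zero-off (zero , suc (suc _)) _ _ = refl

    ordered-rel : ∀ m n → letters (λ p → p) (exponent m n) P ~[ Λ ] Y n ∷ X m ∷ []
    ordered-rel m n = ~trans (~≡ (trans (cong (letters (λ p → p) (exponent m n)) (axes-split P (posPairs-sorted Λ) P-positive))
        (trans (Listₚ.map-++ _ (filterᵇ onX P) _) (cong (letters (λ p → p) (exponent m n) (filterᵇ onX P) ++_) (trans (Listₚ.map-++ _ (filterᵇ interiorᵇ P) _)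
          (cong (_++ letters (λ p → p) (exponent m n) (filterᵇ onY P)) (exponent-interior m n Int Int-interior)))))))
      (~trans (~++ (X-part m n) (~++ˡ (can Int (λ p → Z p m n)) (Y-part m n))) (~sym (rel m n)))

    exponents-determined : ∀ m n u → IsOrderedFactorization m n u → ∀ {p} → p ∈ P → curried u p ≡ exponent m n p
    exponents-determined m n u fact k = unique-exponents Λ P (curried u) (exponent m n) P-unique P-positive
      (equal λ w₁ w₂ → let open Sem Λ w₁ w₂ in ≈-trans (at-weight (factorization-≅ m n u fact) w₁ w₂) (≈-sym (at-weight (~⇒≅ (ordered-rel m n)) w₁ w₂)))
      k (proj₂ (posPairs-range Λ k))

private
  ι-sum : ∀ n f → ι (N.sum n f) ≡ R.sum n (λ i → ι (f i))
  ι-sum zero    f = ι-0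
  ι-sum (suc n) f = trans (ι-+ (f 0) _) (cong (ι (f 0) ℚ.+_) (ι-sum n (λ i → f (suc i))))

  ι-double-sum : ∀ a b (f : ℕ → ℕ → ℕ) → ι (N.sum a (λ i → N.sum b (λ j → f (suc i) (suc j)))) ≡ sum1 a (λ i → sum1 b (λ j → ℕtoℚ (f i j)))
  ι-double-sum a b f = trans (ι-sum a (λ i → N.sum b (λ j → f (suc i) (suc j))))
    (trans (R.sum-cong a (λ i _ → trans (ι-sum b (λ j → f (suc i) (suc j))) (trans (R.sum-cong b (λ j _ → ι-def (f (suc i) (suc j)))) (sym (sum1-sum b (λ j → ℕtoℚ (f (suc i) j)))))))
    (sym (sum1-sum a (λ i → sum1 b (λ j → ℕtoℚ (f i j))))))

  ch-self : ∀ n → ch n n ≡ 1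
  ch-self zero    = refl
  ch-self (suc n) = cong₂ ℕ._+_ (ch-self n) (ch-big n (suc n) ℕₚ.≤-refl)
    where
    ch-big : ∀ n k → n < k → ch n k ≡ 0
    ch-big zero    (suc k) _       = refl
    ch-big (suc n) (suc k) (s≤s p) = cong₂ ℕ._+_ (ch-big n k p) (ch-big n (suc k) (ℕₚ.m<n⇒m<1+n p))

  term≤sum : ∀ n (f : ℕ → ℕ) k → k < n → f k ≤ N.sum n f
  term≤sum (suc n) f zero    _       = ℕₚ.m≤m+n (f 0) _
  term≤sum (suc n) f (suc k) (s≤s p) = ℕₚ.≤-trans (term≤sum n (λ i → f (suc i)) k p) (ℕₚ.m≤n+m _ (f 0))

open import Data.Nat.Combinatorics using (_C_; nCk+nC[k+1]≡[n+1]C[k+1]; k>n⇒nCk≡0; nCn≡1; nCk≡nC[n∸k])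

ch≡C : ∀ n k → ch n k ≡ n C k
ch≡C n       zero    = sym (nC0 n)
  where
  nC0 : ∀ n → n C 0 ≡ 1
  nC0 n = trans (nCk≡nC[n∸k] {0} {n} z≤n) (nCn≡1 n)
ch≡C zero    (suc k) = sym (k>n⇒nCk≡0 {0} {suc k} (s≤s z≤n))
ch≡C (suc n) (suc k) = trans (cong₂ ℕ._+_ (ch≡C n k) (ch≡C n (suc k))) (nCk+nC[k+1]≡[n+1]C[k+1] n k)

-- The vanishing on the axes removes the terms with i = 0 or j = 0 from the binomial expansion.
expand-interior : ∀ {A B f} → Poly₂ A B f → (∀ n → f 0 n ≡ 0) → (∀ m → f m 0 ≡ 0) →
  Σ (ℕ → ℕ → ℕ) λ α → ∀ m n → f m n ≡ N.sum A (λ i → N.sum B (λ j → α (suc i) (suc j) ℕ.* ((m C suc i) ℕ.* (n C suc j))))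
expand-interior {A} {B} {f} c zˡ zʳ with expand₂ c
... | α , e = α , formula
  where
  row : ℕ → ℕ → ℕ
  row i n = N.sum (suc B) (λ j → ch n j ℕ.* α i j)
  row-at-0 : ∀ i → row i 0 ≡ α i 0
  row-at-0 i = trans (cong₂ ℕ._+_ (ℕₚ.+-identityʳ (α i 0)) (N.sum-zero B {λ j → ch 0 (suc j) ℕ.* α i (suc j)} (λ _ _ → refl))) (ℕₚ.+-identityʳ _)
  row-zero : ∀ n → row 0 n ≡ 0
  row-zero n = ℕₚ.n≤0⇒n≡0 (≡.subst₂ _≤_ (ℕₚ.+-identityʳ (row 0 n)) (trans (sym (e 0 n)) (zˡ n)) (term≤sum (suc A) (λ i → ch 0 i ℕ.* row i n) 0 (s≤s z≤n)))
  -- At m = i and n = 0 the term with index i is α i 0, because ch i i = 1. All terms are natural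
  -- numbers and their sum is 0.
  column-zero : ∀ i → i < suc A → α i 0 ≡ 0
  column-zero i lt = ℕₚ.n≤0⇒n≡0 (≡.subst₂ _≤_ (trans (cong₂ ℕ._*_ (ch-self i) (row-at-0 i)) (ℕₚ.+-identityʳ _)) (trans (sym (e i 0)) (zʳ i)) (term≤sum (suc A) (λ k → ch i k ℕ.* row k 0) i lt))
  lem : ∀ x y z → x ℕ.* (y ℕ.* z) ≡ z ℕ.* (x ℕ.* y)
  lem = ℕSolver.solve-∀
  formula : ∀ m n → f m n ≡ N.sum A (λ i → N.sum B (λ j → α (suc i) (suc j) ℕ.* ((m C suc i) ℕ.* (n C suc j))))
  formula m n = trans (e m n) (trans (cong (ℕ._+ N.sum A (λ i → ch m (suc i) ℕ.* row (suc i) n)) (trans (ℕₚ.+-identityʳ (row 0 n)) (row-zero n)))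
    (N.sum-cong A (λ i lt → trans (cong (ch m (suc i) ℕ.*_) (cong (ℕ._+ N.sum B (λ j → ch n (suc j) ℕ.* α (suc i) (suc j))) (trans (ℕₚ.+-identityʳ (α (suc i) 0)) (column-zero (suc i) (s≤s lt)))))
      (trans (SumHom.hom-sum ℕₚ.+-0-commutativeMonoid ℕₚ.+-0-commutativeMonoid (ch m (suc i) ℕ.*_) (ℕₚ.*-zeroʳ (ch m (suc i))) (ℕₚ.*-distribˡ-+ (ch m (suc i))) B (λ j → ch n (suc j) ℕ.* α (suc i) (suc j)))
        (N.sum-cong B (λ j _ → trans (lem (ch m (suc i)) (ch n (suc j)) (α (suc i) (suc j))) (cong₂ (λ u v → α (suc i) (suc j) ℕ.* (u ℕ.* v)) (ch≡C m (suc i)) (ch≡C n (suc j)))))))))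

open import Data.Nat using (_*_)
open import Data.Rational using () renaming (_*_ to _*ℚ_)

theorem6p1 : (a b : ℕ) → 1 ≤ a → 1 ≤ b →
    Σ (ℕ → ℕ → ℕ) λ α →
    (m n : ℕ) (u : ℕ → ℕ → ℚ) → IsOrderedFactorization m n u →
    u a b ≡ frac (+ 1) (gcd a b)
    *ℚ sum1 a (λ i → sum1 b (λ j → ℕtoℚ (α i j * ((m C i) * (n C j)))))
theorem6p1 a@(suc a′) b@(suc b′) 1≤a 1≤b = α , λ m n u fact →
  trans (exponents-determined Λ 2≤Λ m n u fact (posPairs-complete Λ (a , b) (s≤s z≤n) ℕₚ.≤-refl))
    (trans (ℚₚ.*-comm (ι (Z (a , b) m n)) (inv (gcd a b)))
    (cong₂ ℚ._*_ (inv-def (gcd a b)) (trans (cong ι (formula m n)) (ι-double-sum a b (λ i j → α i j ℕ.* ((m C i) ℕ.* (n C j)))))))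
  where
  -- The truncation at the degree of (a, b) already determines the exponent there.
  Λ = a ℕ.+ b
  2≤Λ : 2 ≤ Λ
  2≤Λ = ℕₚ.+-mono-≤ 1≤a 1≤b
  open Fixed Λ
  open Stage (final Λ 2≤Λ)
  k : (a , b) ∈ Int
  k = interior-complete Λ (a , b) (1≤a , 1≤b) ℕₚ.≤-refl
  expansion = expand-interior (cone (a , b) (1≤a , 1≤b)) (zeroˡ k ℕₚ.≤-refl) (zeroʳ k ℕₚ.≤-refl)
  α = proj₁ expansion
  formula = proj₂ expansion
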